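{- Each of the following sums is universal over $\mathbb{Z}$: $6p_4+p_8+p_8+2p_8$, $3p_4+p_8+2p_8+2p_8$, $6p_4+p_8+p_8+3p_8$, $3p_4+p_8+2p_8+3p_8$, $p_4+6p_4+p_8+p_8$, $p_4+3p_4+p_8+2p_8$, $p_4+p_8+p_8+2p_8$, $p_3+p_4+p_5+2p_5$, $p_3+3p_3+p_4+2p_5$, $p_3+6p_3+p_4+p_5$, $p_3+2p_3+3p_4+p_5$, $p_3+2p_3+p_5+p_8$, $p_3+2p_3+3p_3+p_8$.
   Context: For an integer $m\ge 3$ and $x\in\mathbb{Z}$, the generalized $m$-gonal number is $p_m(x)=\frac{(m-2)x^2-(m-4)x}{2}$; thus $p_3(x)=x(x+1)/2$, $p_4(x)=x^2$, $p_5(x)=x(3x-1)/2$, $p_8(x)=x(3x-2)$. For positive integers $a,b,c,d$ and $r,s,t,u\in\{3,4,5,8\}$, the notation $ap_r+bp_s+cp_t+dp_u$ denotes the function $(h,l,m,n)\mapsto ap_r(h)+bp_s(l)+cp_t(m)+dp_u(n)$ on $\mathbb{Z}^4$ (four independent integer variables). Such a sum is called universal over $\mathbb{Z}$ if its set of values on $\mathbb{Z}^4$ equals $\mathbb{N}_0=\{0,1,2,\dots\}$. -}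

module Defs where

open import Data.Nat using (ℕ)
open import Data.Integer using (ℤ; +_; _+_; _-_; _*_; _≤_; 0ℤ)
open import Data.Integer.DivMod using (_/_)
open import Data.Product using (_×_; ∃-syntax)
open import Relation.Binary.PropositionalEquality using (_≡_)

-- generalized m-gonal number  p_m(x) = ((m-2)x^2 - (m-4)x) / 2
-- (the numerator is always even, so the division is exact)
p : ℕ → ℤ → ℤ
p m x = (((+ m - + 2) * x * x) - ((+ m - + 4) * x)) / (+ 2)

sum4 : ℕ → ℕ → ℕ → ℕ → ℕ → ℕ → ℕ → ℕ → ℤ → ℤ → ℤ → ℤ → ℤ
sum4 a r b s c t d u h l m n =
  + a * p r h + + b * p s l + + c * p t m + + d * p u n

Universal : ℕ → ℕ → ℕ → ℕ → ℕ → ℕ → ℕ → ℕ → Set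
Universal a r b s c t d u =
  (∀ h l m n → 0ℤ ≤ sum4 a r b s c t d u h l m n)
  × (∀ (N : ℕ) → ∃[ h ] ∃[ l ] ∃[ m ] ∃[ n ] sum4 a r b s c t d u h l m n ≡ + N)

-- Completing the squares (3p₈ + 1 = (3x-1)², 8p₃ + 1 = (2x+1)², 24p₅ + 1 = (6x-1)²) turns universality into the
-- representability of every number of an arithmetic progression by a diagonal quadratic form in which some variables
-- are units modulo 3, that is, of the shape 3u + 1 up to sign, or odd.
--
-- The sums with p₃ and the sums 6p₄ + p₈ + p₈ + 2p₈ and 3p₄ + p₈ + 2p₈ + 2p₈ follow from Lagrange's theorem.  The
-- reflection in (1,1,1) shows that 9s is a sum of three squares of units if s > 0 is a sum of three squares; hence
-- every n ≡ 1 (mod 3) with n ≥ 4 is a sum of four squares of units, and linear substitutions chosen by the residues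
-- modulo 2 and 3 of the four variables give the other forms.
--
-- The remaining sums follow from the fact that every m > 0 prime to 3 is of the form x² + y² + 3z².  Suppose that
-- c = dm - 3 with d ≡ 16 (mod 24) is a product of primes modulo which -3m is a square.  Then -d is a square b² modulo c,
-- say ac = b² + d, and Hermite reduction of the ternary form with Gram matrix [[a,b,1],[b,c,0],[1,0,m]], which has
-- determinant 3 and represents m, leads to x² + y² + 3z²; the class of x² + 2y² + 2yz + 2z² is excluded by d ≡ 1 (mod 3).
-- Such a c exists without Dirichlet's theorem.  Otherwise the residue class of 16m - 3 modulo k = 24m would lie outside
-- the subgroup generated by the split primes, although χ = (-3m/·) is 1 there, and a quadratic character ψ of the units
-- modulo k would be 1 on that subgroup and -1 at 16m - 3.  The function T = ψ ∗ ψχ is nonnegative, and it is at least 1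
-- at the numbers (1 + ki)² + 3m (2ʲk)², which are products of split primes.  So its sum up to Z² exceeds every multiple
-- of Z, whereas the hyperbola method bounds it by 3kZ.
module Submission where

-- The condition d ≡ 16 (mod 24) does two things. Its part modulo 3 selects the class of x² + y² +
-- 3z²; its part modulo 8 gives c ≡ 5 (mod 8), and with this the symbol of -3m at 16m - 3 comes out
-- as 1 for every power of 2 in m. The classes reached by products of split primes are not found by
-- a search, so the existence of c is proved only under a double negation; it is removed at the end
-- because solvability of x² + y² + 3z² = m is decidable. T is nonnegative because ψ and ψχ are
-- never both -1 at a prime: where χ = 1 the prime splits and ψ = 1. The sum of T outgrows Z
-- because, once i is large, the numbers with j < J fit between consecutive squares (1 + ki)²; each
-- step of i then costs k in Z and yields J, with J free. The factor 2ʲ brings no prime outside k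
-- into the second square. In the cases that rest on Lagrange's theorem the obstacle is s = 0: a
-- representation of n as one square of a unit and three zeros gives nothing to reflect, and has to
-- be replaced first.

-- Integer arithmetic: linear consequences, signs, residues.

module Arith where
  open import Data.Nat.Base as ℕ using (ℕ; zero; suc)
  import Data.Nat.Properties as ℕ
  open import Data.Integer.Base hiding (suc; pred; NonZero)
  open import Data.Integer.Properties
  open import Data.Integer.DivMod using (_%ℕ_; _/ℕ_; n%ℕd<d; a≡a%ℕn+[a/ℕn]*n)
  open import Data.Integer.Tactic.RingSolver using (solve-∀)
  open import Data.Integer.Solver using (module +-*-Solver)
  open +-*-Solver using (solve; _:=_; _:+_; _:*_; _:-_; :-_; con)
  open import Data.Integer.Divisibility.Signed using (divides; _∣?_)
  open import Data.Product using (_×_; _,_; ∃; ∃₂)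
  open import Data.Sum using (_⊎_; inj₁; inj₂)
  open import Relation.Nullary.Decidable using (False; toWitnessFalse; yes; no)
  open import Relation.Binary.PropositionalEquality

  -- Exhibiting `c - d` as a multiple of `a - b` leaves an unconditional ring identity, which the
  -- solver can prove; nearly every equation below is derived in this way.
  linear : ∀ {a b c d} k → a ≡ b → c - d ≡ k * (a - b) → c ≡ d
  linear {a} {b} {c} {d} k refl h =
    i-j≡0⇒i≡j c d (trans h (trans (cong (k *_) (+-inverseʳ a)) (*-zeroʳ k)))

  linear₂ : ∀ {a b a′ b′ c d} k l → a ≡ b → a′ ≡ b′ → c - d ≡ k * (a - b) + l * (a′ - b′) → c ≡ d
  linear₂ {a} {b} {a′} {b′} {c} {d} k l refl refl h = i-j≡0⇒i≡j c d
    (trans h (cong₂ _+_ (trans (cong (k *_) (+-inverseʳ a)) (*-zeroʳ k))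
                        (trans (cong (l *_) (+-inverseʳ a′)) (*-zeroʳ l))))

  -- Clashes modulo `k` end here: the quotient `t` may be any expression, while the closed number
  -- `r` is tested by evaluation when the hidden argument is filled.
  indivisible : ∀ k r t → {False (+ k ∣? r)} → r ≢ t * + k
  indivisible k r t {f} e = toWitnessFalse f (divides t e)

  0≤+ : ∀ {n} → 0ℤ ≤ + n
  0≤+ = +≤+ ℕ.z≤n

  nonneg : ∀ {x} → 0ℤ ≤ x → ∃ λ n → x ≡ + n
  nonneg {+ n} _ = n , refl

  0≤* : ∀ x y → 0ℤ ≤ x → 0ℤ ≤ y → 0ℤ ≤ x * y
  0≤* (+ m) (+ n) _ _ = subst (0ℤ ≤_) (pos-* m n) 0≤+

  0≤sq : ∀ x → 0ℤ ≤ x * x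
  0≤sq (+ n) = 0≤* (+ n) (+ n) 0≤+ 0≤+
  0≤sq -[1+ n ] = 0≤+

  0≤+-both : ∀ {x y} → 0ℤ ≤ x → 0ℤ ≤ y → 0ℤ ≤ x + y
  0≤+-both = +-mono-≤

  i<j⇒0<j-i : ∀ {i j} → i < j → 0ℤ < j - i
  i<j⇒0<j-i {i} {j} h = subst (_< j - i) (+-inverseʳ i) (+-monoˡ-< (- i) h)

  sq≡0 : ∀ x → x * x ≡ 0ℤ → x ≡ 0ℤ
  sq≡0 x e with i*j≡0⇒i≡0∨j≡0 x e
  ... | inj₁ h = h
  ... | inj₂ h = h

  sum≡0 : ∀ {x y} → 0ℤ ≤ x → 0ℤ ≤ y → x + y ≡ 0ℤ → x ≡ 0ℤ × y ≡ 0ℤ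
  sum≡0 {+ zero} {+ zero} _ _ e = refl , refl

  ≢⇒0< : ∀ {x} → 0ℤ ≤ x → x ≢ 0ℤ → 0ℤ < x
  ≢⇒0< p q = ≤∧≢⇒< p (λ e → q (sym e))

  -- The remainder of least absolute value: 2b lies in the interval (-m , m].
  centred : ∀ m .{{_ : ℕ.NonZero m}} a → ∃₂ λ b c →
    a ≡ b + + m * c × 0ℤ ≤ + m - + 2 * b × 0ℤ < + m + + 2 * b
  centred m a with 2 ℕ.* (a %ℕ m) ℕ.≤? m
  ... | yes h = + r , q , a≡ , i≤j⇒0≤j-i (subst (_≤ + m) (pos-* 2 r) (+≤+ h))
              , subst (λ z → 0ℤ < + m + z) (pos-* 2 r) (+<+ (ℕ.≤-trans (ℕ.n≢0⇒n>0 (ℕ.≢-nonZero⁻¹ m)) (ℕ.m≤m+n m _)))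
    where
    r = a %ℕ m
    q = a /ℕ m
    a≡ : a ≡ + r + + m * q
    a≡ = trans (a≡a%ℕn+[a/ℕn]*n a m) (cong (λ z → + r + z) (*-comm q (+ m)))
  ... | no h = + r - + m , q + 1ℤ , a≡ , lo , hi
    where
    r = a %ℕ m
    q = a /ℕ m
    shift : ∀ r q m → r + q * m ≡ r - m + m * (q + 1ℤ)
    shift = solve-∀
    a≡ : a ≡ + r - + m + + m * (q + 1ℤ)
    a≡ = trans (a≡a%ℕn+[a/ℕn]*n a m) (shift (+ r) q (+ m))
    r<m : 0ℤ ≤ + m - + r
    r<m = i≤j⇒0≤j-i (+≤+ (ℕ.<⇒≤ (n%ℕd<d a m)))
    lo : 0ℤ ≤ + m - + 2 * (+ r - + m)
    lo = subst (0ℤ ≤_) (ident (+ m) (+ r)) (0≤+-both (0≤+ {m}) (0≤+-both r<m r<m))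
      where
      ident : ∀ m r → m + (m - r + (m - r)) ≡ m - + 2 * (r - m)
      ident = solve 2 (λ m r → m :+ (m :- r :+ (m :- r)) := m :- con (+ 2) :* (r :- m)) refl
    hi : 0ℤ < + m + + 2 * (+ r - + m)
    hi = subst (0ℤ <_) (trans (cong (_- + m) (pos-* 2 r)) (ident (+ m) (+ r))) (i<j⇒0<j-i (+<+ (ℕ.≰⇒> h)))
      where
      ident : ∀ m r → + 2 * r - m ≡ m + + 2 * (r - m)
      ident = solve-∀

  -- The residue 2 is written as the negative of `3q + 1`, so that the square of a number prime to 3
  -- is always the square of some `3u + 1`.
  Mod3 Mod2 : ℤ → Set
  Mod3 x = ∃ λ q → x ≡ + 3 * q ⊎ x ≡ + 3 * q + 1ℤ ⊎ x ≡ - (+ 3 * q + 1ℤ)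
  Mod2 x = ∃ λ q → x ≡ + 2 * q ⊎ x ≡ + 2 * q + 1ℤ

  mod3 : ∀ x → Mod3 x
  mod3 x with x %ℕ 3 | n%ℕd<d x 3 | x /ℕ 3 | a≡a%ℕn+[a/ℕn]*n x 3
  ... | 0 | _ | q | e = q , inj₁ (trans e (ident q))
    where
    ident : ∀ q → + 0 + q * + 3 ≡ + 3 * q
    ident = solve-∀
  ... | 1 | _ | q | e = q , inj₂ (inj₁ (trans e (ident q)))
    where
    ident : ∀ q → + 1 + q * + 3 ≡ + 3 * q + 1ℤ
    ident = solve-∀
  ... | 2 | _ | q | e = - q - 1ℤ , inj₂ (inj₂ (trans e (ident q)))
    where
    ident : ∀ q → + 2 + q * + 3 ≡ - (+ 3 * (- q - 1ℤ) + 1ℤ)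
    ident = solve 1 (λ q → con (+ 2) :+ q :* con (+ 3) := :- (con (+ 3) :* (:- q :- con 1ℤ) :+ con 1ℤ)) refl
  ... | suc (suc (suc _)) | ℕ.s≤s (ℕ.s≤s (ℕ.s≤s ())) | _ | _

  mod2 : ∀ x → Mod2 x
  mod2 x with x %ℕ 2 | n%ℕd<d x 2 | x /ℕ 2 | a≡a%ℕn+[a/ℕn]*n x 2
  ... | 0 | _ | q | e = q , inj₁ (trans e (ident q))
    where
    ident : ∀ q → + 0 + q * + 2 ≡ + 2 * q
    ident = solve-∀
  ... | 1 | _ | q | e = q , inj₂ (trans e (ident q))
    where
    ident : ∀ q → + 1 + q * + 2 ≡ + 2 * q + 1ℤ
    ident = solve-∀
  ... | suc (suc _) | ℕ.s≤s (ℕ.s≤s ()) | _ | _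

-- Lagrange's four-square theorem by descent.

module Lagrange where
  open Arith
  open import Data.Nat.Base as ℕ using (ℕ; zero; suc)
  import Data.Nat.Properties as ℕ
  import Data.Nat.Divisibility as ℕD
  open import Data.Nat.Primality using (Prime; euclidsLemma; prime⇒nonZero; prime⇒irreducible; prime⇒nonTrivial)
  open import Data.Nat.Primality.Factorisation using (factorise; PrimeFactorisation)
  open import Data.Nat.ListAction using (product)
  open import Data.Nat.Induction using (<-wellFounded)
  open import Induction.WellFounded using (Acc; acc)
  open import Data.Integer.Base hiding (suc; pred; NonZero)
  open import Data.Integer.Properties
  open import Data.Integer.DivMod using (_%ℕ_; _/ℕ_; n%ℕd<d; a≡a%ℕn+[a/ℕn]*n)
  open import Data.Integer.Tactic.RingSolver using (solve-∀)
  open import Data.Integer.Solver using (module +-*-Solver)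
  open +-*-Solver using (solve; _:=_; _:+_; _:*_; _:-_; :-_; con)
  open import Data.Integer.Divisibility.Signed using (_∣_; divides; ∣⇒∣ᵤ)
  open import Data.Fin.Base using (toℕ; fromℕ<)
  open import Data.Fin.Properties using (pigeonhole; toℕ<n; toℕ-fromℕ<)
  open import Data.List.Base using ([]; _∷_)
  open import Data.List.Relation.Unary.All using (All; []; _∷_)
  open import Data.Product using (_×_; _,_; ∃; proj₁; proj₂)
  open import Data.Sum using (_⊎_; inj₁; inj₂)
  open import Relation.Nullary using (yes; no; contradiction)
  open import Relation.Binary.PropositionalEquality

  SumOfFour : ℤ → Set
  SumOfFour n = ∃ λ a → ∃ λ b → ∃ λ c → ∃ λ d → n ≡ a * a + b * b + c * c + d * d

  -- The norm of the quaternion product `q′ conj(q)` with `q = (a,b,c,d)`, `q′ = (x,y,z,w)`; the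
  -- conjugate makes the first coordinate the scalar product, which the descent relies on.
  euler : ∀ a b c d x y z w → (a * a + b * b + c * c + d * d) * (x * x + y * y + z * z + w * w) ≡
    (a * x + b * y + c * z + d * w) * (a * x + b * y + c * z + d * w)
    + (a * y - b * x + c * w - d * z) * (a * y - b * x + c * w - d * z)
    + (a * z - b * w - c * x + d * y) * (a * z - b * w - c * x + d * y)
    + (a * w + b * z - c * y - d * x) * (a * w + b * z - c * y - d * x)
  euler = solve 8 (λ a b c d x y z w → (a :* a :+ b :* b :+ c :* c :+ d :* d) :* (x :* x :+ y :* y :+ z :* z :+ w :* w)
      := (a :* x :+ b :* y :+ c :* z :+ d :* w) :* (a :* x :+ b :* y :+ c :* z :+ d :* w) :+ (a :* y :- b :* x :+ c :* w :- d :* z) :* (a :* y :- b :* x :+ c :* w :- d :* z) :+ (a :* z :- b :* w :- c :* x :+ d :* y) :* (a :* z :- b :* w :- c :* x :+ d :* y) :+ (a :* w :+ b :* z :- c :* y :- d :* x) :* (a :* w :+ b :* z :- c :* y :- d :* x)) refl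

  sumOfFour-* : ∀ {m n} → SumOfFour m → SumOfFour n → SumOfFour (m * n)
  sumOfFour-* (a , b , c , d , refl) (x , y , z , w , refl) =
    a * x + b * y + c * z + d * w , a * y - b * x + c * w - d * z ,
    a * z - b * w - c * x + d * y , a * w + b * z - c * y - d * x , euler a b c d x y z w

  four-zeros : ∀ {x y z w} → 0ℤ ≤ x → 0ℤ ≤ y → 0ℤ ≤ z → 0ℤ ≤ w → x + y + z + w ≡ 0ℤ →
    x ≡ 0ℤ × y ≡ 0ℤ × z ≡ 0ℤ × w ≡ 0ℤ
  four-zeros p q r s e with sum≡0 (0≤+-both (0≤+-both p q) r) s e
  ... | e₁ , ew with sum≡0 (0≤+-both p q) r e₁
  ... | e₂ , ez with sum≡0 p q e₂
  ... | ex , ey = ex , ey , ez , ew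

  0≤sumOfSquares : ∀ a b c d → 0ℤ ≤ a * a + b * b + c * c + d * d
  0≤sumOfSquares a b c d = 0≤+-both (0≤+-both (0≤+-both (0≤sq a) (0≤sq b)) (0≤sq c)) (0≤sq d)

  module Descent (m p : ℤ) (0<m : 0ℤ < m) (m∤p : ∀ q → p ≢ q * m) where
    instance
      nz : ℕ.NonZero ∣ m ∣
      nz = ≢-nonZero (λ e → <-irrefl (sym e) 0<m)

      m-positive : Positive m
      m-positive = positive 0<m

    -- b₁ … b₄ are the centred remainders modulo m; the two extreme values 0 and m of r would make m divide p.
    module Step (b₁ b₂ b₃ b₄ c₁ c₂ c₃ c₄ : ℤ)
      (l₁ : 0ℤ ≤ m - + 2 * b₁) (h₁ : 0ℤ < m + + 2 * b₁) (l₂ : 0ℤ ≤ m - + 2 * b₂) (h₂ : 0ℤ < m + + 2 * b₂)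
      (l₃ : 0ℤ ≤ m - + 2 * b₃) (h₃ : 0ℤ < m + + 2 * b₃) (l₄ : 0ℤ ≤ m - + 2 * b₄) (h₄ : 0ℤ < m + + 2 * b₄) where

      B S C r : ℤ
      B = b₁ * b₁ + b₂ * b₂ + b₃ * b₃ + b₄ * b₄
      S = b₁ * c₁ + b₂ * c₂ + b₃ * c₃ + b₄ * c₄
      C = c₁ * c₁ + c₂ * c₂ + c₃ * c₃ + c₄ * c₄
      -- This is `B / m` written without a division: the squares of the `b + mc` add up to
      -- `B + m(2S + mC)`, which is to equal `mp`.
      r = p - + 2 * S - m * C

      A : ℤ
      A = (b₁ + m * c₁) * (b₁ + m * c₁) + (b₂ + m * c₂) * (b₂ + m * c₂)
        + (b₃ + m * c₃) * (b₃ + m * c₃) + (b₄ + m * c₄) * (b₄ + m * c₄)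

      square : ∀ b c → (b + m * c) * (b + m * c) ≡ b * b + m * (+ 2 * (b * c) + m * (c * c))
      square b c = ident m b c
        where
        ident : ∀ m b c → (b + m * c) * (b + m * c) ≡ b * b + m * (+ 2 * (b * c) + m * (c * c))
        ident = solve 3 (λ m b c → (b :+ m :* c) :* (b :+ m :* c) := b :* b :+ m :* (con (+ 2) :* (b :* c) :+ m :* (c :* c))) refl

      A≡ : A ≡ B + m * (+ 2 * S + m * C)
      A≡ = trans (cong₂ _+_ (cong₂ _+_ (cong₂ _+_ (square b₁ c₁) (square b₂ c₂)) (square b₃ c₃)) (square b₄ c₄))
        (regroup (b₁ * b₁) (b₂ * b₂) (b₃ * b₃) (b₄ * b₄) (b₁ * c₁) (b₂ * c₂) (b₃ * c₃) (b₄ * c₄)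
          (c₁ * c₁) (c₂ * c₂) (c₃ * c₃) (c₄ * c₄) m)
        where
        regroup : ∀ x y z w s t u v e f g h m →
          x + m * (+ 2 * s + m * e) + (y + m * (+ 2 * t + m * f)) + (z + m * (+ 2 * u + m * g)) + (w + m * (+ 2 * v + m * h))
          ≡ x + y + z + w + m * (+ 2 * (s + t + u + v) + m * (e + f + g + h))
        regroup = solve 13 (λ x y z w s t u v e f g h m → x :+ m :* (con (+ 2) :* s :+ m :* e) :+ (y :+ m :* (con (+ 2) :* t :+ m :* f)) :+ (z :+ m :* (con (+ 2) :* u :+ m :* g)) :+ (w :+ m :* (con (+ 2) :* v :+ m :* h))
            := x :+ y :+ z :+ w :+ m :* (con (+ 2) :* (s :+ t :+ u :+ v) :+ m :* (e :+ f :+ g :+ h))) refl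

      module _ (mp≡ : m * p ≡ A) where
        mr≡B : m * r ≡ B
        mr≡B = linear 1ℤ (trans mp≡ A≡) (ident m p S C B)
          where
          ident : ∀ m p S C B → m * (p - + 2 * S - m * C) - B ≡ 1ℤ * (m * p - (B + m * (+ 2 * S + m * C)))
          ident = solve 5 (λ m p S C B → m :* (p :- con (+ 2) :* S :- m :* C) :- B := con 1ℤ :* (m :* p :- (B :+ m :* (con (+ 2) :* S :+ m :* C)))) refl

        0≤r : 0ℤ ≤ r
        0≤r = *-cancelˡ-≤-pos 0ℤ r m (subst₂ _≤_ (sym (*-zeroʳ m)) (sym mr≡B) (0≤sumOfSquares b₁ b₂ b₃ b₄))

        r≢0 : r ≢ 0ℤ
        r≢0 r≡0 = m∤p C (linear₂ 1ℤ (+ 2) r≡0 S≡0 (ident m p S C))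
          where
          S≡0 : S ≡ 0ℤ
          S≡0 = trans (cong₂ _+_ (cong₂ _+_ (cong₂ _+_ (z b₁ c₁ (proj₁ zs)) (z b₂ c₂ (proj₁ (proj₂ zs)))) (z b₃ c₃ (proj₁ (proj₂ (proj₂ zs))))) (z b₄ c₄ (proj₂ (proj₂ (proj₂ zs))))) refl
            where
            zs = four-zeros (0≤sq b₁) (0≤sq b₂) (0≤sq b₃) (0≤sq b₄) (trans (sym mr≡B) (trans (cong (m *_) r≡0) (*-zeroʳ m)))
            z : ∀ b c → b * b ≡ 0ℤ → b * c ≡ 0ℤ
            z b c e = trans (cong (_* c) (sq≡0 b e)) (*-zeroˡ c)
          ident : ∀ m p S C → p - C * m ≡ 1ℤ * (p - + 2 * S - m * C - 0ℤ) + + 2 * (S - 0ℤ)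
          ident = solve 4 (λ m p S C → p :- C :* m := con 1ℤ :* (p :- con (+ 2) :* S :- m :* C :- con 0ℤ) :+ con (+ 2) :* (S :- con 0ℤ)) refl

        δ₁ δ₂ δ₃ δ₄ : ℤ
        δ₁ = (m - + 2 * b₁) * (m + + 2 * b₁)
        δ₂ = (m - + 2 * b₂) * (m + + 2 * b₂)
        δ₃ = (m - + 2 * b₃) * (m + + 2 * b₃)
        δ₄ = (m - + 2 * b₄) * (m + + 2 * b₄)

        -- Each `δ` is `m² - 4b²`, so the four add up to `4m² - 4B = 4m(m - r)`; their nonnegativity
        -- is the bound `r ≤ m`.
        δ≡ : δ₁ + δ₂ + δ₃ + δ₄ ≡ m * (+ 4 * (m - r))
        δ≡ = linear (+ 4) mr≡B (ident b₁ b₂ b₃ b₄ m r)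
          where
          ident : ∀ b₁ b₂ b₃ b₄ m r →
            (m - + 2 * b₁) * (m + + 2 * b₁) + (m - + 2 * b₂) * (m + + 2 * b₂)
            + (m - + 2 * b₃) * (m + + 2 * b₃) + (m - + 2 * b₄) * (m + + 2 * b₄) - m * (+ 4 * (m - r))
            ≡ + 4 * (m * r - (b₁ * b₁ + b₂ * b₂ + b₃ * b₃ + b₄ * b₄))
          ident = solve 6 (λ b₁ b₂ b₃ b₄ m r → (m :- con (+ 2) :* b₁) :* (m :+ con (+ 2) :* b₁) :+ (m :- con (+ 2) :* b₂) :* (m :+ con (+ 2) :* b₂) :+ (m :- con (+ 2) :* b₃) :* (m :+ con (+ 2) :* b₃) :+ (m :- con (+ 2) :* b₄) :* (m :+ con (+ 2) :* b₄) :- m :* (con (+ 4) :* (m :- r))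
              := con (+ 4) :* (m :* r :- (b₁ :* b₁ :+ b₂ :* b₂ :+ b₃ :* b₃ :+ b₄ :* b₄))) refl

        0≤δ₁ : 0ℤ ≤ δ₁
        0≤δ₁ = 0≤* (m - + 2 * b₁) (m + + 2 * b₁) l₁ (<⇒≤ h₁)
        0≤δ₂ : 0ℤ ≤ δ₂
        0≤δ₂ = 0≤* (m - + 2 * b₂) (m + + 2 * b₂) l₂ (<⇒≤ h₂)
        0≤δ₃ : 0ℤ ≤ δ₃
        0≤δ₃ = 0≤* (m - + 2 * b₃) (m + + 2 * b₃) l₃ (<⇒≤ h₃)
        0≤δ₄ : 0ℤ ≤ δ₄
        0≤δ₄ = 0≤* (m - + 2 * b₄) (m + + 2 * b₄) l₄ (<⇒≤ h₄)

        r≤m : r ≤ m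
        r≤m = 0≤i-j⇒j≤i (*-cancelˡ-≤-pos 0ℤ (m - r) (+ 4) (*-cancelˡ-≤-pos 0ℤ (+ 4 * (m - r)) m
          (subst₂ _≤_ (sym (*-zeroʳ m)) δ≡ (0≤+-both (0≤+-both (0≤+-both 0≤δ₁ 0≤δ₂) 0≤δ₃) 0≤δ₄))))

        -- Equality makes every `δ` vanish, hence every `b` equal to `m/2`, since the half-open
        -- range excludes `-m/2`. Then `2S` is `m` times the sum of the `c`, and `p` is a multiple
        -- of `m`.
        r≢m : r ≢ m
        r≢m r≡m = m∤p (1ℤ + (c₁ + c₂ + c₃ + c₄) + C) (linear₂ 1ℤ 1ℤ r≡m S≡ (ident p m S C (c₁ + c₂ + c₃ + c₄)))
          where
          ident₀ : ∀ m → m * (+ 4 * (m - m)) ≡ 0ℤ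
          ident₀ = solve-∀
          zs = four-zeros 0≤δ₁ 0≤δ₂ 0≤δ₃ 0≤δ₄ (trans δ≡ (trans (cong (λ z → m * (+ 4 * (m - z))) r≡m) (ident₀ m)))
          e₁ = proj₁ zs
          e₂ = proj₁ (proj₂ zs)
          e₃ = proj₁ (proj₂ (proj₂ zs))
          e₄ = proj₂ (proj₂ (proj₂ zs))
          half : ∀ b → (m - + 2 * b) * (m + + 2 * b) ≡ 0ℤ → 0ℤ < m + + 2 * b → m ≡ + 2 * b
          half b e h with i*j≡0⇒i≡0∨j≡0 (m - + 2 * b) e
          ... | inj₁ z = i-j≡0⇒i≡j m _ z
          ... | inj₂ z = contradiction h (<-irrefl (sym z))
          S≡ : + 2 * S ≡ m * (c₁ + c₂ + c₃ + c₄)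
          S≡ = trans (ident b₁ b₂ b₃ b₄ c₁ c₂ c₃ c₄)
            (trans (cong₂ _+_ (cong₂ _+_ (cong₂ _+_ (cong (_* c₁) (sym (half b₁ e₁ h₁))) (cong (_* c₂) (sym (half b₂ e₂ h₂))))
              (cong (_* c₃) (sym (half b₃ e₃ h₃)))) (cong (_* c₄) (sym (half b₄ e₄ h₄)))) (ident₂ m c₁ c₂ c₃ c₄))
            where
            ident : ∀ b₁ b₂ b₃ b₄ c₁ c₂ c₃ c₄ → + 2 * (b₁ * c₁ + b₂ * c₂ + b₃ * c₃ + b₄ * c₄)
              ≡ + 2 * b₁ * c₁ + + 2 * b₂ * c₂ + + 2 * b₃ * c₃ + + 2 * b₄ * c₄
            ident = solve 8 (λ b₁ b₂ b₃ b₄ c₁ c₂ c₃ c₄ → con (+ 2) :* (b₁ :* c₁ :+ b₂ :* c₂ :+ b₃ :* c₃ :+ b₄ :* c₄)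
                := con (+ 2) :* b₁ :* c₁ :+ con (+ 2) :* b₂ :* c₂ :+ con (+ 2) :* b₃ :* c₃ :+ con (+ 2) :* b₄ :* c₄) refl
            ident₂ : ∀ m a b c d → m * a + m * b + m * c + m * d ≡ m * (a + b + c + d)
            ident₂ = solve 5 (λ m a b c d → m :* a :+ m :* b :+ m :* c :+ m :* d := m :* (a :+ b :+ c :+ d)) refl
          ident : ∀ p m S C D → p - (1ℤ + D + C) * m ≡ 1ℤ * (p - + 2 * S - m * C - m) + 1ℤ * (+ 2 * S - m * D)
          ident = solve 5 (λ p m S C D → p :- (con 1ℤ :+ D :+ C) :* m
              := con 1ℤ :* (p :- con (+ 2) :* S :- m :* C :- m) :+ con 1ℤ :* (con (+ 2) :* S :- m :* D)) refl

        -- For the quaternions `a = b + mc` one has `a conj(b) = mr + m c conj(b)`. Division by `m`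
        -- leaves `r + c conj(b)`, of norm `(mp)(mr)/m² = rp`, whose coordinates are the witnesses.
        smaller : SumOfFour (r * p)
        smaller = r + S , b₁ * c₂ - b₂ * c₁ + b₃ * c₄ - b₄ * c₃
                , b₁ * c₃ - b₂ * c₄ - b₃ * c₁ + b₄ * c₂ , b₁ * c₄ + b₂ * c₃ - b₃ * c₂ - b₄ * c₁
                , linear₂ C 1ℤ mr≡B (euler b₁ b₂ b₃ b₄ c₁ c₂ c₃ c₄)
                    (ident p S C B m (b₁ * c₂ - b₂ * c₁ + b₃ * c₄ - b₄ * c₃)
                       (b₁ * c₃ - b₂ * c₄ - b₃ * c₁ + b₄ * c₂) (b₁ * c₄ + b₂ * c₃ - b₃ * c₂ - b₄ * c₁))
          where
          ident : ∀ p S C B m x y z →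
            (p - + 2 * S - m * C) * p - ((p - + 2 * S - m * C + S) * (p - + 2 * S - m * C + S) + x * x + y * y + z * z)
            ≡ C * (m * (p - + 2 * S - m * C) - B) + 1ℤ * (B * C - (S * S + x * x + y * y + z * z))
          ident = solve 8 (λ p S C B m x y z → (p :- con (+ 2) :* S :- m :* C) :* p :- ((p :- con (+ 2) :* S :- m :* C :+ S) :* (p :- con (+ 2) :* S :- m :* C :+ S) :+ x :* x :+ y :* y :+ z :* z)
              := C :* (m :* (p :- con (+ 2) :* S :- m :* C) :- B) :+ con 1ℤ :* (B :* C :- (S :* S :+ x :* x :+ y :* y :+ z :* z))) refl

  descend : ∀ m p → 0ℤ < + m → (∀ q → + p ≢ q * + m) → SumOfFour (+ m * + p) →
    ∃ λ r → 0 ℕ.< r × r ℕ.< m × SumOfFour (+ r * + p)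
  descend m p 0<m m∤p (a₁ , a₂ , a₃ , a₄ , e)
    with centred m {{ℕ.>-nonZero (drop‿+<+ 0<m)}} a₁ | centred m {{ℕ.>-nonZero (drop‿+<+ 0<m)}} a₂
       | centred m {{ℕ.>-nonZero (drop‿+<+ 0<m)}} a₃ | centred m {{ℕ.>-nonZero (drop‿+<+ 0<m)}} a₄
  ... | b₁ , c₁ , refl , l₁ , h₁ | b₂ , c₂ , refl , l₂ , h₂ | b₃ , c₃ , refl , l₃ , h₃ | b₄ , c₄ , refl , l₄ , h₄ =
    let open Descent (+ m) (+ p) 0<m m∤p
        open Step b₁ b₂ b₃ b₄ c₁ c₂ c₃ c₄ l₁ h₁ l₂ h₂ l₃ h₃ l₄ h₄
        r′ , r≡ = nonneg (0≤r e)
    in r′ , drop‿+<+ (subst (0ℤ <_) r≡ (≢⇒0< (0≤r e) (r≢0 e)))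
          , drop‿+<+ (subst (_< + m) r≡ (≤∧≢⇒< (r≤m e) (r≢m e)))
          , subst (λ z → SumOfFour (z * + p)) r≡ (smaller e)

  module _ {p : ℕ} (pr : Prime p) where
    private instance
      p≢0 : ℕ.NonZero p
      p≢0 = prime⇒nonZero pr

    1<p : 1 ℕ.< p
    1<p = ℕ.nonTrivial⇒n>1 p {{prime⇒nonTrivial pr}}

    descend-to-1 : ∀ m → Acc ℕ._<_ m → 0 ℕ.< m → m ℕ.< p → SumOfFour (+ m * + p) → SumOfFour (+ p)
    descend-to-1 1 _ _ _ s = subst SumOfFour (*-identityˡ (+ p)) s
    descend-to-1 m@(suc (suc _)) (acc rs) 0<m m<p s with descend m p (+<+ 0<m) m∤p s
      where
      m∤p : ∀ q → + p ≢ q * + m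
      m∤p q e with prime⇒irreducible pr (∣⇒∣ᵤ (divides q e))
      ... | inj₁ ()
      ... | inj₂ m≡p = ℕ.<-irrefl m≡p m<p
    ... | r , 0<r , r<m , s′ = descend-to-1 r (rs r<m) 0<r (ℕ.<-trans r<m m<p) s′

    %ℕ-≡⇒∣ : ∀ x y → x %ℕ p ≡ y %ℕ p → ∃ λ q → x - y ≡ q * + p
    %ℕ-≡⇒∣ x y e = x /ℕ p - y /ℕ p ,
      trans (cong₂ _-_ (a≡a%ℕn+[a/ℕn]*n x p) (trans (a≡a%ℕn+[a/ℕn]*n y p) (cong (λ z → + z + y /ℕ p * + p) (sym e))))
            (ident (+ (x %ℕ p)) (x /ℕ p) (y /ℕ p) (+ p))
      where
      ident : ∀ r s t p → r + s * p - (r + t * p) ≡ (s - t) * p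
      ident = solve 4 (λ r s t p → r :+ s :* p :- (r :+ t :* p) := (s :- t) :* p) refl

    -- Two distinct numbers of sum less than p have distinct squares modulo p.
    squares-distinct : ∀ {i j q} → i ℕ.< j → i ℕ.+ j ℕ.< p → + j * + j - + i * + i ≢ q * + p
    squares-distinct {i} {j} {q} i<j i+j<p e with ℕ.m≤n⇒∃[o]m+o≡n i<j
    ... | o , refl with euclidsLemma (suc o) (suc (i ℕ.+ o) ℕ.+ i) pr (∣⇒∣ᵤ (divides q (trans factor e)))
      where
      factor : + (suc o ℕ.* (suc (i ℕ.+ o) ℕ.+ i)) ≡ + suc (i ℕ.+ o) * + suc (i ℕ.+ o) - + i * + i
      factor = trans (pos-* (suc o) _) (trans (cong (+ suc o *_) (pos-+ (suc (i ℕ.+ o)) i))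
        (trans (cong₂ (λ u v → u * (v + + i)) (pos-+ 1 o) (trans (pos-+ 1 (i ℕ.+ o)) (cong (λ z → 1ℤ + z) (pos-+ i o))))
        (trans (ident (+ i) (+ o)) (cong (λ z → z * z - + i * + i) (sym (trans (pos-+ 1 (i ℕ.+ o)) (cong (λ z → 1ℤ + z) (pos-+ i o))))))))
        where
        ident : ∀ i o → (1ℤ + o) * (1ℤ + (i + o) + i) ≡ (1ℤ + (i + o)) * (1ℤ + (i + o)) - i * i
        ident = solve 2 (λ i o → (con 1ℤ :+ o) :* (con 1ℤ :+ (i :+ o) :+ i) := (con 1ℤ :+ (i :+ o)) :* (con 1ℤ :+ (i :+ o)) :- i :* i) refl
    ... | inj₁ d = ℕD.>⇒∤ (ℕ.≤-<-trans (ℕ.s≤s (ℕ.m≤n+m o i)) (ℕ.≤-<-trans (ℕ.m≤n+m _ i) i+j<p)) d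
    ... | inj₂ d = ℕD.>⇒∤ (subst (ℕ._< p) (ℕ.+-comm i _) i+j<p) d

    module _ {h : ℕ} (p≡ : p ≡ suc (h ℕ.+ h)) where
      -- The `p + 1` pigeons: the indices 0, ..., h carry the squares, the indices h + 1, ..., 2h +
      -- 1 the numbers `-1 - y²` with `0 ≤ y ≤ h`.
      value : ℕ → ℤ
      value i with i ℕ.≤? h
      ... | yes _ = + i * + i
      ... | no _ = - 1ℤ - + (i ℕ.∸ suc h) * + (i ℕ.∸ suc h)

      -- A collision within one block would give two distinct numbers up to `h` with congruent
      -- squares, so the collision is between `x²` and `-1 - y²`.
      pigeon : ∀ i j → i ℕ.< j → j ℕ.≤ p → value i %ℕ p ≡ value j %ℕ p →
        ∃ λ x → ∃ λ y → ∃ λ q → x ℕ.≤ h × y ℕ.≤ h × + x * + x + + y * + y + 1ℤ ≡ q * + p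
      pigeon i j i<j j≤p e with i ℕ.≤? h | j ℕ.≤? h
      ... | yes i≤h | yes j≤h = contradiction (proj₂ (%ℕ-≡⇒∣ (+ j * + j) (+ i * + i) (sym e)))
        (squares-distinct {q = proj₁ (%ℕ-≡⇒∣ (+ j * + j) (+ i * + i) (sym e))} i<j (subst (i ℕ.+ j ℕ.<_) (sym p≡) (ℕ.s≤s (ℕ.+-mono-≤ i≤h j≤h))))
      ... | no i≰h | yes j≤h = contradiction (ℕ.<⇒≤ (ℕ.<-≤-trans i<j j≤h)) i≰h
      ... | yes i≤h | no j≰h = i , j ℕ.∸ suc h , q , i≤h , j∸≤h , trans (ident (+ i) (+ (j ℕ.∸ suc h))) eq
        where
        q = proj₁ (%ℕ-≡⇒∣ (+ i * + i) ( - 1ℤ - + (j ℕ.∸ suc h) * + (j ℕ.∸ suc h)) e)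
        eq = proj₂ (%ℕ-≡⇒∣ (+ i * + i) ( - 1ℤ - + (j ℕ.∸ suc h) * + (j ℕ.∸ suc h)) e)
        j∸≤h : j ℕ.∸ suc h ℕ.≤ h
        j∸≤h = subst (j ℕ.∸ suc h ℕ.≤_) (trans (cong (ℕ._∸ suc h) p≡) (ℕ.m+n∸m≡n (suc h) h)) (ℕ.∸-monoˡ-≤ (suc h) j≤p)
        ident : ∀ x y → x * x + y * y + 1ℤ ≡ x * x - (- 1ℤ - y * y)
        ident = solve 2 (λ x y → x :* x :+ y :* y :+ con 1ℤ := x :* x :- (:- con 1ℤ :- y :* y)) refl
      ... | no i≰h | no j≰h = contradiction
        (trans (ident (+ (j ℕ.∸ suc h)) (+ (i ℕ.∸ suc h))) (proj₂ (%ℕ-≡⇒∣ ( - 1ℤ - + (i ℕ.∸ suc h) * + (i ℕ.∸ suc h)) ( - 1ℤ - + (j ℕ.∸ suc h) * + (j ℕ.∸ suc h)) e)))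
        (squares-distinct {q = proj₁ (%ℕ-≡⇒∣ ( - 1ℤ - + (i ℕ.∸ suc h) * + (i ℕ.∸ suc h)) ( - 1ℤ - + (j ℕ.∸ suc h) * + (j ℕ.∸ suc h)) e)} (ℕ.∸-monoˡ-< i<j (ℕ.≰⇒> i≰h))
          (subst (i ℕ.∸ suc h ℕ.+ (j ℕ.∸ suc h) ℕ.<_) (sym p≡) (ℕ.s≤s (ℕ.+-mono-≤ (bound (ℕ.≤-trans (ℕ.<⇒≤ i<j) j≤p)) (bound j≤p)))))
        where
        bound : ∀ {k} → k ℕ.≤ p → k ℕ.∸ suc h ℕ.≤ h
        bound {k} k≤p = subst (k ℕ.∸ suc h ℕ.≤_) (trans (cong (ℕ._∸ suc h) p≡) (ℕ.m+n∸m≡n (suc h) h)) (ℕ.∸-monoˡ-≤ (suc h) k≤p)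
        ident : ∀ x y → x * x - y * y ≡ - 1ℤ - y * y - (- 1ℤ - x * x)
        ident = solve 2 (λ x y → x :* x :- y :* y := :- con 1ℤ :- y :* y :- (:- con 1ℤ :- x :* x)) refl

      -1-sumOfTwo : ∃ λ x → ∃ λ y → ∃ λ q → x ℕ.≤ h × y ℕ.≤ h × + x * + x + + y * + y + 1ℤ ≡ q * + p
      -1-sumOfTwo with pigeonhole {p} {suc p} ℕ.≤-refl (λ i → fromℕ< (n%ℕd<d (value (toℕ i)) p))
      ... | i , j , i<j , e = pigeon (toℕ i) (toℕ j) i<j (ℕ.≤-pred (toℕ<n j))
        (trans (sym (toℕ-fromℕ< _)) (trans (cong toℕ e) (toℕ-fromℕ< _)))

      odd-prime : SumOfFour (+ p)
      odd-prime with -1-sumOfTwo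
      ... | x , y , q , x≤h , y≤h , e with nonneg {q} 0≤q
        where
        0≤q : 0ℤ ≤ q
        0≤q = *-cancelʳ-≤-pos 0ℤ q (+ p) {{positive (+<+ (ℕ.>-nonZero⁻¹ p))}} (subst (0ℤ ≤_) e (0≤+-both (0≤+-both (0≤sq (+ x)) (0≤sq (+ y))) 0≤+))
      ... | m , refl = descend-to-1 m (<-wellFounded m) 0<m m<p
                         (+ x , + y , 1ℤ , 0ℤ , trans (sym e) (ident (+ x) (+ y)))
        where
        ident : ∀ x y → x * x + y * y + 1ℤ ≡ x * x + y * y + 1ℤ * 1ℤ + 0ℤ * 0ℤ
        ident = solve 2 (λ x y → x :* x :+ y :* y :+ con 1ℤ := x :* x :+ y :* y :+ con 1ℤ :* con 1ℤ :+ con 0ℤ :* con 0ℤ) refl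
        e′ : suc (x ℕ.* x ℕ.+ y ℕ.* y) ≡ m ℕ.* p
        e′ = +-injective (trans (trans (cong +_ (ℕ.+-comm 1 (x ℕ.* x ℕ.+ y ℕ.* y)))
          (trans (pos-+ (x ℕ.* x ℕ.+ y ℕ.* y) 1) (cong (_+ 1ℤ) (trans (pos-+ (x ℕ.* x) (y ℕ.* y)) (cong₂ _+_ (pos-* x x) (pos-* y y)))))) (trans e (sym (pos-* m p))))
        0<m : 0 ℕ.< m
        0<m = ℕ.n≢0⇒n>0 λ { refl → contradiction e′ λ () }
        m<p : m ℕ.< p
        -- As `x, y ≤ h` and `h > 0`, `mp = x² + y² + 1` is at most `2h² + 1`, which is less than
        -- `p² = (2h + 1)²`.
        m<p = ℕ.*-cancelʳ-< p m p (subst₂ ℕ._<_ e′ (sym (cong₂ ℕ._*_ p≡ p≡)) bound)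
          where
          bound : suc (x ℕ.* x ℕ.+ y ℕ.* y) ℕ.< suc (h ℕ.+ h) ℕ.* suc (h ℕ.+ h)
          bound = ℕ.s≤s (ℕ.≤-trans (ℕ.s≤s (ℕ.+-mono-≤ (ℕ.*-mono-≤ x≤h x≤h) (ℕ.*-mono-≤ y≤h y≤h))) lem)
            where
            0<h : 0 ℕ.< h
            0<h = ℕ.n≢0⇒n>0 λ { refl → ℕ.<-irrefl (sym p≡) 1<p }
            lem : suc (h ℕ.* h ℕ.+ h ℕ.* h) ℕ.≤ h ℕ.+ h ℕ.+ (h ℕ.+ h) ℕ.* suc (h ℕ.+ h)
            lem = ℕ.+-mono-≤ (ℕ.≤-trans 0<h (ℕ.m≤m+n h h)) (subst (ℕ._≤ (h ℕ.+ h) ℕ.* suc (h ℕ.+ h)) (ℕ.*-distribʳ-+ h h h)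
                    (ℕ.*-monoʳ-≤ (h ℕ.+ h) (ℕ.≤-trans (ℕ.m≤m+n h h) (ℕ.n≤1+n _))))

  even⊎odd : ∀ n → ∃ λ h → n ≡ h ℕ.+ h ⊎ n ≡ suc (h ℕ.+ h)
  even⊎odd zero = 0 , inj₁ refl
  even⊎odd (suc n) with even⊎odd n
  ... | h , inj₁ refl = h , inj₂ refl
  ... | h , inj₂ refl = suc h , inj₁ (cong suc (sym (ℕ.+-suc h h)))

  prime-sumOfFour : ∀ {p} → Prime p → SumOfFour (+ p)
  prime-sumOfFour {p} pr with even⊎odd p
  ... | h , inj₂ e = odd-prime pr {h} e
  ... | h , inj₁ e with prime⇒irreducible pr {2} (ℕD.divides h (trans e (trans (cong (h ℕ.+_) (sym (ℕ.+-identityʳ h))) (ℕ.*-comm 2 h))))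
  ...   | inj₂ refl = 1ℤ , 1ℤ , 0ℤ , 0ℤ , refl

  four-squares : ∀ n → SumOfFour (+ n)
  four-squares zero = 0ℤ , 0ℤ , 0ℤ , 0ℤ , refl
  four-squares n@(suc _) = subst (λ k → SumOfFour (+ k)) (sym isFactorisation) (go factors factorsPrime)
    where
    open PrimeFactorisation (factorise n)
    go : ∀ ps → All Prime ps → SumOfFour (+ product ps)
    go [] [] = 1ℤ , 0ℤ , 0ℤ , 0ℤ , refl
    go (p ∷ ps) (pr ∷ prs) = subst SumOfFour (sym (pos-* p (product ps))) (sumOfFour-* (prime-sumOfFour pr) (go ps prs))

-- Squares of units modulo 3 and the reflection in (1,1,1).

module Units where
  open Arith
  open Lagrange
  open import Data.Nat.Base as ℕ using (ℕ; suc)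
  import Data.Nat.Properties as ℕ
  open import Induction.WellFounded using (Acc; acc)
  open import Data.Integer.Base hiding (suc; pred; NonZero)
  open import Data.Integer.Properties
  open import Data.Integer.Tactic.RingSolver using (solve-∀)
  open import Data.Integer.Solver using (module +-*-Solver)
  open +-*-Solver using (solve; _:=_; _:+_; _:*_; _:-_; :-_; con)
  open import Data.Vec.Base using (Vec; []; _∷_)
  open import Data.Product using (_,_; ∃; proj₁; proj₂)
  open import Data.Sum using (_⊎_; inj₁; inj₂)
  open import Relation.Binary.PropositionalEquality

  sumOver : ∀ {n} → (ℤ → ℤ) → Vec ℤ n → ℤ
  sumOver f [] = 0ℤ
  sumOver f (x ∷ xs) = f x + sumOver f xs

  -- The summands are sorted into two kinds, so that later case distinctions run over the count `i`
  -- alone and not over the arrangements.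
  record Split (g h : ℤ → ℤ) (n : ℕ) (s : ℤ) : Set where
    constructor splitting
    field
      i j : ℕ
      i+j≡n : i ℕ.+ j ≡ n
      left : Vec ℤ i
      right : Vec ℤ j
      sum≡ : s ≡ sumOver g left + sumOver h right

  split : ∀ {f g h n} → (∀ x → (∃ λ y → f x ≡ g y) ⊎ (∃ λ y → f x ≡ h y)) → (xs : Vec ℤ n) → Split g h n (sumOver f xs)
  split d [] = splitting 0 0 refl [] [] refl
  split {f} {g} {h} d (x ∷ xs) with d x | split {f} {g} {h} d xs
  ... | inj₁ (y , e) | splitting i j l ys zs s = splitting (suc i) j (cong suc l) (y ∷ ys) zs
    (trans (cong₂ _+_ e s) (sym (+-assoc (g y) (sumOver g ys) (sumOver h zs))))
  ... | inj₂ (z , e) | splitting i j l ys zs s = splitting i (suc j) (trans (ℕ.+-suc i j) (cong suc l)) ys (z ∷ zs)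
    (trans (cong₂ _+_ e s) (ident (h z) (sumOver g ys) (sumOver h zs)))
    where
    ident : ∀ a b c → a + (b + c) ≡ b + (a + c)
    ident = solve-∀

  square unit² triple² : ℤ → ℤ
  square x = x * x
  unit² u = (+ 3 * u + 1ℤ) * (+ 3 * u + 1ℤ)
  triple² x = + 9 * (x * x)

  SquareMod3 : ℤ → Set
  SquareMod3 x = (∃ λ y → square x ≡ unit² y) ⊎ (∃ λ y → square x ≡ triple² y)

  by-mod3 : ∀ x → SquareMod3 x
  by-mod3 x with mod3 x
  ... | q , inj₁ refl = inj₂ (q , ident q)
    where
    ident : ∀ q → + 3 * q * (+ 3 * q) ≡ + 9 * (q * q)
    ident = solve-∀
  ... | q , inj₂ (inj₁ refl) = inj₁ (q , refl)
  ... | q , inj₂ (inj₂ refl) = inj₁ (q , ident q)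
    where
    ident : ∀ q → - (+ 3 * q + 1ℤ) * - (+ 3 * q + 1ℤ) ≡ (+ 3 * q + 1ℤ) * (+ 3 * q + 1ℤ)
    ident = solve 1 (λ q → :- (con (+ 3) :* q :+ con 1ℤ) :* :- (con (+ 3) :* q :+ con 1ℤ)
        := (con (+ 3) :* q :+ con 1ℤ) :* (con (+ 3) :* q :+ con 1ℤ)) refl

  sum-unit²-mod3 : ∀ {n} (ys : Vec ℤ n) → ∃ λ t → sumOver unit² ys ≡ + n + t * + 3
  sum-unit²-mod3 [] = 0ℤ , refl
  sum-unit²-mod3 {suc n} (y ∷ ys) with sum-unit²-mod3 ys
  ... | t , e = t + + 3 * (y * y) + + 2 * y , trans (cong (_+_ (unit² y)) e)
    (trans (ident y (+ n) t) (cong (_+ (t + + 3 * (y * y) + + 2 * y) * + 3) (sym (pos-+ 1 n))))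
    where
    ident : ∀ y l t → (+ 3 * y + 1ℤ) * (+ 3 * y + 1ℤ) + (l + t * + 3) ≡ 1ℤ + l + (t + + 3 * (y * y) + + 2 * y) * + 3
    ident = solve 3 (λ y l t → (con (+ 3) :* y :+ con 1ℤ) :* (con (+ 3) :* y :+ con 1ℤ) :+ (l :+ t :* con (+ 3))
        := con 1ℤ :+ l :+ (t :+ con (+ 3) :* (y :* y) :+ con (+ 2) :* y) :* con (+ 3)) refl

  sum-triple²-mod3 : ∀ {n} (ys : Vec ℤ n) → ∃ λ t → sumOver triple² ys ≡ t * + 3
  sum-triple²-mod3 [] = 0ℤ , refl
  sum-triple²-mod3 (y ∷ ys) with sum-triple²-mod3 ys
  ... | t , e = t + + 3 * (y * y) , trans (cong (_+_ (triple² y)) e) (ident y t)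
    where
    ident : ∀ y t → + 9 * (y * y) + t * + 3 ≡ (t + + 3 * (y * y)) * + 3
    ident = solve 2 (λ y t → con (+ 9) :* (y :* y) :+ t :* con (+ 3) := (t :+ con (+ 3) :* (y :* y)) :* con (+ 3)) refl

  -- Modulo 3 a sum of squares counts its units; this is how the residue of a number restricts `i`.
  split-mod3 : ∀ {i j} (ys : Vec ℤ i) (zs : Vec ℤ j) → ∃ λ t → sumOver unit² ys + sumOver triple² zs ≡ + i + t * + 3
  split-mod3 {i} ys zs = let (t , e) = sum-unit²-mod3 ys ; (s , e′) = sum-triple²-mod3 zs in
    t + s , trans (cong₂ _+_ e e′) (ident (+ i) t s)
    where
    ident : ∀ l t s → l + t * + 3 + s * + 3 ≡ l + (t + s) * + 3
    ident = solve 3 (λ l t s → l :+ t :* con (+ 3) :+ s :* con (+ 3) := l :+ (t :+ s) :* con (+ 3)) refl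

  SumOfThreeUnits : ℤ → Set
  SumOfThreeUnits n = ∃ λ u → ∃ λ v → ∃ λ w → n ≡ unit² u + unit² v + unit² w

  -- The reflection in (1,1,1), rescaled by 3, maps (x,y,z) to (3x - 2σ, 3y - 2σ, 3z - 2σ) with σ = x + y + z.
  reflect₁ : ∀ u x y → SumOfThreeUnits (+ 9 * (unit² u + (triple² x + triple² y)))
  reflect₁ u x y = u - + 2 * x - + 2 * y , x - + 2 * u - + 2 * y - 1ℤ , y - + 2 * u - + 2 * x - 1ℤ , ident u x y
    where
    ident : ∀ u x y → + 9 * ((+ 3 * u + 1ℤ) * (+ 3 * u + 1ℤ) + (+ 9 * (x * x) + + 9 * (y * y)))
      ≡ (+ 3 * (u - + 2 * x - + 2 * y) + 1ℤ) * (+ 3 * (u - + 2 * x - + 2 * y) + 1ℤ)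
      + (+ 3 * (x - + 2 * u - + 2 * y - 1ℤ) + 1ℤ) * (+ 3 * (x - + 2 * u - + 2 * y - 1ℤ) + 1ℤ)
      + (+ 3 * (y - + 2 * u - + 2 * x - 1ℤ) + 1ℤ) * (+ 3 * (y - + 2 * u - + 2 * x - 1ℤ) + 1ℤ)
    ident = solve 3 (λ u x y → con (+ 9) :* ((con (+ 3) :* u :+ con 1ℤ) :* (con (+ 3) :* u :+ con 1ℤ) :+ (con (+ 9) :* (x :* x) :+ con (+ 9) :* (y :* y)))
        := (con (+ 3) :* (u :- con (+ 2) :* x :- con (+ 2) :* y) :+ con 1ℤ) :* (con (+ 3) :* (u :- con (+ 2) :* x :- con (+ 2) :* y) :+ con 1ℤ) :+ (con (+ 3) :* (x :- con (+ 2) :* u :- con (+ 2) :* y :- con 1ℤ) :+ con 1ℤ) :* (con (+ 3) :* (x :- con (+ 2) :* u :- con (+ 2) :* y :- con 1ℤ) :+ con 1ℤ) :+ (con (+ 3) :* (y :- con (+ 2) :* u :- con (+ 2) :* x :- con 1ℤ) :+ con 1ℤ) :* (con (+ 3) :* (y :- con (+ 2) :* u :- con (+ 2) :* x :- con 1ℤ) :+ con 1ℤ)) refl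

  -- Each image is congruent to `-2σ ≡ σ` modulo 3, and `σ` to the number of units. Here this is 2,
  -- so all three images are negated to have the form `3u + 1`.
  reflect₂ : ∀ u v x → SumOfThreeUnits (+ 9 * (unit² u + unit² v + triple² x))
  reflect₂ u v x = + 2 * v + + 2 * x - u , + 2 * u + + 2 * x - v , + 2 * u + + 2 * v - x + 1ℤ , ident u v x
    where
    ident : ∀ u v x → + 9 * ((+ 3 * u + 1ℤ) * (+ 3 * u + 1ℤ) + (+ 3 * v + 1ℤ) * (+ 3 * v + 1ℤ) + + 9 * (x * x))
      ≡ (+ 3 * (+ 2 * v + + 2 * x - u) + 1ℤ) * (+ 3 * (+ 2 * v + + 2 * x - u) + 1ℤ)
      + (+ 3 * (+ 2 * u + + 2 * x - v) + 1ℤ) * (+ 3 * (+ 2 * u + + 2 * x - v) + 1ℤ)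
      + (+ 3 * (+ 2 * u + + 2 * v - x + 1ℤ) + 1ℤ) * (+ 3 * (+ 2 * u + + 2 * v - x + 1ℤ) + 1ℤ)
    ident = solve 3 (λ u v x → con (+ 9) :* ((con (+ 3) :* u :+ con 1ℤ) :* (con (+ 3) :* u :+ con 1ℤ) :+ (con (+ 3) :* v :+ con 1ℤ) :* (con (+ 3) :* v :+ con 1ℤ) :+ con (+ 9) :* (x :* x))
        := (con (+ 3) :* (con (+ 2) :* v :+ con (+ 2) :* x :- u) :+ con 1ℤ) :* (con (+ 3) :* (con (+ 2) :* v :+ con (+ 2) :* x :- u) :+ con 1ℤ) :+ (con (+ 3) :* (con (+ 2) :* u :+ con (+ 2) :* x :- v) :+ con 1ℤ) :* (con (+ 3) :* (con (+ 2) :* u :+ con (+ 2) :* x :- v) :+ con 1ℤ) :+ (con (+ 3) :* (con (+ 2) :* u :+ con (+ 2) :* v :- x :+ con 1ℤ) :+ con 1ℤ) :* (con (+ 3) :* (con (+ 2) :* u :+ con (+ 2) :* v :- x :+ con 1ℤ) :+ con 1ℤ)) refl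

  -- With three units `3 | σ`, and no image would be a unit; the sign of the third one is changed
  -- first, which makes `σ ≡ 1`.
  reflect₃ : ∀ u v w → SumOfThreeUnits (+ 9 * (unit² u + unit² v + unit² w))
  reflect₃ u v w = u - + 2 * v + + 2 * w , v - + 2 * u + + 2 * w , - w - + 2 * u - + 2 * v - + 2 , ident u v w
    where
    ident : ∀ u v w → + 9 * ((+ 3 * u + 1ℤ) * (+ 3 * u + 1ℤ) + (+ 3 * v + 1ℤ) * (+ 3 * v + 1ℤ) + (+ 3 * w + 1ℤ) * (+ 3 * w + 1ℤ))
      ≡ (+ 3 * (u - + 2 * v + + 2 * w) + 1ℤ) * (+ 3 * (u - + 2 * v + + 2 * w) + 1ℤ)
      + (+ 3 * (v - + 2 * u + + 2 * w) + 1ℤ) * (+ 3 * (v - + 2 * u + + 2 * w) + 1ℤ)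
      + (+ 3 * (- w - + 2 * u - + 2 * v - + 2) + 1ℤ) * (+ 3 * (- w - + 2 * u - + 2 * v - + 2) + 1ℤ)
    ident = solve 3 (λ u v w → con (+ 9) :* ((con (+ 3) :* u :+ con 1ℤ) :* (con (+ 3) :* u :+ con 1ℤ) :+ (con (+ 3) :* v :+ con 1ℤ) :* (con (+ 3) :* v :+ con 1ℤ) :+ (con (+ 3) :* w :+ con 1ℤ) :* (con (+ 3) :* w :+ con 1ℤ))
        := (con (+ 3) :* (u :- con (+ 2) :* v :+ con (+ 2) :* w) :+ con 1ℤ) :* (con (+ 3) :* (u :- con (+ 2) :* v :+ con (+ 2) :* w) :+ con 1ℤ) :+ (con (+ 3) :* (v :- con (+ 2) :* u :+ con (+ 2) :* w) :+ con 1ℤ) :* (con (+ 3) :* (v :- con (+ 2) :* u :+ con (+ 2) :* w) :+ con 1ℤ) :+ (con (+ 3) :* (:- w :- con (+ 2) :* u :- con (+ 2) :* v :- con (+ 2)) :+ con 1ℤ) :* (con (+ 3) :* (:- w :- con (+ 2) :* u :- con (+ 2) :* v :- con (+ 2)) :+ con 1ℤ)) refl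

  -- If all three roots are multiples of 3, the claim for `s / 9` expresses `s` itself by three
  -- units, and `reflect₃` applies to these. Positivity of `s` makes the recursion descend.
  ninefold : ∀ s → Acc ℕ._<_ s → 0 ℕ.< s → (xs : Vec ℤ 3) → + s ≡ sumOver square xs → SumOfThreeUnits (+ 9 * + s)
  ninefold s (acc rs) 0<s xs e = go (split {square} {unit²} {triple²} by-mod3 xs)
    where
    go : Split unit² triple² 3 (sumOver square xs) → SumOfThreeUnits (+ 9 * + s)
    go (splitting 0 .3 refl [] (x ∷ y ∷ z ∷ []) eq) =
      let (u , v , w , eq₂) = ninefold s′ (rs s′<s) 0<s′ (x ∷ y ∷ z ∷ []) (sym s′≡)
      in subst (λ t → SumOfThreeUnits (+ 9 * t)) (trans (sym eq₂) (sym s≡)) (reflect₃ u v w)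
      where
      Q = sumOver square (x ∷ y ∷ z ∷ [])
      0≤Q : 0ℤ ≤ Q
      0≤Q = 0≤+-both (0≤sq x) (0≤+-both (0≤sq y) (0≤+-both (0≤sq z) ≤-refl))
      s′ = proj₁ (nonneg 0≤Q)
      s′≡ : Q ≡ + s′
      s′≡ = proj₂ (nonneg 0≤Q)
      s≡ : + s ≡ + 9 * + s′
      s≡ = trans e (trans eq (trans (ident (x * x) (y * y) (z * z)) (cong (+ 9 *_) s′≡)))
        where
        ident : ∀ x y z → 0ℤ + (+ 9 * x + (+ 9 * y + (+ 9 * z + 0ℤ))) ≡ + 9 * (x + (y + (z + 0ℤ)))
        ident = solve 3 (λ x y z → con 0ℤ :+ (con (+ 9) :* x :+ (con (+ 9) :* y :+ (con (+ 9) :* z :+ con 0ℤ)))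
            := con (+ 9) :* (x :+ (y :+ (z :+ con 0ℤ)))) refl
      s≡9s′ : s ≡ 9 ℕ.* s′
      s≡9s′ = +-injective (trans s≡ (sym (pos-* 9 s′)))
      0<s′ : 0 ℕ.< s′
      0<s′ = ℕ.n≢0⇒n>0 (λ z → ℕ.<⇒≢ 0<s (sym (trans s≡9s′ (cong (9 ℕ.*_) z))))
      s′<s : s′ ℕ.< s
      s′<s = subst (s′ ℕ.<_) (sym s≡9s′) (ℕ.m<m+n s′ (ℕ.≤-trans 0<s′ (ℕ.m≤m+n s′ _)))
    go (splitting 1 .2 refl (u ∷ []) (x ∷ y ∷ []) eq) =
      subst (λ t → SumOfThreeUnits (+ 9 * t)) (sym (trans e (trans eq (ident (unit² u) (triple² x) (triple² y))))) (reflect₁ u x y)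
      where
      ident : ∀ u x y → u + 0ℤ + (x + (y + 0ℤ)) ≡ u + (x + y)
      ident = solve 3 (λ u x y → u :+ con 0ℤ :+ (x :+ (y :+ con 0ℤ)) := u :+ (x :+ y)) refl
    go (splitting 2 .1 refl (u ∷ v ∷ []) (x ∷ []) eq) =
      subst (λ t → SumOfThreeUnits (+ 9 * t)) (sym (trans e (trans eq (ident (unit² u) (unit² v) (triple² x))))) (reflect₂ u v x)
      where
      ident : ∀ u v x → u + (v + 0ℤ) + (x + 0ℤ) ≡ u + v + x
      ident = solve 3 (λ u v x → u :+ (v :+ con 0ℤ) :+ (x :+ con 0ℤ) := u :+ v :+ x) refl
    go (splitting 3 .0 refl (u ∷ v ∷ w ∷ []) [] eq) =
      subst (λ t → SumOfThreeUnits (+ 9 * t)) (sym (trans e (trans eq (ident (unit² u) (unit² v) (unit² w))))) (reflect₃ u v w)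
      where
      ident : ∀ u v w → u + (v + (w + 0ℤ)) + 0ℤ ≡ u + v + w
      ident = solve 3 (λ u v w → u :+ (v :+ (w :+ con 0ℤ)) :+ con 0ℤ := u :+ v :+ w) refl
    go (splitting (suc (suc (suc (suc _)))) _ () _ _ _)

-- Sums of four squares of units.

module FourUnits where
  open Arith
  open Lagrange
  open Units
  open import Data.Nat.Base as ℕ using (ℕ; suc)
  import Data.Nat.Properties as ℕ
  open import Data.Nat.Induction using (<-wellFounded)
  open import Induction.WellFounded using (Acc; acc)
  open import Data.Integer.Base hiding (suc; pred; NonZero)
  open import Data.Integer.Properties
  open import Data.Integer.Tactic.RingSolver using (solve-∀)
  open import Data.Integer.Solver using (module +-*-Solver)
  open +-*-Solver using (solve; _:=_; _:+_; _:*_; _:-_; :-_; con)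
  open import Data.Vec.Base using (Vec; []; _∷_)
  open import Data.Product using (_×_; _,_; ∃; proj₁; proj₂)
  open import Data.Sum using (_⊎_; inj₁; inj₂)
  open import Relation.Nullary using (yes; no; contradiction)
  open import Relation.Binary.PropositionalEquality

  -- With two nonzero roots, a representation containing only one unit still has a nonzero multiple
  -- of 3, as `ninefold` demands.
  TwoNonzeroSquares : ℤ → Set
  TwoNonzeroSquares n = ∃ λ x → ∃ λ y → ∃ λ z → ∃ λ w → x ≢ 0ℤ × y ≢ 0ℤ × n ≡ x * x + y * y + z * z + w * w

  two-nonzero : ∀ a b c d → TwoNonzeroSquares (a * a + b * b + c * c + d * d)
    ⊎ (∃ λ x → a * a + b * b + c * c + d * d ≡ x * x)
  two-nonzero a b c d with a ≟ 0ℤ | b ≟ 0ℤ | c ≟ 0ℤ | d ≟ 0ℤ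
  ... | no p | no q | _ | _ = inj₁ (a , b , c , d , p , q , refl)
  ... | no p | yes refl | no q | _ = inj₁ (a , c , 0ℤ , d , p , q , ident a c d)
    where
    ident : ∀ a c d → a * a + 0ℤ * 0ℤ + c * c + d * d ≡ a * a + c * c + 0ℤ * 0ℤ + d * d
    ident = solve 3 (λ a c d → a :* a :+ con 0ℤ :* con 0ℤ :+ c :* c :+ d :* d := a :* a :+ c :* c :+ con 0ℤ :* con 0ℤ :+ d :* d) refl
  ... | no p | yes refl | yes refl | no q = inj₁ (a , d , 0ℤ , 0ℤ , p , q , ident a d)
    where
    ident : ∀ a d → a * a + 0ℤ * 0ℤ + 0ℤ * 0ℤ + d * d ≡ a * a + d * d + 0ℤ * 0ℤ + 0ℤ * 0ℤ
    ident = solve 2 (λ a d → a :* a :+ con 0ℤ :* con 0ℤ :+ con 0ℤ :* con 0ℤ :+ d :* d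
        := a :* a :+ d :* d :+ con 0ℤ :* con 0ℤ :+ con 0ℤ :* con 0ℤ) refl
  ... | no p | yes refl | yes refl | yes refl = inj₂ (a , ident a)
    where
    ident : ∀ a → a * a + 0ℤ * 0ℤ + 0ℤ * 0ℤ + 0ℤ * 0ℤ ≡ a * a
    ident = solve 1 (λ a → a :* a :+ con 0ℤ :* con 0ℤ :+ con 0ℤ :* con 0ℤ :+ con 0ℤ :* con 0ℤ := a :* a) refl
  ... | yes refl | no p | no q | _ = inj₁ (b , c , 0ℤ , d , p , q , ident b c d)
    where
    ident : ∀ b c d → 0ℤ * 0ℤ + b * b + c * c + d * d ≡ b * b + c * c + 0ℤ * 0ℤ + d * d
    ident = solve 3 (λ b c d → con 0ℤ :* con 0ℤ :+ b :* b :+ c :* c :+ d :* d := b :* b :+ c :* c :+ con 0ℤ :* con 0ℤ :+ d :* d) refl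
  ... | yes refl | no p | yes refl | no q = inj₁ (b , d , 0ℤ , 0ℤ , p , q , ident b d)
    where
    ident : ∀ b d → 0ℤ * 0ℤ + b * b + 0ℤ * 0ℤ + d * d ≡ b * b + d * d + 0ℤ * 0ℤ + 0ℤ * 0ℤ
    ident = solve 2 (λ b d → con 0ℤ :* con 0ℤ :+ b :* b :+ con 0ℤ :* con 0ℤ :+ d :* d
        := b :* b :+ d :* d :+ con 0ℤ :* con 0ℤ :+ con 0ℤ :* con 0ℤ) refl
  ... | yes refl | no p | yes refl | yes refl = inj₂ (b , ident b)
    where
    ident : ∀ b → 0ℤ * 0ℤ + b * b + 0ℤ * 0ℤ + 0ℤ * 0ℤ ≡ b * b
    ident = solve 1 (λ b → con 0ℤ :* con 0ℤ :+ b :* b :+ con 0ℤ :* con 0ℤ :+ con 0ℤ :* con 0ℤ := b :* b) refl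
  ... | yes refl | yes refl | no p | no q = inj₁ (c , d , 0ℤ , 0ℤ , p , q , ident c d)
    where
    ident : ∀ c d → 0ℤ * 0ℤ + 0ℤ * 0ℤ + c * c + d * d ≡ c * c + d * d + 0ℤ * 0ℤ + 0ℤ * 0ℤ
    ident = solve 2 (λ c d → con 0ℤ :* con 0ℤ :+ con 0ℤ :* con 0ℤ :+ c :* c :+ d :* d
        := c :* c :+ d :* d :+ con 0ℤ :* con 0ℤ :+ con 0ℤ :* con 0ℤ) refl
  ... | yes refl | yes refl | no p | yes refl = inj₂ (c , ident c)
    where
    ident : ∀ c → 0ℤ * 0ℤ + 0ℤ * 0ℤ + c * c + 0ℤ * 0ℤ ≡ c * c
    ident = solve 1 (λ c → con 0ℤ :* con 0ℤ :+ con 0ℤ :* con 0ℤ :+ c :* c :+ con 0ℤ :* con 0ℤ := c :* c) refl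
  ... | yes refl | yes refl | yes refl | _ = inj₂ (d , ident d)
    where
    ident : ∀ d → 0ℤ * 0ℤ + 0ℤ * 0ℤ + 0ℤ * 0ℤ + d * d ≡ d * d
    ident = solve 1 (λ d → con 0ℤ :* con 0ℤ :+ con 0ℤ :* con 0ℤ :+ con 0ℤ :* con 0ℤ :+ d :* d := d :* d) refl

  *-≢0 : ∀ x y → x ≢ 0ℤ → y ≢ 0ℤ → x * y ≢ 0ℤ
  *-≢0 x y p q e with i*j≡0⇒i≡0∨j≡0 x e
  ... | inj₁ h = p h
  ... | inj₂ h = q h

  ∣∣-square : ∀ x → + ∣ x ∣ * + ∣ x ∣ ≡ x * x
  ∣∣-square (+ n) = refl
  ∣∣-square -[1+ n ] = refl

  -- If X is the norm of q then X² is the norm of q², which has at least two nonzero coordinates unless X is a square.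
  odd-square : ∀ n → Acc ℕ._<_ n → 1 ℕ.< n → ∀ k → + n ≡ + 2 * k + 1ℤ → TwoNonzeroSquares (+ n * + n)
  odd-square n (acc rs) 1<n k odd =
    let (a , b , c , d , e) = four-squares n in go a b c d e (two-nonzero a b c d)
    where
    go : ∀ a b c d → + n ≡ a * a + b * b + c * c + d * d →
      TwoNonzeroSquares (a * a + b * b + c * c + d * d) ⊎ (∃ λ x → a * a + b * b + c * c + d * d ≡ x * x) → TwoNonzeroSquares (+ n * + n)
    go a b c d e (inj₁ (x , y , z , w , x≢0 , y≢0 , e′)) =
      x * x - y * y - z * z - w * w , + 2 * x * y , + 2 * x * z , + 2 * x * w ,
      nonzero , *-≢0 (+ 2 * x) y (*-≢0 (+ 2) x (λ ()) x≢0) y≢0 ,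
      trans (cong (λ t → t * t) n≡) (ident x y z w)
      where
      n≡ = trans e e′
      -- This coordinate has the parity of the norm `n`, which is odd.
      nonzero : x * x - y * y - z * z - w * w ≢ 0ℤ
      nonzero e₀ = indivisible 2 1ℤ (x * x - k) (linear₂ 1ℤ -1ℤ (trans (sym odd) n≡) e₀ (ident₀ k (x * x) (y * y) (z * z) (w * w)))
        where
        ident₀ : ∀ k x y z w → 1ℤ - (x - k) * + 2 ≡ 1ℤ * (+ 2 * k + 1ℤ - (x + y + z + w)) + -1ℤ * (x - y - z - w - 0ℤ)
        ident₀ = solve 5 (λ k x y z w → con 1ℤ :- (x :- k) :* con (+ 2)
            := con 1ℤ :* (con (+ 2) :* k :+ con 1ℤ :- (x :+ y :+ z :+ w)) :+ con -1ℤ :* (x :- y :- z :- w :- con 0ℤ)) refl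
      ident : ∀ x y z w → (x * x + y * y + z * z + w * w) * (x * x + y * y + z * z + w * w)
        ≡ (x * x - y * y - z * z - w * w) * (x * x - y * y - z * z - w * w) + + 2 * x * y * (+ 2 * x * y)
        + + 2 * x * z * (+ 2 * x * z) + + 2 * x * w * (+ 2 * x * w)
      ident = solve 4 (λ x y z w → (x :* x :+ y :* y :+ z :* z :+ w :* w) :* (x :* x :+ y :* y :+ z :* z :+ w :* w)
          := (x :* x :- y :* y :- z :* z :- w :* w) :* (x :* x :- y :* y :- z :* z :- w :* w) :+ con (+ 2) :* x :* y :* (con (+ 2) :* x :* y) :+ con (+ 2) :* x :* z :* (con (+ 2) :* x :* z) :+ con (+ 2) :* x :* w :* (con (+ 2) :* x :* w)) refl
    -- Now `n = m²`; the representation of `m²` found for the smaller odd number `m` is multiplied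
    -- by `m`.
    go a b c d e (inj₂ (x , e′)) = scale (mod2 (+ m))
      where
      m = ∣ x ∣
      n≡ : + n ≡ + m * + m
      n≡ = trans e (trans e′ (sym (∣∣-square x)))
      n≡ℕ : n ≡ m ℕ.* m
      n≡ℕ = +-injective (trans n≡ (sym (pos-* m m)))
      1<m : 1 ℕ.< m
      1<m = ℕ.≰⇒> (λ m≤1 → ℕ.<⇒≱ 1<n (subst (ℕ._≤ 1) (sym n≡ℕ) (ℕ.*-mono-≤ m≤1 m≤1)))
      m<n : m ℕ.< n
      m<n = subst (m ℕ.<_) (sym n≡ℕ) (ℕ.m<m*n m m {{ℕ.>-nonZero (ℕ.<⇒≤ 1<m)}} 1<m)
      scale : Mod2 (+ m) → TwoNonzeroSquares (+ n * + n)
      scale (q , inj₁ even) = contradiction (linear₂ 1ℤ (+ m + + 2 * q) (trans (sym odd) n≡) even (ident k q (+ m)))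
          (indivisible 2 1ℤ (+ 2 * q * q - k))
        where
        ident : ∀ k q m → 1ℤ - (+ 2 * q * q - k) * + 2 ≡ 1ℤ * (+ 2 * k + 1ℤ - m * m) + (m + + 2 * q) * (m - + 2 * q)
        ident = solve 3 (λ k q m → con 1ℤ :- (con (+ 2) :* q :* q :- k) :* con (+ 2)
            := con 1ℤ :* (con (+ 2) :* k :+ con 1ℤ :- m :* m) :+ (m :+ con (+ 2) :* q) :* (m :- con (+ 2) :* q)) refl
      scale (q , inj₂ odd′) =
        let (x , y , z , w , x≢0 , y≢0 , eq) = odd-square m (rs m<n) 1<m q odd′
        in + m * x , + m * y , + m * z , + m * w , *-≢0 (+ m) x m≢0 x≢0 , *-≢0 (+ m) y m≢0 y≢0 ,
           trans (cong₂ _*_ n≡ n≡) (linear (+ m * + m) eq (ident (+ m) x y z w))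
        where
        m≢0 : + m ≢ 0ℤ
        m≢0 h = ℕ.<⇒≢ (ℕ.<⇒≤ 1<m) (sym (+-injective h))
        ident : ∀ m x y z w → m * m * (m * m) - (m * x * (m * x) + m * y * (m * y) + m * z * (m * z) + m * w * (m * w))
          ≡ m * m * (m * m - (x * x + y * y + z * z + w * w))
        ident = solve 5 (λ m x y z w → m :* m :* (m :* m) :- (m :* x :* (m :* x) :+ m :* y :* (m :* y) :+ m :* z :* (m :* z) :+ m :* w :* (m :* w))
            := m :* m :* (m :* m :- (x :* x :+ y :* y :+ z :* z :+ w :* w))) refl

  SumOfFourUnits : ℤ → Set
  SumOfFourUnits n = ∃ λ u → ∃ λ v → ∃ λ w → ∃ λ x → n ≡ unit² u + unit² v + unit² w + unit² x

  module _ (N : ℤ) where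
    private
      n = + 3 * N + + 4

    residue-clash : ∀ i r {_ : 1ℤ - + i ≡ r} → (∀ t → r ≢ t * + 3) → ∀ {i′ j} (us : Vec ℤ i′) (ts : Vec ℤ j) → i′ ≡ i →
      n ≢ sumOver unit² us + sumOver triple² ts
    residue-clash i r {refl} h us ts refl e = let (t , e′) = split-mod3 us ts in
      h (t - N - 1ℤ) (linear 1ℤ (trans e e′) (ident N t (+ i)))
      where
      ident : ∀ N t i → 1ℤ - i - (t - N - 1ℤ) * + 3 ≡ 1ℤ * (+ 3 * N + + 4 - (i + t * + 3))
      ident = solve 3 (λ N t i → con 1ℤ :- i :- (t :- N :- con 1ℤ) :* con (+ 3)
          := con 1ℤ :* (con (+ 3) :* N :+ con (+ 4) :- (i :+ t :* con (+ 3)))) refl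

    -- As `n ≡ 1 (mod 3)`, the number of units is 1 or 4; in the first case `ninefold` exchanges the
    -- three multiples of 3 for three units.
    finish : ∀ {i j} (us : Vec ℤ i) (ts : Vec ℤ j) → i ℕ.+ j ≡ 4 → (i ≡ 1 → sumOver square ts ≢ 0ℤ) →
      n ≡ sumOver unit² us + sumOver triple² ts → SumOfFourUnits n
    finish {0} us ts _ _ e = contradiction e (residue-clash 0 1ℤ {refl} (λ t → indivisible 3 1ℤ t) us ts refl)
    finish {2} us ts _ _ e = contradiction e (residue-clash 2 -1ℤ {refl} (λ t → indivisible 3 -1ℤ t) us ts refl)
    finish {3} us ts _ _ e = contradiction e (residue-clash 3 (- + 2) {refl} (λ t → indivisible 3 (- + 2) t) us ts refl)
    finish {4} (u ∷ v ∷ w ∷ x ∷ []) [] refl _ e = u , v , w , x , trans e (ident (unit² u) (unit² v) (unit² w) (unit² x))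
      where
      ident : ∀ u v w x → u + (v + (w + (x + 0ℤ))) + 0ℤ ≡ u + v + w + x
      ident = solve 4 (λ u v w x → u :+ (v :+ (w :+ (x :+ con 0ℤ))) :+ con 0ℤ := u :+ v :+ w :+ x) refl
    finish {1} (u ∷ []) (x ∷ y ∷ z ∷ []) refl h e =
      let (a , b , c , e₂) = ninefold s (<-wellFounded s) 0<s (x ∷ y ∷ z ∷ []) (sym s≡)
      in u , a , b , c , trans e (trans (ident (unit² u) (x * x) (y * y) (z * z))
          (trans (cong (λ t → unit² u + + 9 * t) s≡) (trans (cong (_+_ (unit² u)) e₂) (assoc₄ (unit² u) (unit² a) (unit² b) (unit² c)))))
      where
      Q = sumOver square (x ∷ y ∷ z ∷ [])
      0≤Q : 0ℤ ≤ Q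
      0≤Q = 0≤+-both (0≤sq x) (0≤+-both (0≤sq y) (0≤+-both (0≤sq z) ≤-refl))
      s = proj₁ (nonneg 0≤Q)
      s≡ : Q ≡ + s
      s≡ = proj₂ (nonneg 0≤Q)
      0<s : 0 ℕ.< s
      0<s = ℕ.n≢0⇒n>0 (λ s≡0 → h refl (trans s≡ (cong +_ s≡0)))
      ident : ∀ u x y z → u + 0ℤ + (+ 9 * x + (+ 9 * y + (+ 9 * z + 0ℤ))) ≡ u + + 9 * (x + (y + (z + 0ℤ)))
      ident = solve 4 (λ u x y z → u :+ con 0ℤ :+ (con (+ 9) :* x :+ (con (+ 9) :* y :+ (con (+ 9) :* z :+ con 0ℤ)))
          := u :+ con (+ 9) :* (x :+ (y :+ (z :+ con 0ℤ)))) refl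
      assoc₄ : ∀ u a b c → u + (a + b + c) ≡ u + a + b + c
      assoc₄ = solve-∀
    finish {suc (suc (suc (suc (suc _))))} _ _ () _ _

    private
      nonzero-triple : ∀ {b x} → b ≢ 0ℤ → square b ≡ triple² x → 0ℤ < x * x
      nonzero-triple {b} {x} b≢0 e = ≢⇒0< (0≤sq x) λ z →
        b≢0 (sq≡0 b (trans e (cong (+ 9 *_) z)))

      0≤sumOver : ∀ {k} (ts : Vec ℤ k) → 0ℤ ≤ sumOver square ts
      0≤sumOver [] = ≤-refl
      0≤sumOver (t ∷ ts) = 0≤+-both (0≤sq t) (0≤sumOver ts)

      positive-sum : ∀ {k} x (ts : Vec ℤ k) → 0ℤ < x * x → sumOver square (x ∷ ts) ≢ 0ℤ
      positive-sum x ts p e = <-irrefl (sym e) (+-mono-<-≤ p (0≤sumOver ts))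

    -- At most one of `a`, `b` can be the single unit, so the other is a nonzero multiple of 3.
    from-two-nonzero : TwoNonzeroSquares n → SumOfFourUnits n
    from-two-nonzero (a , b , c , d , a≢0 , b≢0 , e) =
      go (by-mod3 a) (by-mod3 b) (split {square} {unit²} {triple²} by-mod3 (c ∷ d ∷ []))
      where
      assemble : ∀ {A B s} → square a ≡ A → square b ≡ B → sumOver square (c ∷ d ∷ []) ≡ s → n ≡ A + B + s
      assemble ea eb es = trans e (trans (ident (a * a) (b * b) (c * c) (d * d)) (cong₂ _+_ (cong₂ _+_ ea eb) es))
        where
        ident : ∀ a b c d → a + b + c + d ≡ a + b + (c + (d + 0ℤ))
        ident = solve 4 (λ a b c d → a :+ b :+ c :+ d := a :+ b :+ (c :+ (d :+ con 0ℤ))) refl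
      go : SquareMod3 a → SquareMod3 b → Split unit² triple² 2 (sumOver square (c ∷ d ∷ [])) → SumOfFourUnits n
      go (inj₁ (u , ea)) (inj₁ (v , eb)) (splitting i j l us ts es) =
        finish (u ∷ v ∷ us) ts (cong (2 ℕ.+_) l) (λ ()) (trans (assemble ea eb es) (ident (unit² u) (unit² v) (sumOver unit² us) (sumOver triple² ts)))
        where
        ident : ∀ u v p q → u + v + (p + q) ≡ u + (v + p) + q
        ident = solve 4 (λ u v p q → u :+ v :+ (p :+ q) := u :+ (v :+ p) :+ q) refl
      go (inj₁ (u , ea)) (inj₂ (x , eb)) (splitting i j l us ts es) =
        finish (u ∷ us) (x ∷ ts) (cong suc (trans (ℕ.+-suc i j) (cong suc l))) (λ _ → positive-sum x ts (nonzero-triple {b} {x} b≢0 eb))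
          (trans (assemble ea eb es) (ident (unit² u) (triple² x) (sumOver unit² us) (sumOver triple² ts)))
        where
        ident : ∀ u v p q → u + v + (p + q) ≡ u + p + (v + q)
        ident = solve 4 (λ u v p q → u :+ v :+ (p :+ q) := u :+ p :+ (v :+ q)) refl
      go (inj₂ (x , ea)) (inj₁ (u , eb)) (splitting i j l us ts es) =
        finish (u ∷ us) (x ∷ ts) (cong suc (trans (ℕ.+-suc i j) (cong suc l))) (λ _ → positive-sum x ts (nonzero-triple {a} {x} a≢0 ea))
          (trans (assemble ea eb es) (ident (triple² x) (unit² u) (sumOver unit² us) (sumOver triple² ts)))
        where
        ident : ∀ v u p q → v + u + (p + q) ≡ u + p + (v + q)
        ident = solve 4 (λ v u p q → v :+ u :+ (p :+ q) := u :+ p :+ (v :+ q)) refl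
      go (inj₂ (x , ea)) (inj₂ (y , eb)) (splitting i j l us ts es) =
        finish us (x ∷ y ∷ ts) (trans (ℕ.+-suc i (suc j)) (cong suc (trans (ℕ.+-suc i j) (cong suc l)))) (λ _ → positive-sum x (y ∷ ts) (nonzero-triple {a} {x} a≢0 ea))
          (trans (assemble ea eb es) (ident (triple² x) (triple² y) (sumOver unit² us) (sumOver triple² ts)))
        where
        ident : ∀ x y p q → x + y + (p + q) ≡ p + (x + (y + q))
        ident = solve 4 (λ x y p q → x :+ y :+ (p :+ q) := p :+ (x :+ (y :+ q))) refl

    -- `(2h)²` is `h²` four times, and `n ≡ 1 (mod 3)` makes `h` a unit up to sign.
    even-root : ∀ h → n ≡ + 2 * h * (+ 2 * h) → SumOfFourUnits n
    even-root h e = go (by-mod3 h)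
      where
      go : SquareMod3 h → SumOfFourUnits n
      go (inj₁ (q , e′)) = q , q , q , q , trans e (linear (+ 4) e′ (ident h (unit² q)))
        where
        ident : ∀ h q → + 2 * h * (+ 2 * h) - (q + q + q + q) ≡ + 4 * (h * h - q)
        ident = solve 2 (λ h q → con (+ 2) :* h :* (con (+ 2) :* h) :- (q :+ q :+ q :+ q) := con (+ 4) :* (h :* h :- q)) refl
      go (inj₂ (q , e′)) = contradiction (linear₂ 1ℤ (+ 4) e e′ (ident N h q)) (indivisible 3 1ℤ (+ 12 * (q * q) - N - 1ℤ))
        where
        ident : ∀ N h q → 1ℤ - (+ 12 * (q * q) - N - 1ℤ) * + 3 ≡ 1ℤ * (+ 3 * N + + 4 - + 2 * h * (+ 2 * h)) + + 4 * (h * h - + 9 * (q * q))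
        ident = solve 3 (λ N h q → con 1ℤ :- (con (+ 12) :* (q :* q) :- N :- con 1ℤ) :* con (+ 3)
            := con 1ℤ :* (con (+ 3) :* N :+ con (+ 4) :- con (+ 2) :* h :* (con (+ 2) :* h)) :+ con (+ 4) :* (h :* h :- con (+ 9) :* (q :* q))) refl

  four-units : ∀ N → SumOfFourUnits (+ 3 * + N + + 4)
  four-units N = let (a , b , c , d , e) = four-squares (3 ℕ.* N ℕ.+ 4) in
    go (trans (sym n≡) (trans e (ident (a * a) (b * b) (c * c) (d * d)))) (split {square} {unit²} {triple²} by-mod3 (a ∷ b ∷ c ∷ d ∷ []))
    where
    n≡ : + (3 ℕ.* N ℕ.+ 4) ≡ + 3 * + N + + 4
    n≡ = trans (pos-+ (3 ℕ.* N) 4) (cong (_+ + 4) (pos-* 3 N))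
    ident : ∀ a b c d → a + b + c + d ≡ a + (b + (c + (d + 0ℤ)))
    ident = solve 4 (λ a b c d → a :+ b :+ c :+ d := a :+ (b :+ (c :+ (d :+ con 0ℤ)))) refl
    square-case : ∀ u → + 3 * + N + + 4 ≡ unit² u → SumOfFourUnits (+ 3 * + N + + 4)
    square-case u e = go (mod2 (+ m))
      where
      m = ∣ + 3 * u + 1ℤ ∣
      e′ : + 3 * + N + + 4 ≡ + m * + m
      e′ = trans e (sym (∣∣-square (+ 3 * u + 1ℤ)))
      1<m : 1 ℕ.< m
      -- The summand 4 keeps the root away from 1, whose square is not a sum of four squares of
      -- units.
      1<m = ℕ.≰⇒> (λ m≤1 → ℕ.<⇒≱ {1} {4} (ℕ.s≤s (ℕ.s≤s ℕ.z≤n)) (ℕ.≤-trans (ℕ.m≤n+m 4 (3 ℕ.* N))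
        (subst (ℕ._≤ 1) (sym (+-injective (trans n≡ (trans e′ (sym (pos-* m m)))))) (ℕ.*-mono-≤ m≤1 m≤1))))
      go : Mod2 (+ m) → SumOfFourUnits (+ 3 * + N + + 4)
      go (h , inj₁ even) = even-root (+ N) h (trans e′ (cong (λ t → t * t) even))
      go (k , inj₂ odd) = from-two-nonzero (+ N) (subst TwoNonzeroSquares (sym e′) (odd-square m (<-wellFounded m) 1<m k odd))
    go : ∀ {s} → + 3 * + N + + 4 ≡ s → Split unit² triple² 4 s → SumOfFourUnits (+ 3 * + N + + 4)
    go e (splitting i j l us ts es) with sumOver square ts ≟ 0ℤ
    ... | no s≢0 = finish (+ N) us ts l (λ _ → s≢0) (trans e es)
    -- The case that `finish` leaves open: one unit and three zeros, so that `n` is a square.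
    go e (splitting 1 .3 refl (u ∷ []) ts@(x ∷ y ∷ z ∷ []) es) | yes s≡0 =
      square-case u (trans e (trans es (linear (+ 9) s≡0 (ident₁ (unit² u) (x * x) (y * y) (z * z)))))
      where
      ident₁ : ∀ u x y z → u + 0ℤ + (+ 9 * x + (+ 9 * y + (+ 9 * z + 0ℤ))) - u ≡ + 9 * (x + (y + (z + 0ℤ)) - 0ℤ)
      ident₁ = solve 4 (λ u x y z → u :+ con 0ℤ :+ (con (+ 9) :* x :+ (con (+ 9) :* y :+ (con (+ 9) :* z :+ con 0ℤ))) :- u
          := con (+ 9) :* (x :+ (y :+ (z :+ con 0ℤ)) :- con 0ℤ)) refl
    go e (splitting 0 j l us ts es) | yes _ = finish (+ N) us ts l (λ ()) (trans e es)
    go e (splitting (suc (suc i)) j l us ts es) | yes _ = finish (+ N) us ts l (λ ()) (trans e es)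

-- The forms of 6p₄ + p₈ + p₈ + 2p₈ and 3p₄ + p₈ + 2p₈ + 2p₈.

module Forms where
  open Arith
  open Lagrange
  open Units
  open FourUnits
  open import Data.Nat.Base as ℕ using (ℕ; suc)
  import Data.Nat.Properties as ℕ
  open import Data.Integer.Base hiding (suc; pred; NonZero)
  open import Data.Integer.Properties
  open import Data.Integer.Tactic.RingSolver using (solve-∀)
  open import Data.Integer.Solver using (module +-*-Solver)
  open +-*-Solver using (solve; _:=_; _:+_; _:*_; _:-_; :-_; con)
  open import Data.Vec.Base using (Vec; []; _∷_)
  open import Data.Product using (_,_; ∃)
  open import Data.Sum using (_⊎_; inj₁; inj₂)
  open import Relation.Nullary using (contradiction)
  open import Relation.Binary.PropositionalEquality

  -- `sixth²` and `quarter²` are the odd and the even squares among the values of `unit²`, from even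
  -- and odd `u` respectively.
  odd² sixth² quarter² double² : ℤ → ℤ
  odd² k = (+ 2 * k + 1ℤ) * (+ 2 * k + 1ℤ)
  sixth² t = (+ 6 * t + 1ℤ) * (+ 6 * t + 1ℤ)
  quarter² t = (+ 6 * t + + 4) * (+ 6 * t + + 4)
  double² x = + 4 * (x * x)

  parity : ∀ x y → (∃ λ t → x ≡ y + + 2 * t) ⊎ (∃ λ t → x ≡ y + + 2 * t + 1ℤ)
  parity x y with mod2 (x - y)
  ... | t , inj₁ e = inj₁ (t , linear 1ℤ e (ident x y t))
    where
    ident : ∀ x y t → x - (y + + 2 * t) ≡ 1ℤ * (x - y - + 2 * t)
    ident = solve 3 (λ x y t → x :- (y :+ con (+ 2) :* t) := con 1ℤ :* (x :- y :- con (+ 2) :* t)) refl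
  ... | t , inj₂ e = inj₂ (t , linear 1ℤ e (ident x y t))
    where
    ident : ∀ x y t → x - (y + + 2 * t + 1ℤ) ≡ 1ℤ * (x - y - (+ 2 * t + 1ℤ))
    ident = solve 3 (λ x y t → x :- (y :+ con (+ 2) :* t :+ con 1ℤ) := con 1ℤ :* (x :- y :- (con (+ 2) :* t :+ con 1ℤ))) refl

  Form₁ : ℤ → Set
  Form₁ n = ∃ λ h → ∃ λ u → ∃ λ v → ∃ λ w → n ≡ + 18 * (h * h) + unit² u + unit² v + + 2 * unit² w

  -- Two of `u`, `v`, `w` have the same parity. For the units `A`, `B` built on them,
  -- `A² + B² = 2((A+B)/2)² + 2((A-B)/2)²`, where the half sum is a unit and the half difference is
  -- `3t`.
  form₁ : ∀ N → Form₁ (+ 3 * + N + + 4)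
  form₁ N = let (u , v , w , x , e) = four-units N in go u v w x e (parity u v) (parity u w)
    where
    pair : ∀ w t → unit² (w + + 2 * t) + unit² w ≡ + 2 * unit² (w + t) + + 18 * (t * t)
    pair = ident
      where
      ident : ∀ w t → (+ 3 * (w + + 2 * t) + 1ℤ) * (+ 3 * (w + + 2 * t) + 1ℤ) + (+ 3 * w + 1ℤ) * (+ 3 * w + 1ℤ)
        ≡ + 2 * ((+ 3 * (w + t) + 1ℤ) * (+ 3 * (w + t) + 1ℤ)) + + 18 * (t * t)
      ident = solve 2 (λ w t → (con (+ 3) :* (w :+ con (+ 2) :* t) :+ con 1ℤ) :* (con (+ 3) :* (w :+ con (+ 2) :* t) :+ con 1ℤ) :+ (con (+ 3) :* w :+ con 1ℤ) :* (con (+ 3) :* w :+ con 1ℤ)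
          := con (+ 2) :* ((con (+ 3) :* (w :+ t) :+ con 1ℤ) :* (con (+ 3) :* (w :+ t) :+ con 1ℤ)) :+ con (+ 18) :* (t :* t)) refl
    combine : ∀ {n} u v w x t → w ≡ x + + 2 * t → n ≡ unit² u + unit² v + unit² w + unit² x →
      n ≡ + 18 * (t * t) + unit² u + unit² v + + 2 * unit² (x + t)
    combine {n} u v .(x + + 2 * t) x t refl e = linear₂ 1ℤ 1ℤ e (pair x t)
      (ident n (t * t) (unit² u) (unit² v) (unit² (x + + 2 * t)) (unit² x) (unit² (x + t)))
      where
      ident : ∀ n h u v a b c → n - (+ 18 * h + u + v + + 2 * c) ≡ 1ℤ * (n - (u + v + a + b)) + 1ℤ * (a + b - (+ 2 * c + + 18 * h))
      ident = solve 7 (λ n h u v a b c → n :- (con (+ 18) :* h :+ u :+ v :+ con (+ 2) :* c)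
          := con 1ℤ :* (n :- (u :+ v :+ a :+ b)) :+ con 1ℤ :* (a :+ b :- (con (+ 2) :* c :+ con (+ 18) :* h))) refl
    go : ∀ u v w x → + 3 * + N + + 4 ≡ unit² u + unit² v + unit² w + unit² x →
      (∃ λ t → u ≡ v + + 2 * t) ⊎ (∃ λ t → u ≡ v + + 2 * t + 1ℤ) →
      (∃ λ t → u ≡ w + + 2 * t) ⊎ (∃ λ t → u ≡ w + + 2 * t + 1ℤ) → Form₁ (+ 3 * + N + + 4)
    go u v w x e (inj₁ (t , h)) _ = t , w , x , v + t , combine w x u v t h (trans e (ident (unit² u) (unit² v) (unit² w) (unit² x)))
      where
      ident : ∀ u v w x → u + v + w + x ≡ w + x + u + v
      ident = solve-∀
    go u v w x e (inj₂ _) (inj₁ (t , h)) = t , v , x , w + t , combine v x u w t h (trans e (ident (unit² u) (unit² v) (unit² w) (unit² x)))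
      where
      ident : ∀ u v w x → u + v + w + x ≡ v + x + u + w
      ident = solve-∀
    go u v w x e (inj₂ (t , h)) (inj₂ (s , h′)) = s - t , u , x , w + (s - t) ,
      combine u x v w (s - t) (linear₂ -1ℤ 1ℤ h h′ (ident′ u v w t s)) (trans e (ident (unit² u) (unit² v) (unit² w) (unit² x)))
      where
      ident : ∀ u v w x → u + v + w + x ≡ u + x + v + w
      ident = solve-∀
      ident′ : ∀ u v w t s → v - (w + + 2 * (s - t)) ≡ -1ℤ * (u - (v + + 2 * t + 1ℤ)) + 1ℤ * (u - (w + + 2 * s + 1ℤ))
      ident′ = solve-∀

  -- `6M + 8` is twice `3M + 4`. Two of its four units stay doubled; for the others
  -- `2(C² + D²) = (C - D)² + (C + D)²`, where `C - D = 3(c - d)` and `C + D` is minus a unit.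
  form₂-even : ∀ M → ∃ λ h → ∃ λ u → ∃ λ v → ∃ λ w →
    + 6 * + M + + 8 ≡ + 9 * (h * h) + unit² u + + 2 * unit² v + + 2 * unit² w
  form₂-even M = let (a , b , c , d , e) = four-units M in
    c - d , - c - d - 1ℤ , a , b , linear (+ 2) e (ident (+ M) a b c d)
    where
    ident : ∀ M a b c d → + 6 * M + + 8 - (+ 9 * ((c - d) * (c - d))
      + (+ 3 * (- c - d - 1ℤ) + 1ℤ) * (+ 3 * (- c - d - 1ℤ) + 1ℤ)
      + + 2 * ((+ 3 * a + 1ℤ) * (+ 3 * a + 1ℤ)) + + 2 * ((+ 3 * b + 1ℤ) * (+ 3 * b + 1ℤ)))
      ≡ + 2 * (+ 3 * M + + 4 - ((+ 3 * a + 1ℤ) * (+ 3 * a + 1ℤ) + (+ 3 * b + 1ℤ) * (+ 3 * b + 1ℤ)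
        + (+ 3 * c + 1ℤ) * (+ 3 * c + 1ℤ) + (+ 3 * d + 1ℤ) * (+ 3 * d + 1ℤ)))
    ident = solve 5 (λ M a b c d → con (+ 6) :* M :+ con (+ 8) :- (con (+ 9) :* ((c :- d) :* (c :- d)) :+ (con (+ 3) :* (:- c :- d :- con 1ℤ) :+ con 1ℤ) :* (con (+ 3) :* (:- c :- d :- con 1ℤ) :+ con 1ℤ) :+ con (+ 2) :* ((con (+ 3) :* a :+ con 1ℤ) :* (con (+ 3) :* a :+ con 1ℤ)) :+ con (+ 2) :* ((con (+ 3) :* b :+ con 1ℤ) :* (con (+ 3) :* b :+ con 1ℤ)))
        := con (+ 2) :* (con (+ 3) :* M :+ con (+ 4) :- ((con (+ 3) :* a :+ con 1ℤ) :* (con (+ 3) :* a :+ con 1ℤ) :+ (con (+ 3) :* b :+ con 1ℤ) :* (con (+ 3) :* b :+ con 1ℤ) :+ (con (+ 3) :* c :+ con 1ℤ) :* (con (+ 3) :* c :+ con 1ℤ) :+ (con (+ 3) :* d :+ con 1ℤ) :* (con (+ 3) :* d :+ con 1ℤ)))) refl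

  clash-mod3 : ∀ {i j n} r M → n ≡ + 3 * M + r → ∀ k → (∀ t → r - + k ≢ t * + 3) → i ≡ k →
    (us : Vec ℤ i) (ts : Vec ℤ j) → n ≢ sumOver unit² us + sumOver triple² ts
  clash-mod3 {i} {n = n} r M n≡ k h refl us ts e = let (t , e′) = split-mod3 us ts in
    h (t - M) (linear₂ 1ℤ -1ℤ (trans e e′) n≡ (ident n M r t (+ i)))
    where
    ident : ∀ n M r t i → r - i - (t - M) * + 3 ≡ 1ℤ * (n - (i + t * + 3)) + -1ℤ * (n - (+ 3 * M + r))
    ident = solve 5 (λ n M r t i → r :- i :- (t :- M) :* con (+ 3)
        := con 1ℤ :* (n :- (i :+ t :* con (+ 3))) :+ con -1ℤ :* (n :- (con (+ 3) :* M :+ r))) refl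

  -- The residue 2 modulo 3 leaves exactly two units among the four roots. If a unit `U` has the
  -- parity of a multiple `X` of 3, then `U² + X² = 2((U+X)/2)² + 2((U-X)/2)²`, and both halves are
  -- units up to sign.
  form₂-odd : ∀ M → ∃ λ h → ∃ λ u → ∃ λ v → ∃ λ w →
    + 6 * + M + + 5 ≡ + 9 * (h * h) + unit² u + + 2 * unit² v + + 2 * unit² w
  form₂-odd M = let (a , b , c , d , e) = four-squares (6 ℕ.* M ℕ.+ 5) in
    go (split {square} {unit²} {triple²} by-mod3 (a ∷ b ∷ c ∷ d ∷ []))
       (trans (sym n≡) (trans e (ident (a * a) (b * b) (c * c) (d * d))))
    where
    n = + 6 * + M + + 5
    n≡ : + (6 ℕ.* M ℕ.+ 5) ≡ n
    n≡ = trans (pos-+ (6 ℕ.* M) 5) (cong (_+ + 5) (pos-* 6 M))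
    ident : ∀ a b c d → a + b + c + d ≡ a + (b + (c + (d + 0ℤ)))
    ident = solve 4 (λ a b c d → a :+ b :+ c :+ d := a :+ (b :+ (c :+ (d :+ con 0ℤ)))) refl
    n≡3 : n ≡ + 3 * (+ 2 * + M) + + 5
    n≡3 = ident₃ (+ M)
      where
      ident₃ : ∀ M → + 6 * M + + 5 ≡ + 3 * (+ 2 * M) + + 5
      ident₃ = solve-∀
    Result : Set
    Result = ∃ λ h → ∃ λ u → ∃ λ v → ∃ λ w → n ≡ + 9 * (h * h) + unit² u + + 2 * unit² v + + 2 * unit² w
    combine : ∀ u v x y t → u ≡ x + + 2 * t + 1ℤ → n ≡ unit² u + unit² v + triple² x + triple² y → Result
    combine u v x y t refl e = y , v , - x - t - 1ℤ , - t - 1ℤ , trans e (ident₄ x t (unit² v) (y * y))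
      where
      ident₄ : ∀ x t v y → (+ 3 * (x + + 2 * t + 1ℤ) + 1ℤ) * (+ 3 * (x + + 2 * t + 1ℤ) + 1ℤ) + v + + 9 * (x * x) + + 9 * y
        ≡ + 9 * y + v + + 2 * ((+ 3 * (- x - t - 1ℤ) + 1ℤ) * (+ 3 * (- x - t - 1ℤ) + 1ℤ))
        + + 2 * ((+ 3 * (- t - 1ℤ) + 1ℤ) * (+ 3 * (- t - 1ℤ) + 1ℤ))
      ident₄ = solve 4 (λ x t v y → (con (+ 3) :* (x :+ con (+ 2) :* t :+ con 1ℤ) :+ con 1ℤ) :* (con (+ 3) :* (x :+ con (+ 2) :* t :+ con 1ℤ) :+ con 1ℤ) :+ v :+ con (+ 9) :* (x :* x) :+ con (+ 9) :* y
          := con (+ 9) :* y :+ v :+ con (+ 2) :* ((con (+ 3) :* (:- x :- t :- con 1ℤ) :+ con 1ℤ) :* (con (+ 3) :* (:- x :- t :- con 1ℤ) :+ con 1ℤ)) :+ con (+ 2) :* ((con (+ 3) :* (:- t :- con 1ℤ) :+ con 1ℤ) :* (con (+ 3) :* (:- t :- con 1ℤ) :+ con 1ℤ))) refl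
    match : ∀ u v x y → n ≡ unit² u + unit² v + triple² x + triple² y → Result
    match u v x y e = go′ (parity u x) (parity u y) (parity v x)
      where
      go′ : (∃ λ t → u ≡ x + + 2 * t) ⊎ (∃ λ t → u ≡ x + + 2 * t + 1ℤ) → (∃ λ t → u ≡ y + + 2 * t) ⊎ (∃ λ t → u ≡ y + + 2 * t + 1ℤ) →
        (∃ λ t → v ≡ x + + 2 * t) ⊎ (∃ λ t → v ≡ x + + 2 * t + 1ℤ) → Result
      go′ (inj₂ (t , h)) _ _ = combine u v x y t h e
      go′ _ (inj₂ (t , h)) _ = combine u v y x t h (trans e (swap (unit² u) (unit² v) (triple² x) (triple² y)))
        where
        swap : ∀ u v x y → u + v + x + y ≡ u + v + y + x
        swap = solve-∀
      go′ _ _ (inj₂ (t , h)) = combine v u x y t h (trans e (swap (unit² u) (unit² v) (triple² x) (triple² y)))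
        where
        swap : ∀ u v x y → u + v + x + y ≡ v + u + x + y
        swap = solve-∀
      -- Both units now have the parity opposite to both multiples of 3, so the four squares have an
      -- even sum, while `6M + 5` is odd.
      go′ (inj₁ (a , refl)) (inj₁ (b , h)) (inj₁ (c , refl)) = contradiction
        (linear₂ 1ℤ (+ 9 * (y + x + + 2 * a - + 2 * b)) e (sym h) (ident₅ (+ M) x y a b c)) (indivisible 2 1ℤ (W (+ M) x a b c))
        where
        W : ℤ → ℤ → ℤ → ℤ → ℤ → ℤ
        W M x a b c = + 18 * (x * x) + + 6 * x + 1ℤ + + 6 * a * (+ 3 * x + 1ℤ) + + 18 * (a * a) + + 6 * c * (+ 3 * x + 1ℤ)
            + + 18 * (c * c) + + 18 * (x * (a - b)) + + 18 * ((a - b) * (a - b)) - + 3 * M - + 2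
        ident₅ : ∀ M x y a b c → 1ℤ - (+ 18 * (x * x) + + 6 * x + 1ℤ + + 6 * a * (+ 3 * x + 1ℤ) + + 18 * (a * a) + + 6 * c * (+ 3 * x + 1ℤ)
            + + 18 * (c * c) + + 18 * (x * (a - b)) + + 18 * ((a - b) * (a - b)) - + 3 * M - + 2) * + 2
          ≡ 1ℤ * (+ 6 * M + + 5 - ((+ 3 * (x + + 2 * a) + 1ℤ) * (+ 3 * (x + + 2 * a) + 1ℤ)
              + (+ 3 * (x + + 2 * c) + 1ℤ) * (+ 3 * (x + + 2 * c) + 1ℤ) + + 9 * (x * x) + + 9 * (y * y)))
            + + 9 * (y + x + + 2 * a - + 2 * b) * (y + + 2 * b - (x + + 2 * a))
        ident₅ = solve 6 (λ M x y a b c → con 1ℤ :- (con (+ 18) :* (x :* x) :+ con (+ 6) :* x :+ con 1ℤ :+ con (+ 6) :* a :* (con (+ 3) :* x :+ con 1ℤ) :+ con (+ 18) :* (a :* a) :+ con (+ 6) :* c :* (con (+ 3) :* x :+ con 1ℤ) :+ con (+ 18) :* (c :* c) :+ con (+ 18) :* (x :* (a :- b)) :+ con (+ 18) :* ((a :- b) :* (a :- b)) :- con (+ 3) :* M :- con (+ 2)) :* con (+ 2)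
            := con 1ℤ :* (con (+ 6) :* M :+ con (+ 5) :- ((con (+ 3) :* (x :+ con (+ 2) :* a) :+ con 1ℤ) :* (con (+ 3) :* (x :+ con (+ 2) :* a) :+ con 1ℤ) :+ (con (+ 3) :* (x :+ con (+ 2) :* c) :+ con 1ℤ) :* (con (+ 3) :* (x :+ con (+ 2) :* c) :+ con 1ℤ) :+ con (+ 9) :* (x :* x) :+ con (+ 9) :* (y :* y))) :+ con (+ 9) :* (y :+ x :+ con (+ 2) :* a :- con (+ 2) :* b) :* (y :+ con (+ 2) :* b :- (x :+ con (+ 2) :* a))) refl
    go : ∀ {s} → Split unit² triple² 4 s → n ≡ s → Result
    go (splitting 2 .2 refl (u ∷ v ∷ []) (x ∷ y ∷ []) es) e = match u v x y (trans e (trans es (ident′ (unit² u) (unit² v) (triple² x) (triple² y))))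
      where
      ident′ : ∀ u v x y → u + (v + 0ℤ) + (x + (y + 0ℤ)) ≡ u + v + x + y
      ident′ = solve 4 (λ u v x y → u :+ (v :+ con 0ℤ) :+ (x :+ (y :+ con 0ℤ)) := u :+ v :+ x :+ y) refl
    go (splitting 0 _ _ us ts es) e = contradiction (trans e es) (clash-mod3 (+ 5) (+ 2 * + M) n≡3 0 (λ t → indivisible 3 (+ 5) t) refl us ts)
    go (splitting 1 _ _ us ts es) e = contradiction (trans e es) (clash-mod3 (+ 5) (+ 2 * + M) n≡3 1 (λ t → indivisible 3 (+ 4) t) refl us ts)
    go (splitting 3 _ _ us ts es) e = contradiction (trans e es) (clash-mod3 (+ 5) (+ 2 * + M) n≡3 3 (λ t → indivisible 3 (+ 2) t) refl us ts)
    go (splitting 4 _ _ us ts es) e = contradiction (trans e es) (clash-mod3 (+ 5) (+ 2 * + M) n≡3 4 (λ t → indivisible 3 (+ 1) t) refl us ts)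
    go (splitting (suc (suc (suc (suc (suc _))))) _ () _ _ _) _

  form₂ : ∀ N → ∃ λ h → ∃ λ u → ∃ λ v → ∃ λ w →
    + 3 * + N + + 5 ≡ + 9 * (h * h) + unit² u + + 2 * unit² v + + 2 * unit² w
  form₂ N with even⊎odd N
  ... | M , inj₁ refl = let (h , u , v , w , e) = form₂-odd M in h , u , v , w , trans (trans (cong (λ z → + 3 * z + + 5) (pos-+ M M)) (ident (+ M))) e
    where
    ident : ∀ M → + 3 * (M + M) + + 5 ≡ + 6 * M + + 5
    ident = solve-∀
  ... | M , inj₂ refl = let (h , u , v , w , e) = form₂-even M in h , u , v , w ,
    trans (trans (cong (λ z → + 3 * z + + 5) (trans (pos-+ 1 (M ℕ.+ M)) (cong (_+_ 1ℤ) (pos-+ M M)))) (ident (+ M))) e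
    where
    ident : ∀ M → + 3 * (1ℤ + (M + M)) + + 5 ≡ + 6 * M + + 8
    ident = solve 1 (λ M → con (+ 3) :* (con 1ℤ :+ (M :+ M)) :+ con (+ 5) := con (+ 6) :* M :+ con (+ 8)) refl

-- The forms with p₃ that come from units modulo 4 and 8.

module Forms24 where
  open Arith
  open Lagrange
  open Units
  open FourUnits
  open Forms
  open import Data.Nat.Base as ℕ using (ℕ; suc)
  import Data.Nat.Properties as ℕ
  open import Data.Nat.Induction using (<-wellFounded)
  open import Data.Integer.Base hiding (suc; pred; NonZero)
  open import Data.Integer.Properties
  open import Data.Integer.Tactic.RingSolver using (solve-∀)
  open import Data.Integer.Solver using (module +-*-Solver)
  open +-*-Solver using (solve; _:=_; _:+_; _:*_; _:-_; :-_; con)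
  open import Data.Vec.Base using (Vec; []; _∷_)
  open import Data.Product using (_,_; ∃)
  open import Data.Sum using (_⊎_; inj₁; inj₂)
  open import Relation.Nullary using (yes; no; contradiction)
  open import Relation.Binary.PropositionalEquality

  module Residues (k : ℤ) (g h : ℤ → ℤ) (g≡ : ∀ t → ∃ λ q → g t ≡ 1ℤ + q * k) (h≡ : ∀ t → ∃ λ q → h t ≡ q * k) where
    sum-g : ∀ {n} (ys : Vec ℤ n) → ∃ λ q → sumOver g ys ≡ + n + q * k
    sum-g [] = 0ℤ , refl
    sum-g {suc n} (y ∷ ys) = let (q , e) = g≡ y ; (r , e′) = sum-g ys in
      q + r , trans (cong₂ _+_ e e′) (trans (ident k q r (+ n)) (cong (_+ (q + r) * k) (sym (pos-+ 1 n))))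
      where
      ident : ∀ k q r n → 1ℤ + q * k + (n + r * k) ≡ 1ℤ + n + (q + r) * k
      ident = solve 4 (λ k q r n → con 1ℤ :+ q :* k :+ (n :+ r :* k) := con 1ℤ :+ n :+ (q :+ r) :* k) refl

    sum-h : ∀ {n} (ys : Vec ℤ n) → ∃ λ q → sumOver h ys ≡ q * k
    sum-h [] = 0ℤ , refl
    sum-h (y ∷ ys) = let (q , e) = h≡ y ; (r , e′) = sum-h ys in q + r , trans (cong₂ _+_ e e′) (ident k q r)
      where
      ident : ∀ k q r → q * k + r * k ≡ (q + r) * k
      ident = solve-∀

    -- The sum is congruent modulo `k` to the number of `g`-summands; this discards every count `i₀`
    -- that disagrees with the residue `r`.
    clash : ∀ {i j n} r M → n ≡ M * k + r → ∀ i₀ → (∀ t → r - + i₀ ≢ t * k) → i ≡ i₀ →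
      (us : Vec ℤ i) (ts : Vec ℤ j) → n ≢ sumOver g us + sumOver h ts
    clash {i} {n = n} r M n≡ i₀ c refl us ts e =
      let (q , e₁) = sum-g us ; (q′ , e₂) = sum-h ts in
      c (q + q′ - M) (linear₂ 1ℤ -1ℤ (trans e (cong₂ _+_ e₁ e₂)) n≡ (ident n M r q q′ (+ i) k))
      where
      ident : ∀ n M r q q′ i k → r - i - (q + q′ - M) * k ≡ 1ℤ * (n - (i + q * k + q′ * k)) + -1ℤ * (n - (M * k + r))
      ident = solve 7 (λ n M r q q′ i k → r :- i :- (q :+ q′ :- M) :* k := con 1ℤ :* (n :- (i :+ q :* k :+ q′ :* k)) :+ con -1ℤ :* (n :- (M :* k :+ r))) refl

  unit-by-parity : ∀ u → (∃ λ t → unit² u ≡ sixth² t) ⊎ (∃ λ t → unit² u ≡ quarter² t)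
  unit-by-parity u with mod2 u
  ... | t , inj₁ refl = inj₁ (t , ident t)
    where
    ident : ∀ t → (+ 3 * (+ 2 * t) + 1ℤ) * (+ 3 * (+ 2 * t) + 1ℤ) ≡ (+ 6 * t + 1ℤ) * (+ 6 * t + 1ℤ)
    ident = solve 1 (λ t → (con (+ 3) :* (con (+ 2) :* t) :+ con 1ℤ) :* (con (+ 3) :* (con (+ 2) :* t) :+ con 1ℤ)
        := (con (+ 6) :* t :+ con 1ℤ) :* (con (+ 6) :* t :+ con 1ℤ)) refl
  ... | t , inj₂ refl = inj₂ (t , ident t)
    where
    ident : ∀ t → (+ 3 * (+ 2 * t + 1ℤ) + 1ℤ) * (+ 3 * (+ 2 * t + 1ℤ) + 1ℤ) ≡ (+ 6 * t + + 4) * (+ 6 * t + + 4)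
    ident = solve 1 (λ t → (con (+ 3) :* (con (+ 2) :* t :+ con 1ℤ) :+ con 1ℤ) :* (con (+ 3) :* (con (+ 2) :* t :+ con 1ℤ) :+ con 1ℤ)
        := (con (+ 6) :* t :+ con (+ 4)) :* (con (+ 6) :* t :+ con (+ 4))) refl

  sixth-mod4 : ∀ t → ∃ λ q → sixth² t ≡ 1ℤ + q * + 4
  sixth-mod4 t = + 9 * (t * t) + + 3 * t , ident t
    where
    ident : ∀ t → (+ 6 * t + 1ℤ) * (+ 6 * t + 1ℤ) ≡ 1ℤ + (+ 9 * (t * t) + + 3 * t) * + 4
    ident = solve 1 (λ t → (con (+ 6) :* t :+ con 1ℤ) :* (con (+ 6) :* t :+ con 1ℤ)
        := con 1ℤ :+ (con (+ 9) :* (t :* t) :+ con (+ 3) :* t) :* con (+ 4)) refl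

  quarter-mod4 : ∀ t → ∃ λ q → quarter² t ≡ q * + 4
  quarter-mod4 t = + 9 * (t * t) + + 12 * t + + 4 , ident t
    where
    ident : ∀ t → (+ 6 * t + + 4) * (+ 6 * t + + 4) ≡ (+ 9 * (t * t) + + 12 * t + + 4) * + 4
    ident = solve 1 (λ t → (con (+ 6) :* t :+ con (+ 4)) :* (con (+ 6) :* t :+ con (+ 4))
        := (con (+ 9) :* (t :* t) :+ con (+ 12) :* t :+ con (+ 4)) :* con (+ 4)) refl

  -- The two factors have opposite parity. The choices `b = 0`, `b = a`, `b = a - 1` cover `x(x+1)`,
  -- `x(3x+1)` and `x(3x-1)`.
  half-product : ∀ a b → (∃ λ q → a * (a + + 2 * b + 1ℤ) ≡ + 2 * q)
  half-product a b with mod2 a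
  ... | q , inj₁ refl = q * (+ 2 * q + + 2 * b + 1ℤ) , ident q b
    where
    ident : ∀ q b → + 2 * q * (+ 2 * q + + 2 * b + 1ℤ) ≡ + 2 * (q * (+ 2 * q + + 2 * b + 1ℤ))
    ident = solve 2 (λ q b → con (+ 2) :* q :* (con (+ 2) :* q :+ con (+ 2) :* b :+ con 1ℤ)
        := con (+ 2) :* (q :* (con (+ 2) :* q :+ con (+ 2) :* b :+ con 1ℤ))) refl
  ... | q , inj₂ refl = (+ 2 * q + 1ℤ) * (q + b + 1ℤ) , ident q b
    where
    ident : ∀ q b → (+ 2 * q + 1ℤ) * (+ 2 * q + 1ℤ + + 2 * b + 1ℤ) ≡ + 2 * ((+ 2 * q + 1ℤ) * (q + b + 1ℤ))
    ident = solve 2 (λ q b → (con (+ 2) :* q :+ con 1ℤ) :* (con (+ 2) :* q :+ con 1ℤ :+ con (+ 2) :* b :+ con 1ℤ)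
        := con (+ 2) :* ((con (+ 2) :* q :+ con 1ℤ) :* (q :+ b :+ con 1ℤ))) refl

  sixth-mod8 : ∀ t → ∃ λ q → sixth² t ≡ 1ℤ + q * + 8
  sixth-mod8 t = let (q , e) = half-product t t in + 3 * q , linear (+ 12) e (ident t q)
    where
    ident : ∀ t q → (+ 6 * t + 1ℤ) * (+ 6 * t + 1ℤ) - (1ℤ + + 3 * q * + 8) ≡ + 12 * (t * (t + + 2 * t + 1ℤ) - + 2 * q)
    ident = solve 2 (λ t q → (con (+ 6) :* t :+ con 1ℤ) :* (con (+ 6) :* t :+ con 1ℤ) :- (con 1ℤ :+ con (+ 3) :* q :* con (+ 8))
        := con (+ 12) :* (t :* (t :+ con (+ 2) :* t :+ con 1ℤ) :- con (+ 2) :* q)) refl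

  odd-mod8 : ∀ r → ∃ λ q → odd² r ≡ 1ℤ + q * + 8
  odd-mod8 r = let (q , e) = half-product r 0ℤ in q , linear (+ 4) e (ident r q)
    where
    ident : ∀ r q → (+ 2 * r + 1ℤ) * (+ 2 * r + 1ℤ) - (1ℤ + q * + 8) ≡ + 4 * (r * (r + + 2 * 0ℤ + 1ℤ) - + 2 * q)
    ident = solve 2 (λ r q → (con (+ 2) :* r :+ con 1ℤ) :* (con (+ 2) :* r :+ con 1ℤ) :- (con 1ℤ :+ q :* con (+ 8))
        := con (+ 4) :* (r :* (r :+ con (+ 2) :* con 0ℤ :+ con 1ℤ) :- con (+ 2) :* q)) refl

  module Mod4 = Residues (+ 4) sixth² quarter² sixth-mod4 quarter-mod4

  parities : ∀ {n} → SumOfFourUnits n → Split sixth² quarter² 4 n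
  parities (u , v , w , x , e) = subst (Split sixth² quarter² 4) (sym (trans e (ident (unit² u) (unit² v) (unit² w) (unit² x))))
    (split {unit²} {sixth²} {quarter²} unit-by-parity (u ∷ v ∷ w ∷ x ∷ []))
    where
    ident : ∀ a b c d → a + b + c + d ≡ a + (b + (c + (d + 0ℤ)))
    ident = solve 4 (λ a b c d → a :+ b :+ c :+ d := a :+ (b :+ (c :+ (d :+ con 0ℤ)))) refl

  Form₉ Form₁₀ Form₁₁ Form₁₂ Form₁₃ Form₈ : ℤ → Set
  Form₉ n = ∃ λ x → ∃ λ y → ∃ λ z → ∃ λ w → n ≡ + 3 * odd² x + + 9 * odd² y + + 24 * (z * z) + + 2 * sixth² w
  Form₁₀ n = ∃ λ x → ∃ λ y → ∃ λ z → ∃ λ w → n ≡ + 3 * odd² x + + 18 * odd² y + + 24 * (z * z) + sixth² w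
  Form₁₁ n = ∃ λ x → ∃ λ y → ∃ λ z → ∃ λ w → n ≡ + 3 * odd² x + + 6 * odd² y + + 72 * (z * z) + sixth² w
  Form₁₂ n = ∃ λ x → ∃ λ y → ∃ λ z → ∃ λ w → n ≡ + 3 * odd² x + + 6 * odd² y + sixth² z + + 8 * unit² w
  Form₁₃ n = ∃ λ x → ∃ λ y → ∃ λ z → ∃ λ w → n ≡ + 3 * odd² x + + 6 * odd² y + + 9 * odd² z + + 8 * unit² w
  Form₈ n = ∃ λ x → ∃ λ y → ∃ λ z → ∃ λ w → n ≡ + 3 * odd² x + + 24 * (y * y) + sixth² z + + 2 * sixth² w

  -- With units a = 3α+1, b, c, d one has 2(a² + b² + c² + d²) = 9(α-β)² + 3(2γ-α-β)² + 6(α+β+γ+1)² + 2d².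
  form₉ : ∀ N → Form₉ (+ 24 * + N + + 14)
  form₉ N = go (parities (four-units (4 ℕ.* N ℕ.+ 1)))
    where
    m = + 3 * + (4 ℕ.* N ℕ.+ 1) + + 4
    m≡₁₂ : m ≡ + 12 * + N + + 7
    m≡₁₂ = trans (cong (λ z → + 3 * z + + 4) (trans (pos-+ (4 ℕ.* N) 1) (cong (_+ 1ℤ) (pos-* 4 N)))) (ident (+ N))
      where
      ident : ∀ N → + 3 * (+ 4 * N + 1ℤ) + + 4 ≡ + 12 * N + + 7
      ident = solve 1 (λ N → con (+ 3) :* (con (+ 4) :* N :+ con 1ℤ) :+ con (+ 4) := con (+ 12) :* N :+ con (+ 7)) refl
    m≡ : m ≡ + 3 * + N * + 4 + + 7
    m≡ = trans m≡₁₂ (ident (+ N))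
      where
      ident : ∀ N → + 12 * N + + 7 ≡ + 3 * N * + 4 + + 7
      ident = solve-∀
    go : Split sixth² quarter² 4 m → Form₉ (+ 24 * + N + + 14)
    -- `α = 2e + 1`, `β = 2t₁`, `γ = 2t₂`: pairing the even unit with two odd ones makes `α - β` and
    -- `2γ - α - β` odd and `α + β + γ + 1` even.
    go (splitting 3 .1 refl (t₁ ∷ t₂ ∷ t₃ ∷ []) (e ∷ []) s) =
      + 2 * t₂ - e - t₁ - 1ℤ , e - t₁ , e + 1ℤ + t₁ + t₂ , t₃ , linear₂ (+ 2) (- + 2) s m≡₁₂ (ident (+ N) m t₁ t₂ t₃ e)
      where
      ident : ∀ N m t₁ t₂ t₃ e → + 24 * N + + 14 - (+ 3 * ((+ 2 * (+ 2 * t₂ - e - t₁ - 1ℤ) + 1ℤ) * (+ 2 * (+ 2 * t₂ - e - t₁ - 1ℤ) + 1ℤ))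
          + + 9 * ((+ 2 * (e - t₁) + 1ℤ) * (+ 2 * (e - t₁) + 1ℤ)) + + 24 * ((e + 1ℤ + t₁ + t₂) * (e + 1ℤ + t₁ + t₂))
          + + 2 * ((+ 6 * t₃ + 1ℤ) * (+ 6 * t₃ + 1ℤ)))
        ≡ + 2 * (m - ((+ 6 * t₁ + 1ℤ) * (+ 6 * t₁ + 1ℤ) + ((+ 6 * t₂ + 1ℤ) * (+ 6 * t₂ + 1ℤ) + ((+ 6 * t₃ + 1ℤ) * (+ 6 * t₃ + 1ℤ) + 0ℤ))
          + ((+ 6 * e + + 4) * (+ 6 * e + + 4) + 0ℤ))) + - + 2 * (m - (+ 12 * N + + 7))
      ident = solve 6 (λ N m t₁ t₂ t₃ e → con (+ 24) :* N :+ con (+ 14) :- (con (+ 3) :* ((con (+ 2) :* (con (+ 2) :* t₂ :- e :- t₁ :- con 1ℤ) :+ con 1ℤ) :* (con (+ 2) :* (con (+ 2) :* t₂ :- e :- t₁ :- con 1ℤ) :+ con 1ℤ)) :+ con (+ 9) :* ((con (+ 2) :* (e :- t₁) :+ con 1ℤ) :* (con (+ 2) :* (e :- t₁) :+ con 1ℤ)) :+ con (+ 24) :* ((e :+ con 1ℤ :+ t₁ :+ t₂) :* (e :+ con 1ℤ :+ t₁ :+ t₂)) :+ con (+ 2) :* ((con (+ 6) :* t₃ :+ con 1ℤ) :* (con (+ 6) :* t₃ :+ con 1ℤ)))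
          := con (+ 2) :* (m :- ((con (+ 6) :* t₁ :+ con 1ℤ) :* (con (+ 6) :* t₁ :+ con 1ℤ) :+ ((con (+ 6) :* t₂ :+ con 1ℤ) :* (con (+ 6) :* t₂ :+ con 1ℤ) :+ ((con (+ 6) :* t₃ :+ con 1ℤ) :* (con (+ 6) :* t₃ :+ con 1ℤ) :+ con 0ℤ)) :+ ((con (+ 6) :* e :+ con (+ 4)) :* (con (+ 6) :* e :+ con (+ 4)) :+ con 0ℤ))) :+ :- con (+ 2) :* (m :- (con (+ 12) :* N :+ con (+ 7)))) refl
    go (splitting 0 _ _ us ts s) = contradiction s (Mod4.clash (+ 7) (+ 3 * + N) m≡ 0 (λ t → indivisible 4 (+ 7) t) refl us ts)
    go (splitting 1 _ _ us ts s) = contradiction s (Mod4.clash (+ 7) (+ 3 * + N) m≡ 1 (λ t → indivisible 4 (+ 6) t) refl us ts)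
    go (splitting 2 _ _ us ts s) = contradiction s (Mod4.clash (+ 7) (+ 3 * + N) m≡ 2 (λ t → indivisible 4 (+ 5) t) refl us ts)
    go (splitting 4 _ _ us ts s) = contradiction s (Mod4.clash (+ 7) (+ 3 * + N) m≡ 4 (λ t → indivisible 4 (+ 3) t) refl us ts)
    go (splitting (suc (suc (suc (suc (suc _))))) _ () _ _ _)

  -- The identity used for `form₉`, now with one odd unit: `α = 2t`, `β = 2b + 1`, `γ = 2c + 1` make
  -- all three linear forms odd, and twice the square of the remaining even unit is `8(3d + 2)²`.
  form₁₃ : ∀ N → Form₁₃ (+ 24 * + N + + 26)
  form₁₃ N = go (parities (four-units (4 ℕ.* N ℕ.+ 3)))
    where
    m = + 3 * + (4 ℕ.* N ℕ.+ 3) + + 4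
    m≡₁₂ : m ≡ + 12 * + N + + 13
    m≡₁₂ = trans (cong (λ z → + 3 * z + + 4) (trans (pos-+ (4 ℕ.* N) 3) (cong (_+ + 3) (pos-* 4 N)))) (ident (+ N))
      where
      ident : ∀ N → + 3 * (+ 4 * N + + 3) + + 4 ≡ + 12 * N + + 13
      ident = solve 1 (λ N → con (+ 3) :* (con (+ 4) :* N :+ con (+ 3)) :+ con (+ 4) := con (+ 12) :* N :+ con (+ 13)) refl
    m≡ : m ≡ + 3 * + N * + 4 + + 13
    m≡ = trans m≡₁₂ (ident (+ N))
      where
      ident : ∀ N → + 12 * N + + 13 ≡ + 3 * N * + 4 + + 13
      ident = solve-∀
    go : Split sixth² quarter² 4 m → Form₁₃ (+ 24 * + N + + 26)
    go (splitting 1 .3 refl (t ∷ []) (b ∷ c ∷ d ∷ []) s) =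
      + 2 * c - t - b , t + b + c + 1ℤ , t - b - 1ℤ , - d - 1ℤ , linear₂ (+ 2) (- + 2) s m≡₁₂ (ident (+ N) m t b c d)
      where
      ident : ∀ N m t b c d → + 24 * N + + 26 - (+ 3 * ((+ 2 * (+ 2 * c - t - b) + 1ℤ) * (+ 2 * (+ 2 * c - t - b) + 1ℤ))
          + + 6 * ((+ 2 * (t + b + c + 1ℤ) + 1ℤ) * (+ 2 * (t + b + c + 1ℤ) + 1ℤ))
          + + 9 * ((+ 2 * (t - b - 1ℤ) + 1ℤ) * (+ 2 * (t - b - 1ℤ) + 1ℤ))
          + + 8 * ((+ 3 * (- d - 1ℤ) + 1ℤ) * (+ 3 * (- d - 1ℤ) + 1ℤ)))
        ≡ + 2 * (m - ((+ 6 * t + 1ℤ) * (+ 6 * t + 1ℤ) + 0ℤ + ((+ 6 * b + + 4) * (+ 6 * b + + 4)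
          + ((+ 6 * c + + 4) * (+ 6 * c + + 4) + ((+ 6 * d + + 4) * (+ 6 * d + + 4) + 0ℤ))))) + - + 2 * (m - (+ 12 * N + + 13))
      ident = solve 6 (λ N m t b c d → con (+ 24) :* N :+ con (+ 26) :- (con (+ 3) :* ((con (+ 2) :* (con (+ 2) :* c :- t :- b) :+ con 1ℤ) :* (con (+ 2) :* (con (+ 2) :* c :- t :- b) :+ con 1ℤ)) :+ con (+ 6) :* ((con (+ 2) :* (t :+ b :+ c :+ con 1ℤ) :+ con 1ℤ) :* (con (+ 2) :* (t :+ b :+ c :+ con 1ℤ) :+ con 1ℤ)) :+ con (+ 9) :* ((con (+ 2) :* (t :- b :- con 1ℤ) :+ con 1ℤ) :* (con (+ 2) :* (t :- b :- con 1ℤ) :+ con 1ℤ)) :+ con (+ 8) :* ((con (+ 3) :* (:- d :- con 1ℤ) :+ con 1ℤ) :* (con (+ 3) :* (:- d :- con 1ℤ) :+ con 1ℤ)))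
          := con (+ 2) :* (m :- ((con (+ 6) :* t :+ con 1ℤ) :* (con (+ 6) :* t :+ con 1ℤ) :+ con 0ℤ :+ ((con (+ 6) :* b :+ con (+ 4)) :* (con (+ 6) :* b :+ con (+ 4)) :+ ((con (+ 6) :* c :+ con (+ 4)) :* (con (+ 6) :* c :+ con (+ 4)) :+ ((con (+ 6) :* d :+ con (+ 4)) :* (con (+ 6) :* d :+ con (+ 4)) :+ con 0ℤ))))) :+ :- con (+ 2) :* (m :- (con (+ 12) :* N :+ con (+ 13)))) refl
    go (splitting 0 _ _ us ts s) = contradiction s (Mod4.clash (+ 13) (+ 3 * + N) m≡ 0 (λ t → indivisible 4 (+ 13) t) refl us ts)
    go (splitting 2 _ _ us ts s) = contradiction s (Mod4.clash (+ 13) (+ 3 * + N) m≡ 2 (λ t → indivisible 4 (+ 11) t) refl us ts)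
    go (splitting 3 _ _ us ts s) = contradiction s (Mod4.clash (+ 13) (+ 3 * + N) m≡ 3 (λ t → indivisible 4 (+ 10) t) refl us ts)
    go (splitting 4 _ _ us ts s) = contradiction s (Mod4.clash (+ 13) (+ 3 * + N) m≡ 4 (λ t → indivisible 4 (+ 9) t) refl us ts)
    go (splitting (suc (suc (suc (suc (suc _))))) _ () _ _ _)

  -- Two odd and two even units: the residue of the sum modulo 8 decides whether the even ones agree modulo 4.
  two-odd-units : ∀ N r → + 3 * + (8 ℕ.* N ℕ.+ r) + + 4 ≡ (+ 6 * + N + + r) * + 4 + (+ 4 - + r) → 
    (∀ t → + 4 - + r - + 0 ≢ t * + 4) → (∀ t → + 4 - + r - + 1 ≢ t * + 4) → (∀ t → + 4 - + r - + 3 ≢ t * + 4) → (∀ t → + 4 - + r - + 4 ≢ t * + 4) →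
    ∃ λ t₁ → ∃ λ t₂ → ∃ λ e₁ → ∃ λ e₂ → + 24 * + N + (+ 3 * + r + + 4) ≡ sixth² t₁ + sixth² t₂ + quarter² e₁ + quarter² e₂
  two-odd-units N r m≡ c₀ c₁ c₃ c₄ = go (parities (four-units (8 ℕ.* N ℕ.+ r)))
    where
    m = + 3 * + (8 ℕ.* N ℕ.+ r) + + 4
    m≡₂₄ : m ≡ + 24 * + N + (+ 3 * + r + + 4)
    m≡₂₄ = trans (cong (λ z → + 3 * z + + 4) (trans (pos-+ (8 ℕ.* N) r) (cong (_+ + r) (pos-* 8 N)))) (ident (+ N) (+ r))
      where
      ident : ∀ N r → + 3 * (+ 8 * N + r) + + 4 ≡ + 24 * N + (+ 3 * r + + 4)
      ident = solve 2 (λ N r → con (+ 3) :* (con (+ 8) :* N :+ r) :+ con (+ 4) := con (+ 24) :* N :+ (con (+ 3) :* r :+ con (+ 4))) refl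
    go : Split sixth² quarter² 4 m → ∃ λ t₁ → ∃ λ t₂ → ∃ λ e₁ → ∃ λ e₂ → + 24 * + N + (+ 3 * + r + + 4) ≡ sixth² t₁ + sixth² t₂ + quarter² e₁ + quarter² e₂
    go (splitting 2 .2 refl (t₁ ∷ t₂ ∷ []) (e₁ ∷ e₂ ∷ []) s) = t₁ , t₂ , e₁ , e₂ ,
      trans (sym m≡₂₄) (trans s (ident (sixth² t₁) (sixth² t₂) (quarter² e₁) (quarter² e₂)))
      where
      ident : ∀ a b c d → a + (b + 0ℤ) + (c + (d + 0ℤ)) ≡ a + b + c + d
      ident = solve 4 (λ a b c d → a :+ (b :+ con 0ℤ) :+ (c :+ (d :+ con 0ℤ)) := a :+ b :+ c :+ d) refl
    go (splitting 0 _ _ us ts s) = contradiction s (Mod4.clash (+ 4 - + r) (+ 6 * + N + + r) m≡ 0 c₀ refl us ts)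
    go (splitting 1 _ _ us ts s) = contradiction s (Mod4.clash (+ 4 - + r) (+ 6 * + N + + r) m≡ 1 c₁ refl us ts)
    go (splitting 3 _ _ us ts s) = contradiction s (Mod4.clash (+ 4 - + r) (+ 6 * + N + + r) m≡ 3 c₃ refl us ts)
    go (splitting 4 _ _ us ts s) = contradiction s (Mod4.clash (+ 4 - + r) (+ 6 * + N + + r) m≡ 4 c₄ refl us ts)
    go (splitting (suc (suc (suc (suc (suc _))))) _ () _ _ _)

  shift-mod4 : ∀ N r → + 3 * + (8 ℕ.* N ℕ.+ r) + + 4 ≡ (+ 6 * + N + + r) * + 4 + (+ 4 - + r)
  shift-mod4 N r = trans (cong (λ z → + 3 * z + + 4) (trans (pos-+ (8 ℕ.* N) r) (cong (_+ + r) (pos-* 8 N)))) (ident (+ N) (+ r))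
    where
    ident : ∀ N r → + 3 * (+ 8 * N + r) + + 4 ≡ (+ 6 * N + r) * + 4 + (+ 4 - r)
    ident = solve 2 (λ N r → con (+ 3) :* (con (+ 8) :* N :+ r) :+ con (+ 4) := (con (+ 6) :* N :+ r) :* con (+ 4) :+ (con (+ 4) :- r)) refl

  -- With units a = 3α+1, b, c, w one has a² + b² + c² + w² = w² + 3s² + 2u² + 6v² for s = (a+b+c)/3, u = (a-b)/2, v = (a+b-2c)/6.
  form₁₀ : ∀ N → Form₁₀ (+ 24 * + N + + 22)
  form₁₀ N = let (t₁ , t₂ , e₁ , e₂ , s) = two-odd-units N 6 (shift-mod4 N 6) (λ t → indivisible 4 (- + 2) t) (λ t → indivisible 4 (- + 3) t) (λ t → indivisible 4 (- + 5) t) (λ t → indivisible 4 (- + 6) t)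
             in go t₁ t₂ e₁ e₂ s (parity e₁ e₂)
    where
    go : ∀ t₁ t₂ e₁ e₂ → + 24 * + N + + 22 ≡ sixth² t₁ + sixth² t₂ + quarter² e₁ + quarter² e₂ →
      (∃ λ t → e₁ ≡ e₂ + + 2 * t) ⊎ (∃ λ t → e₁ ≡ e₂ + + 2 * t + 1ℤ) → Form₁₀ (+ 24 * + N + + 22)
    go t₁ t₂ .(e₂ + + 2 * r + 1ℤ) e₂ s (inj₂ (r , refl)) = + 2 * e₂ + + 2 * r + + 2 + t₁ , r , e₂ + r + 1ℤ - t₁ , t₂ , trans s (ident t₁ e₂ r (sixth² t₂))
      where
      ident : ∀ t e r w → (+ 6 * t + 1ℤ) * (+ 6 * t + 1ℤ) + w + (+ 6 * (e + + 2 * r + 1ℤ) + + 4) * (+ 6 * (e + + 2 * r + 1ℤ) + + 4)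
          + (+ 6 * e + + 4) * (+ 6 * e + + 4)
        ≡ + 3 * ((+ 2 * (+ 2 * e + + 2 * r + + 2 + t) + 1ℤ) * (+ 2 * (+ 2 * e + + 2 * r + + 2 + t) + 1ℤ))
          + + 18 * ((+ 2 * r + 1ℤ) * (+ 2 * r + 1ℤ)) + + 24 * ((e + r + 1ℤ - t) * (e + r + 1ℤ - t)) + w
      ident = solve 4 (λ t e r w → (con (+ 6) :* t :+ con 1ℤ) :* (con (+ 6) :* t :+ con 1ℤ) :+ w :+ (con (+ 6) :* (e :+ con (+ 2) :* r :+ con 1ℤ) :+ con (+ 4)) :* (con (+ 6) :* (e :+ con (+ 2) :* r :+ con 1ℤ) :+ con (+ 4)) :+ (con (+ 6) :* e :+ con (+ 4)) :* (con (+ 6) :* e :+ con (+ 4))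
          := con (+ 3) :* ((con (+ 2) :* (con (+ 2) :* e :+ con (+ 2) :* r :+ con (+ 2) :+ t) :+ con 1ℤ) :* (con (+ 2) :* (con (+ 2) :* e :+ con (+ 2) :* r :+ con (+ 2) :+ t) :+ con 1ℤ)) :+ con (+ 18) :* ((con (+ 2) :* r :+ con 1ℤ) :* (con (+ 2) :* r :+ con 1ℤ)) :+ con (+ 24) :* ((e :+ r :+ con 1ℤ :- t) :* (e :+ r :+ con 1ℤ :- t)) :+ w) refl
    -- The number is 6 modulo 8 and the odd units give 2; even units whose `e₁`, `e₂` agree in
    -- parity give 0 instead of 4.
    go t₁ t₂ .(e₂ + + 2 * r) e₂ s (inj₁ (r , refl)) = let (q₁ , h₁) = sixth-mod8 t₁ ; (q₂ , h₂) = sixth-mod8 t₂ in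
      contradiction (linear₂ 1ℤ 1ℤ s (cong₂ _+_ h₁ h₂) (ident (+ N) q₁ q₂ e₂ r (sixth² t₁) (sixth² t₂)))
        (indivisible 8 (+ 20) (q₁ + q₂ + + 9 * (e₂ * e₂) + + 18 * (e₂ * r) + + 18 * (r * r) + + 12 * e₂ + + 12 * r + + 4 - + 3 * + N))
      where
      ident : ∀ N p q e r a b → + 20 - (p + q + + 9 * (e * e) + + 18 * (e * r) + + 18 * (r * r) + + 12 * e + + 12 * r + + 4 - + 3 * N) * + 8
        ≡ 1ℤ * (+ 24 * N + + 22 - (a + b + (+ 6 * (e + + 2 * r) + + 4) * (+ 6 * (e + + 2 * r) + + 4) + (+ 6 * e + + 4) * (+ 6 * e + + 4)))
          + 1ℤ * (a + b - (1ℤ + p * + 8 + (1ℤ + q * + 8)))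
      ident = solve 7 (λ N p q e r a b → con (+ 20) :- (p :+ q :+ con (+ 9) :* (e :* e) :+ con (+ 18) :* (e :* r) :+ con (+ 18) :* (r :* r) :+ con (+ 12) :* e :+ con (+ 12) :* r :+ con (+ 4) :- con (+ 3) :* N) :* con (+ 8)
          := con 1ℤ :* (con (+ 24) :* N :+ con (+ 22) :- (a :+ b :+ (con (+ 6) :* (e :+ con (+ 2) :* r) :+ con (+ 4)) :* (con (+ 6) :* (e :+ con (+ 2) :* r) :+ con (+ 4)) :+ (con (+ 6) :* e :+ con (+ 4)) :* (con (+ 6) :* e :+ con (+ 4)))) :+ con 1ℤ :* (a :+ b :- (con 1ℤ :+ p :* con (+ 8) :+ (con 1ℤ :+ q :* con (+ 8))))) refl

  -- The identity used for `form₁₀`; the residue 2 modulo 8 now forces `e₁` and `e₂` to agree in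
  -- parity, so `u = 6r` and `2u² = 72r²`.
  form₁₁ : ∀ N → Form₁₁ (+ 24 * + N + + 10)
  form₁₁ N = let (t₁ , t₂ , e₁ , e₂ , s) = two-odd-units N 2 (shift-mod4 N 2) (λ t → indivisible 4 (+ 2) t) (λ t → indivisible 4 (+ 1) t) (λ t → indivisible 4 (- + 1) t) (λ t → indivisible 4 (- + 2) t)
             in go t₁ t₂ e₁ e₂ s (parity e₁ e₂)
    where
    go : ∀ t₁ t₂ e₁ e₂ → + 24 * + N + + 10 ≡ sixth² t₁ + sixth² t₂ + quarter² e₁ + quarter² e₂ →
      (∃ λ t → e₁ ≡ e₂ + + 2 * t) ⊎ (∃ λ t → e₁ ≡ e₂ + + 2 * t + 1ℤ) → Form₁₁ (+ 24 * + N + + 10)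
    go t₁ t₂ .(e₂ + + 2 * r) e₂ s (inj₁ (r , refl)) = + 2 * e₂ + + 2 * r + t₁ + 1ℤ , e₂ + r - t₁ , r , t₂ , trans s (ident t₁ e₂ r (sixth² t₂))
      where
      ident : ∀ t e r w → (+ 6 * t + 1ℤ) * (+ 6 * t + 1ℤ) + w + (+ 6 * (e + + 2 * r) + + 4) * (+ 6 * (e + + 2 * r) + + 4)
          + (+ 6 * e + + 4) * (+ 6 * e + + 4)
        ≡ + 3 * ((+ 2 * (+ 2 * e + + 2 * r + t + 1ℤ) + 1ℤ) * (+ 2 * (+ 2 * e + + 2 * r + t + 1ℤ) + 1ℤ))
          + + 6 * ((+ 2 * (e + r - t) + 1ℤ) * (+ 2 * (e + r - t) + 1ℤ)) + + 72 * (r * r) + w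
      ident = solve 4 (λ t e r w → (con (+ 6) :* t :+ con 1ℤ) :* (con (+ 6) :* t :+ con 1ℤ) :+ w :+ (con (+ 6) :* (e :+ con (+ 2) :* r) :+ con (+ 4)) :* (con (+ 6) :* (e :+ con (+ 2) :* r) :+ con (+ 4)) :+ (con (+ 6) :* e :+ con (+ 4)) :* (con (+ 6) :* e :+ con (+ 4))
          := con (+ 3) :* ((con (+ 2) :* (con (+ 2) :* e :+ con (+ 2) :* r :+ t :+ con 1ℤ) :+ con 1ℤ) :* (con (+ 2) :* (con (+ 2) :* e :+ con (+ 2) :* r :+ t :+ con 1ℤ) :+ con 1ℤ)) :+ con (+ 6) :* ((con (+ 2) :* (e :+ r :- t) :+ con 1ℤ) :* (con (+ 2) :* (e :+ r :- t) :+ con 1ℤ)) :+ con (+ 72) :* (r :* r) :+ w) refl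
    go t₁ t₂ .(e₂ + + 2 * r + 1ℤ) e₂ s (inj₂ (r , refl)) = let (q₁ , h₁) = sixth-mod8 t₁ ; (q₂ , h₂) = sixth-mod8 t₂ in
      contradiction (linear₂ 1ℤ 1ℤ s (cong₂ _+_ h₁ h₂) (ident (+ N) q₁ q₂ e₂ r (sixth² t₁) (sixth² t₂)))
        (indivisible 8 (+ 4) (q₁ + q₂ + + 9 * (e₂ * e₂) + + 18 * (e₂ * r) + + 18 * (r * r) + + 21 * e₂ + + 30 * r + + 14 - + 3 * + N))
      where
      ident : ∀ N p q e r a b → + 4 - (p + q + + 9 * (e * e) + + 18 * (e * r) + + 18 * (r * r) + + 21 * e + + 30 * r + + 14 - + 3 * N) * + 8
        ≡ 1ℤ * (+ 24 * N + + 10 - (a + b + (+ 6 * (e + + 2 * r + 1ℤ) + + 4) * (+ 6 * (e + + 2 * r + 1ℤ) + + 4) + (+ 6 * e + + 4) * (+ 6 * e + + 4)))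
          + 1ℤ * (a + b - (1ℤ + p * + 8 + (1ℤ + q * + 8)))
      ident = solve 7 (λ N p q e r a b → con (+ 4) :- (p :+ q :+ con (+ 9) :* (e :* e) :+ con (+ 18) :* (e :* r) :+ con (+ 18) :* (r :* r) :+ con (+ 21) :* e :+ con (+ 30) :* r :+ con (+ 14) :- con (+ 3) :* N) :* con (+ 8)
          := con 1ℤ :* (con (+ 24) :* N :+ con (+ 10) :- (a :+ b :+ (con (+ 6) :* (e :+ con (+ 2) :* r :+ con 1ℤ) :+ con (+ 4)) :* (con (+ 6) :* (e :+ con (+ 2) :* r :+ con 1ℤ) :+ con (+ 4)) :+ (con (+ 6) :* e :+ con (+ 4)) :* (con (+ 6) :* e :+ con (+ 4)))) :+ con 1ℤ :* (a :+ b :- (con 1ℤ :+ p :* con (+ 8) :+ (con 1ℤ :+ q :* con (+ 8))))) refl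

  ThreeUnits : ℤ → Set
  ThreeUnits n = ∃ λ u → ∃ λ v → ∃ λ w → ∃ λ x → n ≡ unit² u + unit² v + unit² w + triple² x

  ninefold-sum : ∀ x y z → 0ℤ < x * x + (y * y + (z * z + 0ℤ)) → SumOfThreeUnits (+ 9 * (x * x + (y * y + (z * z + 0ℤ))))
  ninefold-sum x y z p = let (s , e) = nonneg (<⇒≤ p) in
    subst (λ t → SumOfThreeUnits (+ 9 * t)) (sym e)
      (ninefold s (<-wellFounded s) (drop‿+<+ (subst (0ℤ <_) e p)) (x ∷ y ∷ z ∷ []) (sym e))

  -- Divisibility by 3 leaves 0 or 3 units. With none, three of the four multiples of 3 are
  -- exchanged for units by `ninefold`: `x`, `y`, `z` if they are not all zero, otherwise `w`
  -- together with two zeros.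
  three-units : ∀ N → ThreeUnits (+ 24 * + N + + 18)
  three-units N = let (a , b , c , d , e) = four-squares (24 ℕ.* N ℕ.+ 18) in
    go (split {square} {unit²} {triple²} by-mod3 (a ∷ b ∷ c ∷ d ∷ []))
       (trans (sym n≡) (trans e (ident (a * a) (b * b) (c * c) (d * d))))
    where
    n = + 24 * + N + + 18
    n≡ : + (24 ℕ.* N ℕ.+ 18) ≡ n
    n≡ = trans (pos-+ (24 ℕ.* N) 18) (cong (_+ + 18) (pos-* 24 N))
    n≡3 : n ≡ + 3 * (+ 8 * + N) + + 18
    n≡3 = ident₃ (+ N)
      where
      ident₃ : ∀ M → + 24 * M + + 18 ≡ + 3 * (+ 8 * M) + + 18
      ident₃ = solve 1 (λ M → con (+ 24) :* M :+ con (+ 18) := con (+ 3) :* (con (+ 8) :* M) :+ con (+ 18)) refl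
    ident : ∀ a b c d → a + b + c + d ≡ a + (b + (c + (d + 0ℤ)))
    ident = solve-∀
    0<n : n ≢ 0ℤ
    0<n n≡0 = ℕ.m+1+n≢0 (24 ℕ.* N) (+-injective (trans n≡ n≡0))
    go : ∀ {s} → Split unit² triple² 4 s → n ≡ s → ThreeUnits n
    go (splitting 3 .1 refl (u ∷ v ∷ w ∷ []) (x ∷ []) es) e = u , v , w , x , trans e (trans es (ident′ (unit² u) (unit² v) (unit² w) (triple² x)))
      where
      ident′ : ∀ u v w x → u + (v + (w + 0ℤ)) + (x + 0ℤ) ≡ u + v + w + x
      ident′ = solve 4 (λ u v w x → u :+ (v :+ (w :+ con 0ℤ)) :+ (x :+ con 0ℤ) := u :+ v :+ w :+ x) refl
    go (splitting 0 .4 refl [] (x ∷ y ∷ z ∷ w ∷ []) es) e with (x * x + (y * y + (z * z + 0ℤ))) ≟ 0ℤ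
    ... | no s≢0 = let (a , b , c , e′) = ninefold-sum x y z (≢⇒0< (0≤+-both (0≤sq x) (0≤+-both (0≤sq y) (0≤+-both (0≤sq z) ≤-refl))) s≢0)
                   in a , b , c , w , linear₂ 1ℤ 1ℤ (trans e es) e′ (ident₄ n (x * x) (y * y) (z * z) (w * w) (unit² a) (unit² b) (unit² c))
      where
      ident₄ : ∀ n x y z w a b c → n - (a + b + c + + 9 * w)
        ≡ 1ℤ * (n - (0ℤ + (+ 9 * x + (+ 9 * y + (+ 9 * z + (+ 9 * w + 0ℤ)))))) + 1ℤ * (+ 9 * (x + (y + (z + 0ℤ))) - (a + b + c))
      ident₄ = solve 8 (λ n x y z w a b c → n :- (a :+ b :+ c :+ con (+ 9) :* w)
          := con 1ℤ :* (n :- (con 0ℤ :+ (con (+ 9) :* x :+ (con (+ 9) :* y :+ (con (+ 9) :* z :+ (con (+ 9) :* w :+ con 0ℤ)))))) :+ con 1ℤ :* (con (+ 9) :* (x :+ (y :+ (z :+ con 0ℤ))) :- (a :+ b :+ c))) refl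
    ... | yes s≡0 = let (a , b , c , e′) = ninefold-sum w 0ℤ 0ℤ (≢⇒0< (0≤+-both (0≤sq w) ≤-refl) w≢0)
                    in a , b , c , 0ℤ , linear₂ 1ℤ 1ℤ n≡9w e′ (ident₅ n (w * w) (unit² a) (unit² b) (unit² c))
      where
      n≡9w : n ≡ + 9 * (w * w)
      n≡9w = linear₂ 1ℤ (+ 9) (trans e es) s≡0 (ident₄ n (x * x) (y * y) (z * z) (w * w))
        where
        ident₄ : ∀ n x y z w → n - + 9 * w ≡ 1ℤ * (n - (0ℤ + (+ 9 * x + (+ 9 * y + (+ 9 * z + (+ 9 * w + 0ℤ)))))) + + 9 * (x + (y + (z + 0ℤ)) - 0ℤ)
        ident₄ = solve 5 (λ n x y z w → n :- con (+ 9) :* w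
            := con 1ℤ :* (n :- (con 0ℤ :+ (con (+ 9) :* x :+ (con (+ 9) :* y :+ (con (+ 9) :* z :+ (con (+ 9) :* w :+ con 0ℤ)))))) :+ con (+ 9) :* (x :+ (y :+ (z :+ con 0ℤ)) :- con 0ℤ)) refl
      w≢0 : w * w + 0ℤ ≢ 0ℤ
      w≢0 h = 0<n (trans n≡9w (linear (+ 9) h (ident₄ (w * w))))
        where
        ident₄ : ∀ w → + 9 * w - 0ℤ ≡ + 9 * (w + 0ℤ - 0ℤ)
        ident₄ = solve-∀
      ident₅ : ∀ n w a b c → n - (a + b + c + + 9 * (0ℤ * 0ℤ)) ≡ 1ℤ * (n - + 9 * w) + 1ℤ * (+ 9 * (w + (0ℤ * 0ℤ + (0ℤ * 0ℤ + 0ℤ))) - (a + b + c))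
      ident₅ = solve-∀
    go (splitting 1 _ _ us ts es) e = contradiction (trans e es) (clash-mod3 (+ 18) (+ 8 * + N) n≡3 1 (λ t → indivisible 3 (+ 17) t) refl us ts)
    go (splitting 2 _ _ us ts es) e = contradiction (trans e es) (clash-mod3 (+ 18) (+ 8 * + N) n≡3 2 (λ t → indivisible 3 (+ 16) t) refl us ts)
    go (splitting 4 _ _ us ts es) e = contradiction (trans e es) (clash-mod3 (+ 18) (+ 8 * + N) n≡3 4 (λ t → indivisible 3 (+ 14) t) refl us ts)
    go (splitting (suc (suc (suc (suc (suc _))))) _ () _ _ _) _

  -- The identity `a² + b² + c² = 3s² + 2u² + 6v²` with `s = (a+b+c)/3`, `u = (a-b)/2`,
  -- `v = (a+b-2c)/6` is applied to `3x` and two of the units, an odd unit being kept. The signs are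
  -- chosen so that `u` is twice a unit up to sign and `s`, `v` are odd.
  form₁₂ : ∀ N → Form₁₂ (+ 24 * + N + + 18)
  form₁₂ N = let (u , v , w , x , e) = three-units N in
    by-x x (mod2 x) (linear 1ℤ e (ident n (unit² u) (unit² v) (unit² w) (x * x)))
      (split {unit²} {sixth²} {quarter²} unit-by-parity (u ∷ v ∷ w ∷ []))
    where
    n = + 24 * + N + + 18
    ident : ∀ n u v w x → n - + 9 * x - (u + (v + (w + 0ℤ))) ≡ 1ℤ * (n - (u + v + w + + 9 * x))
    ident = solve 5 (λ n u v w x → n :- con (+ 9) :* x :- (u :+ (v :+ (w :+ con 0ℤ))) := con 1ℤ :* (n :- (u :+ v :+ w :+ con (+ 9) :* x))) refl
    odd-x : ∀ N r → + 24 * N + + 18 - + 9 * ((+ 2 * r + 1ℤ) * (+ 2 * r + 1ℤ)) ≡ (+ 6 * N - + 9 * (r * r + r)) * + 4 + + 9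
    odd-x = solve 2 (λ N r → con (+ 24) :* N :+ con (+ 18) :- con (+ 9) :* ((con (+ 2) :* r :+ con 1ℤ) :* (con (+ 2) :* r :+ con 1ℤ))
        := (con (+ 6) :* N :- con (+ 9) :* (r :* r :+ r)) :* con (+ 4) :+ con (+ 9)) refl
    even-x : ∀ N r → + 24 * N + + 18 - + 9 * (+ 2 * r * (+ 2 * r)) ≡ (+ 6 * N - + 9 * (r * r)) * + 4 + + 18
    even-x = solve 2 (λ N r → con (+ 24) :* N :+ con (+ 18) :- con (+ 9) :* (con (+ 2) :* r :* (con (+ 2) :* r))
        := (con (+ 6) :* N :- con (+ 9) :* (r :* r)) :* con (+ 4) :+ con (+ 18)) refl
    by-x : ∀ {s} x → Mod2 x → n - + 9 * (x * x) ≡ s → Split sixth² quarter² 3 s → Form₁₂ n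
    by-x .(+ 2 * r + 1ℤ) (r , inj₂ refl) e₀ (splitting 1 .2 refl (t ∷ []) (e₁ ∷ e₂ ∷ []) s) = go (parity e₁ e₂)
      where
      go : (∃ λ t → e₁ ≡ e₂ + + 2 * t) ⊎ (∃ λ t → e₁ ≡ e₂ + + 2 * t + 1ℤ) → Form₁₂ n
      -- `a = 6e₁ + 4`, `b = -(6e₂ + 4)`, `c = 3x`, so that `u = 2(3e₂ + 3q + 2)`.
      go (inj₁ (q , refl)) = + 2 * q + r , q - r - 1ℤ , t , - e₂ - q - 1ℤ , linear 1ℤ (trans e₀ s) (ident₂ n r t e₂ q (sixth² t))
        where
        ident₂ : ∀ n r t e q T → n - (+ 3 * ((+ 2 * (+ 2 * q + r) + 1ℤ) * (+ 2 * (+ 2 * q + r) + 1ℤ))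
            + + 6 * ((+ 2 * (q - r - 1ℤ) + 1ℤ) * (+ 2 * (q - r - 1ℤ) + 1ℤ)) + T + + 8 * ((+ 3 * (- e - q - 1ℤ) + 1ℤ) * (+ 3 * (- e - q - 1ℤ) + 1ℤ)))
          ≡ 1ℤ * (n - + 9 * ((+ 2 * r + 1ℤ) * (+ 2 * r + 1ℤ)) - (T + 0ℤ + ((+ 6 * (e + + 2 * q) + + 4) * (+ 6 * (e + + 2 * q) + + 4) + ((+ 6 * e + + 4) * (+ 6 * e + + 4) + 0ℤ))))
        ident₂ = solve 6 (λ n r t e q T → n :- (con (+ 3) :* ((con (+ 2) :* (con (+ 2) :* q :+ r) :+ con 1ℤ) :* (con (+ 2) :* (con (+ 2) :* q :+ r) :+ con 1ℤ)) :+ con (+ 6) :* ((con (+ 2) :* (q :- r :- con 1ℤ) :+ con 1ℤ) :* (con (+ 2) :* (q :- r :- con 1ℤ) :+ con 1ℤ)) :+ T :+ con (+ 8) :* ((con (+ 3) :* (:- e :- q :- con 1ℤ) :+ con 1ℤ) :* (con (+ 3) :* (:- e :- q :- con 1ℤ) :+ con 1ℤ)))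
            := con 1ℤ :* (n :- con (+ 9) :* ((con (+ 2) :* r :+ con 1ℤ) :* (con (+ 2) :* r :+ con 1ℤ)) :- (T :+ con 0ℤ :+ ((con (+ 6) :* (e :+ con (+ 2) :* q) :+ con (+ 4)) :* (con (+ 6) :* (e :+ con (+ 2) :* q) :+ con (+ 4)) :+ ((con (+ 6) :* e :+ con (+ 4)) :* (con (+ 6) :* e :+ con (+ 4)) :+ con 0ℤ))))) refl
      -- `n - 9x²` minus the odd square is 0 modulo 8, but even units with `e₁`, `e₂` of opposite
      -- parity give 4.
      go (inj₂ (q , refl)) = let (p , h) = sixth-mod8 t ; (p′ , h′) = odd-mod8 r in
        contradiction (linear₂ 1ℤ 1ℤ (trans e₀ s) (cong₂ (λ a b → a + + 9 * b) h h′) (ident₂ (+ N) p p′ e₂ q (sixth² t) (odd² r)))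
          (indivisible 8 (+ 4) (p + + 9 * p′ + + 9 * (e₂ * e₂) + + 18 * (e₂ * q) + + 18 * (q * q) + + 21 * e₂ + + 30 * q + + 14 - + 3 * + N))
        where
        ident₂ : ∀ N p p′ e r T X → + 4 - (p + + 9 * p′ + + 9 * (e * e) + + 18 * (e * r) + + 18 * (r * r) + + 21 * e + + 30 * r + + 14 - + 3 * N) * + 8
          ≡ 1ℤ * (+ 24 * N + + 18 - + 9 * X - (T + 0ℤ + ((+ 6 * (e + + 2 * r + 1ℤ) + + 4) * (+ 6 * (e + + 2 * r + 1ℤ) + + 4) + ((+ 6 * e + + 4) * (+ 6 * e + + 4) + 0ℤ))))
            + 1ℤ * (T + + 9 * X - (1ℤ + p * + 8 + + 9 * (1ℤ + p′ * + 8)))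
        ident₂ = solve 7 (λ N p p′ e r T X → con (+ 4) :- (p :+ con (+ 9) :* p′ :+ con (+ 9) :* (e :* e) :+ con (+ 18) :* (e :* r) :+ con (+ 18) :* (r :* r) :+ con (+ 21) :* e :+ con (+ 30) :* r :+ con (+ 14) :- con (+ 3) :* N) :* con (+ 8)
            := con 1ℤ :* (con (+ 24) :* N :+ con (+ 18) :- con (+ 9) :* X :- (T :+ con 0ℤ :+ ((con (+ 6) :* (e :+ con (+ 2) :* r :+ con 1ℤ) :+ con (+ 4)) :* (con (+ 6) :* (e :+ con (+ 2) :* r :+ con 1ℤ) :+ con (+ 4)) :+ ((con (+ 6) :* e :+ con (+ 4)) :* (con (+ 6) :* e :+ con (+ 4)) :+ con 0ℤ)))) :+ con 1ℤ :* (T :+ con (+ 9) :* X :- (con 1ℤ :+ p :* con (+ 8) :+ con (+ 9) :* (con 1ℤ :+ p′ :* con (+ 8))))) refl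
    by-x .(+ 2 * r) (r , inj₁ refl) e₀ (splitting 2 .1 refl (t₁ ∷ t₂ ∷ []) (e ∷ []) s) = go (parity r e)
      where
      go : (∃ λ t → r ≡ e + + 2 * t) ⊎ (∃ λ t → r ≡ e + + 2 * t + 1ℤ) → Form₁₂ n
      -- `a = 3x = 6r`, `b = 6e + 4`, `c = -(6t₂ + 1)`, so that `u = 6q - 2`.
      go (inj₁ (q , refl)) = + 2 * e + + 2 * q - t₂ , e + q + t₂ , t₁ , - q , linear 1ℤ (trans e₀ s) (ident₂ n e q t₂ (sixth² t₁))
        where
        ident₂ : ∀ n e q t T → n - (+ 3 * ((+ 2 * (+ 2 * e + + 2 * q - t) + 1ℤ) * (+ 2 * (+ 2 * e + + 2 * q - t) + 1ℤ))
            + + 6 * ((+ 2 * (e + q + t) + 1ℤ) * (+ 2 * (e + q + t) + 1ℤ)) + T + + 8 * ((+ 3 * (- q) + 1ℤ) * (+ 3 * (- q) + 1ℤ)))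
          ≡ 1ℤ * (n - + 9 * (+ 2 * (e + + 2 * q) * (+ 2 * (e + + 2 * q))) - (T + ((+ 6 * t + 1ℤ) * (+ 6 * t + 1ℤ) + 0ℤ) + ((+ 6 * e + + 4) * (+ 6 * e + + 4) + 0ℤ)))
        ident₂ = solve 5 (λ n e q t T → n :- (con (+ 3) :* ((con (+ 2) :* (con (+ 2) :* e :+ con (+ 2) :* q :- t) :+ con 1ℤ) :* (con (+ 2) :* (con (+ 2) :* e :+ con (+ 2) :* q :- t) :+ con 1ℤ)) :+ con (+ 6) :* ((con (+ 2) :* (e :+ q :+ t) :+ con 1ℤ) :* (con (+ 2) :* (e :+ q :+ t) :+ con 1ℤ)) :+ T :+ con (+ 8) :* ((con (+ 3) :* (:- q) :+ con 1ℤ) :* (con (+ 3) :* (:- q) :+ con 1ℤ)))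
            := con 1ℤ :* (n :- con (+ 9) :* (con (+ 2) :* (e :+ con (+ 2) :* q) :* (con (+ 2) :* (e :+ con (+ 2) :* q))) :- (T :+ ((con (+ 6) :* t :+ con 1ℤ) :* (con (+ 6) :* t :+ con 1ℤ) :+ con 0ℤ) :+ ((con (+ 6) :* e :+ con (+ 4)) :* (con (+ 6) :* e :+ con (+ 4)) :+ con 0ℤ)))) refl
      go (inj₂ (q , refl)) = let (p , h) = sixth-mod8 t₁ ; (p′ , h′) = sixth-mod8 t₂ in
        contradiction (linear₂ 1ℤ 1ℤ (trans e₀ s) (cong₂ _+_ h h′) (ident₂ (+ N) p p′ e q (sixth² t₁) (sixth² t₂)))
          (indivisible 8 (+ 12) (p + p′ + + 9 * (e * e) + + 18 * (e * q) + + 18 * (q * q) + + 15 * e + + 18 * q + + 6 - + 3 * + N))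
        where
        ident₂ : ∀ N p p′ e q T X → + 12 - (p + p′ + + 9 * (e * e) + + 18 * (e * q) + + 18 * (q * q) + + 15 * e + + 18 * q + + 6 - + 3 * N) * + 8
          ≡ 1ℤ * (+ 24 * N + + 18 - + 9 * (+ 2 * (e + + 2 * q + 1ℤ) * (+ 2 * (e + + 2 * q + 1ℤ))) - (T + (X + 0ℤ) + ((+ 6 * e + + 4) * (+ 6 * e + + 4) + 0ℤ)))
            + 1ℤ * (T + X - (1ℤ + p * + 8 + (1ℤ + p′ * + 8)))
        ident₂ = solve 7 (λ N p p′ e q T X → con (+ 12) :- (p :+ p′ :+ con (+ 9) :* (e :* e) :+ con (+ 18) :* (e :* q) :+ con (+ 18) :* (q :* q) :+ con (+ 15) :* e :+ con (+ 18) :* q :+ con (+ 6) :- con (+ 3) :* N) :* con (+ 8)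
            := con 1ℤ :* (con (+ 24) :* N :+ con (+ 18) :- con (+ 9) :* (con (+ 2) :* (e :+ con (+ 2) :* q :+ con 1ℤ) :* (con (+ 2) :* (e :+ con (+ 2) :* q :+ con 1ℤ))) :- (T :+ (X :+ con 0ℤ) :+ ((con (+ 6) :* e :+ con (+ 4)) :* (con (+ 6) :* e :+ con (+ 4)) :+ con 0ℤ))) :+ con 1ℤ :* (T :+ X :- (con 1ℤ :+ p :* con (+ 8) :+ (con 1ℤ :+ p′ :* con (+ 8))))) refl
    by-x .(+ 2 * r + 1ℤ) (r , inj₂ refl) e₀ (splitting 0 _ _ us ts s) = contradiction (trans e₀ s) (Mod4.clash (+ 9) (+ 6 * + N - + 9 * (r * r + r)) (odd-x (+ N) r) 0 (λ t → indivisible 4 (+ 9) t) refl us ts)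
    by-x .(+ 2 * r + 1ℤ) (r , inj₂ refl) e₀ (splitting 2 _ _ us ts s) = contradiction (trans e₀ s) (Mod4.clash (+ 9) (+ 6 * + N - + 9 * (r * r + r)) (odd-x (+ N) r) 2 (λ t → indivisible 4 (+ 7) t) refl us ts)
    by-x .(+ 2 * r + 1ℤ) (r , inj₂ refl) e₀ (splitting 3 _ _ us ts s) = contradiction (trans e₀ s) (Mod4.clash (+ 9) (+ 6 * + N - + 9 * (r * r + r)) (odd-x (+ N) r) 3 (λ t → indivisible 4 (+ 6) t) refl us ts)
    by-x .(+ 2 * r) (r , inj₁ refl) e₀ (splitting 0 _ _ us ts s) = contradiction (trans e₀ s) (Mod4.clash (+ 18) (+ 6 * + N - + 9 * (r * r)) (even-x (+ N) r) 0 (λ t → indivisible 4 (+ 18) t) refl us ts)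
    by-x .(+ 2 * r) (r , inj₁ refl) e₀ (splitting 1 _ _ us ts s) = contradiction (trans e₀ s) (Mod4.clash (+ 18) (+ 6 * + N - + 9 * (r * r)) (even-x (+ N) r) 1 (λ t → indivisible 4 (+ 17) t) refl us ts)
    by-x .(+ 2 * r) (r , inj₁ refl) e₀ (splitting 3 _ _ us ts s) = contradiction (trans e₀ s) (Mod4.clash (+ 18) (+ 6 * + N - + 9 * (r * r)) (even-x (+ N) r) 3 (λ t → indivisible 4 (+ 15) t) refl us ts)
    by-x _ _ _ (splitting (suc (suc (suc (suc _)))) _ () _ _ _)

-- The form of p₃ + p₄ + p₅ + 2p₅ and the norm form of ℤ[√-2].

module Form8 where
  open Arith
  open Lagrange
  open Units
  open Forms
  open Forms24
  open import Data.Nat.Base as ℕ using (ℕ; suc)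
  import Data.Nat.Properties as ℕ
  open import Data.Nat.Induction using (<-wellFounded)
  open import Induction.WellFounded using (Acc; acc)
  open import Data.Integer.Base hiding (suc; pred; NonZero)
  open import Data.Integer.Properties
  open import Data.Integer.Tactic.RingSolver using (solve-∀)
  open import Data.Integer.Solver using (module +-*-Solver)
  open +-*-Solver using (solve; _:=_; _:+_; _:*_; _:-_; :-_; con)
  open import Data.Vec.Base using ([]; _∷_)
  open import Data.Product using (_,_; ∃; proj₁; proj₂)
  open import Data.Sum using (_⊎_; inj₁; inj₂)
  open import Relation.Nullary using (contradiction)
  open import Relation.Binary.PropositionalEquality

  odd-by-mod3 : ∀ k → (∃ λ m → odd² k ≡ sixth² m) ⊎ (∃ λ m → odd² k ≡ + 9 * odd² m)
  odd-by-mod3 k with mod3 k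
  ... | m , inj₁ refl = inj₁ (m , ident m)
    where
    ident : ∀ m → (+ 2 * (+ 3 * m) + 1ℤ) * (+ 2 * (+ 3 * m) + 1ℤ) ≡ (+ 6 * m + 1ℤ) * (+ 6 * m + 1ℤ)
    ident = solve 1 (λ m → (con (+ 2) :* (con (+ 3) :* m) :+ con 1ℤ) :* (con (+ 2) :* (con (+ 3) :* m) :+ con 1ℤ)
        := (con (+ 6) :* m :+ con 1ℤ) :* (con (+ 6) :* m :+ con 1ℤ)) refl
  ... | m , inj₂ (inj₁ refl) = inj₂ (m , ident m)
    where
    ident : ∀ m → (+ 2 * (+ 3 * m + 1ℤ) + 1ℤ) * (+ 2 * (+ 3 * m + 1ℤ) + 1ℤ) ≡ + 9 * ((+ 2 * m + 1ℤ) * (+ 2 * m + 1ℤ))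
    ident = solve 1 (λ m → (con (+ 2) :* (con (+ 3) :* m :+ con 1ℤ) :+ con 1ℤ) :* (con (+ 2) :* (con (+ 3) :* m :+ con 1ℤ) :+ con 1ℤ)
        := con (+ 9) :* ((con (+ 2) :* m :+ con 1ℤ) :* (con (+ 2) :* m :+ con 1ℤ))) refl
  ... | m , inj₂ (inj₂ refl) = inj₁ (m , ident m)
    where
    ident : ∀ m → (+ 2 * (- (+ 3 * m + 1ℤ)) + 1ℤ) * (+ 2 * (- (+ 3 * m + 1ℤ)) + 1ℤ) ≡ (+ 6 * m + 1ℤ) * (+ 6 * m + 1ℤ)
    ident = solve 1 (λ m → (con (+ 2) :* (:- (con (+ 3) :* m :+ con 1ℤ)) :+ con 1ℤ) :* (con (+ 2) :* (:- (con (+ 3) :* m :+ con 1ℤ)) :+ con 1ℤ)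
        := (con (+ 6) :* m :+ con 1ℤ) :* (con (+ 6) :* m :+ con 1ℤ)) refl

  SixthPair : ℤ → Set
  SixthPair n = ∃ λ i → ∃ λ j → n ≡ sixth² i + + 2 * sixth² j

  -- Multiplication of z + 2w√-2 by 1 + √-2; when 3 divides both z and w, the induction hypothesis is multiplied by (1 + √-2)².
  threefold : ∀ μ → Acc ℕ._<_ μ → ∀ k w → + μ ≡ odd² k + + 8 * (w * w) → SixthPair (+ 3 * + μ)
  threefold μ (acc rs) k w e = go (odd-by-mod3 k) (by-mod3 w)
    where
    eq : ∀ {A B} → odd² k ≡ A → w * w ≡ B → + 3 * + μ ≡ + 3 * (A + + 8 * B)
    eq ea eb = cong (+ 3 *_) (trans e (cong₂ (λ a b → a + + 8 * b) ea eb))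
    go : (∃ λ m → odd² k ≡ sixth² m) ⊎ (∃ λ m → odd² k ≡ + 9 * odd² m) → SquareMod3 w → SixthPair (+ 3 * + μ)
    go (inj₁ (m , ea)) (inj₂ (q , eb)) = m - + 2 * q , m + q , trans (eq ea eb) (ident m q)
      where
      ident : ∀ m q → + 3 * ((+ 6 * m + 1ℤ) * (+ 6 * m + 1ℤ) + + 8 * (+ 9 * (q * q)))
        ≡ (+ 6 * (m - + 2 * q) + 1ℤ) * (+ 6 * (m - + 2 * q) + 1ℤ) + + 2 * ((+ 6 * (m + q) + 1ℤ) * (+ 6 * (m + q) + 1ℤ))
      ident = solve 2 (λ m q → con (+ 3) :* ((con (+ 6) :* m :+ con 1ℤ) :* (con (+ 6) :* m :+ con 1ℤ) :+ con (+ 8) :* (con (+ 9) :* (q :* q)))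
          := (con (+ 6) :* (m :- con (+ 2) :* q) :+ con 1ℤ) :* (con (+ 6) :* (m :- con (+ 2) :* q) :+ con 1ℤ) :+ con (+ 2) :* ((con (+ 6) :* (m :+ q) :+ con 1ℤ) :* (con (+ 6) :* (m :+ q) :+ con 1ℤ))) refl
    -- For `z = 6m + 1` and `w = 3q + 1` the coordinate `z - 4w` would be divisible by 3, so the
    -- sign of `w` is changed.
    go (inj₁ (m , ea)) (inj₁ (q , eb)) = - m - + 2 * q - 1ℤ , q - m , trans (eq ea eb) (ident m q)
      where
      ident : ∀ m q → + 3 * ((+ 6 * m + 1ℤ) * (+ 6 * m + 1ℤ) + + 8 * ((+ 3 * q + 1ℤ) * (+ 3 * q + 1ℤ)))
        ≡ (+ 6 * (- m - + 2 * q - 1ℤ) + 1ℤ) * (+ 6 * (- m - + 2 * q - 1ℤ) + 1ℤ) + + 2 * ((+ 6 * (q - m) + 1ℤ) * (+ 6 * (q - m) + 1ℤ))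
      ident = solve 2 (λ m q → con (+ 3) :* ((con (+ 6) :* m :+ con 1ℤ) :* (con (+ 6) :* m :+ con 1ℤ) :+ con (+ 8) :* ((con (+ 3) :* q :+ con 1ℤ) :* (con (+ 3) :* q :+ con 1ℤ)))
          := (con (+ 6) :* (:- m :- con (+ 2) :* q :- con 1ℤ) :+ con 1ℤ) :* (con (+ 6) :* (:- m :- con (+ 2) :* q :- con 1ℤ) :+ con 1ℤ) :+ con (+ 2) :* ((con (+ 6) :* (q :- m) :+ con 1ℤ) :* (con (+ 6) :* (q :- m) :+ con 1ℤ))) refl
    go (inj₂ (m , ea)) (inj₁ (q , eb)) = + 2 * q - m , - m - q - 1ℤ , trans (eq ea eb) (ident m q)
      where
      ident : ∀ m q → + 3 * (+ 9 * ((+ 2 * m + 1ℤ) * (+ 2 * m + 1ℤ)) + + 8 * ((+ 3 * q + 1ℤ) * (+ 3 * q + 1ℤ)))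
        ≡ (+ 6 * (+ 2 * q - m) + 1ℤ) * (+ 6 * (+ 2 * q - m) + 1ℤ) + + 2 * ((+ 6 * (- m - q - 1ℤ) + 1ℤ) * (+ 6 * (- m - q - 1ℤ) + 1ℤ))
      ident = solve 2 (λ m q → con (+ 3) :* (con (+ 9) :* ((con (+ 2) :* m :+ con 1ℤ) :* (con (+ 2) :* m :+ con 1ℤ)) :+ con (+ 8) :* ((con (+ 3) :* q :+ con 1ℤ) :* (con (+ 3) :* q :+ con 1ℤ)))
          := (con (+ 6) :* (con (+ 2) :* q :- m) :+ con 1ℤ) :* (con (+ 6) :* (con (+ 2) :* q :- m) :+ con 1ℤ) :+ con (+ 2) :* ((con (+ 6) :* (:- m :- q :- con 1ℤ) :+ con 1ℤ) :* (con (+ 6) :* (:- m :- q :- con 1ℤ) :+ con 1ℤ))) refl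
    go (inj₂ (m , ea)) (inj₂ (q , eb)) =
      let (i , j , e′) = threefold ν (rs ν<μ) m q (sym ν≡)
      in - i - + 4 * j - 1ℤ , + 2 * i - j , linear₂ 1ℤ (+ 9) μ≡ e′ (ident (+ μ) (+ ν) i j)
      where
      S = odd² m + + 8 * (q * q)
      0≤S : 0ℤ ≤ S
      0≤S = 0≤+-both (0≤sq (+ 2 * m + 1ℤ)) (0≤* (+ 8) (q * q) 0≤+ (0≤sq q))
      ν = proj₁ (nonneg 0≤S)
      ν≡ : S ≡ + ν
      ν≡ = proj₂ (nonneg 0≤S)
      μ≡ : + 3 * + μ ≡ + 27 * + ν
      μ≡ = trans (eq ea eb) (linear (+ 27) ν≡ (ident′ (odd² m) (q * q) (+ ν)))
        where
        ident′ : ∀ m q n → + 3 * (+ 9 * m + + 8 * (+ 9 * q)) - + 27 * n ≡ + 27 * (m + + 8 * q - n)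
        ident′ = solve 3 (λ m q n → con (+ 3) :* (con (+ 9) :* m :+ con (+ 8) :* (con (+ 9) :* q)) :- con (+ 27) :* n
            := con (+ 27) :* (m :+ con (+ 8) :* q :- n)) refl
      μ≡9ν : μ ≡ 9 ℕ.* ν
      μ≡9ν = +-injective (trans (*-cancelˡ-≡ (+ 3) (+ μ) (+ 9 * + ν) (trans μ≡ (ident′ (+ ν)))) (sym (pos-* 9 ν)))
        where
        ident′ : ∀ n → + 27 * n ≡ + 3 * (+ 9 * n)
        ident′ = solve-∀
      0<ν : 0 ℕ.< ν
      0<ν = ℕ.n≢0⇒n>0 λ ν≡0 → indivisible 2 1ℤ (- (+ 2 * (m * m) + + 2 * m + + 4 * (q * q)))
          (linear 1ℤ (trans ν≡ (cong +_ ν≡0)) (ident′ m q))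
        where
        ident′ : ∀ m q → 1ℤ - - (+ 2 * (m * m) + + 2 * m + + 4 * (q * q)) * + 2 ≡ 1ℤ * ((+ 2 * m + 1ℤ) * (+ 2 * m + 1ℤ) + + 8 * (q * q) - 0ℤ)
        ident′ = solve 2 (λ m q → con 1ℤ :- :- (con (+ 2) :* (m :* m) :+ con (+ 2) :* m :+ con (+ 4) :* (q :* q)) :* con (+ 2)
            := con 1ℤ :* ((con (+ 2) :* m :+ con 1ℤ) :* (con (+ 2) :* m :+ con 1ℤ) :+ con (+ 8) :* (q :* q) :- con 0ℤ)) refl
      ν<μ : ν ℕ.< μ
      ν<μ = subst (ν ℕ.<_) (sym μ≡9ν) (ℕ.m<m+n ν (ℕ.≤-trans 0<ν (ℕ.m≤m+n ν _)))
      ident : ∀ μ ν i j → + 3 * μ - ((+ 6 * (- i - + 4 * j - 1ℤ) + 1ℤ) * (+ 6 * (- i - + 4 * j - 1ℤ) + 1ℤ)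
          + + 2 * ((+ 6 * (+ 2 * i - j) + 1ℤ) * (+ 6 * (+ 2 * i - j) + 1ℤ)))
        ≡ 1ℤ * (+ 3 * μ - + 27 * ν) + + 9 * (+ 3 * ν - ((+ 6 * i + 1ℤ) * (+ 6 * i + 1ℤ) + + 2 * ((+ 6 * j + 1ℤ) * (+ 6 * j + 1ℤ))))
      ident = solve 4 (λ μ ν i j → con (+ 3) :* μ :- ((con (+ 6) :* (:- i :- con (+ 4) :* j :- con 1ℤ) :+ con 1ℤ) :* (con (+ 6) :* (:- i :- con (+ 4) :* j :- con 1ℤ) :+ con 1ℤ) :+ con (+ 2) :* ((con (+ 6) :* (con (+ 2) :* i :- j) :+ con 1ℤ) :* (con (+ 6) :* (con (+ 2) :* i :- j) :+ con 1ℤ)))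
          := con 1ℤ :* (con (+ 3) :* μ :- con (+ 27) :* ν) :+ con (+ 9) :* (con (+ 3) :* ν :- ((con (+ 6) :* i :+ con 1ℤ) :* (con (+ 6) :* i :+ con 1ℤ) :+ con (+ 2) :* ((con (+ 6) :* j :+ con 1ℤ) :* (con (+ 6) :* j :+ con 1ℤ))))) refl

  square-by-parity : ∀ x → (∃ λ t → square x ≡ odd² t) ⊎ (∃ λ t → square x ≡ double² t)
  square-by-parity x with mod2 x
  ... | t , inj₂ refl = inj₁ (t , refl)
  ... | t , inj₁ refl = inj₂ (t , ident t)
    where
    ident : ∀ t → + 2 * t * (+ 2 * t) ≡ + 4 * (t * t)
    ident = solve-∀

  odd-mod4 : ∀ t → ∃ λ q → odd² t ≡ 1ℤ + q * + 4
  odd-mod4 t = t * t + t , ident t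
    where
    ident : ∀ t → (+ 2 * t + 1ℤ) * (+ 2 * t + 1ℤ) ≡ 1ℤ + (t * t + t) * + 4
    ident = solve 1 (λ t → (con (+ 2) :* t :+ con 1ℤ) :* (con (+ 2) :* t :+ con 1ℤ) := con 1ℤ :+ (t :* t :+ t) :* con (+ 4)) refl

  double-mod4 : ∀ t → ∃ λ q → double² t ≡ q * + 4
  double-mod4 t = t * t , *-comm (+ 4) (t * t)

  module OddMod4 = Residues (+ 4) odd² double² odd-mod4 double-mod4

  -- Modulo 4 exactly one root of `4N + 1` is odd: `4N + 1 = A² + 4b² + 4y² + 4w²`. After
  -- multiplication by 6, `6A² + 24b² = 3(A + 2b)² + 3(A - 2b)²`, and `3((A - 2b)² + 8w²)` is a
  -- `SixthPair`.
  form₈ : ∀ N → Form₈ (+ 24 * + N + + 6)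
  form₈ N = let (a , b , c , d , e) = four-squares (4 ℕ.* N ℕ.+ 1) in
    go (split {square} {odd²} {double²} square-by-parity (a ∷ b ∷ c ∷ d ∷ []))
       (trans (sym n≡) (trans e (ident (a * a) (b * b) (c * c) (d * d))))
    where
    n≡ : + (4 ℕ.* N ℕ.+ 1) ≡ + N * + 4 + 1ℤ
    n≡ = trans (pos-+ (4 ℕ.* N) 1) (cong (_+ 1ℤ) (trans (pos-* 4 N) (*-comm (+ 4) (+ N))))
    ident : ∀ a b c d → a + b + c + d ≡ a + (b + (c + (d + 0ℤ)))
    ident = solve 4 (λ a b c d → a :+ b :+ c :+ d := a :+ (b :+ (c :+ (d :+ con 0ℤ)))) refl
    go : ∀ {s} → Split odd² double² 4 s → + N * + 4 + 1ℤ ≡ s → Form₈ (+ 24 * + N + + 6)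
    go (splitting 1 .3 refl (a ∷ []) (b ∷ y ∷ w ∷ []) s) e =
      let (i , j , e′) = threefold μ (<-wellFounded μ) (a - b) w (sym μ≡)
      in a + b , y , i , j , linear₂ (+ 6) 1ℤ (trans e s) (trans (cong (+ 3 *_) μ≡) e′) (ident′ (+ N) a b y w (sixth² i) (sixth² j))
      where
      S = odd² (a - b) + + 8 * (w * w)
      0≤S : 0ℤ ≤ S
      0≤S = 0≤+-both (0≤sq (+ 2 * (a - b) + 1ℤ)) (0≤* (+ 8) (w * w) 0≤+ (0≤sq w))
      μ = proj₁ (nonneg 0≤S)
      μ≡ : S ≡ + μ
      μ≡ = proj₂ (nonneg 0≤S)
      ident′ : ∀ N a b y w i j → + 24 * N + + 6 - (+ 3 * ((+ 2 * (a + b) + 1ℤ) * (+ 2 * (a + b) + 1ℤ)) + + 24 * (y * y) + i + + 2 * j)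
        ≡ + 6 * (N * + 4 + 1ℤ - ((+ 2 * a + 1ℤ) * (+ 2 * a + 1ℤ) + 0ℤ + (+ 4 * (b * b) + (+ 4 * (y * y) + (+ 4 * (w * w) + 0ℤ)))))
          + 1ℤ * (+ 3 * ((+ 2 * (a - b) + 1ℤ) * (+ 2 * (a - b) + 1ℤ) + + 8 * (w * w)) - (i + + 2 * j))
      ident′ = solve 7 (λ N a b y w i j → con (+ 24) :* N :+ con (+ 6) :- (con (+ 3) :* ((con (+ 2) :* (a :+ b) :+ con 1ℤ) :* (con (+ 2) :* (a :+ b) :+ con 1ℤ)) :+ con (+ 24) :* (y :* y) :+ i :+ con (+ 2) :* j)
          := con (+ 6) :* (N :* con (+ 4) :+ con 1ℤ :- ((con (+ 2) :* a :+ con 1ℤ) :* (con (+ 2) :* a :+ con 1ℤ) :+ con 0ℤ :+ (con (+ 4) :* (b :* b) :+ (con (+ 4) :* (y :* y) :+ (con (+ 4) :* (w :* w) :+ con 0ℤ))))) :+ con 1ℤ :* (con (+ 3) :* ((con (+ 2) :* (a :- b) :+ con 1ℤ) :* (con (+ 2) :* (a :- b) :+ con 1ℤ) :+ con (+ 8) :* (w :* w)) :- (i :+ con (+ 2) :* j))) refl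
    go (splitting 0 _ _ us ts s) e = contradiction (trans e s) (OddMod4.clash 1ℤ (+ N) refl 0 (λ t → indivisible 4 (+ 1) t) refl us ts)
    go (splitting 2 _ _ us ts s) e = contradiction (trans e s) (OddMod4.clash 1ℤ (+ N) refl 2 (λ t → indivisible 4 (- + 1) t) refl us ts)
    go (splitting 3 _ _ us ts s) e = contradiction (trans e s) (OddMod4.clash 1ℤ (+ N) refl 3 (λ t → indivisible 4 (- + 2) t) refl us ts)
    go (splitting 4 _ _ us ts s) e = contradiction (trans e s) (OddMod4.clash 1ℤ (+ N) refl 4 (λ t → indivisible 4 (- + 3) t) refl us ts)
    go (splitting (suc (suc (suc (suc (suc _))))) _ () _ _ _) _

-- Finite sums and products over initial segments.

module Range where
  open import Algebra.Bundles using (CommutativeMonoid)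
  open import Data.Nat.Base as ℕ using (ℕ; zero; suc; _<_; s≤s; z≤n)
  import Data.Nat.Properties as ℕ
  open import Data.Fin.Base using (Fin; toℕ; fromℕ<)
  open import Data.Fin.Properties using (toℕ<n; toℕ-fromℕ<; toℕ-injective)
  open import Data.Fin.Permutation using (permutation)
  open import Function.Base using (_∘_)
  open import Level using (0ℓ)
  import Relation.Binary.PropositionalEquality as ≡
  open ≡ using (_≡_)

  module Fold (M : CommutativeMonoid 0ℓ 0ℓ) where
    open CommutativeMonoid M
    open import Algebra.Properties.CommutativeMonoid.Sum M

    -- One fold serves for character sums and for the products in Gauss's lemma; indices are natural
    -- numbers, so that summands carry no bounds in their types.
    fold : ℕ → (ℕ → Carrier) → Carrier
    fold n f = sum {n} (λ i → f (toℕ i))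

    fold-cong : ∀ n {f g} → (∀ i → i < n → f i ≈ g i) → fold n f ≈ fold n g
    fold-cong n h = sum-cong-≋ (λ i → h (toℕ i) (toℕ<n i))

    fold-ε : ∀ n {f} → (∀ i → i < n → f i ≈ ε) → fold n f ≈ ε
    fold-ε zero h = refl
    fold-ε (suc n) h = trans (∙-cong (h 0 (s≤s z≤n)) (fold-ε n (λ i i<n → h (suc i) (s≤s i<n)))) (identityˡ ε)

    fold-∙ : ∀ n f g → fold n (λ i → f i ∙ g i) ≈ fold n f ∙ fold n g
    fold-∙ n f g = ∑-distrib-+ {n} (λ i → f (toℕ i)) (λ i → g (toℕ i))

    fold-swap : ∀ m n (f : ℕ → ℕ → Carrier) → fold m (λ i → fold n (f i)) ≈ fold n (λ j → fold m (λ i → f i j))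
    fold-swap m n f = ∑-comm {m} {n} (λ i j → f (toℕ i) (toℕ j))

    fold-+ : ∀ m n f → fold (m ℕ.+ n) f ≈ fold m f ∙ fold n (λ i → f (m ℕ.+ i))
    fold-+ zero n f = sym (identityˡ _)
    fold-+ (suc m) n f = trans (∙-congˡ (fold-+ m n (f ∘ suc))) (sym (assoc _ _ _))

    fold-last : ∀ n f → fold (suc n) f ≈ fold n f ∙ f n
    fold-last zero f = trans (identityʳ _) (sym (identityˡ _))
    fold-last (suc n) f = trans (∙-congˡ (fold-last n (f ∘ suc))) (sym (assoc _ _ _))

    fold-permute : ∀ n f (π ρ : ℕ → ℕ) → (∀ i → i < n → π i < n) → (∀ i → i < n → ρ i < n) →
      (∀ i → i < n → π (ρ i) ≡ i) → (∀ i → i < n → ρ (π i) ≡ i) → fold n (f ∘ π) ≈ fold n f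
    fold-permute n f π ρ π< ρ< πρ ρπ = trans
      (reflexive (sum-cong-≗ {n} (λ i → ≡.cong f (≡.sym (toℕ-fromℕ< (π< (toℕ i) (toℕ<n i)))))))
      (sym (sum-permute (λ i → f (toℕ i)) (permutation to from to-from from-to)))
      where
      to from : Fin n → Fin n
      to i = fromℕ< (π< (toℕ i) (toℕ<n i))
      from i = fromℕ< (ρ< (toℕ i) (toℕ<n i))
      to-from : ∀ i → to (from i) ≡ i
      to-from i = toℕ-injective (≡.trans (toℕ-fromℕ< _) (≡.trans (≡.cong π (toℕ-fromℕ< _)) (πρ (toℕ i) (toℕ<n i))))
      from-to : ∀ i → from (to i) ≡ i
      from-to i = toℕ-injective (≡.trans (toℕ-fromℕ< _) (≡.trans (≡.cong ρ (toℕ-fromℕ< _)) (ρπ (toℕ i) (toℕ<n i))))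

-- Integer sums and indicators.

module Sigma where
  open Arith
  open Range
  open import Data.Nat.Base as ℕ using (ℕ; zero; suc; s≤s; z≤n)
  import Data.Nat.Properties as ℕ
  open import Data.Integer.Base hiding (suc; pred; NonZero)
  open import Data.Integer.Properties
  open import Data.Product using (_×_; _,_; ∃)
  open import Relation.Nullary using (Dec; yes; no; ¬_; contradiction)
  open import Relation.Nullary.Decidable using (_×-dec_)
  open import Relation.Binary.PropositionalEquality

  open Fold +-0-commutativeMonoid public renaming
    (fold to ∑; fold-cong to ∑-cong; fold-ε to ∑-zero; fold-∙ to ∑-+; fold-swap to ∑-swap; fold-+ to ∑-split; fold-last to ∑-last; fold-permute to ∑-permute)

  ⟦_⟧ : {P : Set} → Dec P → ℤ
  ⟦ yes _ ⟧ = 1ℤ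
  ⟦ no _ ⟧ = 0ℤ

  ⟦⟧-true : ∀ {P : Set} (d : Dec P) → P → ⟦ d ⟧ ≡ 1ℤ
  ⟦⟧-true (yes _) p = refl
  ⟦⟧-true (no ¬p) p = contradiction p ¬p

  ⟦⟧-false : ∀ {P : Set} (d : Dec P) → ¬ P → ⟦ d ⟧ ≡ 0ℤ
  ⟦⟧-false (yes p) ¬p = contradiction p ¬p
  ⟦⟧-false (no _) ¬p = refl

  ⟦⟧-cong : ∀ {P Q : Set} (d : Dec P) (e : Dec Q) → (P → Q) → (Q → P) → ⟦ d ⟧ ≡ ⟦ e ⟧
  ⟦⟧-cong (yes p) e f g = sym (⟦⟧-true e (f p))
  ⟦⟧-cong (no ¬p) e f g = sym (⟦⟧-false e (λ q → ¬p (g q)))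

  ⟦⟧-× : ∀ {P Q : Set} (d : Dec P) (e : Dec Q) → ⟦ d ×-dec e ⟧ ≡ ⟦ d ⟧ * ⟦ e ⟧
  ⟦⟧-× (yes _) (yes _) = refl
  ⟦⟧-× (yes _) (no _) = refl
  ⟦⟧-× (no _) (yes _) = refl
  ⟦⟧-× (no _) (no _) = refl

  ∑-*ˡ : ∀ n c f → ∑ n (λ i → c * f i) ≡ c * ∑ n f
  ∑-*ˡ zero c f = sym (*-zeroʳ c)
  ∑-*ˡ (suc n) c f = trans (cong (_+_ (c * f 0)) (∑-*ˡ n c (λ i → f (suc i)))) (sym (*-distribˡ-+ c (f 0) _))

  ∑-neg : ∀ n f → ∑ n (λ i → - f i) ≡ - ∑ n f
  ∑-neg zero f = refl
  ∑-neg (suc n) f = trans (cong (_+_ (- f 0)) (∑-neg n (λ i → f (suc i)))) (sym (neg-distrib-+ (f 0) _))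

  ∑-mono : ∀ n {f g} → (∀ i → i ℕ.< n → f i ≤ g i) → ∑ n f ≤ ∑ n g
  ∑-mono zero h = ≤-refl
  ∑-mono (suc n) h = +-mono-≤ (h 0 (s≤s z≤n)) (∑-mono n (λ i i<n → h (suc i) (s≤s i<n)))

  0≤∑ : ∀ n {f} → (∀ i → i ℕ.< n → 0ℤ ≤ f i) → 0ℤ ≤ ∑ n f
  0≤∑ zero h = ≤-refl
  0≤∑ (suc n) h = +-mono-≤ (h 0 (s≤s z≤n)) (0≤∑ n (λ i i<n → h (suc i) (s≤s i<n)))

  ∑-single : ∀ n {f} → (∀ i → i ℕ.< n → 0ℤ ≤ f i) → ∀ i → i ℕ.< n → f i ≤ ∑ n f
  ∑-single (suc n) {f} h zero _ = subst (_≤ ∑ (suc n) f) (+-identityʳ (f 0)) (+-monoʳ-≤ (f 0) (0≤∑ n (λ i i<n → h (suc i) (s≤s i<n))))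
  ∑-single (suc n) {f} h (suc i) (s≤s i<n) = subst (_≤ ∑ (suc n) f) (+-identityˡ (f (suc i)))
    (+-mono-≤ (h 0 (s≤s z≤n)) (∑-single n (λ i i<n → h (suc i) (s≤s i<n)) i i<n))

  ∑-∣∣ : ∀ n (f : ℕ → ℤ) (c : ℕ → ℕ) → (∀ i → i ℕ.< n → ∣ f i ∣ ℕ.≤ c i) → + ∣ ∑ n f ∣ ≤ ∑ n (λ i → + c i)
  ∑-∣∣ zero f c h = ≤-refl
  ∑-∣∣ (suc n) f c h = ≤-trans (+≤+ (∣i+j∣≤∣i∣+∣j∣ (f 0) _)) (≤-trans (≤-reflexive (pos-+ ∣ f 0 ∣ _))
    (+-mono-≤ (+≤+ (h 0 (s≤s z≤n))) (∑-∣∣ n (λ i → f (suc i)) (λ i → c (suc i)) (λ i i<n → h (suc i) (s≤s i<n)))))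

  ∑-delta : ∀ n c f → ∑ n (λ i → ⟦ i ℕ.≟ c ⟧ * f i) ≡ ⟦ c ℕ.<? n ⟧ * f c
  ∑-delta n c f with c ℕ.<? n
  ... | yes c<n = trans (go n c f c<n) (sym (*-identityˡ (f c)))
    where
    go : ∀ n c f → c ℕ.< n → ∑ n (λ i → ⟦ i ℕ.≟ c ⟧ * f i) ≡ f c
    go (suc n) zero f _ = trans (cong₂ _+_ (*-identityˡ (f 0)) (∑-zero n (λ i _ → *-zeroˡ (f (suc i))))) (+-identityʳ (f 0))
    go (suc n) (suc c) f (s≤s c<n) = trans (cong (_+ ∑ n (λ i → ⟦ suc i ℕ.≟ suc c ⟧ * f (suc i))) (*-zeroˡ (f 0)))
      (trans (+-identityˡ (∑ n (λ i → ⟦ suc i ℕ.≟ suc c ⟧ * f (suc i))))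
        (trans (∑-cong n (λ i _ → cong (_* f (suc i)) (⟦⟧-cong (suc i ℕ.≟ suc c) (i ℕ.≟ c) ℕ.suc-injective (cong suc)))) (go n c (λ i → f (suc i)) c<n)))
  ... | no c≮n = trans (∑-zero n (λ i i<n → trans (cong (_* f i) (⟦⟧-false (i ℕ.≟ c) (λ { refl → c≮n i<n }))) (*-zeroˡ (f i)))) (sym (*-zeroˡ (f c)))

  -- A condition inherited by smaller indices cuts off an initial segment; so the constrained sums
  -- of the hyperbola method are partial sums of a character.
  ∑-initial : ∀ n {P : ℕ → Set} (d : ∀ i → Dec (P i)) f → (∀ i → P (suc i) → P i) → ∃ λ c → c ℕ.≤ n × ∑ n (λ i → ⟦ d i ⟧ * f i) ≡ ∑ c f
  ∑-initial zero d f h = 0 , z≤n , refl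
  ∑-initial (suc n) {P} d f h with d 0
  ... | no ¬p = 0 , z≤n , trans (cong (_+ ∑ n (λ i → ⟦ d (suc i) ⟧ * f (suc i))) (*-zeroˡ (f 0)))
    (trans (+-identityˡ _) (∑-zero n (λ i _ → trans (cong (_* f (suc i)) (⟦⟧-false (d (suc i)) (never i))) (*-zeroˡ (f (suc i))))))
    where
    never : ∀ i → ¬ P (suc i)
    never zero p = ¬p (h 0 p)
    never (suc i) p = never i (h (suc i) p)
  ... | yes p = let (c , c≤n , e) = ∑-initial n (λ i → d (suc i)) (λ i → f (suc i)) (λ i → h (suc i)) in
    suc c , s≤s c≤n , cong₂ _+_ (*-identityˡ (f 0)) e

-- Real characters and the hyperbola method.

module Hyperbola where
  open Arith
  open Sigma
  open import Data.Nat.Base as ℕ using (ℕ; zero; suc; z≤n; NonZero)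
  import Data.Nat.Properties as ℕ
  open import Data.Nat.DivMod using (_%_; m%n<n; %-distribˡ-*; m%n%n≡m%n; m<n⇒m%n≡m; [m+kn]%n≡m%n)
  open import Data.Nat.Induction using (<-wellFounded)
  open import Induction.WellFounded using (Acc; acc)
  open import Data.Integer.Base hiding (suc; pred; NonZero; _%_)
  open import Data.Integer.Properties
  open import Data.Integer.Tactic.RingSolver using (solve-∀)
  open import Data.Integer.Solver using (module +-*-Solver)
  open +-*-Solver using (solve; _:=_; _:+_; _:*_; _:-_; :-_; con)
  open import Data.Product using (_,_; proj₁; proj₂)
  open import Relation.Nullary using (yes; no)
  open import Relation.Nullary.Decidable using (_×-dec_)
  open import Relation.Binary.PropositionalEquality

  ∑-const : ∀ n c → ∑ n (λ _ → + c) ≡ + (n ℕ.* c)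
  ∑-const zero c = refl
  ∑-const (suc n) c = trans (cong (_+_ (+ c)) (∑-const n c)) (sym (pos-+ c (n ℕ.* c)))

  ∑-∣∣-const : ∀ n (f : ℕ → ℤ) c → (∀ i → i ℕ.< n → ∣ f i ∣ ℕ.≤ c) → ∣ ∑ n f ∣ ℕ.≤ n ℕ.* c
  ∑-∣∣-const n f c h = drop‿+≤+ (≤-trans (∑-∣∣ n f (λ _ → c) h) (≤-reflexive (∑-const n c)))

  ∑-below : ∀ Z X f → Z ℕ.≤ X → ∑ X (λ i → ⟦ i ℕ.<? Z ⟧ * f i) ≡ ∑ Z f
  ∑-below Z X f Z≤X = subst (λ X → ∑ X g ≡ ∑ Z f) (ℕ.m+[n∸m]≡n Z≤X) (trans (∑-split Z (X ℕ.∸ Z) g)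
    (trans (cong₂ _+_ (∑-cong Z inside) (∑-zero (X ℕ.∸ Z) outside)) (+-identityʳ _)))
    where
    g : ℕ → ℤ
    g i = ⟦ i ℕ.<? Z ⟧ * f i
    inside : ∀ i → i ℕ.< Z → g i ≡ f i
    inside i i<Z = trans (cong (_* f i) (⟦⟧-true (i ℕ.<? Z) i<Z)) (*-identityˡ (f i))
    outside : ∀ i → i ℕ.< X ℕ.∸ Z → g (Z ℕ.+ i) ≡ 0ℤ
    outside i _ = trans (cong (_* f (Z ℕ.+ i)) (⟦⟧-false (Z ℕ.+ i ℕ.<? Z) (ℕ.m+n≮m Z i))) (*-zeroˡ (f (Z ℕ.+ i)))

  -- Nontriviality is given by a witness, a unit `a` of value -1.
  record Character (k : ℕ) .{{k≢0 : NonZero k}} : Set where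
    field
      f : ℕ → ℤ
      multiplicative : ∀ x y → f (x ℕ.* y) ≡ f x * f y
      periodic : ∀ x y → x % k ≡ y % k → f x ≡ f y
      bounded : ∀ x → ∣ f x ∣ ℕ.≤ 1
      a a⁻¹ : ℕ
      inverse : (a ℕ.* a⁻¹) % k ≡ 1 % k
      fa≡-1 : f a ≡ -1ℤ

    f0≡0 : f 0 ≡ 0ℤ
    f0≡0 = *-cancelˡ-≡ (+ 2) (f 0) 0ℤ (linear₂ 1ℤ (f 0) (trans (cong f (ℕ.*-comm 0 a)) (multiplicative a 0)) fa≡-1 (ident (f 0) (f a)))
      where
      ident : ∀ x y → + 2 * x - + 2 * 0ℤ ≡ 1ℤ * (x - y * x) + x * (y - -1ℤ)
      ident = solve 2 (λ x y → con (+ 2) :* x :- con (+ 2) :* con 0ℤ := con 1ℤ :* (x :- y :* x) :+ x :* (y :- con -1ℤ)) refl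

    -- Multiplication by `a` permutes the residues and changes the sign of the sum.
    period-sum : ∑ k f ≡ 0ℤ
    period-sum = *-cancelˡ-≡ (+ 2) (∑ k f) 0ℤ (linear -1ℤ negated (ident (∑ k f)))
      where
      ident : ∀ x → + 2 * x - + 2 * 0ℤ ≡ -1ℤ * (-1ℤ * x - x)
      ident = solve 1 (λ x → con (+ 2) :* x :- con (+ 2) :* con 0ℤ := con -1ℤ :* (con -1ℤ :* x :- x)) refl
      π ρ : ℕ → ℕ
      π i = (a ℕ.* i) % k
      ρ i = (a⁻¹ ℕ.* i) % k
      cancel : ∀ x y → (x ℕ.* y) % k ≡ 1 % k → ∀ i → i ℕ.< k → (x ℕ.* ((y ℕ.* i) % k)) % k ≡ i
      cancel x y e i i<k = begin
        (x ℕ.* ((y ℕ.* i) % k)) % k ≡⟨ %-distribˡ-* x ((y ℕ.* i) % k) k ⟩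
        ((x % k) ℕ.* ((y ℕ.* i) % k % k)) % k ≡⟨ cong (λ t → ((x % k) ℕ.* t) % k) (m%n%n≡m%n (y ℕ.* i) k) ⟩
        ((x % k) ℕ.* ((y ℕ.* i) % k)) % k ≡⟨ %-distribˡ-* x (y ℕ.* i) k ⟨
        (x ℕ.* (y ℕ.* i)) % k ≡⟨ cong (_% k) (sym (ℕ.*-assoc x y i)) ⟩
        (x ℕ.* y ℕ.* i) % k ≡⟨ %-distribˡ-* (x ℕ.* y) i k ⟩
        ((x ℕ.* y) % k ℕ.* (i % k)) % k ≡⟨ cong (λ t → (t ℕ.* (i % k)) % k) e ⟩
        (1 % k ℕ.* (i % k)) % k ≡⟨ %-distribˡ-* 1 i k ⟨
        (1 ℕ.* i) % k ≡⟨ cong (_% k) (ℕ.*-identityˡ i) ⟩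
        i % k ≡⟨ m<n⇒m%n≡m i<k ⟩
        i ∎
        where open ≡-Reasoning
      negated : -1ℤ * ∑ k f ≡ ∑ k f
      negated = trans (sym (∑-*ˡ k -1ℤ f)) (trans (∑-cong k λ i _ → sym (step i))
        (∑-permute k f π ρ (λ i _ → m%n<n (a ℕ.* i) k) (λ i _ → m%n<n (a⁻¹ ℕ.* i) k)
          (cancel a a⁻¹ inverse) (cancel a⁻¹ a (trans (cong (_% k) (ℕ.*-comm a⁻¹ a)) inverse))))
        where
        step : ∀ i → f (π i) ≡ -1ℤ * f i
        step i = trans (periodic (π i) (a ℕ.* i) (m%n%n≡m%n (a ℕ.* i) k)) (trans (multiplicative a i) (cong (_* f i) fa≡-1))

    -- Whole periods cancel, and at most `k` terms of absolute value at most 1 remain.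
    partial-sum : ∀ n → ∣ ∑ n f ∣ ℕ.≤ k
    partial-sum n = go n (<-wellFounded n)
      where
      go : ∀ n → Acc ℕ._<_ n → ∣ ∑ n f ∣ ℕ.≤ k
      go n (acc rs) with n ℕ.≤? k
      ... | yes n≤k = ℕ.≤-trans (∑-∣∣-const n f 1 (λ i _ → bounded i)) (subst (ℕ._≤ k) (sym (ℕ.*-identityʳ n)) n≤k)
      ... | no n≰k = subst (λ n → ∣ ∑ n f ∣ ℕ.≤ k) (ℕ.m+[n∸m]≡n k≤n)
          (subst (λ t → ∣ t ∣ ℕ.≤ k) (sym shift) (go (n ℕ.∸ k) (rs (ℕ.∸-monoʳ-< (ℕ.>-nonZero⁻¹ k) k≤n))))
        where
        k≤n = ℕ.<⇒≤ (ℕ.≰⇒> n≰k)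
        shift : ∑ (k ℕ.+ (n ℕ.∸ k)) f ≡ ∑ (n ℕ.∸ k) f
        shift = trans (∑-split k (n ℕ.∸ k) f) (trans (cong₂ _+_ period-sum (∑-cong (n ℕ.∸ k) λ i _ →
          periodic (k ℕ.+ i) i (trans (cong (_% k) (trans (ℕ.+-comm k i) (cong (i ℕ.+_) (sym (ℕ.*-identityˡ k))))) ([m+kn]%n≡m%n i 1 k)))) (+-identityˡ _))

  n≤n*n : ∀ n → n ℕ.≤ n ℕ.* n
  n≤n*n zero = z≤n
  n≤n*n (suc n) = ℕ.m≤m+n (suc n) (n ℕ.* suc n)

  ∣*∣≤ : ∀ x y c → ∣ x ∣ ℕ.≤ 1 → ∣ y ∣ ℕ.≤ c → ∣ x * y ∣ ℕ.≤ c
  ∣*∣≤ x y c p q = subst₂ ℕ._≤_ (sym (abs-* x y)) (ℕ.*-identityˡ c) (ℕ.*-mono-≤ p q)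

  module Convolution {k : ℕ} .{{k≢0 : NonZero k}} (ψ φ : Character k) where
    private
      module ψ = Character ψ
      module φ = Character φ

    F : ℕ → ℕ → ℤ
    F a b = ψ.f a * φ.f b

    -- The convolution `ψ ∗ φ` at `n`: for `0 < n < X` the range `X` contains all divisors of `n`.
    T : ℕ → ℕ → ℤ
    T X n = ∑ X (λ a → ∑ X (λ b → ⟦ a ℕ.* b ℕ.≟ n ⟧ * F a b))

    S : ℕ → ℤ
    S X = ∑ X (λ a → ∑ X (λ b → ⟦ a ℕ.* b ℕ.<? X ⟧ * F a b))

    ∑T≡S : ∀ X → ∑ X (T X) ≡ S X
    ∑T≡S X = trans (∑-swap X X (λ n a → ∑ X (λ b → ⟦ a ℕ.* b ℕ.≟ n ⟧ * F a b))) (∑-cong X λ a _ →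
      trans (∑-swap X X (λ n b → ⟦ a ℕ.* b ℕ.≟ n ⟧ * F a b)) (∑-cong X λ b _ →
        trans (∑-cong X (λ n _ → cong (_* F a b) (⟦⟧-cong (a ℕ.* b ℕ.≟ n) (n ℕ.≟ a ℕ.* b) sym sym)))
          (∑-delta X (a ℕ.* b) (λ _ → F a b))))

    module _ (Z : ℕ) where
      private
        X = Z ℕ.* Z
        Z≤X : Z ℕ.≤ X
        Z≤X = n≤n*n Z
        I : ℕ → ℕ → ℤ
        I a b = ⟦ a ℕ.* b ℕ.<? X ⟧
        L : ℕ → ℤ
        L a = ⟦ a ℕ.<? Z ⟧

        -- The region `ab < Z²` is cut at `a = Z`: `U` sums over `b` for a fixed `a`, to be used for
        -- `a < Z`, and `G` sums over the `a ≥ Z` for a fixed `b`.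
        U G : ℕ → ℤ
        U a = ∑ X (λ b → I a b * φ.f b)
        G b = ∑ X (λ a → (1ℤ - L a) * I a b * ψ.f a)

        U≤ : ∀ a → ∣ U a ∣ ℕ.≤ k
        U≤ a = let (c , _ , e) = ∑-initial X (λ b → a ℕ.* b ℕ.<? X) φ.f (λ b h → ℕ.≤-<-trans (ℕ.*-monoʳ-≤ a (ℕ.n≤1+n b)) h) in
          subst (λ t → ∣ t ∣ ℕ.≤ k) (sym e) (φ.partial-sum c)

        -- The `a ≥ Z` with `ab < X` are the difference of two initial segments, whence twice the
        -- bound for a partial sum.
        G≤ : ∀ b → ∣ G b ∣ ℕ.≤ k ℕ.+ k
        G≤ b = subst (λ t → ∣ t ∣ ℕ.≤ k ℕ.+ k) (sym G≡)
            (ℕ.≤-trans (∣i-j∣≤∣i∣+∣j∣ (∑ c ψ.f) (∑ c′ ψ.f)) (ℕ.+-mono-≤ (ψ.partial-sum c) (ψ.partial-sum c′)))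
          where
          decreasing : ∀ a → suc a ℕ.* b ℕ.< X → a ℕ.* b ℕ.< X
          decreasing a h = ℕ.≤-<-trans (ℕ.m≤n+m (a ℕ.* b) b) h
          s = ∑-initial X (λ a → a ℕ.* b ℕ.<? X) ψ.f decreasing
          s′ = ∑-initial X (λ a → (a ℕ.<? Z) ×-dec (a ℕ.* b ℕ.<? X)) ψ.f (λ { a (p , q) → ℕ.<-trans (ℕ.n<1+n a) p , decreasing a q })
          D : ℕ → ℤ
          D a = ⟦ (a ℕ.<? Z) ×-dec (a ℕ.* b ℕ.<? X) ⟧
          c = proj₁ s
          c′ = proj₁ s′
          G≡ : G b ≡ ∑ c ψ.f - ∑ c′ ψ.f
          G≡ = trans (∑-cong X (λ a _ → trans (ident (L a) (I a b) (ψ.f a)) (cong (λ t → I a b * ψ.f a + - (t * ψ.f a)) (sym (⟦⟧-× (a ℕ.<? Z) (a ℕ.* b ℕ.<? X))))))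
            (trans (∑-+ X (λ a → I a b * ψ.f a) (λ a → - (D a * ψ.f a))) (cong₂ _+_ (proj₂ (proj₂ s)) (trans (∑-neg X (λ a → D a * ψ.f a)) (cong -_ (proj₂ (proj₂ s′))))))
            where
            ident : ∀ l i x → (1ℤ - l) * i * x ≡ i * x + - (l * i * x)
            ident = solve 3 (λ l i x → (con 1ℤ :- l) :* i :* x := i :* x :+ :- (l :* i :* x)) refl

        -- If `a, b ≥ Z`, the product reaches `Z²`; so the second part of the region has `b < Z`
        -- throughout.
        G-outside : ∀ b → G b ≡ ⟦ b ℕ.<? Z ⟧ * G b
        G-outside b with b ℕ.<? Z
        ... | yes _ = sym (*-identityˡ (G b))
        ... | no b≮Z = trans (∑-zero X λ a _ → vanish a) (sym (*-zeroˡ (G b)))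
          where
          vanish : ∀ a → (1ℤ - L a) * I a b * ψ.f a ≡ 0ℤ
          vanish a with a ℕ.<? Z
          ... | yes _ = trans (cong (_* ψ.f a) (*-zeroˡ (I a b))) (*-zeroˡ (ψ.f a))
          ... | no a≮Z = trans (cong (λ t → 1ℤ * t * ψ.f a) (⟦⟧-false (a ℕ.* b ℕ.<? X) (λ h → ℕ.<⇒≱ h (ℕ.*-mono-≤ (ℕ.≮⇒≥ a≮Z) (ℕ.≮⇒≥ b≮Z))))) (*-zeroˡ (ψ.f a))

        S≡ : S X ≡ ∑ Z (λ a → ψ.f a * U a) + ∑ Z (λ b → φ.f b * G b)
        S≡ = trans (∑-cong X (λ a _ → trans (∑-cong X (λ b _ → ident (L a) (I a b) (ψ.f a) (φ.f b))) (∑-+ X (near-term a) (far-term a))))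
          (trans (∑-+ X (λ a → ∑ X (near-term a)) (λ a → ∑ X (far-term a))) (cong₂ _+_ near far))
          where
          ident : ∀ l i x y → i * (x * y) ≡ l * x * (i * y) + y * ((1ℤ - l) * i * x)
          ident = solve 4 (λ l i x y → i :* (x :* y) := l :* x :* (i :* y) :+ y :* ((con 1ℤ :- l) :* i :* x)) refl
          near-term far-term : ℕ → ℕ → ℤ
          near-term a b = L a * ψ.f a * (I a b * φ.f b)
          far-term a b = φ.f b * ((1ℤ - L a) * I a b * ψ.f a)
          near : ∑ X (λ a → ∑ X (λ b → L a * ψ.f a * (I a b * φ.f b))) ≡ ∑ Z (λ a → ψ.f a * U a)
          near = trans (∑-cong X (λ a _ → trans (∑-*ˡ X (L a * ψ.f a) (λ b → I a b * φ.f b)) (*-assoc (L a) (ψ.f a) (U a))))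
            (∑-below Z X (λ a → ψ.f a * U a) Z≤X)
          far : ∑ X (λ a → ∑ X (λ b → φ.f b * ((1ℤ - L a) * I a b * ψ.f a))) ≡ ∑ Z (λ b → φ.f b * G b)
          far = trans (∑-swap X X (λ a b → φ.f b * ((1ℤ - L a) * I a b * ψ.f a))) (trans (∑-cong X (λ b _ →
              trans (∑-*ˡ X (φ.f b) (λ a → (1ℤ - L a) * I a b * ψ.f a)) (trans (cong (φ.f b *_) (G-outside b)) (ident′ (φ.f b) ⟦ b ℕ.<? Z ⟧ (G b)))))
            (∑-below Z X (λ b → φ.f b * G b) Z≤X))
            where
            ident′ : ∀ x l g → x * (l * g) ≡ l * (x * g)
            ident′ = solve-∀

      -- Dirichlet's hyperbola method.
      hyperbola : ∣ S (Z ℕ.* Z) ∣ ℕ.≤ Z ℕ.* (k ℕ.+ (k ℕ.+ k))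
      hyperbola = subst (λ t → ∣ t ∣ ℕ.≤ Z ℕ.* (k ℕ.+ (k ℕ.+ k))) (sym S≡) (ℕ.≤-trans (∣i+j∣≤∣i∣+∣j∣ (∑ Z (λ a → ψ.f a * U a)) (∑ Z (λ b → φ.f b * G b)))
        (subst (∣ ∑ Z (λ a → ψ.f a * U a) ∣ ℕ.+ ∣ ∑ Z (λ b → φ.f b * G b) ∣ ℕ.≤_) (sym (ℕ.*-distribˡ-+ Z k (k ℕ.+ k)))
          (ℕ.+-mono-≤ (∑-∣∣-const Z (λ a → ψ.f a * U a) k (λ a _ → ∣*∣≤ (ψ.f a) (U a) k (ψ.bounded a) (U≤ a)))
                      (∑-∣∣-const Z (λ b → φ.f b * G b) (k ℕ.+ k) (λ b _ → ∣*∣≤ (φ.f b) (G b) (k ℕ.+ k) (φ.bounded b) (G≤ b))))))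

-- Nonnegativity of the convolution, one prime power at a time.

module Positivity where
  open Arith
  open Sigma
  open Hyperbola
  open import Data.Nat.Base as ℕ using (ℕ; zero; suc; s≤s; z≤n; NonZero; _^_)
  import Data.Nat.Properties as ℕ
  import Data.Nat.Divisibility as ℕD
  open ℕD using (_∣_; _∣?_; divides)
  open import Data.Nat.Primality using (Prime; euclidsLemma; prime⇒nonZero; prime⇒nonTrivial)
  open import Data.Nat.Primality.Factorisation using (factorise; PrimeFactorisation)
  open import Data.Nat.ListAction using (product)
  open import Data.Nat.Induction using (<-wellFounded)
  open import Induction.WellFounded using (Acc; acc)
  open import Data.Integer.Base hiding (suc; pred; NonZero; _^_)
  open import Data.Integer.Properties
  open import Data.Integer.Tactic.RingSolver using (solve-∀)
  open import Data.Integer.Solver using (module +-*-Solver)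
  open +-*-Solver using (solve; _:=_; _:+_; _:*_; _:-_; :-_; con)
  open import Data.List.Base using ([]; _∷_)
  open import Data.List.Relation.Unary.All using (All; []; _∷_)
  open import Data.Product using (_×_; _,_; ∃₂; proj₂)
  open import Data.Sum using (_⊎_; inj₁; inj₂)
  open import Relation.Nullary using (Dec; yes; no; ¬_; contradiction)
  open import Relation.Binary.PropositionalEquality

  -- The substitution `a = q a′`, carried out by inserting a Kronecker delta and exchanging the two
  -- sums.
  ∑-multiples : ∀ q .{{_ : NonZero q}} X g → ∑ X (λ a → ⟦ q ∣? a ⟧ * g a) ≡ ∑ X (λ a → ⟦ q ℕ.* a ℕ.<? X ⟧ * g (q ℕ.* a))
  ∑-multiples q X g = trans (∑-cong X spread) (trans (∑-swap X X (λ a a′ → ⟦ a ℕ.≟ q ℕ.* a′ ⟧ * g a))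
      (∑-cong X λ a′ _ → ∑-delta X (q ℕ.* a′) g))
    where
    spread : ∀ a → a ℕ.< X → ⟦ q ∣? a ⟧ * g a ≡ ∑ X (λ a′ → ⟦ a ℕ.≟ q ℕ.* a′ ⟧ * g a)
    spread a a<X with q ∣? a
    ... | yes (divides c refl) = sym (trans (∑-cong X λ a′ _ → cong (_* g (c ℕ.* q)) (⟦⟧-cong (c ℕ.* q ℕ.≟ q ℕ.* a′) (a′ ℕ.≟ c)
          (λ e → ℕ.*-cancelˡ-≡ a′ c q (trans (sym e) (ℕ.*-comm c q))) (λ { refl → ℕ.*-comm c q })))
        (trans (∑-delta X c (λ _ → g (c ℕ.* q))) (cong (_* g (c ℕ.* q)) (⟦⟧-true (c ℕ.<? X) (ℕ.≤-<-trans (ℕ.m≤m*n c q) a<X)))))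
    ... | no q∤a = trans (*-zeroˡ (g a)) (sym (∑-zero X λ a′ _ → trans (cong (_* g a)
        (⟦⟧-false (a ℕ.≟ q ℕ.* a′) (λ { refl → q∤a (ℕD.m∣m*n a′) }))) (*-zeroˡ (g a))))

  -- The possible values of `ψ` and `φ = ψχ` at a prime. Missing is (-1, -1), for which `ψ ∗ φ`
  -- would be -2 at that prime.
  data PrimeValues : ℤ → ℤ → Set where
    both : PrimeValues 1ℤ 1ℤ
    first : PrimeValues 1ℤ -1ℤ
    second : PrimeValues -1ℤ 1ℤ
    neither : PrimeValues 0ℤ 0ℤ

  strip : ∀ q N → 1 ℕ.< q → 0 ℕ.< N → Acc ℕ._<_ N → ∃₂ λ e M → N ≡ q ^ e ℕ.* M × ¬ q ∣ M
  strip q N 1<q 0<N (acc rs) with q ∣? N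
  ... | no q∤N = 0 , N , sym (ℕ.*-identityˡ N) , q∤N
  ... | yes (divides zero refl) = contradiction 0<N λ ()
  ... | yes (divides N′@(suc _) refl) =
    let (e , M , eq , q∤M) = strip q N′ 1<q (s≤s z≤n) (rs (ℕ.m<m*n N′ q 1<q)) in
    suc e , M , trans (cong (ℕ._* q) eq) (trans (ℕ.*-comm (q ^ e ℕ.* M) q) (sym (ℕ.*-assoc q (q ^ e) M))) , q∤M

  module _ {k : ℕ} .{{k≢0 : NonZero k}} (χ : Character k) where
    open Character χ

    f1≡1 : f 1 ≡ 1ℤ
    f1≡1 = linear₂ 1ℤ (f 1 - 1ℤ) (trans (cong f (sym (ℕ.*-identityˡ a))) (multiplicative 1 a)) fa≡-1 (ident (f 1) (f a))
      where
      ident : ∀ x y → x - 1ℤ ≡ 1ℤ * (y - x * y) + (x - 1ℤ) * (y - -1ℤ)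
      ident = solve 2 (λ x y → x :- con 1ℤ := con 1ℤ :* (y :- x :* y) :+ (x :- con 1ℤ) :* (y :- con -1ℤ)) refl

    one-from-primes : ∀ n → 0 ℕ.< n → (∀ q → Prime q → q ∣ n → f q ≡ 1ℤ) → f n ≡ 1ℤ
    one-from-primes n@(suc _) _ h = subst (λ n → (∀ q → Prime q → q ∣ n → f q ≡ 1ℤ) → f n ≡ 1ℤ) (sym isFactorisation) (go factors factorsPrime) h
      where
      open PrimeFactorisation (factorise n)
      go : ∀ ps → All Prime ps → (∀ q → Prime q → q ∣ product ps → f q ≡ 1ℤ) → f (product ps) ≡ 1ℤ
      go [] [] h = f1≡1
      go (p ∷ ps) (pr ∷ prs) h = trans (multiplicative p (product ps))
        (cong₂ _*_ (h p pr (ℕD.m∣m*n (product ps))) (go ps prs (λ q pq d → h q pq (ℕD.∣n⇒∣m*n p d))))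

  module Nonnegativity {k : ℕ} .{{k≢0 : NonZero k}} (ψ φ : Character k)
    (values : ∀ q → Prime q → PrimeValues (Character.f ψ q) (Character.f φ q)) where
    open Convolution ψ φ
    private
      module ψ = Character ψ
      module φ = Character φ

    module AtPrime (X q : ℕ) (pr : Prime q) where
      private instance
        q≢0 : NonZero q
        q≢0 = prime⇒nonZero pr

      w : ℕ → ℤ
      w a = 1ℤ - ⟦ q ∣? a ⟧

      -- The part of `T` coming from the pairs with `q ∤ a`. The recurrences `A(qN) = φ(q) A(N)` and
      -- `T(qN) = A(qN) + ψ(q) T(N)` take the place of the multiplicativity of `T`.
      A : ℕ → ℤ
      A N = ∑ X (λ a → ∑ X (λ b → w a * (⟦ a ℕ.* b ℕ.≟ N ⟧ * F a b)))

      A-coprime : ∀ {N} → ¬ q ∣ N → A N ≡ T X N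
      A-coprime {N} q∤N = ∑-cong X λ a _ → ∑-cong X λ b _ → term a b
        where
        term : ∀ a b → w a * (⟦ a ℕ.* b ℕ.≟ N ⟧ * F a b) ≡ ⟦ a ℕ.* b ℕ.≟ N ⟧ * F a b
        term a b with a ℕ.* b ℕ.≟ N
        ... | no _ = trans (cong (w a *_) (*-zeroˡ (F a b))) (trans (*-zeroʳ (w a)) (sym (*-zeroˡ (F a b))))
        ... | yes refl = trans (cong (λ t → (1ℤ - t) * (1ℤ * F a b)) (⟦⟧-false (q ∣? a) (λ d → q∤N (ℕD.∣m⇒∣m*n b d)))) (*-identityˡ (1ℤ * F a b))

      module _ {N : ℕ} (0<N : 0 ℕ.< N) (qN<X : q ℕ.* N ℕ.< X) where
        factor≤ : ∀ a b → a ℕ.* b ≡ N → q ℕ.* a ℕ.< X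
        factor≤ a zero e = contradiction (trans (sym (ℕ.*-zeroʳ a)) e) (ℕ.<⇒≢ 0<N)
        factor≤ a (suc b) e = ℕ.≤-<-trans (ℕ.*-monoʳ-≤ q (subst (a ℕ.≤_) e (ℕ.m≤m*n a (suc b)))) qN<X

        -- `m a` is the product of `a` with a fixed cofactor, so that one substitution `a ↦ qa`
        -- serves both variables of the double sum; `small` keeps the substituted factors inside the
        -- range `X`.
        rescale : ∀ c (g h : ℕ → ℤ) (m : ℕ → ℕ) → (∀ a → m (q ℕ.* a) ≡ q ℕ.* m a) → (∀ a → m a ≡ N → q ℕ.* a ℕ.< X) →
          (∀ a → g (q ℕ.* a) ≡ c * h a) → ∑ X (λ a → ⟦ q ∣? a ⟧ * (⟦ m a ℕ.≟ q ℕ.* N ⟧ * g a)) ≡ c * ∑ X (λ a → ⟦ m a ℕ.≟ N ⟧ * h a)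
        rescale c g h m m≡ small g≡ = trans (∑-multiples q X (λ a → ⟦ m a ℕ.≟ q ℕ.* N ⟧ * g a))
          (trans (∑-cong X λ a _ → term a) (∑-*ˡ X c (λ a → ⟦ m a ℕ.≟ N ⟧ * h a)))
          where
          term : ∀ a → ⟦ q ℕ.* a ℕ.<? X ⟧ * (⟦ m (q ℕ.* a) ℕ.≟ q ℕ.* N ⟧ * g (q ℕ.* a)) ≡ c * (⟦ m a ℕ.≟ N ⟧ * h a)
          term a = trans (cong₂ (λ s t → ⟦ q ℕ.* a ℕ.<? X ⟧ * (s * t))
              (⟦⟧-cong (m (q ℕ.* a) ℕ.≟ q ℕ.* N) (m a ℕ.≟ N) (λ e → ℕ.*-cancelˡ-≡ (m a) N q (trans (sym (m≡ a)) e)) (λ e → trans (m≡ a) (cong (q ℕ.*_) e)))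
              (g≡ a)) (final (m a ℕ.≟ N))
            where
            ident : ∀ c x → 1ℤ * (1ℤ * (c * x)) ≡ c * (1ℤ * x)
            ident = solve-∀
            ident₀ : ∀ l c x → l * (0ℤ * (c * x)) ≡ c * (0ℤ * x)
            ident₀ = solve-∀
            final : (d : Dec (m a ≡ N)) → ⟦ q ℕ.* a ℕ.<? X ⟧ * (⟦ d ⟧ * (c * h a)) ≡ c * (⟦ d ⟧ * h a)
            final (yes e) = trans (cong (λ t → t * (1ℤ * (c * h a))) (⟦⟧-true (q ℕ.* a ℕ.<? X) (small a e))) (ident c (h a))
            final (no _) = ident₀ ⟦ q ℕ.* a ℕ.<? X ⟧ c (h a)

        B-step : ∑ X (λ a → ∑ X (λ b → ⟦ q ∣? a ⟧ * (⟦ a ℕ.* b ℕ.≟ q ℕ.* N ⟧ * F a b))) ≡ ψ.f q * T X N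
        B-step = trans (∑-swap X X (λ a b → ⟦ q ∣? a ⟧ * (⟦ a ℕ.* b ℕ.≟ q ℕ.* N ⟧ * F a b)))
          (trans (∑-cong X λ b _ → rescale (ψ.f q) (λ a → F a b) (λ a → F a b) (ℕ._* b) (λ a → ℕ.*-assoc q a b) (λ a → factor≤ a b)
              (λ a → trans (cong (_* φ.f b) (ψ.multiplicative q a)) (*-assoc (ψ.f q) (ψ.f a) (φ.f b))))
            (trans (∑-*ˡ X (ψ.f q) (λ b → ∑ X (λ a → ⟦ a ℕ.* b ℕ.≟ N ⟧ * F a b)))
              (cong (ψ.f q *_) (∑-swap X X (λ b a → ⟦ a ℕ.* b ℕ.≟ N ⟧ * F a b)))))

        T-step : T X (q ℕ.* N) ≡ A (q ℕ.* N) + ψ.f q * T X N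
        T-step = trans (∑-cong X λ a _ → trans (∑-cong X λ b _ → ident ⟦ q ∣? a ⟧ (⟦ a ℕ.* b ℕ.≟ q ℕ.* N ⟧ * F a b))
            (∑-+ X (λ b → w a * (⟦ a ℕ.* b ℕ.≟ q ℕ.* N ⟧ * F a b)) (λ b → ⟦ q ∣? a ⟧ * (⟦ a ℕ.* b ℕ.≟ q ℕ.* N ⟧ * F a b))))
          (trans (∑-+ X (λ a → ∑ X (λ b → w a * (⟦ a ℕ.* b ℕ.≟ q ℕ.* N ⟧ * F a b))) (λ a → ∑ X (λ b → ⟦ q ∣? a ⟧ * (⟦ a ℕ.* b ℕ.≟ q ℕ.* N ⟧ * F a b))))
            (cong (_+_ (A (q ℕ.* N))) B-step))
          where
          ident : ∀ d x → x ≡ (1ℤ - d) * x + d * x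
          ident = solve-∀

        -- If `q ∤ a` and `ab = qN`, Euclid's lemma puts `q` into `b`, and the substitution is made
        -- there.
        A-step : A (q ℕ.* N) ≡ φ.f q * A N
        A-step = trans (∑-cong X λ a _ → row a) (∑-*ˡ X (φ.f q) (λ a → ∑ X (λ b → w a * (⟦ a ℕ.* b ℕ.≟ N ⟧ * F a b))))
          where
          row : ∀ a → ∑ X (λ b → w a * (⟦ a ℕ.* b ℕ.≟ q ℕ.* N ⟧ * F a b)) ≡ φ.f q * ∑ X (λ b → w a * (⟦ a ℕ.* b ℕ.≟ N ⟧ * F a b))
          row a = trans (∑-cong X λ b _ → term b) (trans (∑-*ˡ X (w a) (λ b → ⟦ q ∣? b ⟧ * (⟦ a ℕ.* b ℕ.≟ q ℕ.* N ⟧ * F a b)))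
            (trans (cong (w a *_) (rescale (φ.f q) (F a) (F a) (a ℕ.*_) (λ b → trans (sym (ℕ.*-assoc a q b)) (trans (cong (ℕ._* b) (ℕ.*-comm a q)) (ℕ.*-assoc q a b)))
                (λ b e → factor≤ b a (trans (ℕ.*-comm b a) e)) (λ b → trans (cong (ψ.f a *_) (φ.multiplicative q b)) (ident (ψ.f a) (φ.f q) (φ.f b)))))
              (trans (ident (w a) (φ.f q) (∑ X (λ b → ⟦ a ℕ.* b ℕ.≟ N ⟧ * F a b))) (cong (φ.f q *_) (sym (∑-*ˡ X (w a) (λ b → ⟦ a ℕ.* b ℕ.≟ N ⟧ * F a b)))))))
            where
            ident : ∀ x y z → x * (y * z) ≡ y * (x * z)
            ident = solve-∀
            drop : ∀ x d s → (1ℤ - 1ℤ) * x ≡ (1ℤ - 1ℤ) * (d * s)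
            drop = solve-∀
            keep : ∀ w s → w * s ≡ w * (1ℤ * s)
            keep = solve-∀
            zeroes : ∀ w d s → w * (0ℤ * s) ≡ w * (d * (0ℤ * s))
            zeroes = solve-∀
            term : ∀ b → w a * (⟦ a ℕ.* b ℕ.≟ q ℕ.* N ⟧ * F a b) ≡ w a * (⟦ q ∣? b ⟧ * (⟦ a ℕ.* b ℕ.≟ q ℕ.* N ⟧ * F a b))
            term b with a ℕ.* b ℕ.≟ q ℕ.* N
            ... | no _ = zeroes (w a) ⟦ q ∣? b ⟧ (F a b)
            ... | yes e with euclidsLemma a b pr (subst (q ∣_) (sym e) (ℕD.m∣m*n N))
            ...   | inj₁ q∣a = trans (cong (λ t → (1ℤ - t) * (1ℤ * F a b)) (⟦⟧-true (q ∣? a) q∣a))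
                    (trans (drop (1ℤ * F a b) ⟦ q ∣? b ⟧ (1ℤ * F a b)) (cong (λ t → (1ℤ - t) * (⟦ q ∣? b ⟧ * (1ℤ * F a b))) (sym (⟦⟧-true (q ∣? a) q∣a))))
            ...   | inj₂ q∣b = trans (keep (w a) (1ℤ * F a b)) (cong (λ t → w a * (t * (1ℤ * F a b))) (sym (⟦⟧-true (q ∣? b) q∣b)))

      module _ {M : ℕ} (0<M : 0 ℕ.< M) (q∤M : ¬ q ∣ M) (0≤τ : 0ℤ ≤ T X M) where
        private
          τ = T X M
          N : ℕ → ℕ
          N e = q ^ e ℕ.* M
          0<N : ∀ e → 0 ℕ.< N e
          0<N e = ℕ.*-mono-< {0} {q ^ e} {0} {M} (ℕ.m^n>0 q e) 0<M
          N-suc : ∀ e → N (suc e) ≡ q ℕ.* N e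
          N-suc e = ℕ.*-assoc q (q ^ e) M
          below : ∀ e → N (suc e) ℕ.< X → N e ℕ.< X
          below e h = ℕ.≤-<-trans (subst (N e ℕ.≤_) (sym (N-suc e)) (ℕ.m≤n*m (N e) q)) h
          A₀ : A (N 0) ≡ τ
          A₀ = trans (cong A (ℕ.*-identityˡ M)) (A-coprime q∤M)
          T₀ : T X (N 0) ≡ τ
          T₀ = cong (T X) (ℕ.*-identityˡ M)
          stepA : ∀ e {x y} → N (suc e) ℕ.< X → φ.f q ≡ x → A (N e) ≡ y → A (N (suc e)) ≡ x * y
          stepA e h p r = trans (cong A (N-suc e)) (trans (A-step (0<N e) (subst (ℕ._< X) (N-suc e) h)) (cong₂ _*_ p r))
          stepT : ∀ e {x y z} → N (suc e) ℕ.< X → A (N (suc e)) ≡ z → ψ.f q ≡ x → T X (N e) ≡ y → T X (N (suc e)) ≡ z + x * y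
          stepT e h p r s = trans (cong (T X) (N-suc e)) (trans (T-step (0<N e) (subst (ℕ._< X) (N-suc e) h))
            (cong₂ _+_ (trans (cong A (sym (N-suc e))) p) (cong₂ _*_ r s)))

        -- Starting from `τ`, the recurrences give `(e + 1)τ` for the values (1, 1), alternately `τ`
        -- and 0 for opposite signs, and 0 from `e = 1` on for the values (0, 0).
        tower : ∀ {x y} → PrimeValues x y → ψ.f q ≡ x → φ.f q ≡ y → ∀ e → N e ℕ.< X → 0ℤ ≤ T X (N e)
        tower both p r e h = subst (0ℤ ≤_) (sym (proj₂ (go e h))) (0≤* (+ suc e) τ 0≤+ 0≤τ)
          where
          go : ∀ e → N e ℕ.< X → A (N e) ≡ τ × T X (N e) ≡ + suc e * τ
          go zero h = A₀ , trans T₀ (sym (*-identityˡ τ))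
          go (suc e) h = let (a , t) = go e (below e h) ; a′ = trans (stepA e h r a) (*-identityˡ τ) in
            a′ , trans (stepT e h a′ p t) (trans (ident τ (+ suc e)) (cong (_* τ) (sym (pos-+ 1 (suc e)))))
            where
            ident : ∀ τ n → τ + 1ℤ * (n * τ) ≡ (1ℤ + n) * τ
            ident = solve-∀
        tower first p r e h with go e h
          where
          go : ∀ e → N e ℕ.< X → (A (N e) ≡ τ × T X (N e) ≡ τ) ⊎ (A (N e) ≡ - τ × T X (N e) ≡ 0ℤ)
          go zero h = inj₁ (A₀ , T₀)
          go (suc e) h with go e (below e h)
          ... | inj₁ (a , t) = let a′ = trans (stepA e h r a) (-1*i≡-i τ) in inj₂ (a′ , trans (stepT e h a′ p t) (ident τ))
            where
            ident : ∀ τ → - τ + 1ℤ * τ ≡ 0ℤ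
            ident = solve-∀
          ... | inj₂ (a , t) = let a′ = trans (stepA e h r a) (ident τ) in inj₁ (a′ , trans (stepT e h a′ p t) (+-identityʳ τ))
            where
            ident : ∀ τ → -1ℤ * - τ ≡ τ
            ident = solve-∀
        ... | inj₁ (_ , t) = subst (0ℤ ≤_) (sym t) 0≤τ
        ... | inj₂ (_ , t) = ≤-reflexive (sym t)
        tower second p r e h with go e h
          where
          go : ∀ e → N e ℕ.< X → A (N e) ≡ τ × (T X (N e) ≡ τ ⊎ T X (N e) ≡ 0ℤ)
          go zero h = A₀ , inj₁ T₀
          go (suc e) h with go e (below e h)
          ... | a , inj₁ t = let a′ = trans (stepA e h r a) (*-identityˡ τ) in a′ , inj₂ (trans (stepT e h a′ p t) (ident τ))
            where
            ident : ∀ τ → τ + -1ℤ * τ ≡ 0ℤ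
            ident = solve-∀
          ... | a , inj₂ t = let a′ = trans (stepA e h r a) (*-identityˡ τ) in a′ , inj₁ (trans (stepT e h a′ p t) (+-identityʳ τ))
        ... | _ , inj₁ t = subst (0ℤ ≤_) (sym t) 0≤τ
        ... | _ , inj₂ t = ≤-reflexive (sym t)
        tower neither p r zero h = subst (0ℤ ≤_) (sym T₀) 0≤τ
        tower neither p r (suc e) h = ≤-reflexive (sym (trans (stepT e h (trans (stepA e h r refl) (*-zeroˡ (A (N e)))) p refl) (trans (+-identityˡ _) (*-zeroˡ (T X (N e))))))

    module _ {X N : ℕ} (one : ∀ a b → a ℕ.* b ≡ N → F a b ≡ 1ℤ) where
      private
        0≤term : ∀ a b → 0ℤ ≤ ⟦ a ℕ.* b ℕ.≟ N ⟧ * F a b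
        0≤term a b with a ℕ.* b ℕ.≟ N
        ... | yes e = subst (λ t → 0ℤ ≤ 1ℤ * t) (sym (one a b e)) 0≤+
        ... | no _ = ≤-reflexive (sym (*-zeroˡ (F a b)))

      0≤T-good : 0ℤ ≤ T X N
      0≤T-good = 0≤∑ X (λ a _ → 0≤∑ X (λ b _ → 0≤term a b))

      -- All terms are nonnegative, and the pair `(1, N)` contributes 1.
      1≤T-good : 1 ℕ.< X → N ℕ.< X → 1ℤ ≤ T X N
      1≤T-good 1<X N<X = ≤-trans (≤-reflexive (sym (trans (cong₂ _*_ (⟦⟧-true (1 ℕ.* N ℕ.≟ N) (ℕ.*-identityˡ N)) (one 1 N (ℕ.*-identityˡ N))) refl)))
        (≤-trans (∑-single X (λ b _ → 0≤term 1 b) N N<X) (∑-single X (λ a _ → 0≤∑ X (λ b _ → 0≤term a b)) 1 1<X))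

    T-zero : ∀ X → T X 0 ≡ 0ℤ
    T-zero X = ∑-zero X λ a _ → ∑-zero X λ b _ → term a b
      where
      term : ∀ a b → ⟦ a ℕ.* b ℕ.≟ 0 ⟧ * F a b ≡ 0ℤ
      term a b with a ℕ.* b ℕ.≟ 0
      ... | no _ = *-zeroˡ (F a b)
      ... | yes e with ℕ.m*n≡0⇒m≡0∨n≡0 a e
      ...   | inj₁ refl = trans (*-identityˡ (F 0 b)) (trans (cong (_* φ.f b) ψ.f0≡0) (*-zeroˡ (φ.f b)))
      ...   | inj₂ refl = trans (*-identityˡ (F a 0)) (trans (cong (ψ.f a *_) φ.f0≡0) (*-zeroʳ (ψ.f a)))

    -- A full prime power `q^e` is split off, the cofactor is handled by recursion, and `tower` puts
    -- the power back.
    0≤T : ∀ X N → Acc ℕ._<_ N → N ℕ.< X → 0ℤ ≤ T X N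
    0≤T X 0 _ _ = ≤-reflexive (sym (T-zero X))
    0≤T X 1 _ _ = 0≤T-good {X} {1} λ a b e → cong₂ _*_ (trans (cong ψ.f (ℕ.m*n≡1⇒m≡1 a b e)) (f1≡1 ψ)) (trans (cong φ.f (ℕ.m*n≡1⇒n≡1 a b e)) (f1≡1 φ))
    0≤T X N@(suc (suc _)) (acc rs) N<X = go (PrimeFactorisation.factors (factorise N)) (PrimeFactorisation.factorsPrime (factorise N)) (PrimeFactorisation.isFactorisation (factorise N))
      where
      go : ∀ ps → All Prime ps → N ≡ product ps → 0ℤ ≤ T X N
      go [] [] ()
      go (q ∷ ps) (pr ∷ _) e₀ = at (strip q N 1<q (s≤s z≤n) (<-wellFounded N))
        where
        1<q : 1 ℕ.< q
        1<q = ℕ.nonTrivial⇒n>1 q {{prime⇒nonTrivial pr}}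
        at : ∃₂ (λ e M → N ≡ q ^ e ℕ.* M × ¬ q ∣ M) → 0ℤ ≤ T X N
        at (zero , M , e , q∤M) = contradiction (subst (q ∣_) (trans e (ℕ.*-identityˡ M)) (subst (q ∣_) (sym e₀) (ℕD.m∣m*n (product ps)))) q∤M
        at (e , zero , eq , q∤M) = contradiction (q ℕD.∣0) q∤M
        at (suc e , M@(suc _) , eq , q∤M) = subst (λ n → 0ℤ ≤ T X n) (sym eq)
            (AtPrime.tower X q pr (s≤s z≤n) q∤M (0≤T X M (rs M<N) (ℕ.<-trans M<N N<X)) (values q pr) refl refl (suc e) (subst (ℕ._< X) eq N<X))
          where
          M<N : M ℕ.< N
          M<N = subst (M ℕ.<_) (sym eq) (subst (M ℕ.<_) (ℕ.*-comm M (q ^ suc e)) (ℕ.m<m*n M (q ^ suc e) (ℕ.<-≤-trans 1<q (ℕ.m≤m*n q (q ^ e) {{ℕ.m^n≢0 q e {{prime⇒nonZero pr}}}}))))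

-- The lower bound that contradicts the hyperbola method.

module Growth where
  open Arith
  open Sigma
  open Hyperbola
  open Positivity
  open import Data.Nat.Base as ℕ using (ℕ; zero; suc; s≤s; z≤n; NonZero; _^_)
  import Data.Nat.Properties as ℕ
  open import Data.Nat.Divisibility using (_∣_; ∣-trans; m∣m*n; n∣m*n)
  open import Data.Nat.Primality using (Prime)
  open import Data.Nat.Induction using (<-wellFounded)
  import Data.Nat.Tactic.RingSolver as ℕRing
  open import Data.Integer.Base hiding (suc; pred; NonZero; _^_)
  open import Data.Integer.Properties
  open import Data.Product using (_×_; proj₁; proj₂)
  open import Data.Empty using (⊥)
  open import Relation.Nullary using (contradiction)
  open import Relation.Binary.PropositionalEquality hiding (J)

  -- The numbers (1+ki)² + E 4^j are so many that Σ T exceeds the hyperbola bound.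
  module _ {k : ℕ} .{{k≢0 : NonZero k}} (ψ φ : Character k)
    (values : ∀ q → Prime q → PrimeValues (Character.f ψ q) (Character.f φ q)) (E : ℕ) (0<E : 0 ℕ.< E)
    (split : ∀ i j q → Prime q → q ∣ (suc (k ℕ.* i) ℕ.* suc (k ℕ.* i) ℕ.+ E ℕ.* 4 ^ j) → Character.f ψ q ≡ 1ℤ × Character.f φ q ≡ 1ℤ) where
    open Convolution ψ φ
    open Nonnegativity ψ φ values

    x² : ℕ → ℕ
    x² i = suc (k ℕ.* i) ℕ.* suc (k ℕ.* i)

    N : ℕ → ℕ → ℕ
    N i j = x² i ℕ.+ E ℕ.* 4 ^ j

    F-good : ∀ i j a b → a ℕ.* b ≡ N i j → F a b ≡ 1ℤ
    F-good i j zero b ()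
    F-good i j (suc a) zero e = contradiction (trans (sym (ℕ.*-zeroʳ a)) e) λ ()
    F-good i j a@(suc _) b@(suc _) e = cong₂ _*_
      (one-from-primes ψ a (s≤s z≤n) (λ q pr d → proj₁ (split i j q pr (subst (q ∣_) e (∣-trans d (m∣m*n b))))))
      (one-from-primes φ b (s≤s z≤n) (λ q pr d → proj₂ (split i j q pr (subst (q ∣_) e (∣-trans d (n∣m*n a))))))

    module _ (X : ℕ) (1<X : 1 ℕ.< X) where
      C : ℕ → ℤ
      C m = ∑ m (T X)

      C-mono : ∀ m d → m ℕ.+ d ℕ.≤ X → C m ≤ C (m ℕ.+ d)
      C-mono m d h = subst₂ _≤_ (+-identityʳ (C m)) (sym (∑-split m d (T X)))
        (+-monoʳ-≤ (C m) (0≤∑ d (λ i i<d → 0≤T X (m ℕ.+ i) (<-wellFounded _) (ℕ.<-≤-trans (ℕ.+-monoʳ-< m i<d) h))))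

      C-mono′ : ∀ m m′ → m ℕ.≤ m′ → m′ ℕ.≤ X → C m ≤ C m′
      C-mono′ m m′ h h′ = subst (λ t → C m ≤ C t) (ℕ.m+[n∸m]≡n h) (C-mono m (m′ ℕ.∸ m) (subst (ℕ._≤ X) (sym (ℕ.m+[n∸m]≡n h)) h′))

      C-step : ∀ i j → N i j ℕ.< X → C (N i j) + 1ℤ ≤ C (suc (N i j))
      C-step i j h = subst (C (N i j) + 1ℤ ≤_) (sym (∑-last (N i j) (T X)))
        (+-monoʳ-≤ (C (N i j)) (1≤T-good (F-good i j) 1<X h))

      N-< : ∀ i j → N i j ℕ.< N i (suc j)
      N-< i j = ℕ.+-monoʳ-< (x² i) (ℕ.*-monoʳ-< E {{ℕ.>-nonZero 0<E}} (ℕ.^-monoʳ-< 4 (s≤s (s≤s z≤n)) (ℕ.n<1+n j)))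

      -- The numbers `N i 0 < … < N i (j - 1)` lie in the interval between the two arguments of `C`,
      -- and each adds at least 1.
      row : ∀ i j → N i j ℕ.≤ X → C (x² i) + + j ≤ C (N i j)
      row i zero h = subst (_≤ C (N i 0)) (sym (+-identityʳ (C (x² i)))) (C-mono (x² i) (E ℕ.* 1) h)
      row i (suc j) h = ≤-trans (≤-reflexive (trans (cong (_+_ (C (x² i))) (trans (cong +_ (ℕ.+-comm 1 j)) (pos-+ j 1))) (sym (+-assoc (C (x² i)) (+ j) 1ℤ))))
        (≤-trans (+-monoˡ-≤ 1ℤ (row i j (ℕ.<⇒≤ (ℕ.<-≤-trans (N-< i j) h))))
          (≤-trans (C-step i j (ℕ.<-≤-trans (N-< i j) h)) (C-mono′ (suc (N i j)) (N i (suc j)) (N-< i j) h)))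

      -- From `i ≥ E 4^J` on, a row ends before the next square, so that numbers counted in
      -- different rows are distinct.
      gap : ∀ i J → E ℕ.* 4 ^ J ℕ.≤ i → N i J ℕ.≤ x² (suc i)
      gap i J h = subst (N i J ℕ.≤_) (sym square) (ℕ.+-monoʳ-≤ (x² i) (ℕ.≤-trans h (ℕ.≤-trans i≤a (ℕ.≤-trans (ℕ.m≤m*n a k) (ℕ.m≤m+n (a ℕ.* k) _)))))
        where
        a = suc (k ℕ.* i)
        i≤a : i ℕ.≤ a
        i≤a = ℕ.≤-trans (ℕ.m≤n*m i k) (ℕ.n≤1+n (k ℕ.* i))
        ident : ∀ a k → (a ℕ.+ k) ℕ.* (a ℕ.+ k) ≡ a ℕ.* a ℕ.+ (a ℕ.* k ℕ.+ (k ℕ.* a ℕ.+ k ℕ.* k))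
        ident = ℕRing.solve-∀
        square : x² (suc i) ≡ x² i ℕ.+ (a ℕ.* k ℕ.+ (k ℕ.* a ℕ.+ k ℕ.* k))
        square = trans (cong (λ t → suc t ℕ.* suc t) (trans (ℕ.*-suc k i) (ℕ.+-comm k (k ℕ.* i)))) (ident a k)

      x²-mono : ∀ {i i′} → i ℕ.≤ i′ → x² i ℕ.≤ x² i′
      x²-mono h = ℕ.*-mono-≤ (s≤s (ℕ.*-monoʳ-≤ k h)) (s≤s (ℕ.*-monoʳ-≤ k h))

      rows : ∀ J d → x² (E ℕ.* 4 ^ J ℕ.+ d) ℕ.≤ X → + (d ℕ.* J) ≤ C (x² (E ℕ.* 4 ^ J ℕ.+ d))
      rows J zero h = 0≤∑ _ (λ n n< → 0≤T X n (<-wellFounded n) (ℕ.<-≤-trans n< h))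
      rows J (suc d) h = subst (λ t → + (J ℕ.+ d ℕ.* J) ≤ C (x² t)) (sym (ℕ.+-suc I₀ d)) (≤-trans (≤-reflexive (trans (cong +_ (ℕ.+-comm J (d ℕ.* J))) (pos-+ (d ℕ.* J) J)))
        (≤-trans (+-monoˡ-≤ (+ J) (rows J d (ℕ.≤-trans (x²-mono (ℕ.n≤1+n i)) h′)))
          (≤-trans (row i J (ℕ.≤-trans (gap i J (ℕ.m≤m+n I₀ d)) h′)) (C-mono′ (N i J) (x² (suc i)) (gap i J (ℕ.m≤m+n I₀ d)) h′))))
        where
        I₀ = E ℕ.* 4 ^ J
        i = I₀ ℕ.+ d
        h′ : x² (suc i) ℕ.≤ X
        h′ = subst (λ t → x² t ℕ.≤ X) (ℕ.+-suc I₀ d) h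

    -- With J rows of length d the hyperbola bound 3kZ is exceeded by exactly one.
    growth-contradiction : ⊥
    growth-contradiction = overflow J d refl refl
      where
      J d : ℕ
      -- In `3kZ` with `Z = 1 + k(I₀ + d)` the coefficient of `d` is `3k²`, which `J` exceeds by 1;
      -- `d` in turn exceeds by 1 the part `3k(1 + kI₀)` free of `d`.
      J = suc (3 ℕ.* (k ℕ.* k))
      d = suc (3 ℕ.* k ℕ.* suc (k ℕ.* (E ℕ.* 4 ^ J)))
      overflow : ∀ J d → J ≡ suc (3 ℕ.* (k ℕ.* k)) → d ≡ suc (3 ℕ.* k ℕ.* suc (k ℕ.* (E ℕ.* 4 ^ J))) → ⊥
      overflow J d J≡ d≡ = ℕ.<-irrefl refl (ℕ.≤-<-trans (ℕ.≤-trans (drop‿+≤+ lower) (hyperbola Z)) (subst (Z ℕ.* (k ℕ.+ (k ℕ.+ k)) ℕ.<_) (sym count) (ℕ.n<1+n _)))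
        where
        I₀ = E ℕ.* 4 ^ J
        Z = suc (k ℕ.* (I₀ ℕ.+ d))
        1<Z : 1 ℕ.< Z
        1<Z = s≤s (ℕ.*-mono-< {0} {k} {0} {I₀ ℕ.+ d} (ℕ.>-nonZero⁻¹ k) (ℕ.≤-trans (subst (0 ℕ.<_) (sym d≡) (s≤s z≤n)) (ℕ.m≤n+m d I₀)))
        lower : + (d ℕ.* J) ≤ + ∣ S (Z ℕ.* Z) ∣
        lower = ≤-trans (≤-trans (rows (Z ℕ.* Z) (ℕ.*-mono-< 1<Z 1<Z) J d ℕ.≤-refl) (≤-reflexive (∑T≡S (Z ℕ.* Z)))) (i≤+∣i∣ (S (Z ℕ.* Z)))
          where
          i≤+∣i∣ : ∀ i → i ≤ + ∣ i ∣
          i≤+∣i∣ (+ n) = ≤-refl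
          i≤+∣i∣ -[1+ n ] = -≤+
        count : d ℕ.* J ≡ suc (Z ℕ.* (k ℕ.+ (k ℕ.+ k)))
        count = trans (cong (d ℕ.*_) J≡) (trans (ident₁ d k) (trans (cong (ℕ._+ 3 ℕ.* (k ℕ.* k) ℕ.* d) d≡) (ident₂ k I₀ d)))
          where
          ident₁ : ∀ d k → d ℕ.* suc (3 ℕ.* (k ℕ.* k)) ≡ d ℕ.+ 3 ℕ.* (k ℕ.* k) ℕ.* d
          ident₁ = ℕRing.solve-∀
          ident₂ : ∀ k I d → suc (3 ℕ.* k ℕ.* suc (k ℕ.* I)) ℕ.+ 3 ℕ.* (k ℕ.* k) ℕ.* d ≡ suc (suc (k ℕ.* (I ℕ.+ d)) ℕ.* (k ℕ.+ (k ℕ.+ k)))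
          ident₂ = ℕRing.solve-∀

-- A quadratic character separating a unit from a subgroup.

module Separation where
  open Hyperbola using (Character)
  open import Data.Nat.Base as ℕ using (ℕ; zero; suc; s≤s; z≤n; NonZero; _*_; _<_)
  import Data.Nat.Properties as ℕ
  open import Data.Nat.DivMod using (_%_; m%n<n; %-distribˡ-*; m%n%n≡m%n)
  import Data.Nat.Tactic.RingSolver as ℕRing
  open import Data.Integer.Base as ℤ using (ℤ; 0ℤ; 1ℤ; -1ℤ; ∣_∣)
  open import Data.Integer.Properties using (*-zeroʳ)
  open import Data.Product using (_×_; _,_; ∃; Σ; proj₁; proj₂)
  open import Data.Sum using (_⊎_; inj₁; inj₂) renaming (map to map-⊎)
  open import Relation.Nullary using (Dec; yes; no; ¬_; contradiction)
  open import Relation.Nullary.Decidable using (_⊎-dec_)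
  open import Relation.Binary.PropositionalEquality hiding (resp)

  module Residues (k : ℕ) .{{k≢0 : NonZero k}} where
    infix 4 _≈_
    _≈_ : ℕ → ℕ → Set
    x ≈ y = x % k ≡ y % k

    ≈-* : ∀ {x x′ y y′} → x ≈ x′ → y ≈ y′ → x * y ≈ x′ * y′
    ≈-* {x} {x′} {y} {y′} p q = trans (%-distribˡ-* x y k) (trans (cong₂ (λ s t → (s * t) % k) p q) (sym (%-distribˡ-* x′ y′ k)))

    Unit : ℕ → Set
    Unit g = ∃ λ h → g * h ≈ 1

    unit-resp : ∀ {g g′} → g ≈ g′ → Unit g → Unit g′
    unit-resp {g} {g′} e (h , u) = h , trans (≈-* {g′} {g} {h} {h} (sym e) refl) u

    unit-factor : ∀ g h → Unit (g * h) → Unit g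
    unit-factor g h (i , e) = h * i , trans (cong (_% k) (sym (ℕ.*-assoc g h i))) e

    -- The squares of all units belong to it, so the quotient has exponent 2: adjoining an element
    -- adds a single coset, and the separating character has values ±1. Inverses come along, because
    -- `g′ ≡ g (g′)²` for an inverse `g′` of `g`.
    record SubgroupAvoiding (a : ℕ) : Set₁ where
      field
        In : ℕ → Set
        in? : ∀ g → Dec (In g)
        resp : ∀ {g h} → g ≈ h → In g → In h
        mult : ∀ {g h} → In g → In h → In (g * h)
        squares : ∀ {g} → Unit g → In (g * g)
        units : ∀ {g} → In g → Unit g
        avoids : ¬ In a

      rename : ∀ {g h} → g ≡ h → In g → In h
      rename = subst In

      cancel-square : ∀ x h → Unit h → In (x * (h * h)) → In x
      cancel-square x h (h′ , e) p = resp eq (mult p (squares {h′} (h , trans (cong (_% k) (ℕ.*-comm h′ h)) e)))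
        where
        ident : ∀ x h h′ → x * (h * h) * (h′ * h′) ≡ x * (h * h′ * (h * h′))
        ident = ℕRing.solve-∀
        eq : x * (h * h) * (h′ * h′) ≈ x
        eq = trans (cong (_% k) (ident x h h′)) (trans (≈-* {x} {x} {h * h′ * (h * h′)} {1} refl (≈-* {h * h′} {1} {h * h′} {1} e e)) (cong (_% k) (ℕ.*-identityʳ x)))

    module _ {a : ℕ} where
      open SubgroupAvoiding

      Decided : SubgroupAvoiding a → ℕ → Set
      Decided S h = Unit h → In S h ⊎ In S (a * h)

      -- The group enlarged by `h` contains `a` exactly when `ah` is already in `S`; only then is
      -- `h` left out, and either outcome settles `h`.
      extend : (∀ g → Dec (Unit g)) → ∀ h (S : SubgroupAvoiding a) → Σ (SubgroupAvoiding a) λ S′ → (∀ {g} → In S g → In S′ g) × Decided S′ h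
      extend unit? h S with unit? h
      ... | no ¬u = S , (λ p → p) , λ u → contradiction u ¬u
      ... | yes u with in? S (a * h)
      ...   | yes ah = S , (λ p → p) , λ _ → inj₂ ah
      ...   | no ¬ah = S′ , inj₁ , λ _ → inj₁ (inj₂ (squares S {h} u))
        where
        In′ : ℕ → Set
        In′ g = In S g ⊎ In S (g * h)
        i₁ : ∀ g g′ h → g * (g′ * h) ≡ g * g′ * h
        i₁ = ℕRing.solve-∀
        i₂ : ∀ g g′ h → g * h * g′ ≡ g * g′ * h
        i₂ = ℕRing.solve-∀
        i₃ : ∀ g g′ h → g * h * (g′ * h) ≡ g * g′ * (h * h)
        i₃ = ℕRing.solve-∀
        S′ : SubgroupAvoiding a
        S′ .In = In′
        S′ .in? g = in? S g ⊎-dec in? S (g * h)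
        S′ .resp e (inj₁ p) = inj₁ (resp S e p)
        S′ .resp {g} {g′} e (inj₂ p) = inj₂ (resp S (≈-* {g} {g′} {h} {h} e refl) p)
        S′ .mult (inj₁ p) (inj₁ q) = inj₁ (mult S p q)
        S′ .mult {g} {g′} (inj₁ p) (inj₂ q) = inj₂ (rename S (i₁ g g′ h) (mult S p q))
        S′ .mult {g} {g′} (inj₂ p) (inj₁ q) = inj₂ (rename S (i₂ g g′ h) (mult S p q))
        S′ .mult {g} {g′} (inj₂ p) (inj₂ q) = inj₁ (cancel-square S (g * g′) h u (rename S (i₃ g g′ h) (mult S p q)))
        S′ .squares {g} v = inj₁ (squares S {g} v)
        S′ .units (inj₁ p) = units S p
        S′ .units {g} (inj₂ p) = unit-factor g h (units S p)
        S′ .avoids (inj₁ p) = avoids S p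
        S′ .avoids (inj₂ p) = ¬ah p

      -- A finite substitute for Zorn's lemma: once every residue has been offered, the subgroup and
      -- its coset by `a` exhaust the units.
      maximal : (∀ g → Dec (Unit g)) → ∀ n (S : SubgroupAvoiding a) → Σ (SubgroupAvoiding a) λ S′ → (∀ {g} → In S g → In S′ g) × (∀ h → h < n → Decided S′ h)
      maximal unit? zero S = S , (λ p → p) , λ _ ()
      maximal unit? (suc n) S with maximal unit? n S
      ... | S₁ , S⊆S₁ , d₁ with extend unit? n S₁
      ...   | S₂ , S₁⊆S₂ , d₂ = S₂ , (λ p → S₁⊆S₂ (S⊆S₁ p)) , decided
        where
        decided : ∀ h → h < suc n → Decided S₂ h
        decided h h<1+n with ℕ.m<1+n⇒m<n∨m≡n h<1+n
        ... | inj₂ refl = d₂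
        ... | inj₁ h<n = λ u → map-⊎ S₁⊆S₂ S₁⊆S₂ (d₁ h h<n u)

      module _ (unit? : ∀ g → Dec (Unit g)) (unit-a : Unit a) (S : SubgroupAvoiding a) where
        private
          max = maximal unit? k S
          S′ = proj₁ max

          dichotomy : ∀ h → Unit h → In S′ h ⊎ In S′ (a * h)
          dichotomy h u = map-⊎ (resp S′ (m%n%n≡m%n h k)) (resp S′ (≈-* {a} {a} {h % k} {h} refl (m%n%n≡m%n h k)))
            (proj₂ (proj₂ max) (h % k) (m%n<n h k) (unit-resp {h} {h % k} (sym (m%n%n≡m%n h k)) u))

        value : ℕ → ℤ
        value x with unit? x | in? S′ x
        ... | no _ | _ = 0ℤ
        ... | yes _ | yes _ = 1ℤ
        ... | yes _ | no _ = -1ℤ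

        value-in : ∀ {x} → In S′ x → value x ≡ 1ℤ
        value-in {x} p with unit? x | in? S′ x
        ... | no ¬u | _ = contradiction (units S′ p) ¬u
        ... | yes _ | yes _ = refl
        ... | yes _ | no ¬p = contradiction p ¬p

        value-out : ∀ {x} → Unit x → ¬ In S′ x → value x ≡ -1ℤ
        value-out {x} u ¬p with unit? x | in? S′ x
        ... | no ¬u | _ = contradiction u ¬u
        ... | yes _ | yes p = contradiction p ¬p
        ... | yes _ | no _ = refl

        value-nonunit : ∀ {x} → ¬ Unit x → value x ≡ 0ℤ
        value-nonunit {x} ¬u with unit? x | in? S′ x
        ... | no _ | _ = refl
        ... | yes u | _ = contradiction u ¬u

        value-bounded : ∀ x → ∣ value x ∣ ℕ.≤ 1
        value-bounded x with unit? x | in? S′ x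
        ... | no _ | _ = z≤n
        ... | yes _ | yes _ = s≤s z≤n
        ... | yes _ | no _ = s≤s z≤n

        data Value (x : ℕ) : Set where
          nonunit : ¬ Unit x → Value x
          inside : In S′ x → Value x
          outside : Unit x → ¬ In S′ x → Value x

        classify : ∀ x → Value x
        classify x with unit? x | in? S′ x
        ... | no ¬u | _ = nonunit ¬u
        ... | yes _ | yes p = inside p
        ... | yes u | no ¬p = outside u ¬p

        unit-* : ∀ x y → Unit x → Unit y → Unit (x * y)
        unit-* x y (x′ , e) (y′ , e′) = x′ * y′ , trans (cong (_% k) (ident x y x′ y′)) (≈-* {x * x′} {1} {y * y′} {1} e e′)
          where
          ident : ∀ x y x′ y′ → x * y * (x′ * y′) ≡ x * x′ * (y * y′)
          ident = ℕRing.solve-∀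

        value-* : ∀ x y → value (x * y) ≡ value x ℤ.* value y
        value-* x y with classify x | classify y
        ... | nonunit ¬u | _ = trans (value-nonunit (λ u → ¬u (unit-factor x y u))) (cong (ℤ._* value y) (sym (value-nonunit ¬u)))
        ... | inside p | inside q = trans (value-in (mult S′ p q)) (sym (cong₂ ℤ._*_ (value-in p) (value-in q)))
        ... | inside p | outside u ¬q = trans (value-out (unit-* x y (units S′ p) u) (λ r → ¬q (cancel-square S′ y x (units S′ p) (rename S′ (ident x y) (mult S′ p r)))))
            (sym (cong₂ ℤ._*_ (value-in p) (value-out u ¬q)))
          where
          ident : ∀ x y → x * (x * y) ≡ y * (x * x)
          ident = ℕRing.solve-∀
        ... | outside u ¬p | inside q = trans (value-out (unit-* x y u (units S′ q)) (λ r → ¬p (cancel-square S′ x y (units S′ q) (rename S′ (ℕ.*-assoc x y y) (mult S′ r q)))))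
            (sym (cong₂ ℤ._*_ (value-out u ¬p) (value-in q)))
        -- Both `ax` and `ay` lie in the subgroup, hence `xy a²`, and the square cancels.
        ... | outside u ¬p | outside v ¬q = trans (value-in (both (dichotomy x u) (dichotomy y v))) (sym (cong₂ ℤ._*_ (value-out u ¬p) (value-out v ¬q)))
          where
          ident : ∀ a x y → a * x * (a * y) ≡ x * y * (a * a)
          ident = ℕRing.solve-∀
          both : In S′ x ⊎ In S′ (a * x) → In S′ y ⊎ In S′ (a * y) → In S′ (x * y)
          both (inj₁ p) _ = contradiction p ¬p
          both _ (inj₁ q) = contradiction q ¬q
          both (inj₂ p) (inj₂ q) = cancel-square S′ (x * y) a unit-a (rename S′ (ident a x y) (mult S′ p q))
        value-* x y | inside p | nonunit ¬v = trans (value-nonunit (λ u → ¬v (unit-factor y x (subst Unit (ℕ.*-comm x y) u))))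
          (sym (trans (cong (value x ℤ.*_) (value-nonunit ¬v)) (*-zeroʳ (value x))))

        value-* x y | outside _ _ | nonunit ¬v = trans (value-nonunit (λ u → ¬v (unit-factor y x (subst Unit (ℕ.*-comm x y) u))))
          (sym (trans (cong (value x ℤ.*_) (value-nonunit ¬v)) (*-zeroʳ (value x))))


        value-periodic : ∀ x y → x ≈ y → value x ≡ value y
        value-periodic x y e with classify x
        ... | nonunit ¬u = trans (value-nonunit ¬u) (sym (value-nonunit (λ v → ¬u (unit-resp {y} {x} (sym e) v))))
        ... | inside p = trans (value-in p) (sym (value-in (resp S′ e p)))
        ... | outside u ¬p = trans (value-out u ¬p) (sym (value-out (unit-resp {x} {y} e u) (λ q → ¬p (resp S′ (sym e) q))))

        separating : Character k
        separating = record { f = value ; multiplicative = value-* ; periodic = value-periodic ; bounded = value-bounded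
          ; a = a ; a⁻¹ = proj₁ unit-a ; inverse = proj₂ unit-a ; fa≡-1 = value-out unit-a (avoids S′) }

        separating-in : ∀ {x} → In S x → Character.f separating x ≡ 1ℤ
        separating-in p = value-in (proj₁ (proj₂ max) p)

        separating-value : ∀ x → (¬ Unit x × Character.f separating x ≡ 0ℤ) ⊎ (Unit x × (Character.f separating x ≡ 1ℤ ⊎ Character.f separating x ≡ -1ℤ))
        separating-value x with classify x
        ... | nonunit ¬u = inj₁ (¬u , value-nonunit ¬u)
        ... | inside p = inj₂ (units S′ p , inj₁ (value-in p))
        ... | outside u ¬p = inj₂ (u , inj₂ (value-out u ¬p))

-- The Jacobi symbol as a product of Gauss signs.

module Jacobi where
  open Arith
  open Range
  open import Data.Nat.Base as ℕ using (ℕ; zero; suc; s≤s; z≤n)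
  import Data.Nat.Properties as ℕ
  open import Data.Nat.DivMod using (_%_; _/_; m%n<n; %-distribˡ-*; %-distribˡ-+; m<n⇒m%n≡m; m≡m%n+[m/n]*n)
  open import Data.Nat.Divisibility as ℕD using (divides; m%n≡0⇒n∣m; n∣m⇒m%n≡0)
  open import Data.Nat.Coprimality as Coprimality using (Coprime)
  open import Data.Nat.GCD using (gcd; gcd[m,n]∣m; gcd[m,n]∣n)
  import Data.Nat.Tactic.RingSolver as ℕRing
  open import Data.Integer.Base hiding (suc; pred; NonZero; _%_; _/_)
  open import Data.Integer.Properties
  open import Data.Integer.Tactic.RingSolver using (solve-∀)
  open import Data.Product using (_×_; _,_; proj₁; proj₂)
  open import Function.Base using (_∘_)
  open import Relation.Nullary using (yes; no; ¬_; contradiction)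
  open import Relation.Binary.PropositionalEquality hiding (J)

  open Fold *-1-commutativeMonoid public renaming
    (fold to ∏; fold-cong to ∏-cong; fold-ε to ∏-one; fold-∙ to ∏-*; fold-swap to ∏-swap; fold-last to ∏-last; fold-permute to ∏-permute)
    hiding (fold-+)

  sg : ℕ → ℤ
  sg zero = 1ℤ
  sg (suc n) = - sg n

  sg-+ : ∀ m n → sg (m ℕ.+ n) ≡ sg m * sg n
  sg-+ zero n = sym (*-identityˡ (sg n))
  sg-+ (suc m) n = trans (cong -_ (sg-+ m n)) (neg-distribˡ-* (sg m) (sg n))

  sg-square : ∀ n → sg n * sg n ≡ 1ℤ
  sg-square zero = refl
  sg-square (suc n) = trans (ident (sg n)) (sg-square n)
    where
    ident : ∀ x → - x * - x ≡ x * x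
    ident = solve-∀

  sg-double : ∀ n → sg (n ℕ.+ n) ≡ 1ℤ
  sg-double n = trans (sg-+ n n) (sg-square n)

  sg-*-odd : ∀ g n → sg (suc (g ℕ.+ g) ℕ.* n) ≡ sg n
  sg-*-odd g n = trans (sg-+ n ((g ℕ.+ g) ℕ.* n)) (trans (cong (sg n *_) (trans (cong sg (ℕ.*-distribʳ-+ n g g)) (sg-double (g ℕ.* n)))) (*-identityʳ (sg n)))

  ∏-zero : ∀ n f i → i ℕ.< n → f i ≡ 0ℤ → ∏ n f ≡ 0ℤ
  ∏-zero (suc n) f zero _ e = trans (cong (_* ∏ n (f ∘ suc)) e) (*-zeroˡ (∏ n (f ∘ suc)))
  ∏-zero (suc n) f (suc i) (s≤s h) e = trans (cong (f 0 *_) (∏-zero n (f ∘ suc) i h e)) (*-zeroʳ (f 0))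

  ∏-bounded : ∀ n f → (∀ i → ∣ f i ∣ ℕ.≤ 1) → ∣ ∏ n f ∣ ℕ.≤ 1
  ∏-bounded zero f h = s≤s z≤n
  ∏-bounded (suc n) f h = subst (ℕ._≤ 1) (sym (abs-* (f 0) (∏ n (f ∘ suc)))) (ℕ.*-mono-≤ (h 0) (∏-bounded n (f ∘ suc) (h ∘ suc)))

  -- Odd moduli are given by `h`, the size of the half-system 1, ..., h.
  odd : ℕ → ℕ
  odd h = suc (h ℕ.+ h)

  -- The sign and the absolute value of the residue of x modulo odd h of least absolute value.
  module _ (h : ℕ) where
    private
      N = odd h

    ε-of : ℕ → ℤ × ℕ
    ε-of zero = 0ℤ , 0
    ε-of r@(suc _) with r ℕ.≤? h
    ... | yes _ = 1ℤ , r
    ... | no _ = -1ℤ , N ℕ.∸ r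

    ε : ℕ → ℤ
    ε x = proj₁ (ε-of (x % N))

    ρ : ℕ → ℕ
    ρ x = proj₂ (ε-of (x % N))

    ε-cong : ∀ {x y} → x % N ≡ y % N → ε x ≡ ε y
    ε-cong e = cong (λ r → proj₁ (ε-of r)) e

    ρ-cong : ∀ {x y} → x % N ≡ y % N → ρ x ≡ ρ y
    ρ-cong e = cong (λ r → proj₂ (ε-of r)) e

    data Residue (x : ℕ) : ℤ → ℕ → Set where
      none : N ℕD.∣ x → Residue x 0ℤ 0
      plus : ∀ {r} → 0 ℕ.< r → r ℕ.≤ h → x % N ≡ r → Residue x 1ℤ r
      minus : ∀ {r} → 0 ℕ.< r → r ℕ.≤ h → x % N ℕ.+ r ≡ N → Residue x -1ℤ r

    residue : ∀ x → Residue x (ε x) (ρ x)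
    residue x = go (x % N) refl
      where
      go : ∀ r → x % N ≡ r → Residue x (proj₁ (ε-of r)) (proj₂ (ε-of r))
      go zero e = none (m%n≡0⇒n∣m x N e)
      go r@(suc r′) e with r ℕ.≤? h
      ... | yes r≤h = plus (s≤s z≤n) r≤h e
      ... | no r≰h = minus (ℕ.m<n⇒0<n∸m r<N) (ℕ.≤-trans (ℕ.∸-monoʳ-≤ N (ℕ.≰⇒> r≰h)) (ℕ.≤-reflexive (ℕ.m+n∸m≡n (suc h) h)))
          (trans (cong (ℕ._+ (N ℕ.∸ r)) e) (ℕ.m+[n∸m]≡n (ℕ.<⇒≤ r<N)))
        where
        r<N : r ℕ.< N
        r<N = subst (ℕ._< N) e (m%n<n x N)

    h<N : ∀ {r} → r ℕ.≤ h → r ℕ.< N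
    h<N r≤h = s≤s (ℕ.≤-trans r≤h (ℕ.m≤m+n h h))

    plus-ε : ∀ {r} → 0 ℕ.< r → r ℕ.≤ h → ∀ x → x % N ≡ r → ε x ≡ 1ℤ × ρ x ≡ r
    plus-ε {r} 0<r r≤h x e = cong proj₁ (eq r 0<r r≤h (x % N) e) , cong proj₂ (eq r 0<r r≤h (x % N) e)
      where
      eq : ∀ r → 0 ℕ.< r → r ℕ.≤ h → ∀ s → s ≡ r → ε-of s ≡ (1ℤ , r)
      eq r@(suc _) _ r≤h _ refl with r ℕ.≤? h
      ... | yes _ = refl
      ... | no r≰h = contradiction r≤h r≰h

    minus-ε : ∀ {r} → 0 ℕ.< r → r ℕ.≤ h → ∀ x → x % N ℕ.+ r ≡ N → ε x ≡ -1ℤ × ρ x ≡ r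
    minus-ε {r} 0<r r≤h x e = cong proj₁ (eq (x % N) e) , cong proj₂ (eq (x % N) e)
      where
      eq : ∀ s → s ℕ.+ r ≡ N → ε-of s ≡ (-1ℤ , r)
      eq zero e = contradiction (subst (ℕ._≤ h) e r≤h) (ℕ.<⇒≱ (s≤s (ℕ.m≤m+n h h)))
      eq s@(suc s′) e with s ℕ.≤? h
      ... | yes s≤h = contradiction (subst (ℕ._≤ h ℕ.+ h) e (ℕ.+-mono-≤ s≤h r≤h)) ℕ.1+n≰n
      ... | no _ = cong (-1ℤ ,_) (trans (cong (ℕ._∸ s) (sym e)) (ℕ.m+n∸m≡n s r))

    none-ε : ∀ x → N ℕD.∣ x → ε x ≡ 0ℤ × ρ x ≡ 0
    none-ε x d = cong (proj₁ ∘ ε-of) (n∣m⇒m%n≡0 x N d) , cong (proj₂ ∘ ε-of) (n∣m⇒m%n≡0 x N d)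

    residue-sum : ∀ x y → N ℕD.∣ (x ℕ.+ y) → 0 ℕ.< y % N → x % N ℕ.+ y % N ≡ N
    residue-sum x y d 0<y = go (m%n≡0⇒n∣m _ N (trans (sym (%-distribˡ-+ x y N)) (n∣m⇒m%n≡0 _ N d)))
      where
      go : N ℕD.∣ (x % N ℕ.+ y % N) → x % N ℕ.+ y % N ≡ N
      go (divides 0 e) = contradiction (subst (y % N ℕ.≤_) e (ℕ.m≤n+m (y % N) (x % N))) (ℕ.<⇒≱ 0<y)
      go (divides 1 e) = trans e (ℕ.*-identityˡ N)
      go (divides (suc (suc c)) e) = contradiction (subst (ℕ._< N ℕ.+ N) e (ℕ.+-mono-< (m%n<n x N) (m%n<n y N))) (ℕ.≤⇒≯ (ℕ.+-monoʳ-≤ N (ℕ.m≤m+n N (c ℕ.* N))))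

    opposite : ∀ x y → N ℕD.∣ (x ℕ.+ y) → ε x ≡ - ε y × ρ x ≡ ρ y
    opposite x y d with ε y | ρ y | residue y
    ... | _ | _ | none d′ = none-ε x (ℕD.∣m+n∣m⇒∣n (subst (N ℕD.∣_) (ℕ.+-comm x y) d) d′)
    ... | _ | _ | plus {r} 0<r r≤h e = minus-ε 0<r r≤h x (trans (cong (x % N ℕ.+_) (sym e)) (residue-sum x y d (subst (0 ℕ.<_) (sym e) 0<r)))
    ... | _ | _ | minus {r} 0<r r≤h e = plus-ε 0<r r≤h x
        (ℕ.+-cancelˡ-≡ (y % N) (x % N) r (trans (ℕ.+-comm (y % N) (x % N)) (trans (residue-sum x y d 0<y) (sym e))))
      where
      0<y : 0 ℕ.< y % N
      0<y = ℕ.n≢0⇒n>0 λ y≡0 → ℕ.<⇒≢ (h<N r≤h) (trans (cong (ℕ._+ r) (sym y≡0)) e)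

    ρ-small : ∀ {r} → 0 ℕ.< r → r ℕ.≤ h → ε r ≡ 1ℤ × ρ r ≡ r
    ρ-small {r} 0<r r≤h = plus-ε 0<r r≤h r (m<n⇒m%n≡m (h<N r≤h))

    multiply : ∀ a {x y} → x % N ≡ y % N → (a ℕ.* x) % N ≡ (a ℕ.* y) % N
    multiply a {x} {y} e = trans (%-distribˡ-* a x N) (trans (cong (λ t → (a % N ℕ.* t) % N) e) (sym (%-distribˡ-* a y N)))

    N∣x+ρ : ∀ x {r} → x % N ℕ.+ r ≡ N → N ℕD.∣ (x ℕ.+ r)
    N∣x+ρ x {r} e = subst (N ℕD.∣_) (trans (ident (x % N) r (x / N ℕ.* N)) (cong (ℕ._+ r) (sym (m≡m%n+[m/n]*n x N))))
      (ℕD.∣m∣n⇒∣m+n (subst (N ℕD.∣_) (sym e) ℕD.∣-refl) (ℕD.n∣m*n (x / N)))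
      where
      ident : ∀ x r y → x ℕ.+ r ℕ.+ y ≡ x ℕ.+ y ℕ.+ r
      ident = ℕRing.solve-∀

    -- Multiplying by a commutes with replacing x by ± ρ x.
    ε-multiply : ∀ a x → ε (a ℕ.* x) ≡ ε x * ε (a ℕ.* ρ x) × ρ (a ℕ.* x) ≡ ρ (a ℕ.* ρ x)
    ε-multiply a x with ε x | ρ x | residue x
    ... | _ | _ | none d = trans (proj₁ (none-ε (a ℕ.* x) (ℕD.∣n⇒∣m*n a d))) (sym (*-zeroˡ (ε (a ℕ.* 0)))) ,
          trans (proj₂ (none-ε (a ℕ.* x) (ℕD.∣n⇒∣m*n a d))) (sym (proj₂ (none-ε (a ℕ.* 0) (subst (N ℕD.∣_) (sym (ℕ.*-zeroʳ a)) (N ℕD.∣0)))))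
    ... | _ | _ | plus {r} 0<r r≤h e = trans (ε-cong {a ℕ.* x} {a ℕ.* r} eq) (sym (*-identityˡ (ε (a ℕ.* r)))) , ρ-cong {a ℕ.* x} {a ℕ.* r} eq
      where
      eq = multiply a {x} {r} (trans e (sym (m<n⇒m%n≡m (h<N r≤h))))
    ... | _ | _ | minus {r} 0<r r≤h e = trans (proj₁ opp) (sym (-1*i≡-i (ε (a ℕ.* r)))) , proj₂ opp
      where
      opp = opposite (a ℕ.* x) (a ℕ.* r) (subst (N ℕD.∣_) (ℕ.*-distribˡ-+ a x r) (ℕD.∣n⇒∣m*n a (N∣x+ρ x e)))

    ε-bounded : ∀ x → ∣ ε x ∣ ℕ.≤ 1
    ε-bounded x with ε x | ρ x | residue x
    ... | _ | _ | none _ = z≤n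
    ... | _ | _ | plus _ _ _ = s≤s z≤n
    ... | _ | _ | minus _ _ _ = s≤s z≤n

    -- The Jacobi symbol of `a` over `2h + 1` in the form of Gauss's lemma, which by Schering holds
    -- for composite odd moduli too. Taken as the definition, it yields multiplicativity and
    -- reciprocity without factoring the modulus.
    J : ℕ → ℤ
    J a = ∏ h (λ i → ε (a ℕ.* suc i))

    J-periodic : ∀ a b → a % N ≡ b % N → J a ≡ J b
    J-periodic a b e = ∏-cong h λ i _ → ε-cong {a ℕ.* suc i} {b ℕ.* suc i}
      (trans (cong (_% N) (ℕ.*-comm a (suc i))) (trans (multiply (suc i) {a} {b} e) (cong (_% N) (ℕ.*-comm (suc i) b))))

    J-bounded : ∀ a → ∣ J a ∣ ℕ.≤ 1
    J-bounded a = ∏-bounded h (λ i → ε (a ℕ.* suc i)) (λ i → ε-bounded (a ℕ.* suc i))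

    J-1 : J 1 ≡ 1ℤ
    J-1 = ∏-one h λ i i<h → trans (cong ε (ℕ.*-identityˡ (suc i))) (proj₁ (ρ-small (s≤s z≤n) i<h))

    -- A common divisor `d > 1` gives `N = (i + 1) d` with `i + 1 ≤ h`; then `N` divides
    -- `a (i + 1)`, and that factor of the product is 0.
    J-noncoprime : ∀ a → ¬ Coprime a N → J a ≡ 0ℤ
    J-noncoprime a ¬c = go (gcd[m,n]∣n a N) (gcd[m,n]∣m a N)
      where
      d = gcd a N
      d≢1 : d ≢ 1
      d≢1 e = ¬c (Coprimality.gcd≡1⇒coprime e)
      go : d ℕD.∣ N → d ℕD.∣ a → J a ≡ 0ℤ
      go (divides zero ()) _
      go (divides (suc i) e) (divides c e′) = ∏-zero h (λ i → ε (a ℕ.* suc i)) i i<h (proj₁ (none-ε (a ℕ.* suc i) (divides c (trans (cong (ℕ._* suc i) e′)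
          (trans (ℕ.*-assoc c d (suc i)) (cong (c ℕ.*_) (trans (ℕ.*-comm d (suc i)) (sym e))))))))
        where
        two≤ : ∀ d → d ≢ 1 → N ≡ suc i ℕ.* d → 2 ℕ.≤ d
        two≤ 0 _ e = contradiction (trans e (ℕ.*-zeroʳ (suc i))) λ ()
        two≤ 1 n _ = contradiction refl n
        two≤ (suc (suc _)) _ _ = s≤s (s≤s z≤n)
        2≤d : 2 ℕ.≤ d
        2≤d = two≤ d d≢1 e
        i<h : i ℕ.< h
        i<h = ℕ.≮⇒≥ λ { (s≤s h≤i) → ℕ.<-irrefl refl (ℕ.<-≤-trans (subst (ℕ._< suc i ℕ.* 2) refl
            (subst (N ℕ.<_) (trans (cong suc (sym (ℕ.+-suc i i))) (trans (cong (suc i ℕ.+_) (sym (ℕ.+-identityʳ (suc i)))) (ℕ.*-comm 2 (suc i)))) (s≤s (s≤s (ℕ.+-mono-≤ h≤i h≤i)))))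
            (subst (suc i ℕ.* 2 ℕ.≤_) (sym e) (ℕ.*-monoʳ-≤ (suc i) 2≤d))) }

    Inverse : ℕ → ℕ → Set
    Inverse b b′ = (b′ ℕ.* b) % N ≡ 1 % N

    module Permutation {b b′ : ℕ} (inv : Inverse b b′) where
      cancel : ∀ x → 0 ℕ.< x → x ℕ.≤ h → ρ (b′ ℕ.* ρ (b ℕ.* x)) ≡ x
      cancel x 0<x x≤h = trans (sym (proj₂ (ε-multiply b′ (b ℕ.* x)))) (trans (ρ-cong {b′ ℕ.* (b ℕ.* x)} {x} eq) (proj₂ (ρ-small 0<x x≤h)))
        where
        eq : (b′ ℕ.* (b ℕ.* x)) % N ≡ x % N
        eq = trans (cong (_% N) (trans (sym (ℕ.*-assoc b′ b x)) (ℕ.*-comm (b′ ℕ.* b) x))) (trans (multiply x {b′ ℕ.* b} {1} inv) (cong (_% N) (ℕ.*-identityʳ x)))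

      ρ-range : ∀ i → i ℕ.< h → 0 ℕ.< ρ (b ℕ.* suc i) × ρ (b ℕ.* suc i) ℕ.≤ h
      ρ-range i i<h with ρ (b ℕ.* suc i) | cancel (suc i) (s≤s z≤n) i<h | ε (b ℕ.* suc i) | residue (b ℕ.* suc i)
      ... | _ | c | _ | none _ = contradiction (trans (sym c) (proj₂ (none-ε (b′ ℕ.* 0) (subst (N ℕD.∣_) (sym (ℕ.*-zeroʳ b′)) (N ℕD.∣0))))) λ ()
      ... | _ | _ | _ | plus p q _ = p , q
      ... | _ | _ | _ | minus p q _ = p , q

      π : ℕ → ℕ
      π i = ℕ.pred (ρ (b ℕ.* suc i))

      suc-π : ∀ i → i ℕ.< h → suc (π i) ≡ ρ (b ℕ.* suc i)
      suc-π i i<h = ℕ.suc-pred _ {{ℕ.>-nonZero (proj₁ (ρ-range i i<h))}}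

      π< : ∀ i → i ℕ.< h → π i ℕ.< h
      π< i i<h = subst (ℕ._≤ h) (sym (suc-π i i<h)) (proj₂ (ρ-range i i<h))

    Inverse-sym : ∀ {b b′} → Inverse b b′ → Inverse b′ b
    Inverse-sym {b} {b′} e = trans (cong (_% N) (ℕ.*-comm b b′)) e

    -- Up to sign, multiplication by a unit permutes the half-system; the permutation inverse to it
    -- comes from `b′`.
    ∏-ρ : ∀ {b b′} → Inverse b b′ → ∀ f → ∏ h (λ i → f (ρ (b ℕ.* suc i))) ≡ ∏ h (λ i → f (suc i))
    ∏-ρ {b} {b′} inv f = trans (∏-cong h λ i i<h → cong f (sym (P.suc-π i i<h)))
        (∏-permute h (f ∘ suc) P.π Q.π P.π< Q.π< (λ i i<h → ℕ.suc-injective (back {b′} {b} Q.suc-π P.suc-π Q.π< Q.cancel i i<h)) (λ i i<h → ℕ.suc-injective (back {b} {b′} P.suc-π Q.suc-π P.π< P.cancel i i<h)))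
      where
      module P = Permutation {b} {b′} inv
      module Q = Permutation {b′} {b} (Inverse-sym {b} {b′} inv)
      back : ∀ {b b′} {π π′ : ℕ → ℕ} → (∀ i → i ℕ.< h → suc (π i) ≡ ρ (b ℕ.* suc i)) → (∀ i → i ℕ.< h → suc (π′ i) ≡ ρ (b′ ℕ.* suc i)) →
        (∀ i → i ℕ.< h → π i ℕ.< h) → (∀ x → 0 ℕ.< x → x ℕ.≤ h → ρ (b′ ℕ.* ρ (b ℕ.* x)) ≡ x) → ∀ i → i ℕ.< h → suc (π′ (π i)) ≡ suc i
      back {b} {b′} {π} s s′ π< c i i<h = trans (s′ (π i) (π< i i<h)) (trans (cong (λ t → ρ (b′ ℕ.* t)) (s i i<h)) (c (suc i) (s≤s z≤n) i<h))

-- Multiplicativity, quadratic reciprocity and its supplements.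

module Reciprocity where
  open Arith
  open Jacobi
  open import Data.Nat.Base as ℕ using (ℕ; zero; suc; s≤s; z≤n; NonZero)
  import Data.Nat.Properties as ℕ
  open import Data.Nat.DivMod using (_%_; _/_; m≡m%n+[m/n]*n; m<n*o⇒m/o<n; m*n/n≡m; /-monoˡ-≤; m/n*n≤m; [m+kn]%n≡m%n)
  open import Data.Nat.Divisibility as ℕD using (divides)
  open import Data.Nat.Coprimality as Coprimality using (Coprime; coprime?; coprime-divisor; coprime-Bézout)
  open import Data.Nat.GCD using (module Bézout)
  import Data.Nat.Tactic.RingSolver as ℕRing
  open import Data.Integer.Base hiding (suc; pred; NonZero; _%_; _/_)
  open import Data.Integer.Properties
  open import Data.Integer.Tactic.RingSolver using (solve-∀)
  open import Data.Integer.Solver using (module +-*-Solver)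
  open +-*-Solver using (solve; _:=_; _:+_; _:*_; _:-_; :-_; con)
  open import Data.Product using (_,_; ∃; proj₁)
  open import Relation.Nullary using (Dec; yes; no; contradiction)
  open import Relation.Binary.PropositionalEquality hiding (J)

  inverse : ∀ a n .{{_ : NonZero n}} → Coprime a n → ∃ λ b → (b ℕ.* a) % n ≡ 1 % n
  inverse a n@(suc m) c with coprime-Bézout c
  ... | Bézout.+- x y e = x , trans (cong (_% n) (sym e)) ([m+kn]%n≡m%n 1 y n)
  -- The inverse is `-x`; `m = n - 1` stands for -1 in order to stay among the natural numbers.
  ... | Bézout.-+ x y e = m ℕ.* x , (begin
      (m ℕ.* x ℕ.* a) % n ≡⟨ sym ([m+kn]%n≡m%n (m ℕ.* x ℕ.* a) y n) ⟩
      (m ℕ.* x ℕ.* a ℕ.+ y ℕ.* n) % n ≡⟨ cong (λ t → (m ℕ.* x ℕ.* a ℕ.+ t) % n) (sym e) ⟩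
      (m ℕ.* x ℕ.* a ℕ.+ suc (x ℕ.* a)) % n ≡⟨ cong (_% n) (ident m x a) ⟩
      (1 ℕ.+ x ℕ.* a ℕ.* n) % n ≡⟨ [m+kn]%n≡m%n 1 (x ℕ.* a) n ⟩
      1 % n ∎)
    where
    open ≡-Reasoning
    ident : ∀ m x a → m ℕ.* x ℕ.* a ℕ.+ suc (x ℕ.* a) ≡ 1 ℕ.+ x ℕ.* a ℕ.* suc m
    ident = ℕRing.solve-∀

  unit-coprime : ∀ a b n .{{_ : NonZero n}} → (b ℕ.* a) % n ≡ 1 % n → Coprime a n
  unit-coprime a b n e {d} (d∣a , d∣n) = ℕD.∣1⇒≡1 (subst (d ℕD.∣_) (sym (m≡m%n+[m/n]*n 1 n))
    (ℕD.∣m∣n⇒∣m+n (subst (d ℕD.∣_) e (ℕD.%-presˡ-∣ (ℕD.∣n⇒∣m*n b d∣a) d∣n)) (ℕD.∣n⇒∣m*n (1 / n) d∣n)))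

  -- A product of these signs is the parity of the number of true conditions, so that lattice points
  -- are counted multiplicatively.
  δ : ∀ {P : Set} → Dec P → ℤ
  δ (yes _) = -1ℤ
  δ (no _) = 1ℤ

  δ-cong : ∀ {P Q : Set} (d : Dec P) (e : Dec Q) → (P → Q) → (Q → P) → δ d ≡ δ e
  δ-cong (yes _) (yes _) _ _ = refl
  δ-cong (no _) (no _) _ _ = refl
  δ-cong (yes p) (no ¬q) f _ = contradiction (f p) ¬q
  δ-cong (no ¬p) (yes q) _ g = contradiction (g q) ¬p

  ∏-neg : ∀ n → ∏ n (λ _ → -1ℤ) ≡ sg n
  ∏-neg zero = refl
  ∏-neg (suc n) = trans (cong (-1ℤ *_) (∏-neg n)) (-1*i≡-i (sg n))

  module _ (h : ℕ) where
    private
      N = odd h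

    -- The sign of `abx` is that of `bx` times that of `a ρ(bx)`, and `ρ(bx)` runs through the
    -- half-system. If `b` is not prime to the modulus, both sides vanish.
    J-* : ∀ a b → J h (a ℕ.* b) ≡ J h a * J h b
    J-* a b with coprime? b N
    ... | no ¬c = trans (J-noncoprime h (a ℕ.* b) (λ c → ¬c (λ { (d∣b , d∣N) → c (ℕD.∣n⇒∣m*n a d∣b , d∣N) })))
        (sym (trans (cong (J h a *_) (J-noncoprime h b ¬c)) (*-zeroʳ (J h a))))
    ... | yes c = let (b′ , inv) = inverse b N c in begin
        J h (a ℕ.* b) ≡⟨ ∏-cong h (λ i _ → trans (cong (ε h) (ℕ.*-assoc a b (suc i))) (proj₁ (ε-multiply h a (b ℕ.* suc i)))) ⟩
        ∏ h (λ i → ε h (b ℕ.* suc i) * ε h (a ℕ.* ρ h (b ℕ.* suc i))) ≡⟨ ∏-* h (λ i → ε h (b ℕ.* suc i)) (λ i → ε h (a ℕ.* ρ h (b ℕ.* suc i))) ⟩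
        J h b * ∏ h (λ i → ε h (a ℕ.* ρ h (b ℕ.* suc i))) ≡⟨ cong (J h b *_) (∏-ρ h {b} {b′} inv (λ x → ε h (a ℕ.* x))) ⟩
        J h b * J h a ≡⟨ *-comm (J h b) (J h a) ⟩
        J h a * J h b ∎
      where open ≡-Reasoning

    J-square : ∀ a → Coprime a N → J h a * J h a ≡ 1ℤ
    J-square a c = let (b , inv) = inverse a N c in
      go (J h a) (J h b) (J-bounded h a) (J-bounded h b) (trans (*-comm (J h a) (J h b)) (trans (sym (J-* b a)) (trans (J-periodic h (b ℕ.* a) 1 inv) (J-1 h))))
      where
      go : ∀ x y → ∣ x ∣ ℕ.≤ 1 → ∣ y ∣ ℕ.≤ 1 → x * y ≡ 1ℤ → x * x ≡ 1ℤ
      go (+ 0) y _ _ e = contradiction (trans (sym (*-zeroˡ y)) e) λ ()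
      go (+ 1) _ _ _ _ = refl
      go -[1+ 0 ] _ _ _ _ = refl
      go (+ suc (suc _)) _ (s≤s ()) _ _
      go -[1+ suc _ ] _ (s≤s ()) _ _

    J-neg : ∀ a b → N ℕD.∣ (a ℕ.+ b) → J h a ≡ sg h * J h b
    J-neg a b d = trans (∏-cong h λ i _ → trans (proj₁ (opposite h (a ℕ.* suc i) (b ℕ.* suc i) (subst (N ℕD.∣_) (ℕ.*-distribʳ-+ (suc i) a b) (ℕD.∣m⇒∣m*n (suc i) d))))
        (sym (-1*i≡-i (ε h (b ℕ.* suc i))))) (trans (∏-* h (λ _ → -1ℤ) (λ i → ε h (b ℕ.* suc i))) (cong (_* J h b) (∏-neg h)))

    -- Eisenstein: modulo 2, M(i+1) = N⌊M(i+1)/N⌋ ± ρ, and ρ runs through 1, …, h.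
    module Eisenstein (g : ℕ) (c : Coprime (odd g) N) where
      private
        M = odd g

      quotient : ℕ → ℕ
      quotient i = (M ℕ.* suc i) / N

      factor : ∀ i → ε h (M ℕ.* suc i) ≢ 0ℤ → ε h (M ℕ.* suc i) ≡ sg (suc i) * (sg (quotient i) * sg (ρ h (M ℕ.* suc i)))
      factor i ε≢0 with ε h (M ℕ.* suc i) | ρ h (M ℕ.* suc i) | residue h (M ℕ.* suc i)
      ... | _ | _ | none _ = contradiction refl ε≢0
      ... | _ | _ | plus {r} _ _ e = sym (begin
          sg (suc i) * (sg q * sg r) ≡⟨ cong (_* (sg q * sg r)) (sym (sg-*-odd g (suc i))) ⟩
          sg (M ℕ.* suc i) * (sg q * sg r) ≡⟨ cong (λ t → sg t * (sg q * sg r)) (trans (m≡m%n+[m/n]*n (M ℕ.* suc i) N) (cong₂ ℕ._+_ e (ℕ.*-comm q N))) ⟩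
          sg (r ℕ.+ N ℕ.* q) * (sg q * sg r) ≡⟨ cong (_* (sg q * sg r)) (trans (sg-+ r (N ℕ.* q)) (cong (sg r *_) (sg-*-odd h q))) ⟩
          sg r * sg q * (sg q * sg r) ≡⟨ squares (sg r) (sg q) (sg-square r) (sg-square q) ⟩
          1ℤ ∎)
        where
        open ≡-Reasoning
        q = quotient i
        squares : ∀ x y → x * x ≡ 1ℤ → y * y ≡ 1ℤ → x * y * (y * x) ≡ 1ℤ
        squares x y p s = trans (ident x y) (cong₂ _*_ p s)
          where
          ident : ∀ x y → x * y * (y * x) ≡ x * x * (y * y)
          ident = solve-∀
      ... | _ | _ | minus {r} _ _ e = sym (begin
          sg (suc i) * (sg q * sg r) ≡⟨ cong (_* (sg q * sg r)) (sym (sg-*-odd g (suc i))) ⟩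
          sg (M ℕ.* suc i) * (sg q * sg r) ≡⟨ ident₀ (sg (M ℕ.* suc i)) (sg q) (sg r) ⟩
          sg (M ℕ.* suc i) * sg r * sg q ≡⟨ cong (_* sg q) (sym (sg-+ (M ℕ.* suc i) r)) ⟩
          sg (M ℕ.* suc i ℕ.+ r) * sg q ≡⟨ cong (λ t → sg t * sg q) sum≡ ⟩
          sg (N ℕ.* suc q) * sg q ≡⟨ cong (_* sg q) (sg-*-odd h (suc q)) ⟩
          - sg q * sg q ≡⟨ sym (neg-distribˡ-* (sg q) (sg q)) ⟩
          - (sg q * sg q) ≡⟨ cong -_ (sg-square q) ⟩
          -1ℤ ∎)
        where
        open ≡-Reasoning
        q = quotient i
        ident₀ : ∀ x y z → x * (y * z) ≡ x * z * y
        ident₀ = solve-∀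
        ident₁ : ∀ a b r → a ℕ.+ b ℕ.+ r ≡ a ℕ.+ r ℕ.+ b
        ident₁ = ℕRing.solve-∀
        sum≡ : M ℕ.* suc i ℕ.+ r ≡ N ℕ.* suc q
        sum≡ = trans (cong (ℕ._+ r) (m≡m%n+[m/n]*n (M ℕ.* suc i) N)) (trans (ident₁ ((M ℕ.* suc i) % N) (q ℕ.* N) r)
          (trans (cong (ℕ._+ q ℕ.* N) e) (ℕ.*-comm (suc q) N)))

      not-multiple : ∀ i j → i ℕ.< h → N ℕ.* j ≢ M ℕ.* suc i
      not-multiple i j i<h e = ℕD.>⇒∤ (s≤s (ℕ.≤-trans i<h (ℕ.m≤m+n h h))) (coprime-divisor (Coprimality.sym c) (divides j (trans (sym e) (ℕ.*-comm N j))))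

      ε≢0 : ∀ i → i ℕ.< h → ε h (M ℕ.* suc i) ≢ 0ℤ
      ε≢0 i i<h with ε h (M ℕ.* suc i) | ρ h (M ℕ.* suc i) | residue h (M ℕ.* suc i)
      ... | _ | _ | none (divides q e) = λ _ → not-multiple i q i<h (trans (ℕ.*-comm N q) (sym e))
      ... | _ | _ | plus _ _ _ = λ ()
      ... | _ | _ | minus _ _ _ = λ ()

      -- In the product of the relations `factor` the signs of `i + 1` and of `ρ` cancel, as both
      -- range over 1, ..., h.
      J≡quotients : J h M ≡ ∏ h (λ i → sg (quotient i))
      J≡quotients = let (b′ , inv) = inverse M N c in begin
          J h M ≡⟨ ∏-cong h (λ i i<h → factor i (ε≢0 i i<h)) ⟩
          ∏ h (λ i → sg (suc i) * (sg (quotient i) * sg (ρ h (M ℕ.* suc i)))) ≡⟨ ∏-* h (λ i → sg (suc i)) (λ i → sg (quotient i) * sg (ρ h (M ℕ.* suc i))) ⟩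
          S * ∏ h (λ i → sg (quotient i) * sg (ρ h (M ℕ.* suc i))) ≡⟨ cong (S *_) (∏-* h (λ i → sg (quotient i)) (λ i → sg (ρ h (M ℕ.* suc i)))) ⟩
          S * (Q * ∏ h (λ i → sg (ρ h (M ℕ.* suc i)))) ≡⟨ cong (λ t → S * (Q * t)) (∏-ρ h {M} {b′} inv sg) ⟩
          S * (Q * S) ≡⟨ ident S Q ⟩
          S * S * Q ≡⟨ cong (_* Q) (trans (sym (∏-* h (λ i → sg (suc i)) (λ i → sg (suc i)))) (∏-one h (λ i _ → sg-square (suc i)))) ⟩
          1ℤ * Q ≡⟨ *-identityˡ Q ⟩
          Q ∎
        where
        open ≡-Reasoning
        S = ∏ h (λ i → sg (suc i))
        Q = ∏ h (λ i → sg (quotient i))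
        ident : ∀ s q → s * (q * s) ≡ s * s * q
        ident = solve-∀

      quotient≤ : ∀ i → i ℕ.< h → quotient i ℕ.≤ g
      quotient≤ i i<h = ℕ.≤-pred (m<n*o⇒m/o<n (ℕ.*-cancelʳ-< 2 (M ℕ.* suc i) (suc g ℕ.* N) (ℕ.≤-<-trans
        (ℕ.≤-trans (ℕ.≤-reflexive (ℕ.*-assoc M (suc i) 2)) (ℕ.*-monoʳ-≤ M (ℕ.≤-trans (ℕ.*-monoˡ-≤ 2 i<h) (ℕ.≤-trans (ℕ.≤-reflexive (double h)) (ℕ.n≤1+n (h ℕ.+ h))))))
        (subst (M ℕ.* N ℕ.<_) (ident g N) (ℕ.m<m+n (M ℕ.* N) (s≤s z≤n))))))
        where
        double : ∀ h → h ℕ.* 2 ≡ h ℕ.+ h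
        double = ℕRing.solve-∀
        ident : ∀ g N → suc (g ℕ.+ g) ℕ.* N ℕ.+ N ≡ suc g ℕ.* N ℕ.* 2
        ident = ℕRing.solve-∀

      sg-count : ∀ n f → f ℕ.≤ n → ∏ n (λ j → δ (suc j ℕ.≤? f)) ≡ sg f
      sg-count n zero _ = ∏-one n λ j _ → refl
      sg-count (suc n) (suc f) (s≤s f≤n) = trans (-1*i≡-i (∏ n (λ j → δ (suc (suc j) ℕ.≤? suc f))))
        (cong -_ (trans (∏-cong n λ j _ → δ-cong (suc (suc j) ℕ.≤? suc f) (suc j ℕ.≤? f) ℕ.≤-pred s≤s) (sg-count n f f≤n)))

      -- The quotient for `i` is the number of lattice points below the diagonal of the rectangle in
      -- the column `i + 1`.
      J≡lattice : J h M ≡ ∏ h (λ i → ∏ g (λ j → δ (N ℕ.* suc j ℕ.≤? M ℕ.* suc i)))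
      J≡lattice = trans J≡quotients (∏-cong h λ i i<h → trans (sym (sg-count g (quotient i) (quotient≤ i i<h)))
        (∏-cong g λ j _ → δ-cong (suc j ℕ.≤? quotient i) (N ℕ.* suc j ℕ.≤? M ℕ.* suc i) (below i j) (above i j)))
        where
        below : ∀ i j → suc j ℕ.≤ quotient i → N ℕ.* suc j ℕ.≤ M ℕ.* suc i
        below i j p = ℕ.≤-trans (ℕ.*-monoʳ-≤ N p) (subst (ℕ._≤ M ℕ.* suc i) (ℕ.*-comm (quotient i) N) (m/n*n≤m (M ℕ.* suc i) N))
        above : ∀ i j → N ℕ.* suc j ℕ.≤ M ℕ.* suc i → suc j ℕ.≤ quotient i
        above i j p = subst (ℕ._≤ quotient i) (trans (cong (_/ N) (ℕ.*-comm N (suc j))) (m*n/n≡m (suc j) N)) (/-monoˡ-≤ N p)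

  -- No lattice point of the `g` by `h` rectangle lies on the diagonal, so each of the `gh` points
  -- is counted by exactly one of the two symbols.
  reciprocity : ∀ g h → Coprime (odd g) (odd h) → J h (odd g) * J g (odd h) ≡ sg (g ℕ.* h)
  reciprocity g h c = begin
      J h M * J g N ≡⟨ cong₂ _*_ (Eisenstein.J≡lattice h g c) (trans (Eisenstein.J≡lattice g h (Coprimality.sym c)) (∏-swap g h (λ j i → δ (M ℕ.* suc i ℕ.≤? N ℕ.* suc j)))) ⟩
      ∏ h (λ i → ∏ g (λ j → L i j)) * ∏ h (λ i → ∏ g (λ j → R i j)) ≡⟨ sym (∏-* h (λ i → ∏ g (L i)) (λ i → ∏ g (R i))) ⟩
      ∏ h (λ i → ∏ g (L i) * ∏ g (R i)) ≡⟨ ∏-cong h (λ i i<h → trans (sym (∏-* g (L i) (R i))) (trans (∏-cong g λ j _ → opposite-signs i j i<h) (∏-neg g))) ⟩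
      ∏ h (λ _ → sg g) ≡⟨ power h ⟩
      sg (g ℕ.* h) ∎
    where
    open ≡-Reasoning
    M = odd g
    N = odd h
    L R : ℕ → ℕ → ℤ
    L i j = δ (N ℕ.* suc j ℕ.≤? M ℕ.* suc i)
    R i j = δ (M ℕ.* suc i ℕ.≤? N ℕ.* suc j)
    opposite-signs : ∀ i j → i ℕ.< h → L i j * R i j ≡ -1ℤ
    opposite-signs i j i<h with N ℕ.* suc j ℕ.≤? M ℕ.* suc i | M ℕ.* suc i ℕ.≤? N ℕ.* suc j
    ... | yes p | yes q = contradiction (ℕ.≤-antisym p q) (Eisenstein.not-multiple h g c i (suc j) i<h)
    ... | yes _ | no _ = refl
    ... | no _ | yes _ = refl
    ... | no p | no q = contradiction (ℕ.<⇒≤ (ℕ.≰⇒> p)) q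
    power : ∀ n → ∏ n (λ _ → sg g) ≡ sg (g ℕ.* n)
    power zero = cong sg (sym (ℕ.*-zeroʳ g))
    power (suc n) = trans (cong (sg g *_) (power n)) (trans (sym (sg-+ g (g ℕ.* n))) (cong sg (sym (ℕ.*-suc g n))))

  J-minus-one : ∀ h → J h (h ℕ.+ h) ≡ sg h
  J-minus-one h = trans (J-neg h (h ℕ.+ h) 1 (divides 1 (trans (ℕ.+-comm (h ℕ.+ h) 1) (sym (ℕ.*-identityˡ (odd h))))))
    (trans (cong (sg h *_) (J-1 h)) (*-identityʳ (sg h)))

  -- The sign with exponent 1 + 2 + ... + h, that is (2 / 2h + 1), in the recursive shape of the
  -- induction below.
  τ : ℕ → ℤ
  τ zero = 1ℤ
  τ (suc h) = sg (suc h) * τ h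

  -- 2 ≡ odd h + 2 and odd h ≡ -2 modulo the moduli odd h and odd (h+1), to which reciprocity applies.
  J-two : ∀ h → J h 2 ≡ τ h
  J-two zero = refl
  J-two (suc h) = isolate (sg h′) (J h 2) (J h′ 2) (J-square h′ 2 coprime-2) key (J-two h)
    where
    h′ = suc h
    coprime-2 : Coprime 2 (odd h′)
    coprime-2 = unit-coprime 2 (suc h′) (odd h′) (trans (cong (_% odd h′) (ident h)) ([m+kn]%n≡m%n 1 1 (odd h′)))
      where
      ident : ∀ h → suc (suc h) ℕ.* 2 ≡ 1 ℕ.+ 1 ℕ.* suc (suc h ℕ.+ suc h)
      ident = ℕRing.solve-∀
    consecutive : Coprime (odd h′) (odd h)
    consecutive {d} (p , q) = coprime-2-h (ℕD.∣m+n∣m⇒∣n (subst (d ℕD.∣_) (ident h) p) q , q)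
      where
      ident : ∀ h → suc (suc h ℕ.+ suc h) ≡ suc (h ℕ.+ h) ℕ.+ 2
      ident = ℕRing.solve-∀
      coprime-2-h : Coprime 2 (odd h)
      coprime-2-h = unit-coprime 2 (suc h) (odd h) (trans (cong (_% odd h) (ident′ h)) ([m+kn]%n≡m%n 1 1 (odd h)))
        where
        ident′ : ∀ h → suc h ℕ.* 2 ≡ 1 ℕ.+ 1 ℕ.* suc (h ℕ.+ h)
        ident′ = ℕRing.solve-∀
    key : J h 2 * (sg h′ * J h′ 2) ≡ 1ℤ
    key = trans (cong₂ _*_
        (sym (J-periodic h (odd h′) 2 (trans (cong (_% odd h) (ident₁ h)) ([m+kn]%n≡m%n 2 1 (odd h)))))
        (sym (J-neg h′ (odd h) 2 (divides 1 (ident₂ h)))))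
      (trans (reciprocity h′ h consecutive) (even-product h))
      where
      ident₁ : ∀ h → suc (suc h ℕ.+ suc h) ≡ 2 ℕ.+ 1 ℕ.* suc (h ℕ.+ h)
      ident₁ = ℕRing.solve-∀
      ident₂ : ∀ h → suc (h ℕ.+ h) ℕ.+ 2 ≡ 1 ℕ.* suc (suc h ℕ.+ suc h)
      ident₂ = ℕRing.solve-∀
      even-product : ∀ h → sg (suc h ℕ.* h) ≡ 1ℤ
      even-product zero = refl
      even-product (suc h) = trans (cong sg (ident₃ h)) (trans (sg-+ (suc h ℕ.* h) (suc h ℕ.+ suc h)) (cong₂ _*_ (even-product h) (sg-double (suc h))))
        where
        ident₃ : ∀ h → suc (suc h) ℕ.* suc h ≡ suc h ℕ.* h ℕ.+ (suc h ℕ.+ suc h)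
        ident₃ = ℕRing.solve-∀
    isolate : ∀ s a b {t} → b * b ≡ 1ℤ → a * (s * b) ≡ 1ℤ → a ≡ t → b ≡ s * t
    isolate s a b bb k refl = begin
      b ≡⟨ sym (*-identityʳ b) ⟩
      b * 1ℤ ≡⟨ cong (b *_) (sym k) ⟩
      b * (a * (s * b)) ≡⟨ ident s a b ⟩
      s * a * (b * b) ≡⟨ cong (s * a *_) bb ⟩
      s * a * 1ℤ ≡⟨ *-identityʳ (s * a) ⟩
      s * a ∎
      where
      open ≡-Reasoning
      ident : ∀ s a b → b * (a * (s * b)) ≡ s * a * (b * b)
      ident = solve 3 (λ s a b → b :* (a :* (s :* b)) := s :* a :* (b :* b)) refl

-- Euler's criterion and square roots modulo a prime.

module Euler where
  open Arith
  open Jacobi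
  open Reciprocity
  open Lagrange using (squares-distinct)
  open import Data.Nat.Base as ℕ using (ℕ; zero; suc; s≤s; z≤n)
  import Data.Nat.Properties as ℕ
  open import Data.Nat.DivMod using (_%_; _/_; m≡m%n+[m/n]*n)
  open import Data.Nat.Divisibility as ℕD using (divides)
  open import Data.Nat.Primality using (Prime; euclidsLemma; prime⇒irreducible; prime⇒nonTrivial)
  open import Data.Nat.Coprimality using (Coprime; coprime?)
  open import Data.Integer.Base hiding (suc; pred; NonZero; _%_; _/_)
  open import Data.Integer.Properties
  open import Data.Integer.Tactic.RingSolver using (solve-∀)
  open import Data.Integer.Solver using (module +-*-Solver)
  open +-*-Solver using (solve; _:=_; _:+_; _:*_; _:-_; :-_; con)
  open import Data.Integer.Divisibility.Signed as ℤD using (_∣_; ∣⇒∣ᵤ; ∣ᵤ⇒∣; _∣?_)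
  open import Data.Vec.Base using (Vec; []; _∷_; replicate)
  open import Data.Product using (_,_; ∃)
  open import Data.Sum using (_⊎_; inj₁; inj₂)
  open import Function.Base using (_∘_)
  open import Relation.Nullary using (yes; no; ¬_; contradiction)
  open import Relation.Binary.PropositionalEquality hiding (J)

  -- Monic polynomials, given by their lower coefficients.
  eval : ∀ {n} → Vec ℤ n → ℤ → ℤ
  eval [] x = 1ℤ
  eval (c ∷ cs) x = c + x * eval cs x

  addmul : ∀ {n} → Vec ℤ (suc n) → ℤ → Vec ℤ n → Vec ℤ (suc n)
  addmul (c ∷ []) r [] = c + r ∷ []
  addmul (c ∷ cs@(_ ∷ _)) r (q ∷ qs) = c + r * q ∷ addmul cs r qs

  eval-addmul : ∀ {n} (cs : Vec ℤ (suc n)) r qs x → eval (addmul cs r qs) x ≡ eval cs x + r * eval qs x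
  eval-addmul (c ∷ []) r [] x = ident c r x
    where
    ident : ∀ c r x → c + r + x * 1ℤ ≡ c + x * 1ℤ + r * 1ℤ
    ident = solve 3 (λ c r x → c :+ r :+ x :* con 1ℤ := c :+ x :* con 1ℤ :+ r :* con 1ℤ) refl
  eval-addmul (c ∷ cs@(_ ∷ _)) r (q ∷ qs) x = trans (cong (λ t → c + r * q + x * t) (eval-addmul cs r qs x)) (ident c r q x (eval cs x) (eval qs x))
    where
    ident : ∀ c r q x a b → c + r * q + x * (a + r * b) ≡ c + x * a + r * (q + x * b)
    ident = solve 6 (λ c r q x a b → c :+ r :* q :+ x :* (a :+ r :* b) := c :+ x :* a :+ r :* (q :+ x :* b)) refl

  -- Division of `P - P(r)` by `X - r`: if `P = c + X p`, the quotient is `p` plus `r` times the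
  -- quotient for `p`.
  quotient : ∀ {n} → Vec ℤ (suc n) → ℤ → Vec ℤ n
  quotient (c ∷ []) r = []
  quotient (c ∷ cs@(_ ∷ _)) r = addmul cs r (quotient cs r)

  factor-theorem : ∀ {n} (cs : Vec ℤ (suc n)) r x → eval cs x - eval cs r ≡ (x - r) * eval (quotient cs r) x
  factor-theorem (c ∷ []) r x = ident c r x
    where
    ident : ∀ c r x → c + x * 1ℤ - (c + r * 1ℤ) ≡ (x - r) * 1ℤ
    ident = solve 3 (λ c r x → c :+ x :* con 1ℤ :- (c :+ r :* con 1ℤ) := (x :- r) :* con 1ℤ) refl
  factor-theorem (c ∷ cs@(_ ∷ _)) r x = trans (linear r (factor-theorem cs r x) (ident c r x (eval cs x) (eval cs r) (eval (quotient cs r) x)))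
      (cong ((x - r) *_) (sym (eval-addmul cs r (quotient cs r) x)))
    where
    ident : ∀ c r x a b q → c + x * a - (c + r * b) - (x - r) * (a + r * q) ≡ r * (a - b - (x - r) * q)
    ident = solve 6 (λ c r x a b q → c :+ x :* a :- (c :+ r :* b) :- (x :- r) :* (a :+ r :* q) := r :* (a :- b :- (x :- r) :* q)) refl

  module _ {p : ℕ} (pr : Prime p) where
    euclid : ∀ x y → + p ∣ x * y → (+ p ∣ x) ⊎ (+ p ∣ y)
    euclid x y d with euclidsLemma ∣ x ∣ ∣ y ∣ pr (subst (p ℕD.∣_) (abs-* x y) (∣⇒∣ᵤ d))
    ... | inj₁ d = inj₁ (∣ᵤ⇒∣ d)
    ... | inj₂ d = inj₂ (∣ᵤ⇒∣ d)

    p∤1 : ¬ + p ∣ 1ℤ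
    p∤1 d = ℕ.<-irrefl (sym (ℕD.∣1⇒≡1 (∣⇒∣ᵤ d))) (ℕ.nonTrivial⇒n>1 p {{prime⇒nonTrivial pr}})

    -- Lagrange's bound for the number of roots: after division by `X - root 0` the other roots
    -- remain, since `p` divides none of the differences.
    few-roots : ∀ {n} (cs : Vec ℤ n) (root : ℕ → ℤ) → (∀ i → i ℕ.≤ n → + p ∣ eval cs (root i)) →
      ¬ (∀ i j → i ℕ.< j → j ℕ.≤ n → ¬ + p ∣ root i - root j)
    few-roots [] root vanish distinct = p∤1 (vanish 0 z≤n)
    few-roots {suc n} cs root vanish distinct = few-roots (quotient cs (root 0)) (root ∘ suc) vanish′
        (λ i j i<j j≤n → distinct (suc i) (suc j) (s≤s i<j) (s≤s j≤n))
      where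
      vanish′ : ∀ i → i ℕ.≤ n → + p ∣ eval (quotient cs (root 0)) (root (suc i))
      vanish′ i i≤n with euclid (root (suc i) - root 0) (eval (quotient cs (root 0)) (root (suc i)))
          (subst (+ p ∣_) (factor-theorem cs (root 0) (root (suc i))) (ℤD.∣m∣n⇒∣m-n (vanish (suc i) (s≤s i≤n)) (vanish 0 z≤n)))
      ... | inj₂ d = d
      ... | inj₁ d = contradiction (subst (+ p ∣_) (ident (root (suc i)) (root 0)) (ℤD.∣m⇒∣-m d)) (distinct 0 (suc i) (s≤s z≤n) (s≤s i≤n))
        where
        ident : ∀ x y → - (x - y) ≡ y - x
        ident = solve-∀

  power : ℤ → ℕ → ℤ
  power a n = ∏ n (λ _ → a)

  power-* : ∀ n a b → power (a * b) n ≡ power a n * power b n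
  power-* n a b = ∏-* n (λ _ → a) (λ _ → b)

  -- Gauss's lemma.
  module _ (h : ℕ) (pr : Prime (odd h)) where
    private
      p = odd h

    residue-congruence : ∀ x → + p ∣ + x - ε h x * + ρ h x
    residue-congruence x with ε h x | ρ h x | residue h x
    ... | _ | _ | none d = subst (+ p ∣_) (sym (+-identityʳ (+ x))) (∣ᵤ⇒∣ d)
    ... | _ | _ | plus {r} _ _ e = ℤD.divides (+ (x / p)) (linear₂ 1ℤ 1ℤ division (cong +_ e) (ident (+ x) (+ r) (+ (x % p)) (+ (x / p) * + p)))
      where
      division : + x ≡ + (x % p) + + (x / p) * + p
      division = trans (cong +_ (m≡m%n+[m/n]*n x p)) (trans (pos-+ (x % p) _) (cong (_+_ (+ (x % p))) (pos-* (x / p) p)))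
      ident : ∀ x r s q → x - 1ℤ * r - q ≡ 1ℤ * (x - (s + q)) + 1ℤ * (s - r)
      ident = solve 4 (λ x r s q → x :- con 1ℤ :* r :- q := con 1ℤ :* (x :- (s :+ q)) :+ con 1ℤ :* (s :- r)) refl
    ... | _ | _ | minus {r} _ _ e = subst (+ p ∣_) (trans (pos-+ x r) (ident (+ x) (+ r))) (∣ᵤ⇒∣ {+ p} {+ (x ℕ.+ r)} (N∣x+ρ h x e))
      where
      ident : ∀ x r → x + r ≡ x - -1ℤ * r
      ident = solve-∀

    ∏-congruence : ∀ n f g → (∀ i → + p ∣ f i - g i) → + p ∣ ∏ n f - ∏ n g
    ∏-congruence zero f g d = ℤD.divides 0ℤ refl
    ∏-congruence (suc n) f g d = subst (+ p ∣_) (ident (f 0) (g 0) (∏ n (f ∘ suc)) (∏ n (g ∘ suc)))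
      (ℤD.∣m∣n⇒∣m+n (ℤD.∣m⇒∣m*n (∏ n (f ∘ suc)) (d 0)) (ℤD.∣n⇒∣m*n (g 0) (∏-congruence n (f ∘ suc) (g ∘ suc) (d ∘ suc))))
      where
      ident : ∀ a b x y → (a - b) * x + b * (x - y) ≡ a * x - b * y
      ident = solve 4 (λ a b x y → (a :- b) :* x :+ b :* (x :- y) := a :* x :- b :* y) refl

    factorial : ℤ
    factorial = ∏ h (λ i → + suc i)

    p∤factorial : ∀ n → n ℕ.≤ h → ¬ + p ∣ ∏ n (λ i → + suc i)
    p∤factorial zero _ d = p∤1 pr d
    p∤factorial (suc n) n<h d with euclid pr (∏ n (λ i → + suc i)) (+ suc n) (subst (+ p ∣_) (∏-last n (λ i → + suc i)) d)
    ... | inj₁ d = p∤factorial n (ℕ.<⇒≤ n<h) d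
    ... | inj₂ d = ℕD.>⇒∤ (s≤s (ℕ.≤-trans n<h (ℕ.m≤m+n h h))) (∣⇒∣ᵤ d)

    -- The congruences `ai ≡ ε ρ` are multiplied; the numbers `ρ` make up `h!` again, which is prime
    -- to `p` and cancels.
    gauss : ∀ a → Coprime a p → + p ∣ power (+ a) h - J h a
    gauss a c = cancel (euclid pr (power (+ a) h - J h a) factorial (subst (+ p ∣_) products
        (∏-congruence h (λ i → + (a ℕ.* suc i)) (λ i → ε h (a ℕ.* suc i) * + ρ h (a ℕ.* suc i)) (λ i → residue-congruence (a ℕ.* suc i)))))
      where
      cancel : (+ p ∣ power (+ a) h - J h a) ⊎ (+ p ∣ factorial) → + p ∣ power (+ a) h - J h a
      cancel (inj₁ d) = d
      cancel (inj₂ d) = contradiction d (p∤factorial h ℕ.≤-refl)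
      ident : ∀ x y z → x * z - y * z ≡ (x - y) * z
      ident = solve-∀
      products : ∏ h (λ i → + (a ℕ.* suc i)) - ∏ h (λ i → ε h (a ℕ.* suc i) * + ρ h (a ℕ.* suc i)) ≡ (power (+ a) h - J h a) * factorial
      products = let (b , inv) = inverse a p c in trans
        (cong₂ _-_ (trans (∏-cong h (λ i _ → pos-* a (suc i))) (∏-* h (λ _ → + a) (λ i → + suc i)))
          (trans (∏-* h (λ i → ε h (a ℕ.* suc i)) (λ i → + ρ h (a ℕ.* suc i))) (cong (J h a *_) (∏-ρ h {a} {b} inv (λ x → + x)))))
        (ident (power (+ a) h) (J h a) factorial)

    J≢0⇒coprime : ∀ a → J h a ≢ 0ℤ → Coprime a p
    J≢0⇒coprime a J≢0 with coprime? a p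
    ... | yes c = c
    ... | no ¬c = contradiction (J-noncoprime h a ¬c) J≢0

    1-root : ∀ a → Coprime a p → J h a ≡ 1ℤ → + p ∣ power (+ a) h - 1ℤ
    1-root a c e = subst (λ t → + p ∣ power (+ a) h - t) e (gauss a c)

    xʰ-1 : ∀ m → h ≡ suc m → ∀ x → eval (-1ℤ ∷ replicate m 0ℤ) x ≡ power x h - 1ℤ
    xʰ-1 m refl x = trans (cong (λ t → -1ℤ + x * t) (zeros m)) (+-comm -1ℤ (x * power x m))
      where
      zeros : ∀ m → eval (replicate m 0ℤ) x ≡ power x m
      zeros zero = refl
      zeros (suc m) = trans (+-identityˡ _) (cong (x *_) (zeros m))

    -- Otherwise a, 1², …, h² would be h + 1 roots of X^h - 1.
    square-root : ∀ a → J h a ≡ 1ℤ → ∃ λ b → + p ∣ + b * + b - + a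
    square-root a Ja≡1 = go h refl
      where
      coprime-a = J≢0⇒coprime a (λ e → contradiction (trans (sym Ja≡1) e) λ ())
      go : ∀ n → h ≡ n → ∃ λ b → + p ∣ + b * + b - + a
      go zero e = contradiction (subst (Prime ∘ odd) e pr) λ { pr → p∤1 pr (ℤD.divides 1ℤ refl) }
      go (suc m) e with ℕ.anyUpTo? (λ i → + p ∣? + suc i * + suc i - + a) h
      ... | yes (i , _ , d) = suc i , d
      ... | no ¬found = contradiction distinct (few-roots pr (-1ℤ ∷ replicate m 0ℤ) root vanish)
        where
        root : ℕ → ℤ
        root zero = + a
        root (suc i) = + suc i * + suc i
        coprime-small : ∀ i → i ℕ.< h → Coprime (suc i) p
        coprime-small i i<h {d} (d∣i , d∣p) with prime⇒irreducible pr d∣p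
        ... | inj₁ d≡1 = d≡1
        ... | inj₂ refl = contradiction d∣i (ℕD.>⇒∤ (s≤s (ℕ.≤-trans i<h (ℕ.m≤m+n h h))))
        vanish : ∀ i → i ℕ.≤ suc m → + p ∣ eval (-1ℤ ∷ replicate m 0ℤ) (root i)
        vanish zero _ = subst (+ p ∣_) (sym (xʰ-1 m e (+ a))) (1-root a coprime-a Ja≡1)
        vanish (suc i) i≤m = subst (+ p ∣_) (trans (cong (λ t → power t h - 1ℤ) (pos-* (suc i) (suc i))) (sym (xʰ-1 m e (root (suc i)))))
          (1-root (suc i ℕ.* suc i) (square-coprime i i<h) (trans (J-* h (suc i) (suc i)) (J-square h (suc i) (coprime-small i i<h))))
          where
          i<h : i ℕ.< h
          i<h = subst (i ℕ.<_) (sym e) i≤m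
          square-coprime : ∀ i → i ℕ.< h → Coprime (suc i ℕ.* suc i) p
          square-coprime i i<h = J≢0⇒coprime (suc i ℕ.* suc i) (λ z → contradiction (trans (sym (trans (J-* h (suc i) (suc i)) (J-square h (suc i) (coprime-small i i<h)))) z) λ ())
        distinct : ∀ i j → i ℕ.< j → j ℕ.≤ suc m → ¬ + p ∣ root i - root j
        distinct zero (suc j) _ j≤m d = ¬found (j , subst (j ℕ.<_) (sym e) j≤m , subst (+ p ∣_) (ident (+ a) (root (suc j))) (ℤD.∣m⇒∣-m d))
          where
          ident : ∀ x y → - (x - y) ≡ y - x
          ident = solve-∀
        distinct (suc i) (suc j) i<j j≤m (ℤD.divides t eq) = squares-distinct pr {suc i} {suc j} { - t} i<j
            (s≤s (ℕ.+-mono-≤ (ℕ.≤-trans (ℕ.<⇒≤ i<j) j≤h) j≤h)) (linear -1ℤ eq (ident (root (suc i)) (root (suc j)) t (+ p)))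
          where
          j≤h : suc j ℕ.≤ h
          j≤h = subst (suc j ℕ.≤_) (sym e) j≤m
          ident : ∀ x y t p → y - x - - t * p ≡ -1ℤ * (x - y - t * p)
          ident = solve 4 (λ x y t p → y :- x :- :- t :* p := con -1ℤ :* (x :- y :- t :* p)) refl

-- Hermite reduction of ternary forms of determinant 3.

module Reduction where
  open Arith
  open import Data.Nat.Base as ℕ using (ℕ; suc; s≤s; z≤n)
  import Data.Nat.Properties as ℕ
  import Data.Nat.Tactic.RingSolver as ℕRing
  open import Data.Nat.Induction using (<-wellFounded)
  open import Induction.WellFounded using (Acc; acc)
  open import Data.Integer.Base hiding (suc; pred; NonZero)
  open import Data.Integer.Properties
  open import Data.Integer.Tactic.RingSolver using (solve-∀)
  open import Data.Integer.Solver using (module +-*-Solver)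
  open +-*-Solver using (solve; _:=_; _:+_; _:*_; _:-_; :-_; con)
  open import Data.Product using (_×_; _,_; ∃; ∃₂)
  open import Data.Sum using (inj₁; inj₂)
  open import Data.Empty using (⊥)
  open import Relation.Nullary using (yes; no; contradiction)
  open import Relation.Binary.PropositionalEquality

  TernaryValue : ℤ → Set
  TernaryValue n = ∃ λ x → ∃ λ y → ∃ λ z → n ≡ x * x + y * y + + 3 * (z * z)

  -- The form a x² + b y² + c z² + 2f yz + 2g xz + 2h xy of determinant 3 represents n,
  -- and its adjoint represents a number ≡ 1 (mod 3), which is how x² + y² + 3z² differs from x² + 2y² + 2yz + 2z².
  record Form (n a b c f g h : ℤ) : Set where
    field
      det : a * b * c + + 2 * (f * g * h) - a * (f * f) - b * (g * g) - c * (h * h) ≡ + 3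
      x y z : ℤ
      value : n ≡ a * (x * x) + b * (y * y) + c * (z * z) + + 2 * (f * (y * z)) + + 2 * (g * (x * z)) + + 2 * (h * (x * y))
      u v w t : ℤ
      adjoint : + 3 * t + 1ℤ ≡ (b * c - f * f) * (u * u) + (a * c - g * g) * (v * v) + (a * b - h * h) * (w * w)
        + + 2 * ((g * h - a * f) * (v * w)) + + 2 * ((h * f - b * g) * (u * w)) + + 2 * ((f * g - h * c) * (u * v))

  swap-xy : ∀ {n a b c f g h} → Form n a b c f g h → Form n b a c g f h
  swap-xy {n} {a} {b} {c} {f} {g} {h} F = record
    { det = trans (i₁ a b c f g h) det ; x = y ; y = x ; z = z ; value = trans value (i₂ a b c f g h x y z)
    ; u = v ; v = u ; w = w ; t = t ; adjoint = trans adjoint (i₃ a b c f g h u v w) }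
    where
    open Form F
    i₁ : ∀ a b c f g h → b * a * c + + 2 * (g * f * h) - b * (g * g) - a * (f * f) - c * (h * h) ≡ a * b * c + + 2 * (f * g * h) - a * (f * f) - b * (g * g) - c * (h * h)
    i₁ = solve 6 (λ a b c f g h → b :* a :* c :+ con (+ 2) :* (g :* f :* h) :- b :* (g :* g) :- a :* (f :* f) :- c :* (h :* h)
        := a :* b :* c :+ con (+ 2) :* (f :* g :* h) :- a :* (f :* f) :- b :* (g :* g) :- c :* (h :* h)) refl
    i₂ : ∀ a b c f g h x y z → a * (x * x) + b * (y * y) + c * (z * z) + + 2 * (f * (y * z)) + + 2 * (g * (x * z)) + + 2 * (h * (x * y))
      ≡ b * (y * y) + a * (x * x) + c * (z * z) + + 2 * (g * (x * z)) + + 2 * (f * (y * z)) + + 2 * (h * (y * x))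
    i₂ = solve 9 (λ a b c f g h x y z → a :* (x :* x) :+ b :* (y :* y) :+ c :* (z :* z) :+ con (+ 2) :* (f :* (y :* z)) :+ con (+ 2) :* (g :* (x :* z)) :+ con (+ 2) :* (h :* (x :* y))
        := b :* (y :* y) :+ a :* (x :* x) :+ c :* (z :* z) :+ con (+ 2) :* (g :* (x :* z)) :+ con (+ 2) :* (f :* (y :* z)) :+ con (+ 2) :* (h :* (y :* x))) refl
    i₃ : ∀ a b c f g h u v w → (b * c - f * f) * (u * u) + (a * c - g * g) * (v * v) + (a * b - h * h) * (w * w)
        + + 2 * ((g * h - a * f) * (v * w)) + + 2 * ((h * f - b * g) * (u * w)) + + 2 * ((f * g - h * c) * (u * v))
      ≡ (a * c - g * g) * (v * v) + (b * c - f * f) * (u * u) + (b * a - h * h) * (w * w)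
        + + 2 * ((f * h - b * g) * (u * w)) + + 2 * ((h * g - a * f) * (v * w)) + + 2 * ((g * f - h * c) * (v * u))
    i₃ = solve 9 (λ a b c f g h u v w → (b :* c :- f :* f) :* (u :* u) :+ (a :* c :- g :* g) :* (v :* v) :+ (a :* b :- h :* h) :* (w :* w) :+ con (+ 2) :* ((g :* h :- a :* f) :* (v :* w)) :+ con (+ 2) :* ((h :* f :- b :* g) :* (u :* w)) :+ con (+ 2) :* ((f :* g :- h :* c) :* (u :* v))
        := (a :* c :- g :* g) :* (v :* v) :+ (b :* c :- f :* f) :* (u :* u) :+ (b :* a :- h :* h) :* (w :* w) :+ con (+ 2) :* ((f :* h :- b :* g) :* (u :* w)) :+ con (+ 2) :* ((h :* g :- a :* f) :* (v :* w)) :+ con (+ 2) :* ((g :* f :- h :* c) :* (v :* u))) refl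

  swap-yz : ∀ {n a b c f g h} → Form n a b c f g h → Form n a c b f h g
  swap-yz {n} {a} {b} {c} {f} {g} {h} F = record
    { det = trans (i₁ a b c f g h) det ; x = x ; y = z ; z = y ; value = trans value (i₂ a b c f g h x y z)
    ; u = u ; v = w ; w = v ; t = t ; adjoint = trans adjoint (i₃ a b c f g h u v w) }
    where
    open Form F
    i₁ : ∀ a b c f g h → a * c * b + + 2 * (f * h * g) - a * (f * f) - c * (h * h) - b * (g * g) ≡ a * b * c + + 2 * (f * g * h) - a * (f * f) - b * (g * g) - c * (h * h)
    i₁ = solve 6 (λ a b c f g h → a :* c :* b :+ con (+ 2) :* (f :* h :* g) :- a :* (f :* f) :- c :* (h :* h) :- b :* (g :* g)
        := a :* b :* c :+ con (+ 2) :* (f :* g :* h) :- a :* (f :* f) :- b :* (g :* g) :- c :* (h :* h)) refl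
    i₂ : ∀ a b c f g h x y z → a * (x * x) + b * (y * y) + c * (z * z) + + 2 * (f * (y * z)) + + 2 * (g * (x * z)) + + 2 * (h * (x * y))
      ≡ a * (x * x) + c * (z * z) + b * (y * y) + + 2 * (f * (z * y)) + + 2 * (h * (x * y)) + + 2 * (g * (x * z))
    i₂ = solve 9 (λ a b c f g h x y z → a :* (x :* x) :+ b :* (y :* y) :+ c :* (z :* z) :+ con (+ 2) :* (f :* (y :* z)) :+ con (+ 2) :* (g :* (x :* z)) :+ con (+ 2) :* (h :* (x :* y))
        := a :* (x :* x) :+ c :* (z :* z) :+ b :* (y :* y) :+ con (+ 2) :* (f :* (z :* y)) :+ con (+ 2) :* (h :* (x :* y)) :+ con (+ 2) :* (g :* (x :* z))) refl
    i₃ : ∀ a b c f g h u v w → (b * c - f * f) * (u * u) + (a * c - g * g) * (v * v) + (a * b - h * h) * (w * w)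
        + + 2 * ((g * h - a * f) * (v * w)) + + 2 * ((h * f - b * g) * (u * w)) + + 2 * ((f * g - h * c) * (u * v))
      ≡ (c * b - f * f) * (u * u) + (a * b - h * h) * (w * w) + (a * c - g * g) * (v * v)
        + + 2 * ((h * g - a * f) * (w * v)) + + 2 * ((g * f - c * h) * (u * v)) + + 2 * ((f * h - g * b) * (u * w))
    i₃ = solve 9 (λ a b c f g h u v w → (b :* c :- f :* f) :* (u :* u) :+ (a :* c :- g :* g) :* (v :* v) :+ (a :* b :- h :* h) :* (w :* w) :+ con (+ 2) :* ((g :* h :- a :* f) :* (v :* w)) :+ con (+ 2) :* ((h :* f :- b :* g) :* (u :* w)) :+ con (+ 2) :* ((f :* g :- h :* c) :* (u :* v))
        := (c :* b :- f :* f) :* (u :* u) :+ (a :* b :- h :* h) :* (w :* w) :+ (a :* c :- g :* g) :* (v :* v) :+ con (+ 2) :* ((h :* g :- a :* f) :* (w :* v)) :+ con (+ 2) :* ((g :* f :- c :* h) :* (u :* v)) :+ con (+ 2) :* ((f :* h :- g :* b) :* (u :* w))) refl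

  -- The old `x` is the new `x + sy`. The vector of the adjoint form transforms contragrediently, by
  -- `v ↦ v + su`, so its value is kept.
  shear : ∀ s {n a b c f g h} → Form n a b c f g h → Form n a (b + + 2 * (s * h) + s * s * a) c (f + s * g) g (h + s * a)
  shear s {n} {a} {b} {c} {f} {g} {h} F = record
    { det = trans (i₁ s a b c f g h) det ; x = x - s * y ; y = y ; z = z ; value = trans value (i₂ s a b c f g h x y z)
    ; u = u ; v = v + s * u ; w = w ; t = t ; adjoint = trans adjoint (i₃ s a b c f g h u v w) }
    where
    open Form F
    i₁ : ∀ s a b c f g h → a * (b + + 2 * (s * h) + s * s * a) * c + + 2 * ((f + s * g) * g * (h + s * a)) - a * ((f + s * g) * (f + s * g))
        - (b + + 2 * (s * h) + s * s * a) * (g * g) - c * ((h + s * a) * (h + s * a))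
      ≡ a * b * c + + 2 * (f * g * h) - a * (f * f) - b * (g * g) - c * (h * h)
    i₁ = solve 7 (λ s a b c f g h → a :* (b :+ con (+ 2) :* (s :* h) :+ s :* s :* a) :* c :+ con (+ 2) :* ((f :+ s :* g) :* g :* (h :+ s :* a)) :- a :* ((f :+ s :* g) :* (f :+ s :* g)) :- (b :+ con (+ 2) :* (s :* h) :+ s :* s :* a) :* (g :* g) :- c :* ((h :+ s :* a) :* (h :+ s :* a))
        := a :* b :* c :+ con (+ 2) :* (f :* g :* h) :- a :* (f :* f) :- b :* (g :* g) :- c :* (h :* h)) refl
    i₂ : ∀ s a b c f g h x y z → a * (x * x) + b * (y * y) + c * (z * z) + + 2 * (f * (y * z)) + + 2 * (g * (x * z)) + + 2 * (h * (x * y))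
      ≡ a * ((x - s * y) * (x - s * y)) + (b + + 2 * (s * h) + s * s * a) * (y * y) + c * (z * z) + + 2 * ((f + s * g) * (y * z))
        + + 2 * (g * ((x - s * y) * z)) + + 2 * ((h + s * a) * ((x - s * y) * y))
    i₂ = solve 10 (λ s a b c f g h x y z → a :* (x :* x) :+ b :* (y :* y) :+ c :* (z :* z) :+ con (+ 2) :* (f :* (y :* z)) :+ con (+ 2) :* (g :* (x :* z)) :+ con (+ 2) :* (h :* (x :* y))
        := a :* ((x :- s :* y) :* (x :- s :* y)) :+ (b :+ con (+ 2) :* (s :* h) :+ s :* s :* a) :* (y :* y) :+ c :* (z :* z) :+ con (+ 2) :* ((f :+ s :* g) :* (y :* z)) :+ con (+ 2) :* (g :* ((x :- s :* y) :* z)) :+ con (+ 2) :* ((h :+ s :* a) :* ((x :- s :* y) :* y))) refl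
    i₃ : ∀ s a b c f g h u v w → (b * c - f * f) * (u * u) + (a * c - g * g) * (v * v) + (a * b - h * h) * (w * w)
        + + 2 * ((g * h - a * f) * (v * w)) + + 2 * ((h * f - b * g) * (u * w)) + + 2 * ((f * g - h * c) * (u * v))
      ≡ ((b + + 2 * (s * h) + s * s * a) * c - (f + s * g) * (f + s * g)) * (u * u) + (a * c - g * g) * ((v + s * u) * (v + s * u))
        + (a * (b + + 2 * (s * h) + s * s * a) - (h + s * a) * (h + s * a)) * (w * w)
        + + 2 * ((g * (h + s * a) - a * (f + s * g)) * ((v + s * u) * w))
        + + 2 * (((h + s * a) * (f + s * g) - (b + + 2 * (s * h) + s * s * a) * g) * (u * w))
        + + 2 * (((f + s * g) * g - (h + s * a) * c) * (u * (v + s * u)))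
    i₃ = solve 10 (λ s a b c f g h u v w → (b :* c :- f :* f) :* (u :* u) :+ (a :* c :- g :* g) :* (v :* v) :+ (a :* b :- h :* h) :* (w :* w) :+ con (+ 2) :* ((g :* h :- a :* f) :* (v :* w)) :+ con (+ 2) :* ((h :* f :- b :* g) :* (u :* w)) :+ con (+ 2) :* ((f :* g :- h :* c) :* (u :* v))
        := ((b :+ con (+ 2) :* (s :* h) :+ s :* s :* a) :* c :- (f :+ s :* g) :* (f :+ s :* g)) :* (u :* u) :+ (a :* c :- g :* g) :* ((v :+ s :* u) :* (v :+ s :* u)) :+ (a :* (b :+ con (+ 2) :* (s :* h) :+ s :* s :* a) :- (h :+ s :* a) :* (h :+ s :* a)) :* (w :* w) :+ con (+ 2) :* ((g :* (h :+ s :* a) :- a :* (f :+ s :* g)) :* ((v :+ s :* u) :* w)) :+ con (+ 2) :* (((h :+ s :* a) :* (f :+ s :* g) :- (b :+ con (+ 2) :* (s :* h) :+ s :* s :* a) :* g) :* (u :* w)) :+ con (+ 2) :* (((f :+ s :* g) :* g :- (h :+ s :* a) :* c) :* (u :* (v :+ s :* u)))) refl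

  -- z ↦ z + s y, obtained from shear by permuting the variables.
  shear-yz : ∀ s {n a b c f g h} → Form n a b c f g h → Form n a b (c + + 2 * (s * f) + s * s * b) (f + s * b) (g + s * h) h
  shear-yz s F = swap-xy (swap-yz (shear s (swap-yz (swap-xy F))))

  shear-xz : ∀ s {n a b c f g h} → Form n a b c f g h → Form n a b (c + + 2 * (s * g) + s * s * a) (f + s * h) (g + s * a) h
  shear-xz s F = swap-yz (shear s (swap-yz F))

  -- For `A = ab - h²`, `B = af - gh`, `C = ac - g²` the determinant gives `AC - B² = 3a`; from
  -- `A ≤ C` and `2|B| ≤ A` follows `A² ≤ 4a`.
  record Reduced (n a : ℤ) : Set where
    field
      b c f g h : ℤ
      form : Form n a b c f g h
      0<A : 0ℤ < a * b - h * h
      A²≤4a : (a * b - h * h) * (a * b - h * h) ≤ + 4 * a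

  positive-product : ∀ x y → 0ℤ < x → 0ℤ < x * y → 0ℤ < y
  positive-product (+ suc m) (+ suc n) _ _ = +<+ (s≤s z≤n)
  positive-product (+ suc m) (+ 0) _ p = contradiction (subst (0ℤ <_) (*-zeroʳ (+ suc m)) p) λ { (+<+ ()) }
  positive-product (+ 0) y (+<+ ()) _

  positive-ℕ : ∀ {x} → 0ℤ < x → ∃ λ n → 0 ℕ.< n × x ≡ + n
  positive-ℕ {+ n} (+<+ p) = n , p , refl

  4sq≤ : ∀ m r → 0ℤ ≤ m - + 2 * r → 0ℤ < m + + 2 * r → 0ℤ ≤ m * m - + 4 * (r * r)
  4sq≤ m r p q = subst (0ℤ ≤_) (ident m r) (0≤* (m - + 2 * r) (m + + 2 * r) p (<⇒≤ q))
    where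
    ident : ∀ m r → (m - + 2 * r) * (m + + 2 * r) ≡ m * m - + 4 * (r * r)
    ident = solve 2 (λ m r → (m :- con (+ 2) :* r) :* (m :+ con (+ 2) :* r) := m :* m :- con (+ 4) :* (r :* r)) refl

  -- Gauss reduction of the binary form `(A, B, C)`: a shear of `y` and `z` changes `B` by a
  -- multiple of `A`, and when `C < A`, exchanging `y` and `z` exchanges `A` and `C`. Neither move
  -- touches `a`.
  reduce-binary : ∀ n a → 0ℤ < a → ∀ k → Acc ℕ._<_ k → 0 ℕ.< k → ∀ b c f g h → Form n a b c f g h → a * b - h * h ≡ + k → Reduced n a
  reduce-binary n a 0<a k (acc rs) 0<k b c f g h F A≡ = go (centred k {{ℕ.>-nonZero 0<k}} (a * f - g * h))
    where
    go : (∃₂ λ r q → a * f - g * h ≡ r + + k * q × 0ℤ ≤ + k - + 2 * r × 0ℤ < + k + + 2 * r) → Reduced n a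
    go (r , q , B≡ , lo , hi) = finish (C <? + k)
      where
      c′ f′ g′ C : ℤ
      c′ = c + + 2 * (- q * f) + - q * - q * b
      f′ = f + - q * b
      g′ = g + - q * h
      C = a * c′ - g′ * g′
      F′ : Form n a b c′ f′ g′ h
      F′ = shear-yz (- q) F
      B′≡ : a * f′ - g′ * h ≡ r
      B′≡ = linear₂ 1ℤ (- q) B≡ A≡ (ident a b f g h q r (+ k))
        where
        ident : ∀ a b f g h q r k → a * (f + - q * b) - (g + - q * h) * h - r ≡ 1ℤ * (a * f - g * h - (r + k * q)) + - q * (a * b - h * h - k)
        ident = solve 8 (λ a b f g h q r k → a :* (f :+ :- q :* b) :- (g :+ :- q :* h) :* h :- r
            := con 1ℤ :* (a :* f :- g :* h :- (r :+ k :* q)) :+ :- q :* (a :* b :- h :* h :- k)) refl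
      AC≡ : + k * C ≡ + 3 * a + r * r
      AC≡ = trans (cong (_* C) (sym A≡)) (trans (ident a b c′ f′ g′ h) (cong₂ _+_ (trans (cong (a *_) (Form.det F′)) (*-comm a (+ 3))) (cong (λ t → t * t) B′≡)))
        where
        ident : ∀ a b c f g h → (a * b - h * h) * (a * c - g * g)
          ≡ a * (a * b * c + + 2 * (f * g * h) - a * (f * f) - b * (g * g) - c * (h * h)) + (a * f - g * h) * (a * f - g * h)
        ident = solve 6 (λ a b c f g h → (a :* b :- h :* h) :* (a :* c :- g :* g)
            := a :* (a :* b :* c :+ con (+ 2) :* (f :* g :* h) :- a :* (f :* f) :- b :* (g :* g) :- c :* (h :* h)) :+ (a :* f :- g :* h) :* (a :* f :- g :* h)) refl
      0<3a : 0ℤ < + 3 * a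
      0<3a = subst (_< + 3 * a) (*-zeroʳ (+ 3)) (*-monoˡ-<-pos (+ 3) 0<a)
      0<C : 0ℤ < C
      0<C = positive-product (+ k) C (+<+ 0<k) (subst (0ℤ <_) (sym AC≡) (+-mono-<-≤ 0<3a (0≤sq r)))
      finish : _ → Reduced n a
      finish (yes C<k) = let (k′ , 0<k′ , C≡) = positive-ℕ 0<C in
        reduce-binary n a 0<a k′ (rs (drop‿+<+ (subst (_< + k) C≡ C<k))) 0<k′ c′ b f′ h g′ (swap-yz F′) C≡
      finish (no C≮k) = record { form = F′ ; 0<A = subst (0ℤ <_) (sym A≡) (+<+ 0<k)
        ; A²≤4a = subst (λ t → t * t ≤ + 4 * a) (sym A≡) (*-cancelˡ-≤-pos (+ k * + k) (+ 4 * a) (+ 3) (0≤i-j⇒j≤i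
            (subst (0ℤ ≤_) (ident (+ k) C a r AC≡) (0≤+-both (0≤* (+ 4) (+ k * (C - + k)) 0≤+ (0≤* (+ k) (C - + k) 0≤+ (i≤j⇒0≤j-i (≮⇒≥ C≮k)))) (4sq≤ (+ k) r lo hi))))) }
        where
        ident₀ : ∀ k C a r → + 4 * (k * (C - k)) + (k * k - + 4 * (r * r)) - (+ 3 * (+ 4 * a) - + 3 * (k * k)) ≡ + 4 * (k * C - (+ 3 * a + r * r))
        ident₀ = solve 4 (λ k C a r → con (+ 4) :* (k :* (C :- k)) :+ (k :* k :- con (+ 4) :* (r :* r)) :- (con (+ 3) :* (con (+ 4) :* a) :- con (+ 3) :* (k :* k))
            := con (+ 4) :* (k :* C :- (con (+ 3) :* a :+ r :* r))) refl
        ident : ∀ k C a r → k * C ≡ + 3 * a + r * r → + 4 * (k * (C - k)) + (k * k - + 4 * (r * r)) ≡ + 3 * (+ 4 * a) - + 3 * (k * k)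
        ident k C a r e = linear (+ 4) e (ident₀ k C a r)

  diagonal-1 : ∀ {n a b c f g h} → a ≡ 1ℤ → b ≡ 1ℤ → f ≡ 0ℤ → g ≡ 0ℤ → h ≡ 0ℤ → Form n a b c f g h → TernaryValue n
  diagonal-1 {c = c} refl refl refl refl refl F = x , y , z , trans value (linear (z * z) det (ident c x y z))
    where
    open Form F
    ident : ∀ c x y z → 1ℤ * (x * x) + 1ℤ * (y * y) + c * (z * z) + + 2 * (0ℤ * (y * z)) + + 2 * (0ℤ * (x * z)) + + 2 * (0ℤ * (x * y)) - (x * x + y * y + + 3 * (z * z))
      ≡ z * z * (1ℤ * 1ℤ * c + + 2 * 0ℤ - 1ℤ * 0ℤ - 1ℤ * 0ℤ - c * 0ℤ - + 3)
    ident = solve 4 (λ c x y z → con 1ℤ :* (x :* x) :+ con 1ℤ :* (y :* y) :+ c :* (z :* z) :+ con (+ 2) :* (con 0ℤ :* (y :* z)) :+ con (+ 2) :* (con 0ℤ :* (x :* z)) :+ con (+ 2) :* (con 0ℤ :* (x :* y)) :- (x :* x :+ y :* y :+ con (+ 3) :* (z :* z))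
        := z :* z :* (con 1ℤ :* con 1ℤ :* c :+ con (+ 2) :* con 0ℤ :- con 1ℤ :* con 0ℤ :- con 1ℤ :* con 0ℤ :- c :* con 0ℤ :- con (+ 3))) refl

  diagonal-2 : ∀ {n a b c f g h} → a ≡ 1ℤ → b ≡ + 2 → f ≡ 0ℤ → g ≡ 0ℤ → h ≡ 0ℤ → Form n a b c f g h → ⊥
  diagonal-2 {c = c} refl refl refl refl refl F = indivisible 2 1ℤ (c - 1ℤ) (linear -1ℤ (Form.det F) (ident c))
    where
    ident : ∀ c → 1ℤ - (c - 1ℤ) * + 2 ≡ -1ℤ * (+ 2 * c + 0ℤ - 0ℤ - + 2 * 0ℤ - c * 0ℤ - + 3)
    ident = solve 1 (λ c → con 1ℤ :- (c :- con 1ℤ) :* con (+ 2)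
        := con -1ℤ :* (con (+ 2) :* c :+ con 0ℤ :- con 0ℤ :- con (+ 2) :* con 0ℤ :- c :* con 0ℤ :- con (+ 3))) refl

  -- Here `c = 2`, and the adjoint `3u² + 2v² + 2w² - 2vw` is congruent to `2(v + w)²` modulo 3,
  -- hence never to 1.
  hexagonal : ∀ {n a b c f g h} → a ≡ 1ℤ → b ≡ + 2 → f ≡ 1ℤ → g ≡ 0ℤ → h ≡ 0ℤ → Form n a b c f g h → ⊥
  hexagonal {c = c} refl refl refl refl refl F = go (mod3 (v + w))
    where
    open Form F
    2c≡4 : + 2 * c ≡ + 2 * + 2
    2c≡4 = linear 1ℤ det (ident c)
      where
      ident : ∀ c → + 2 * c - + 2 * + 2 ≡ 1ℤ * (+ 2 * c + 0ℤ - 1ℤ - + 2 * 0ℤ - c * 0ℤ - + 3)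
      ident = solve 1 (λ c → con (+ 2) :* c :- con (+ 2) :* con (+ 2)
          := con 1ℤ :* (con (+ 2) :* c :+ con 0ℤ :- con 1ℤ :- con (+ 2) :* con 0ℤ :- c :* con 0ℤ :- con (+ 3))) refl
    c≡2 : c ≡ + 2
    c≡2 = *-cancelˡ-≡ (+ 2) c (+ 2) 2c≡4
    square-mod3 : + 2 * ((v + w) * (v + w)) ≡ + 3 * t + 1ℤ - + 3 * (u * u) + + 6 * (v * w)
    square-mod3 = linear₂ -1ℤ (- (+ 2 * (u * u) + v * v)) adjoint c≡2 (ident c t u v w)
      where
      ident : ∀ c t u v w → + 2 * ((v + w) * (v + w)) - (+ 3 * t + 1ℤ - + 3 * (u * u) + + 6 * (v * w))
        ≡ -1ℤ * (+ 3 * t + 1ℤ - ((+ 2 * c - 1ℤ) * (u * u) + (1ℤ * c - 0ℤ) * (v * v) + + 2 * (w * w) + + 2 * (-1ℤ * (v * w)) + + 2 * (0ℤ * (u * w)) + + 2 * ((0ℤ - 0ℤ * c) * (u * v))))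
          + - (+ 2 * (u * u) + v * v) * (c - + 2)
      ident = solve 5 (λ c t u v w → con (+ 2) :* ((v :+ w) :* (v :+ w)) :- (con (+ 3) :* t :+ con 1ℤ :- con (+ 3) :* (u :* u) :+ con (+ 6) :* (v :* w))
          := con -1ℤ :* (con (+ 3) :* t :+ con 1ℤ :- ((con (+ 2) :* c :- con 1ℤ) :* (u :* u) :+ (con 1ℤ :* c :- con 0ℤ) :* (v :* v) :+ con (+ 2) :* (w :* w) :+ con (+ 2) :* (con -1ℤ :* (v :* w)) :+ con (+ 2) :* (con 0ℤ :* (u :* w)) :+ con (+ 2) :* ((con 0ℤ :- con 0ℤ :* c) :* (u :* v)))) :+ :- (con (+ 2) :* (u :* u) :+ v :* v) :* (c :- con (+ 2))) refl
    go : Mod3 (v + w) → ⊥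
    go (q , inj₁ e) = indivisible 3 1ℤ (+ 6 * (q * q) - t + u * u - + 2 * (v * w)) (linear -1ℤ (trans (sym (cong (λ s → + 2 * (s * s)) e)) square-mod3) (ident q t (u * u) (v * w)))
      where
      ident : ∀ q t u p → 1ℤ - (+ 6 * (q * q) - t + u - + 2 * p) * + 3 ≡ -1ℤ * (+ 2 * (+ 3 * q * (+ 3 * q)) - (+ 3 * t + 1ℤ - + 3 * u + + 6 * p))
      ident = solve 4 (λ q t u p → con 1ℤ :- (con (+ 6) :* (q :* q) :- t :+ u :- con (+ 2) :* p) :* con (+ 3)
          := con -1ℤ :* (con (+ 2) :* (con (+ 3) :* q :* (con (+ 3) :* q)) :- (con (+ 3) :* t :+ con 1ℤ :- con (+ 3) :* u :+ con (+ 6) :* p))) refl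
    go (q , inj₂ (inj₁ e)) = indivisible 3 -1ℤ (+ 6 * (q * q) + + 4 * q - t + u * u - + 2 * (v * w)) (linear -1ℤ (trans (sym (cong (λ s → + 2 * (s * s)) e)) square-mod3) (ident q t (u * u) (v * w)))
      where
      ident : ∀ q t u p → -1ℤ - (+ 6 * (q * q) + + 4 * q - t + u - + 2 * p) * + 3 ≡ -1ℤ * (+ 2 * ((+ 3 * q + 1ℤ) * (+ 3 * q + 1ℤ)) - (+ 3 * t + 1ℤ - + 3 * u + + 6 * p))
      ident = solve 4 (λ q t u p → con -1ℤ :- (con (+ 6) :* (q :* q) :+ con (+ 4) :* q :- t :+ u :- con (+ 2) :* p) :* con (+ 3)
          := con -1ℤ :* (con (+ 2) :* ((con (+ 3) :* q :+ con 1ℤ) :* (con (+ 3) :* q :+ con 1ℤ)) :- (con (+ 3) :* t :+ con 1ℤ :- con (+ 3) :* u :+ con (+ 6) :* p))) refl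
    go (q , inj₂ (inj₂ e)) = indivisible 3 -1ℤ (+ 6 * (q * q) + + 4 * q - t + u * u - + 2 * (v * w)) (linear -1ℤ (trans (sym (cong (λ s → + 2 * (s * s)) e)) square-mod3) (ident q t (u * u) (v * w)))
      where
      ident : ∀ q t u p → -1ℤ - (+ 6 * (q * q) + + 4 * q - t + u - + 2 * p) * + 3 ≡ -1ℤ * (+ 2 * (- (+ 3 * q + 1ℤ) * - (+ 3 * q + 1ℤ)) - (+ 3 * t + 1ℤ - + 3 * u + + 6 * p))
      ident = solve 4 (λ q t u p → con -1ℤ :- (con (+ 6) :* (q :* q) :+ con (+ 4) :* q :- t :+ u :- con (+ 2) :* p) :* con (+ 3)
          := con -1ℤ :* (con (+ 2) :* (:- (con (+ 3) :* q :+ con 1ℤ) :* :- (con (+ 3) :* q :+ con 1ℤ)) :- (con (+ 3) :* t :+ con 1ℤ :- con (+ 3) :* u :+ con (+ 6) :* p))) refl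

  -- `k² ≤ 4` leaves 1 and 2, and `f` is reduced modulo `b = k`. For `k = 2` an even `f` contradicts
  -- the odd determinant, and an odd `f` leads to the excluded class.
  unimodular-step : ∀ {n a b c f g h} k → a ≡ 1ℤ → b ≡ + k → 0 ℕ.< k → k ℕ.* k ℕ.≤ 4 → g ≡ 0ℤ → h ≡ 0ℤ → Form n a b c f g h → TernaryValue n
  unimodular-step {f = f} 1 a≡1 b≡1 _ _ refl refl F = diagonal-1 a≡1 b≡1 (trans (cong (λ t → f + - f * t) b≡1) (ident f)) (trans (+-identityˡ _) (*-zeroʳ (- f))) refl (shear-yz (- f) F)
    where
    ident : ∀ f → f + - f * 1ℤ ≡ 0ℤ
    ident = solve-∀
  unimodular-step {f = f} 2 a≡1 b≡2 _ _ refl refl F with mod2 f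
  ... | k , inj₁ e = contradiction (shear-yz (- k) F) (diagonal-2 a≡1 b≡2 (trans (cong₂ (λ s t → s + - k * t) e b≡2) (ident k)) (trans (+-identityˡ _) (*-zeroʳ (- k))) refl)
    where
    ident : ∀ k → + 2 * k + - k * + 2 ≡ 0ℤ
    ident = solve-∀
  ... | k , inj₂ e = contradiction (shear-yz (- k) F) (hexagonal a≡1 b≡2 (trans (cong₂ (λ s t → s + - k * t) e b≡2) (ident k)) (trans (+-identityˡ _) (*-zeroʳ (- k))) refl)
    where
    ident : ∀ k → + 2 * k + 1ℤ + - k * + 2 ≡ 1ℤ
    ident = solve-∀
  unimodular-step (suc (suc (suc k))) _ _ _ p _ _ _ = contradiction (ℕ.≤-trans (ℕ.*-mono-≤ {3} {suc (suc (suc k))} {3} {suc (suc (suc k))} (s≤s (s≤s (s≤s z≤n))) (s≤s (s≤s (s≤s z≤n)))) p)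
    λ { (s≤s (s≤s (s≤s (s≤s ())))) }

  -- Two shears by the coefficient 1 clear `h` and `g`, and turn `b` into `ab - h²`.
  minimum-one : ∀ {n a b c f g h} → a ≡ 1ℤ → Form n a b c f g h → 0ℤ < a * b - h * h → (a * b - h * h) * (a * b - h * h) ≤ + 4 * a → TernaryValue n
  minimum-one {n} {_} {b} {c} {f} {g} {h} refl F 0<A A²≤4 = let (k , 0<k , A≡) = positive-ℕ 0<A in
    unimodular-step k refl (trans (B≡ b h) A≡) 0<k (drop‿+≤+ (subst (_≤ + 4) (trans (cong₂ _*_ A≡ A≡) (sym (pos-* k k))) A²≤4))
      (zero-sum g) (zero-sum h) (shear-xz (- g) (shear (- h) F))
    where
    B≡ : ∀ b h → b + + 2 * (- h * h) + - h * - h * 1ℤ ≡ 1ℤ * b - h * h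
    B≡ = solve 2 (λ b h → b :+ con (+ 2) :* (:- h :* h) :+ :- h :* :- h :* con 1ℤ := con 1ℤ :* b :- h :* h) refl
    zero-sum : ∀ g → g + - g * 1ℤ ≡ 0ℤ
    zero-sum = solve-∀

  -- With `h` centred modulo `m`, a new `b` below `m` replaces `m` as leading coefficient. Otherwise
  -- `3m² ≤ 4A`, which together with `A² ≤ 4m` gives `9m³ ≤ 64`, so `m = 1`.
  reduce : ∀ n m → Acc ℕ._<_ m → 0 ℕ.< m → Reduced n (+ m) → TernaryValue n
  reduce n m (acc rs) 0<m R = go (centred m {{ℕ.>-nonZero 0<m}} h)
    where
    open Reduced R
    go : (∃₂ λ r q → h ≡ r + + m * q × 0ℤ ≤ + m - + 2 * r × 0ℤ < + m + + 2 * r) → TernaryValue n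
    go (r , q , h≡ , lo , hi) = finish (b′ <? + m)
      where
      b′ f′ h′ A : ℤ
      b′ = b + + 2 * (- q * h) + - q * - q * + m
      f′ = f + - q * g
      h′ = h + - q * + m
      A = + m * b - h * h
      F′ : Form n (+ m) b′ c f′ g h′
      F′ = shear (- q) form
      h′≡ : h′ ≡ r
      h′≡ = linear 1ℤ h≡ (ident h r q (+ m))
        where
        ident : ∀ h r q m → h + - q * m - r ≡ 1ℤ * (h - (r + m * q))
        ident = solve 4 (λ h r q m → h :+ :- q :* m :- r := con 1ℤ :* (h :- (r :+ m :* q))) refl
      A′≡ : + m * b′ - h′ * h′ ≡ A
      A′≡ = ident (+ m) b h q
        where
        ident : ∀ m b h q → m * (b + + 2 * (- q * h) + - q * - q * m) - (h + - q * m) * (h + - q * m) ≡ m * b - h * h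
        ident = solve 4 (λ m b h q → m :* (b :+ con (+ 2) :* (:- q :* h) :+ :- q :* :- q :* m) :- (h :+ :- q :* m) :* (h :+ :- q :* m)
            := m :* b :- h :* h) refl
      mb′≡ : + m * b′ ≡ A + h′ * h′
      mb′≡ = linear 1ℤ A′≡ (ident (+ m * b′) (h′ * h′) A)
        where
        ident : ∀ x y z → x - (z + y) ≡ 1ℤ * (x - y - z)
        ident = solve-∀
      0<b′ : 0ℤ < b′
      0<b′ = positive-product (+ m) b′ (+<+ 0<m) (subst (0ℤ <_) (sym mb′≡) (+-mono-<-≤ 0<A (0≤sq h′)))
      finish : _ → TernaryValue n
      finish (yes b′<m) = let (k , 0<k , b≡) = positive-ℕ 0<b′
                              (j , 0<j , A≡) = positive-ℕ 0<A
                          in reduce n k (rs (drop‿+<+ (subst (_< + m) b≡ b′<m))) 0<k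
                               (subst (Reduced n) b≡ (reduce-binary n b′ 0<b′ j (<-wellFounded j) 0<j (+ m) c g f′ h′ (swap-xy F′)
                                 (trans (cong (_- h′ * h′) (*-comm b′ (+ m))) (trans A′≡ A≡))))
      finish (no b′≮m) = minimum-one (cong +_ (one m 0<m small)) form 0<A A²≤4a
        where
        3m²≤4A : + 3 * (+ m * + m) ≤ + 4 * A
        3m²≤4A = 0≤i-j⇒j≤i (subst (0ℤ ≤_) (ident (+ m) b′ A h′ r mb′≡ h′≡)
          (0≤+-both (0≤* (+ 4) (+ m * (b′ - + m)) 0≤+ (0≤* (+ m) (b′ - + m) 0≤+ (i≤j⇒0≤j-i (≮⇒≥ b′≮m)))) (4sq≤ (+ m) r lo hi)))
          where
          ident₀ : ∀ m b A r → + 4 * (m * (b - m)) + (m * m - + 4 * (r * r)) - (+ 4 * A - + 3 * (m * m)) ≡ + 4 * (m * b - (A + r * r))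
          ident₀ = solve 4 (λ m b A r → con (+ 4) :* (m :* (b :- m)) :+ (m :* m :- con (+ 4) :* (r :* r)) :- (con (+ 4) :* A :- con (+ 3) :* (m :* m))
              := con (+ 4) :* (m :* b :- (A :+ r :* r))) refl
          ident : ∀ m b A h r → m * b ≡ A + h * h → h ≡ r → + 4 * (m * (b - m)) + (m * m - + 4 * (r * r)) ≡ + 4 * A - + 3 * (m * m)
          ident m b A η _ e refl = linear (+ 4) e (ident₀ m b A η)
        small : 9 ℕ.* (m ℕ.* m) ℕ.* (m ℕ.* m) ℕ.≤ 64 ℕ.* m
        small = bound (positive-ℕ 0<A)
          where
          bound : (∃ λ k → 0 ℕ.< k × A ≡ + k) → 9 ℕ.* (m ℕ.* m) ℕ.* (m ℕ.* m) ℕ.≤ 64 ℕ.* m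
          bound (k , _ , A≡) = ℕ.≤-trans (ℕ.≤-reflexive (i₁ (m ℕ.* m))) (ℕ.≤-trans (ℕ.*-mono-≤ 3m²≤4k 3m²≤4k)
              (ℕ.≤-trans (ℕ.≤-reflexive (i₂ k)) (ℕ.≤-trans (ℕ.*-monoʳ-≤ 16 k²≤4m) (ℕ.≤-reflexive (i₃ m)))))
            where
            3m²≤4k : 3 ℕ.* (m ℕ.* m) ℕ.≤ 4 ℕ.* k
            3m²≤4k = drop‿+≤+ (subst₂ _≤_ (trans (cong (+ 3 *_) (sym (pos-* m m))) (sym (pos-* 3 (m ℕ.* m)))) (trans (cong (+ 4 *_) A≡) (sym (pos-* 4 k))) 3m²≤4A)
            k²≤4m : k ℕ.* k ℕ.≤ 4 ℕ.* m
            k²≤4m = drop‿+≤+ (subst₂ _≤_ (trans (cong₂ _*_ A≡ A≡) (sym (pos-* k k))) (sym (pos-* 4 m)) A²≤4a)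
            i₁ : ∀ x → 9 ℕ.* x ℕ.* x ≡ 3 ℕ.* x ℕ.* (3 ℕ.* x)
            i₁ = ℕRing.solve-∀
            i₂ : ∀ k → 4 ℕ.* k ℕ.* (4 ℕ.* k) ≡ 16 ℕ.* (k ℕ.* k)
            i₂ = ℕRing.solve-∀
            i₃ : ∀ m → 16 ℕ.* (4 ℕ.* m) ≡ 64 ℕ.* m
            i₃ = ℕRing.solve-∀
        one : ∀ m → 0 ℕ.< m → 9 ℕ.* (m ℕ.* m) ℕ.* (m ℕ.* m) ℕ.≤ 64 ℕ.* m → m ≡ 1
        one 1 _ _ = refl
        one m@(suc (suc k)) _ h = contradiction (ℕ.*-cancelʳ-≤ (9 ℕ.* (m ℕ.* m) ℕ.* m) 64 m (subst (ℕ._≤ 64 ℕ.* m) (sym (ℕ.*-assoc (9 ℕ.* (m ℕ.* m)) m m)) h))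
          (ℕ.<⇒≱ (ℕ.<-≤-trans {64} {72} (ℕ.m<m+n 64 (s≤s z≤n)) (ℕ.*-mono-≤ (ℕ.*-monoʳ-≤ 9 (ℕ.*-mono-≤ 2≤m 2≤m)) 2≤m)))
          where
          2≤m : 2 ℕ.≤ m
          2≤m = s≤s (s≤s z≤n)

  -- The variables of the Gram matrix are ordered so that the positive `c` leads. The form takes the
  -- value `n` at (0,0,1), and its adjoint takes there the value `ac - b² = d`.
  ternary-value : ∀ n a b c d s → a * c - b * b ≡ d → d * n - c ≡ + 3 → d ≡ + 3 * s + 1ℤ → 0ℤ < c → 0ℤ < d → TernaryValue n
  ternary-value n a b c d s ac≡ dn≡ d≡ 0<c 0<d =
    let (k , 0<k , c≡) = positive-ℕ 0<c
        (j , 0<j , d≡j) = positive-ℕ 0<d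
    in reduce n k (<-wellFounded k) 0<k (subst (Reduced n) c≡ (reduce-binary n c 0<c j (<-wellFounded j) 0<j a n 1ℤ 0ℤ b F (trans A≡ d≡j)))
    where
    A≡ : c * a - b * b ≡ d
    A≡ = trans (cong (_- b * b) (*-comm c a)) ac≡
    F : Form n c a n 1ℤ 0ℤ b
    F = record
      { det = linear₂ 1ℤ n dn≡ A≡ (i₁ a b c d n)
      ; x = 0ℤ ; y = 0ℤ ; z = 1ℤ ; value = i₂ a b c n
      ; u = 0ℤ ; v = 0ℤ ; w = 1ℤ ; t = s ; adjoint = linear₂ -1ℤ -1ℤ d≡ A≡ (i₃ a b c d n s) }
      where
      i₁ : ∀ a b c d n → c * a * n + + 2 * (1ℤ * 0ℤ * b) - c * (1ℤ * 1ℤ) - a * (0ℤ * 0ℤ) - n * (b * b) - + 3 ≡ 1ℤ * (d * n - c - + 3) + n * (c * a - b * b - d)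
      i₁ = solve 5 (λ a b c d n → c :* a :* n :+ con (+ 2) :* (con 1ℤ :* con 0ℤ :* b) :- c :* (con 1ℤ :* con 1ℤ) :- a :* (con 0ℤ :* con 0ℤ) :- n :* (b :* b) :- con (+ 3)
          := con 1ℤ :* (d :* n :- c :- con (+ 3)) :+ n :* (c :* a :- b :* b :- d)) refl
      i₂ : ∀ a b c n → n ≡ c * (0ℤ * 0ℤ) + a * (0ℤ * 0ℤ) + n * (1ℤ * 1ℤ) + + 2 * (1ℤ * (0ℤ * 1ℤ)) + + 2 * (0ℤ * (0ℤ * 1ℤ)) + + 2 * (b * (0ℤ * 0ℤ))
      i₂ = solve 4 (λ a b c n → n
          := c :* (con 0ℤ :* con 0ℤ) :+ a :* (con 0ℤ :* con 0ℤ) :+ n :* (con 1ℤ :* con 1ℤ) :+ con (+ 2) :* (con 1ℤ :* (con 0ℤ :* con 1ℤ)) :+ con (+ 2) :* (con 0ℤ :* (con 0ℤ :* con 1ℤ)) :+ con (+ 2) :* (b :* (con 0ℤ :* con 0ℤ))) refl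
      i₃ : ∀ a b c d n s → + 3 * s + 1ℤ - ((a * n - 1ℤ * 1ℤ) * (0ℤ * 0ℤ) + (c * n - 0ℤ * 0ℤ) * (0ℤ * 0ℤ) + (c * a - b * b) * (1ℤ * 1ℤ)
          + + 2 * ((0ℤ * b - c * 1ℤ) * (0ℤ * 1ℤ)) + + 2 * ((b * 1ℤ - a * 0ℤ) * (0ℤ * 1ℤ)) + + 2 * ((1ℤ * 0ℤ - b * n) * (0ℤ * 0ℤ)))
        ≡ -1ℤ * (d - (+ 3 * s + 1ℤ)) + -1ℤ * (c * a - b * b - d)
      i₃ = solve 6 (λ a b c d n s → con (+ 3) :* s :+ con 1ℤ :- ((a :* n :- con 1ℤ :* con 1ℤ) :* (con 0ℤ :* con 0ℤ) :+ (c :* n :- con 0ℤ :* con 0ℤ) :* (con 0ℤ :* con 0ℤ) :+ (c :* a :- b :* b) :* (con 1ℤ :* con 1ℤ) :+ con (+ 2) :* ((con 0ℤ :* b :- c :* con 1ℤ) :* (con 0ℤ :* con 1ℤ)) :+ con (+ 2) :* ((b :* con 1ℤ :- a :* con 0ℤ) :* (con 0ℤ :* con 1ℤ)) :+ con (+ 2) :* ((con 1ℤ :* con 0ℤ :- b :* n) :* (con 0ℤ :* con 0ℤ)))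
          := con -1ℤ :* (d :- (con (+ 3) :* s :+ con 1ℤ)) :+ con -1ℤ :* (c :* a :- b :* b :- d)) refl

-- The quadratic character attached to -3m.

module QuadChar where
  open Arith
  open Jacobi public using (odd)
  open Jacobi
  open Reciprocity
  open Euler
  open Lagrange using (even⊎odd)
  open import Data.Nat.Base as ℕ using (ℕ; zero; suc; NonZero; _^_)
  import Data.Nat.Properties as ℕ
  open import Data.Nat.DivMod using (_%_; m%n<n; %-distribˡ-*; [m+kn]%n≡m%n; m∣n⇒o%n%m≡o%m)
  open import Data.Nat.Divisibility as ℕD using (divides)
  open import Data.Nat.Primality using (Prime; euclidsLemma; prime⇒irreducible; prime⇒nonTrivial; prime[2])
  open import Data.Nat.Coprimality as Coprimality using (Coprime; coprime?)
  import Data.Nat.Tactic.RingSolver as ℕRing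
  open import Data.Fin.Base using (Fin; toℕ; fromℕ<)
  open import Data.Fin.Properties using (all?; toℕ-fromℕ<)
  open import Data.Integer.Base hiding (suc; pred; NonZero; _%_; _/_; _^_)
  open import Data.Integer.Properties
  open import Data.Integer.Tactic.RingSolver using (solve-∀)
  open import Data.Integer.Solver using (module +-*-Solver)
  open +-*-Solver using (solve; _:=_; _:+_; _:*_; _:-_; :-_; con)
  open import Data.Integer.Divisibility.Signed as ℤD using (_∣_)
  open import Data.Product using (_,_; ∃)
  open import Data.Sum using (_⊎_; inj₁; inj₂)
  open import Relation.Nullary using (yes; no; ¬_; contradiction)
  open import Relation.Nullary.Decidable using (toWitness; True)
  open import Relation.Binary.PropositionalEquality hiding (J)
  open import Data.Unit.Base using (tt)

  -- Characters modulo 8, as tables.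
  module Mod8 (T : ℕ → ℤ) (mult : True (all? λ (x : Fin 8) → all? λ (y : Fin 8) → T ((toℕ x ℕ.* toℕ y) % 8) ≟ T (toℕ x) * T (toℕ y))) where
    value : ℕ → ℤ
    value n = T (n % 8)

    value-* : ∀ x y → value (x ℕ.* y) ≡ value x * value y
    value-* x y = trans (cong T (%-distribˡ-* x y 8)) (subst₂ (λ s t → T ((s ℕ.* t) % 8) ≡ T s * T t)
      (toℕ-fromℕ< (m%n<n x 8)) (toℕ-fromℕ< (m%n<n y 8)) (toWitness mult (fromℕ< (m%n<n x 8)) (fromℕ< (m%n<n y 8))))

  -- The principal character and the symbols (-1 / n) and (2 / n), as functions of n modulo 8.
  table₀ table₄ table₈ : ℕ → ℤ
  table₀ 1 = 1ℤ
  table₀ 3 = 1ℤ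
  table₀ 5 = 1ℤ
  table₀ 7 = 1ℤ
  table₀ _ = 0ℤ
  table₄ 1 = 1ℤ
  table₄ 3 = -1ℤ
  table₄ 5 = 1ℤ
  table₄ 7 = -1ℤ
  table₄ _ = 0ℤ
  table₈ 1 = 1ℤ
  table₈ 3 = -1ℤ
  table₈ 5 = -1ℤ
  table₈ 7 = 1ℤ
  table₈ _ = 0ℤ

  open Mod8 table₀ tt using () renaming (value to c₀; value-* to c₀-*)
  open Mod8 table₄ tt using () renaming (value to s₄; value-* to s₄-*)
  open Mod8 table₈ tt using () renaming (value to s₈; value-* to s₈-*)

  odd-step : ∀ h → odd (4 ℕ.+ h) % 8 ≡ odd h % 8
  odd-step h = trans (cong (_% 8) (ident h)) ([m+kn]%n≡m%n (odd h) 1 8)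
    where
    ident : ∀ h → suc (4 ℕ.+ h ℕ.+ (4 ℕ.+ h)) ≡ suc (h ℕ.+ h) ℕ.+ 8
    ident = ℕRing.solve-∀

  c₀-odd : ∀ h → c₀ (odd h) ≡ 1ℤ
  c₀-odd 0 = refl
  c₀-odd 1 = refl
  c₀-odd 2 = refl
  c₀-odd 3 = refl
  c₀-odd (suc (suc (suc (suc h)))) = trans (cong table₀ (odd-step h)) (c₀-odd h)

  s₄-odd : ∀ h → s₄ (odd h) ≡ sg h
  s₄-odd 0 = refl
  s₄-odd 1 = refl
  s₄-odd 2 = refl
  s₄-odd 3 = refl
  s₄-odd (suc (suc (suc (suc h)))) = trans (cong table₄ (odd-step h)) (trans (s₄-odd h)
    (sym (trans (neg-involutive (- - sg h)) (neg-involutive (sg h)))))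

  s₈-odd : ∀ h → s₈ (odd h) ≡ τ h
  s₈-odd 0 = refl
  s₈-odd 1 = refl
  s₈-odd 2 = refl
  s₈-odd 3 = refl
  s₈-odd (suc (suc (suc (suc h)))) = trans (cong table₈ (odd-step h)) (trans (s₈-odd h)
    (sym (trans (ident (sg h) (τ h)) (trans (cong₂ (λ s t → s * t * τ h) (sg-square h) (sg-square h)) (*-identityˡ (τ h))))))
    where
    ident : ∀ s t → - - - - s * (- - - s * (- - s * (- s * t))) ≡ s * s * (s * s) * t
    ident = solve 2 (λ s t → :- :- :- :- s :* (:- :- :- s :* (:- :- s :* (:- s :* t))) := s :* s :* (s :* s) :* t) refl

  table-bounded : (T : ℕ → ℤ) → True (all? λ (x : Fin 8) → ∣ T (toℕ x) ∣ ℕ.≤? 1) → ∀ n → ∣ T (n % 8) ∣ ℕ.≤ 1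
  table-bounded T b n = subst (λ r → ∣ T r ∣ ℕ.≤ 1) (toℕ-fromℕ< (m%n<n n 8)) (toWitness b (fromℕ< (m%n<n n 8)))

  ∣*∣≤1 : ∀ x y → ∣ x ∣ ℕ.≤ 1 → ∣ y ∣ ℕ.≤ 1 → ∣ x * y ∣ ℕ.≤ 1
  ∣*∣≤1 x y p q = subst (ℕ._≤ 1) (sym (abs-* x y)) (ℕ.*-mono-≤ p q)

  power-square : ∀ x n → x * x ≡ 1ℤ → power x n * power x n ≡ 1ℤ
  power-square x n e = trans (sym (∏-* n (λ _ → x) (λ _ → x))) (∏-one n (λ _ _ → e))

  sg-* : ∀ m h → sg (m ℕ.* h) ≡ power (sg h) m
  sg-* zero h = refl
  sg-* (suc m) h = trans (sg-+ h (m ℕ.* h)) (cong (sg h *_) (sg-* m h))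

  -- For moduli with a common factor both symbols vanish, so the law solved for one symbol covers
  -- all pairs.
  reciprocity′ : ∀ g h → J h (odd g) ≡ sg (g ℕ.* h) * J g (odd h)
  reciprocity′ g h with coprime? (odd g) (odd h)
  ... | yes c = trans (ident (J h (odd g)) (J g (odd h)) (J-square g (odd h) (Coprimality.sym c))) (cong (_* J g (odd h)) (reciprocity g h c))
    where
    ident : ∀ x y → y * y ≡ 1ℤ → x ≡ x * y * y
    ident x y e = sym (trans (*-assoc x y y) (trans (cong (x *_) e) (*-identityʳ x)))
  ... | no ¬c = trans (J-noncoprime h (odd g) ¬c) (sym (trans (cong (sg (g ℕ.* h) *_) (J-noncoprime g (odd h) (λ c → ¬c (Coprimality.sym c)))) (*-zeroʳ (sg (g ℕ.* h)))))

  J-power : ∀ h a e → J h (a ^ e) ≡ power (J h a) e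
  J-power h a zero = J-1 h
  J-power h a (suc e) = trans (J-* h a (a ^ e)) (cong (J h a *_) (J-power h a e))

  J-even-reciprocity : ∀ g h → J (h ℕ.+ h) (odd g) ≡ J g (odd (h ℕ.+ h))
  J-even-reciprocity g h = trans (reciprocity′ g (h ℕ.+ h)) (trans (cong (_* J g (odd (h ℕ.+ h))) (trans (cong sg (ℕ.*-distribˡ-+ g h h)) (sg-double (g ℕ.* h)))) (*-identityˡ _))

  prime≢1 : ∀ {q} → Prime q → q ≢ 1
  prime≢1 {q} pr refl = ℕ.<-irrefl refl (ℕ.nonTrivial⇒n>1 1 {{prime⇒nonTrivial pr}})

  prime∣2^ : ∀ q n → Prime q → q ℕD.∣ 2 ^ n → q ≡ 2
  prime∣2^ q zero pr d = contradiction (ℕD.∣1⇒≡1 d) (prime≢1 pr)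
  prime∣2^ q (suc n) pr d with euclidsLemma 2 (2 ^ n) pr d
  ... | inj₂ d = prime∣2^ q n pr d
  ... | inj₁ d with prime⇒irreducible prime[2] d
  ...   | inj₁ q≡1 = contradiction q≡1 (prime≢1 pr)
  ...   | inj₂ q≡2 = q≡2

  -- Modulo 2h + 1 the number 2h · 3m is -3m.
  minus-root : ∀ h m → (∃ λ b → + odd h ∣ + b * + b - + ((h ℕ.+ h) ℕ.* (3 ℕ.* m))) → ∃ λ b → + odd h ∣ + b * + b + + 3 * + m
  minus-root h m (b , d) = b , subst (+ odd h ∣_) shift (ℤD.∣m∣n⇒∣m+n {+ odd h} {+ b * + b - + ((h ℕ.+ h) ℕ.* (3 ℕ.* m))} {+ odd h * (+ 3 * + m)} d (ℤD.∣m⇒∣m*n (+ 3 * + m) ℤD.∣-refl))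
    where
    ident : ∀ b h m → b * b - h * (+ 3 * m) + (1ℤ + h) * (+ 3 * m) ≡ b * b + + 3 * m
    ident = solve 3 (λ b h m → b :* b :- h :* (con (+ 3) :* m) :+ (con 1ℤ :+ h) :* (con (+ 3) :* m) := b :* b :+ con (+ 3) :* m) refl
    product≡ : + ((h ℕ.+ h) ℕ.* (3 ℕ.* m)) ≡ + (h ℕ.+ h) * (+ 3 * + m)
    product≡ = trans (pos-* (h ℕ.+ h) (3 ℕ.* m)) (cong (_*_ (+ (h ℕ.+ h))) (pos-* 3 m))
    shift : + b * + b - + ((h ℕ.+ h) ℕ.* (3 ℕ.* m)) + + odd h * (+ 3 * + m) ≡ + b * + b + + 3 * + m
    shift = trans (cong₂ (λ s t → + b * + b - s + t * (+ 3 * + m)) product≡ (pos-+ 1 (h ℕ.+ h))) (ident (+ b) (+ (h ℕ.+ h)) (+ m))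

  -- The quadratic character of Q(√-3m), for m = 2ᵉ (2ν+1) prime to 3.
  module _ (e ν : ℕ) where
    μ m k : ℕ
    μ = suc (3 ℕ.* ν)
    m = 2 ^ e ℕ.* odd ν
    k = 24 ℕ.* m

    odd-μ : odd μ ≡ 3 ℕ.* odd ν
    odd-μ = ident ν
      where
      ident : ∀ ν → suc (suc (3 ℕ.* ν) ℕ.+ suc (3 ℕ.* ν)) ≡ 3 ℕ.* suc (ν ℕ.+ ν)
      ident = ℕRing.solve-∀

    3m≡ : 3 ℕ.* m ≡ 2 ^ e ℕ.* odd μ
    3m≡ = trans (ident (2 ^ e) (odd ν)) (cong (2 ^ e ℕ.*_) (sym odd-μ))
      where
      ident : ∀ x y → 3 ℕ.* (x ℕ.* y) ≡ x ℕ.* (3 ℕ.* y)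
      ident = ℕRing.solve-∀

    -- For odd n, (-3m / n) is the product of (-1 / n), the `e`-th power of (2 / n) and (odd μ / n);
    -- reciprocity turns the last factor into (n / odd μ) times the `μ`-th power of (-1 / n). In
    -- this shape periodicity modulo `24m` is visible, and `c₀` kills the even n.
    w χ : ℕ → ℤ
    w n = c₀ n * (power (s₄ n) (suc μ) * power (s₈ n) e)
    χ n = w n * J μ n

    χ-* : ∀ x y → χ (x ℕ.* y) ≡ χ x * χ y
    χ-* x y = trans (cong₂ _*_ (cong₂ _*_ (c₀-* x y) (cong₂ _*_
          (trans (cong (λ t → power t (suc μ)) (s₄-* x y)) (power-* (suc μ) (s₄ x) (s₄ y)))
          (trans (cong (λ t → power t e) (s₈-* x y)) (power-* e (s₈ x) (s₈ y))))) (J-* μ x y))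
        (ident (c₀ x) (c₀ y) (power (s₄ x) (suc μ)) (power (s₄ y) (suc μ)) (power (s₈ x) e) (power (s₈ y) e) (J μ x) (J μ y))
      where
      ident : ∀ a b c d e f g h → a * b * (c * d * (e * f)) * (g * h) ≡ a * (c * e) * g * (b * (d * f) * h)
      ident = solve 8 (λ a b c d e f g h → a :* b :* (c :* d :* (e :* f)) :* (g :* h) := a :* (c :* e) :* g :* (b :* (d :* f) :* h)) refl

    χ-bounded : ∀ x → ∣ χ x ∣ ℕ.≤ 1
    χ-bounded x = ∣*∣≤1 (w x) (J μ x) (∣*∣≤1 (c₀ x) _ (table-bounded table₀ tt x)
      (∣*∣≤1 (power (s₄ x) (suc μ)) (power (s₈ x) e) (∏-bounded (suc μ) (λ _ → s₄ x) (λ _ → table-bounded table₄ tt x))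
        (∏-bounded e (λ _ → s₈ x) (λ _ → table-bounded table₈ tt x)))) (J-bounded μ x)

    m≢0 : m ≢ 0
    m≢0 e₀ with ℕ.m*n≡0⇒m≡0∨n≡0 (2 ^ e) e₀
    ... | inj₁ z = ℕ.<⇒≢ (ℕ.m^n>0 2 e) (sym z)

    instance
      k≢0 : NonZero k
      k≢0 = ℕ.m*n≢0 24 m {{_}} {{ℕ.≢-nonZero m≢0}}

    8∣k : 8 ℕD.∣ k
    8∣k = divides (3 ℕ.* m) (ident m)
      where
      ident : ∀ m → 24 ℕ.* m ≡ 3 ℕ.* m ℕ.* 8
      ident = ℕRing.solve-∀

    odd-μ∣k : odd μ ℕD.∣ k
    odd-μ∣k = divides (8 ℕ.* 2 ^ e) (trans (ident m) (trans (cong (8 ℕ.*_) 3m≡) (sym (ℕ.*-assoc 8 (2 ^ e) (odd μ)))))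
      where
      ident : ∀ m → 24 ℕ.* m ≡ 8 ℕ.* (3 ℕ.* m)
      ident = ℕRing.solve-∀

    %-divisor : ∀ d .{{_ : NonZero d}} → d ℕD.∣ k → ∀ x y → x % k ≡ y % k → x % d ≡ y % d
    %-divisor d d∣k x y h = trans (sym (m∣n⇒o%n%m≡o%m d k x d∣k)) (trans (cong (_% d) h) (m∣n⇒o%n%m≡o%m d k y d∣k))

    χ-periodic : ∀ x y → x % k ≡ y % k → χ x ≡ χ y
    χ-periodic x y h = cong₂ _*_ (cong (λ r → table₀ r * (power (table₄ r) (suc μ) * power (table₈ r) e)) (%-divisor 8 8∣k x y h))
      (J-periodic μ x y (%-divisor (odd μ) odd-μ∣k x y h))

    w-odd : ∀ h → w (odd h) ≡ sg h * (sg (μ ℕ.* h) * power (τ h) e)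
    w-odd h = trans (cong₂ _*_ (c₀-odd h) (cong₂ _*_ (cong (λ t → power t (suc μ)) (s₄-odd h)) (cong (λ t → power t e) (s₈-odd h))))
      (trans (*-identityˡ _) (trans (*-assoc (sg h) (power (sg h) μ) (power (τ h) e)) (cong (λ t → sg h * (t * power (τ h) e)) (sym (sg-* μ h)))))

    -- As `2h ≡ -1` modulo `2h + 1`, the right side is the Jacobi symbol of -3m; the supplements and
    -- reciprocity expand it into `χ`.
    χ-odd : ∀ h → χ (odd h) ≡ J h ((h ℕ.+ h) ℕ.* (3 ℕ.* m))
    χ-odd h = sym (trans (J-* h (h ℕ.+ h) (3 ℕ.* m)) (trans (cong₂ _*_ (J-minus-one h)
        (trans (cong (J h) 3m≡) (trans (J-* h (2 ^ e) (odd μ)) (cong₂ _*_ (trans (J-power h 2 e) (cong (λ t → power t e) (J-two h))) (reciprocity′ μ h)))))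
      (trans (ident (sg h) (power (τ h) e) (sg (μ ℕ.* h)) (J μ (odd h))) (cong (_* J μ (odd h)) (sym (w-odd h))))))
      where
      ident : ∀ a b c d → a * (b * (c * d)) ≡ a * (c * b) * d
      ident = solve 4 (λ a b c d → a :* (b :* (c :* d)) := a :* (c :* b) :* d) refl

    -- `a₀` is `16m - 3` written as `4h₀ + 1` with `h₀ = 4m - 1`, which removes the sign from
    -- reciprocity; `pred` avoids a truncated difference.
    h₀ a₀ : ℕ
    h₀ = 3 ℕ.+ 4 ℕ.* ℕ.pred m
    a₀ = odd (h₀ ℕ.+ h₀)

    a₀+3 : a₀ ℕ.+ 3 ≡ 16 ℕ.* m
    a₀+3 = trans (ident (ℕ.pred m)) (cong (16 ℕ.*_) (ℕ.suc-pred m {{ℕ.≢-nonZero m≢0}}))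
      where
      ident : ∀ p → suc (3 ℕ.+ 4 ℕ.* p ℕ.+ (3 ℕ.+ 4 ℕ.* p) ℕ.+ (3 ℕ.+ 4 ℕ.* p ℕ.+ (3 ℕ.+ 4 ℕ.* p))) ℕ.+ 3 ≡ 16 ℕ.* suc p
      ident = ℕRing.solve-∀

    odd-ν∣m : odd ν ℕD.∣ m
    odd-ν∣m = ℕD.n∣m*n (2 ^ e)

    -- a₀ ≡ 5 (mod 8), a₀ ≡ m (mod 3) and a₀ ≡ -3 (mod m).
    χ-a₀ : Coprime (odd ν) 3 → χ a₀ ≡ 1ℤ
    χ-a₀ c = trans (cong₂ _*_ w≡ J≡) (power-square -1ℤ e refl)
      where
      H = h₀ ℕ.+ h₀
      P = power -1ℤ e
      -- The Legendre symbol modulo `odd 1 = 3`. It occurs once through the modulus 3 and once, by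
      -- reciprocity for -3, through the modulus `odd ν`, and so cancels.
      j = J 1 (odd ν)
      τ-H : τ H ≡ -1ℤ
      τ-H = trans (sym (s₈-odd H)) (cong table₈ (trans (cong (_% 8) (ident (ℕ.pred m))) ([m+kn]%n≡m%n 5 (1 ℕ.+ 2 ℕ.* ℕ.pred m) 8)))
        where
        ident : ∀ p → suc (3 ℕ.+ 4 ℕ.* p ℕ.+ (3 ℕ.+ 4 ℕ.* p) ℕ.+ (3 ℕ.+ 4 ℕ.* p ℕ.+ (3 ℕ.+ 4 ℕ.* p))) ≡ 5 ℕ.+ (1 ℕ.+ 2 ℕ.* p) ℕ.* 8
        ident = ℕRing.solve-∀
      w≡ : w a₀ ≡ P
      w≡ = trans (w-odd H) (trans (cong₂ _*_ (sg-double h₀) (cong₂ _*_ (trans (cong sg (ℕ.*-distribˡ-+ μ h₀ h₀)) (sg-double (μ ℕ.* h₀))) (cong (λ t → power t e) τ-H)))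
        (trans (*-identityˡ (1ℤ * P)) (*-identityˡ P)))
      J₁ : J 1 a₀ ≡ P * j
      J₁ = trans (J-periodic 1 a₀ m residue₃) (trans (J-* 1 (2 ^ e) (odd ν)) (cong (_* j) (J-power 1 2 e)))
        where
        ident : ∀ m → 16 ℕ.* m ≡ m ℕ.+ (5 ℕ.* m) ℕ.* 3
        ident = ℕRing.solve-∀
        residue₃ : a₀ % 3 ≡ m % 3
        residue₃ = trans (sym ([m+kn]%n≡m%n a₀ 1 3)) (trans (cong (_% 3) (trans a₀+3 (ident m))) ([m+kn]%n≡m%n m (5 ℕ.* m) 3))
      Jν : J ν a₀ ≡ j
      Jν = begin
        J ν a₀ ≡⟨ J-neg ν a₀ 3 (subst (odd ν ℕD.∣_) (sym a₀+3) (ℕD.∣n⇒∣m*n 16 odd-ν∣m)) ⟩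
        sg ν * J ν 3 ≡⟨ cong (sg ν *_) (trans (reciprocity′ 1 ν) (cong (λ t → sg t * j) (ℕ.*-identityˡ ν))) ⟩
        sg ν * (sg ν * j) ≡⟨ sym (*-assoc (sg ν) (sg ν) j) ⟩
        sg ν * sg ν * j ≡⟨ cong (_* j) (sg-square ν) ⟩
        1ℤ * j ≡⟨ *-identityˡ j ⟩
        j ∎
        where open ≡-Reasoning
      J≡ : J μ a₀ ≡ P
      J≡ = begin
        J μ a₀ ≡⟨ sym (J-even-reciprocity μ h₀) ⟩
        J H (odd μ) ≡⟨ cong (J H) odd-μ ⟩
        J H (3 ℕ.* odd ν) ≡⟨ J-* H 3 (odd ν) ⟩
        J H 3 * J H (odd ν) ≡⟨ cong₂ _*_ (trans (J-even-reciprocity 1 h₀) J₁) (trans (J-even-reciprocity ν h₀) Jν) ⟩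
        P * j * j ≡⟨ *-assoc P j j ⟩
        P * (j * j) ≡⟨ cong (P *_) (J-square 1 (odd ν) c) ⟩
        P * 1ℤ ≡⟨ *-identityʳ P ⟩
        P ∎
        where open ≡-Reasoning

    prime∣k : ∀ q → Prime q → q ℕD.∣ k → q ≡ 2 ⊎ q ℕD.∣ odd μ
    prime∣k q pr d = go (euclidsLemma 8 (3 ℕ.* m) pr (subst (q ℕD.∣_) (ident m) d))
      where
      ident : ∀ m → 24 ℕ.* m ≡ 8 ℕ.* (3 ℕ.* m)
      ident = ℕRing.solve-∀
      go : q ℕD.∣ 8 ⊎ q ℕD.∣ 3 ℕ.* m → q ≡ 2 ⊎ q ℕD.∣ odd μ
      go (inj₁ d) = inj₁ (prime∣2^ q 3 pr d)
      go (inj₂ d) with euclidsLemma (2 ^ e) (odd μ) pr (subst (q ℕD.∣_) 3m≡ d)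
      ... | inj₁ d = inj₁ (prime∣2^ q e pr d)
      ... | inj₂ d = inj₂ d

    χ-divisor : ∀ q → Prime q → q ℕD.∣ k → χ q ≡ 0ℤ
    χ-divisor q pr d = go (prime∣k q pr d)
      where
      zero-* : ∀ {a} b c → a ≡ 0ℤ → a * b * c ≡ 0ℤ
      zero-* b c refl = trans (cong (_* c) (*-zeroˡ b)) (*-zeroˡ c)
      c₀-two : c₀ 2 ≡ 0ℤ
      c₀-two = refl
      χ-two : χ 2 ≡ 0ℤ
      χ-two = zero-* {c₀ 2} (power (s₄ 2) (suc μ) * power (s₈ 2) e) (J μ 2) c₀-two
      go : q ≡ 2 ⊎ q ℕD.∣ odd μ → χ q ≡ 0ℤ
      go (inj₁ q≡2) = subst (λ q → χ q ≡ 0ℤ) (sym q≡2) χ-two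
      go (inj₂ d′) = trans (cong (_*_ (w q)) (J-noncoprime μ q λ c → prime≢1 pr (c (ℕD.∣-refl , d′)))) (*-zeroʳ (w q))

    odd-prime : ∀ q → Prime q → ¬ q ℕD.∣ k → ∃ λ h → q ≡ odd h
    odd-prime q pr q∤k with even⊎odd q
    ... | h , inj₂ eq = h , eq
    ... | h , inj₁ eq with prime⇒irreducible pr {2} (divides h (trans eq (double h)))
      where
      double : ∀ h → h ℕ.+ h ≡ h ℕ.* 2
      double = ℕRing.solve-∀
    ...   | inj₂ refl = contradiction (ℕD.∣-trans (divides 4 refl) 8∣k) q∤k

    prime-coprime : ∀ q n → Prime q → ¬ q ℕD.∣ n → Coprime n q
    prime-coprime q n pr q∤n {d} (d∣n , d∣q) with prime⇒irreducible pr d∣q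
    ... | inj₁ d≡1 = d≡1
    ... | inj₂ refl = contradiction d∣n q∤n

    χ-square : ∀ q → Prime q → ¬ q ℕD.∣ k → χ q * χ q ≡ 1ℤ
    χ-square q pr q∤k with odd-prime q pr q∤k
    ... | h , refl = trans (cong (λ t → t * J μ q * (t * J μ q)) (w-odd h))
        (trans (ident (sg h) (sg (μ ℕ.* h)) (power (τ h) e) (J μ q))
          (cong₂ _*_ (cong₂ _*_ (sg-square h) (sg-square (μ ℕ.* h))) (cong₂ _*_ (power-square (τ h) e (τ-square h))
            (J-square μ q (Coprimality.sym (prime-coprime q (odd μ) pr (λ d → q∤k (ℕD.∣-trans d odd-μ∣k))))))))
      where
      ident : ∀ a b c d → a * (b * c) * d * (a * (b * c) * d) ≡ a * a * (b * b) * (c * c * (d * d))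
      ident = solve 4 (λ a b c d → a :* (b :* c) :* d :* (a :* (b :* c) :* d) := a :* a :* (b :* b) :* (c :* c :* (d :* d))) refl
      τ-square : ∀ h → τ h * τ h ≡ 1ℤ
      τ-square zero = refl
      τ-square (suc h) = trans (ident′ (sg (suc h)) (τ h)) (cong₂ _*_ (sg-square (suc h)) (τ-square h))
        where
        ident′ : ∀ a b → a * b * (a * b) ≡ a * a * (b * b)
        ident′ = solve-∀

    split⇒root : ∀ q → Prime q → χ q ≡ 1ℤ → ∃ λ b → + q ∣ + b * + b + + 3 * + m
    split⇒root q pr χ≡1 = go (odd-prime q pr λ d → contradiction (trans (sym χ≡1) (χ-divisor q pr d)) λ ())
      where
      go : (∃ λ h → q ≡ odd h) → ∃ λ b → + q ∣ + b * + b + + 3 * + m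
      go (h , eq) = subst (λ q → ∃ λ b → + q ∣ + b * + b + + 3 * + m) (sym eq)
        (minus-root h m (square-root h (subst Prime eq pr) ((h ℕ.+ h) ℕ.* (3 ℕ.* m)) (trans (sym (χ-odd h)) (subst (λ q → χ q ≡ 1ℤ) eq χ≡1))))

    -- Modulo `q` the number `-3m y²` is the square of `x`, and the symbols of `x²` and `y²` are 1.
    root⇒split : ∀ q → Prime q → ¬ q ℕD.∣ k → ∀ x y → ¬ q ℕD.∣ y → q ℕD.∣ (x ℕ.* x ℕ.+ 3 ℕ.* m ℕ.* (y ℕ.* y)) → χ q ≡ 1ℤ
    root⇒split q pr q∤k x y q∤y d with odd-prime q pr q∤k
    ... | h , refl = trans (χ-odd h) (begin
        J h n ≡⟨ sym (trans (cong (J h n *_) (J-square h y (prime-coprime q y pr q∤y))) (*-identityʳ (J h n))) ⟩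
        J h n * (J h y * J h y) ≡⟨ cong (J h n *_) (sym (J-* h y y)) ⟩
        J h n * J h (y ℕ.* y) ≡⟨ sym (J-* h n (y ℕ.* y)) ⟩
        J h (n ℕ.* (y ℕ.* y)) ≡⟨ J-periodic h (n ℕ.* (y ℕ.* y)) (x ℕ.* x) congruence ⟩
        J h (x ℕ.* x) ≡⟨ J-* h x x ⟩
        J h x * J h x ≡⟨ J-square h x (prime-coprime q x pr q∤x) ⟩
        1ℤ ∎)
      where
      open ≡-Reasoning
      n = (h ℕ.+ h) ℕ.* (3 ℕ.* m)
      Y = 3 ℕ.* m ℕ.* (y ℕ.* y)
      q∤Y : ¬ q ℕD.∣ Y
      q∤Y d with euclidsLemma (3 ℕ.* m) (y ℕ.* y) pr d
      ... | inj₁ d = q∤k (ℕD.∣-trans d (divides 8 (ident m)))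
        where
        ident : ∀ m → 24 ℕ.* m ≡ 8 ℕ.* (3 ℕ.* m)
        ident = ℕRing.solve-∀
      ... | inj₂ d with euclidsLemma y y pr d
      ...   | inj₁ d = q∤y d
      ...   | inj₂ d = q∤y d
      q∤x : ¬ q ℕD.∣ x
      q∤x d′ = q∤Y (ℕD.∣m+n∣m⇒∣n d (ℕD.∣m⇒∣m*n x d′))
      congruence : (n ℕ.* (y ℕ.* y)) % q ≡ (x ℕ.* x) % q
      congruence = go d
        where
        go : q ℕD.∣ (x ℕ.* x ℕ.+ Y) → (n ℕ.* (y ℕ.* y)) % q ≡ (x ℕ.* x) % q
        go (divides t eq) = begin
          (n ℕ.* (y ℕ.* y)) % q ≡⟨ sym ([m+kn]%n≡m%n (n ℕ.* (y ℕ.* y)) t q) ⟩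
          (n ℕ.* (y ℕ.* y) ℕ.+ t ℕ.* q) % q ≡⟨ cong (λ s → (n ℕ.* (y ℕ.* y) ℕ.+ s) % q) (sym eq) ⟩
          (n ℕ.* (y ℕ.* y) ℕ.+ (x ℕ.* x ℕ.+ Y)) % q ≡⟨ cong (_% q) (ident h m (x ℕ.* x) (y ℕ.* y)) ⟩
          (x ℕ.* x ℕ.+ Y ℕ.* q) % q ≡⟨ [m+kn]%n≡m%n (x ℕ.* x) Y q ⟩
          (x ℕ.* x) % q ∎
          where
          ident : ∀ h m x y → (h ℕ.+ h) ℕ.* (3 ℕ.* m) ℕ.* y ℕ.+ (x ℕ.+ 3 ℕ.* m ℕ.* y) ≡ x ℕ.+ 3 ℕ.* m ℕ.* y ℕ.* suc (h ℕ.+ h)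
          ident = ℕRing.solve-∀

-- Products of split primes in the class of a₀.

module Existence where
  open Hyperbola using (Character)
  open Positivity using (PrimeValues; both; first; second; neither)
  open Growth using (growth-contradiction)
  open Separation
  open Reciprocity using (inverse; unit-coprime)
  open QuadChar using (prime≢1; prime∣2^; ∣*∣≤1)
  open import Data.Nat.Base as ℕ using (ℕ; zero; suc; s≤s; z≤n; NonZero; _^_; _*_; _+_; _<_)
  import Data.Nat.Properties as ℕ
  open import Data.Nat.DivMod using (_%_; m%n<n; m%n%n≡m%n; [m+kn]%n≡m%n)
  open import Data.Nat.Divisibility as ℕD using (_∣_; divides)
  open import Data.Nat.Primality using (Prime; euclidsLemma; prime⇒irreducible; prime⇒nonTrivial)
  open import Data.Nat.Primality.Factorisation using (factorise; PrimeFactorisation)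
  open import Data.Nat.ListAction using (product)
  open import Data.Nat.Coprimality using (Coprime; coprime?)
  import Data.Nat.Tactic.RingSolver as ℕRing
  open import Data.Integer.Base as ℤ using (ℤ; 0ℤ; 1ℤ; -1ℤ; ∣_∣)
  import Data.Integer.Properties as ℤ
  open import Data.List.Base using ([]; _∷_)
  open import Data.List.Relation.Unary.All using (All; []; _∷_)
  open import Data.Product using (_×_; _,_; ∃; proj₁; proj₂)
  open import Data.Sum using (_⊎_; inj₁; inj₂)
  open import Data.Empty using (⊥)
  open import Relation.Nullary using (Dec; yes; no; ¬_; contradiction)
  open import Relation.Nullary.Decidable using (map′)
  open import Relation.Binary.PropositionalEquality

  coprime-from-primes : ∀ a b → 0 < a → (∀ q → Prime q → q ∣ a → ¬ q ∣ b) → Coprime a b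
  coprime-from-primes a b 0<a h {zero} (d∣a , _) = contradiction (ℕD.0∣⇒≡0 d∣a) (λ a≡0 → ℕ.<⇒≢ 0<a (sym a≡0))
  coprime-from-primes a b 0<a h {d@(suc _)} (d∣a , d∣b) = go factors factorsPrime isFactorisation
    where
    open PrimeFactorisation (factorise d)
    go : ∀ ps → All Prime ps → d ≡ product ps → d ≡ 1
    go [] [] e = e
    go (p ∷ ps) (pr ∷ _) e = contradiction (ℕD.∣-trans p∣d d∣b) (h p pr (ℕD.∣-trans p∣d d∣a))
      where
      p∣d : p ∣ d
      p∣d = subst (p ∣_) (sym e) (ℕD.m∣m*n (product ps))

  -- Excluded middle for finitely many propositions holds under a double negation; this supplies the
  -- decidable subgroup from which the character is built.
  ¬¬-decidable : ∀ {P : ℕ → Set} n → ¬ ¬ (∀ g → g < n → Dec (P g))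
  ¬¬-decidable zero ¬d = ¬d λ _ ()
  ¬¬-decidable {P} (suc n) ¬d = ¬¬-decidable {P} n λ d → let
      extend : Dec (P n) → ∀ g → g < suc n → Dec (P g)
      extend dn g g<1+n = case d dn g (ℕ.m<1+n⇒m<n∨m≡n g<1+n)
    in ¬d (extend (no λ p → ¬d (extend (yes p))))
    where
    case : (∀ g → g < n → Dec (P g)) → Dec (P n) → ∀ g → g < n ⊎ g ≡ n → Dec (P g)
    case d dn g (inj₁ g<n) = d g g<n
    case d dn g (inj₂ refl) = dn

  -- The interface between the explicit symbol and the existence argument; `χ q ≡ 1` plays the part
  -- of `q` being split.
  record SplittingCharacter (m k a₀ : ℕ) .{{_ : NonZero k}} : Set where
    field
      χ : ℕ → ℤ
      χ-* : ∀ x y → χ (x * y) ≡ χ x ℤ.* χ y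
      χ-periodic : ∀ x y → x % k ≡ y % k → χ x ≡ χ y
      χ-bounded : ∀ x → ∣ χ x ∣ ℕ.≤ 1
      χ-divisor : ∀ q → Prime q → q ∣ k → χ q ≡ 0ℤ
      χ-square : ∀ q → Prime q → ¬ q ∣ k → χ q ℤ.* χ q ≡ 1ℤ
      χ-a₀ : χ a₀ ≡ 1ℤ
      root⇒split : ∀ q → Prime q → ¬ q ∣ k → ∀ x y → ¬ q ∣ y → q ∣ (x * x + 3 * m * (y * y)) → χ q ≡ 1ℤ
      0<m : 0 < m
      0<a₀ : 0 < a₀
      2∣k : 2 ∣ k

  module SplitPrimes {m k a₀ : ℕ} .{{k≢0 : NonZero k}} (C : SplittingCharacter m k a₀) where
    open SplittingCharacter C
    open Residues k

    Good : ℕ → Set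
    Good c = 0 < c × (∀ q → Prime q → q ∣ c → χ q ≡ 1ℤ)

    good-coprime : ∀ {c} → Good c → Coprime c k
    good-coprime {c} (0<c , h) = coprime-from-primes c k 0<c λ q pr q∣c q∣k →
      contradiction (trans (sym (h q pr q∣c)) (χ-divisor q pr q∣k)) λ ()

    coprime⇒unit : ∀ {g} → Coprime g k → Unit g
    coprime⇒unit {g} c = let (h , eq) = inverse g k c in h , trans (cong (_% k) (ℕ.*-comm g h)) eq

    unit⇒coprime : ∀ {g} → Unit g → Coprime g k
    unit⇒coprime {g} (h , eq) = unit-coprime g h k (trans (cong (_% k) (ℕ.*-comm h g)) eq)

    unit? : ∀ g → Dec (Unit g)
    unit? g = map′ coprime⇒unit unit⇒coprime (coprime? g k)

    E : ℕ
    E = 3 * m * (k * k)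

    0<E : 0 < E
    0<E = ℕ.*-mono-< {0} {3 * m} {0} {k * k} (ℕ.*-mono-< {0} {3} {0} {m} (s≤s z≤n) (0<m)) (ℕ.*-mono-< {0} {k} {0} {k} (ℕ.>-nonZero⁻¹ k) (ℕ.>-nonZero⁻¹ k))

    -- x² + E 4^j = x² + 3m (2^j k)² is a primitive value of the principal form.
    principal : ∀ x j → Coprime x k → ∀ q → Prime q → q ∣ (x * x + E * 4 ^ j) → χ q ≡ 1ℤ
    principal x j c q pr d = root⇒split q pr q∤k x (k * 2 ^ j) q∤y (subst (λ t → q ∣ (x * x + t)) square d)
      where
      4^ : ∀ j → 4 ^ j ≡ 2 ^ j * 2 ^ j
      4^ zero = refl
      4^ (suc j) = trans (cong (4 *_) (4^ j)) (ident (2 ^ j))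
        where
        ident : ∀ x → 4 * (x * x) ≡ 2 * x * (2 * x)
        ident = ℕRing.solve-∀
      square : E * 4 ^ j ≡ 3 * m * (k * 2 ^ j * (k * 2 ^ j))
      square = trans (cong (E *_) (4^ j)) (ident m k (2 ^ j))
        where
        ident : ∀ m k x → 3 * m * (k * k) * (x * x) ≡ 3 * m * (k * x * (k * x))
        ident = ℕRing.solve-∀
      q∤k : ¬ q ∣ k
      q∤k q∣k = prime≢1 pr (c (q∣x , q∣k))
        where
        q∣x : q ∣ x
        q∣x with euclidsLemma x x pr (ℕD.∣m+n∣m⇒∣n (subst (q ∣_) (ℕ.+-comm (x * x) (E * 4 ^ j)) d) (ℕD.∣m⇒∣m*n (4 ^ j) (ℕD.∣n⇒∣m*n (3 * m) (ℕD.∣m⇒∣m*n k q∣k))))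
        ... | inj₁ d = d
        ... | inj₂ d = d
      q∤y : ¬ q ∣ (k * 2 ^ j)
      q∤y d with euclidsLemma k (2 ^ j) pr d
      ... | inj₁ d = q∤k d
      ... | inj₂ d with prime∣2^ q j pr d
      ...   | refl = q∤k (2∣k)

    -- The residue classes of products of split primes. They form the subgroup in question, given
    -- without a decision procedure, as the size of the products is not bounded.
    P : ℕ → Set
    P g = ∃ λ c → Good c × c ≈ g

    good-* : ∀ {c c′} → Good c → Good c′ → Good (c * c′)
    good-* {c} {c′} (p , h) (p′ , h′) = ℕ.*-mono-< {0} {c} {0} {c′} p p′ , λ q pr d → go q pr (euclidsLemma c c′ pr d)
      where
      go : ∀ q → Prime q → (q ∣ c) ⊎ (q ∣ c′) → χ q ≡ 1ℤ
      go q pr (inj₁ d) = h q pr d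
      go q pr (inj₂ d) = h′ q pr d

    -- As `k` divides `E`, the principal value `g² + E` lies in the class of `g²`.
    square∈P : ∀ {g} → Unit g → P (g * g)
    square∈P {g} u = g * g + E * 4 ^ 0 , (ℕ.≤-trans (subst (0 <_) (sym (ℕ.*-identityʳ E)) 0<E) (ℕ.m≤n+m (E * 1) (g * g)) , principal g 0 (unit⇒coprime u)) ,
      trans (cong (λ t → (g * g + t) % k) (ident m k)) ([m+kn]%n≡m%n (g * g) (3 * m * k) k)
      where
      ident : ∀ m k → 3 * m * (k * k) * 1 ≡ 3 * m * k * k
      ident = ℕRing.solve-∀

    coprime-a₀ : Coprime a₀ k
    coprime-a₀ = coprime-from-primes a₀ k 0<a₀ λ q pr q∣a₀ q∣k → absurd q pr q∣a₀ q∣k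
      where
      absurd : ∀ q → Prime q → q ∣ a₀ → ¬ q ∣ k
      absurd q pr (divides t eq) q∣k = contradiction (trans (sym (χ-a₀)) (trans (cong χ eq) (trans (χ-* t q)
        (trans (cong (χ t ℤ.*_) (χ-divisor q pr q∣k)) (ℤ.*-zeroʳ (χ t)))))) λ ()

    module _ (P? : ∀ g → Dec (P g)) (¬P : ¬ P a₀) where
      S : SubgroupAvoiding a₀
      S = record
        { In = P ; in? = P? ; resp = λ { eq (c , gc , h) → c , gc , trans h eq }
        ; mult = λ { {g} {h} (c , gc , p) (c′ , gc′ , p′) → c * c′ , good-* gc gc′ , ≈-* {c} {g} {c′} {h} p p′ }
        ; squares = λ {g} → square∈P {g} ; units = λ { {g} (c , gc , p) → unit-resp {c} {g} p (coprime⇒unit (good-coprime gc)) } ; avoids = ¬P }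

      unit-a₀ : Unit a₀
      unit-a₀ = coprime⇒unit coprime-a₀

      ψ φ : Character k
      ψ = separating unit? unit-a₀ S
      -- The value `χ a₀ = 1` enters here: `ψχ` is again -1 at `a₀`, so both characters have
      -- vanishing period sums.
      φ = record
        { f = λ x → Character.f ψ x ℤ.* χ x
        ; multiplicative = λ x y → trans (cong₂ ℤ._*_ (Character.multiplicative ψ x y) (χ-* x y)) (interchange (Character.f ψ x) (Character.f ψ y) (χ x) (χ y))
        ; periodic = λ x y eq → cong₂ ℤ._*_ (Character.periodic ψ x y eq) (χ-periodic x y eq)
        ; bounded = λ x → ∣*∣≤1 (Character.f ψ x) (χ x) (Character.bounded ψ x) (χ-bounded x)
        ; a = a₀ ; a⁻¹ = proj₁ unit-a₀ ; inverse = proj₂ unit-a₀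
        ; fa≡-1 = cong₂ ℤ._*_ (Character.fa≡-1 ψ) (χ-a₀) }
        where
        open import Data.Integer.Tactic.RingSolver using (solve-∀)
        interchange : ∀ a b c d → a ℤ.* b ℤ.* (c ℤ.* d) ≡ a ℤ.* c ℤ.* (b ℤ.* d)
        interchange = solve-∀

      split⇒ψ : ∀ q → Prime q → χ q ≡ 1ℤ → Character.f ψ q ≡ 1ℤ
      split⇒ψ q pr h = separating-in unit? unit-a₀ S (q , (ℕ.<⇒≤ (ℕ.nonTrivial⇒n>1 q {{prime⇒nonTrivial pr}}) , only) , refl)
        where
        only : ∀ q′ → Prime q′ → q′ ∣ q → χ q′ ≡ 1ℤ
        only q′ pr′ d with prime⇒irreducible pr d
        ... | inj₁ q′≡1 = contradiction q′≡1 (prime≢1 pr′)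
        ... | inj₂ refl = h

      ±1 : ∀ x → x ℤ.* x ≡ 1ℤ → ∣ x ∣ ℕ.≤ 1 → x ≡ 1ℤ ⊎ x ≡ -1ℤ
      ±1 (ℤ.+ 0) () _
      ±1 (ℤ.+ 1) _ _ = inj₁ refl
      ±1 ℤ.-[1+ 0 ] _ _ = inj₂ refl
      ±1 (ℤ.+ suc (suc _)) _ (s≤s ())
      ±1 ℤ.-[1+ suc _ ] _ (s≤s ())

      values : ∀ q → Prime q → PrimeValues (Character.f ψ q) (Character.f φ q)
      values q pr = go (separating-value unit? unit-a₀ S q)
        where
        combine : ∀ {x y x′ y′} → x ≡ x′ → y ≡ y′ → PrimeValues x′ (x′ ℤ.* y′) → PrimeValues x (x ℤ.* y)
        combine refl refl v = v
        go : _ → PrimeValues (Character.f ψ q) (Character.f φ q)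
        go (inj₁ (_ , z)) = subst₂ PrimeValues (sym z) (sym (trans (cong (ℤ._* χ q) z) (ℤ.*-zeroˡ (χ q)))) neither
        go (inj₂ (u , v)) with ±1 (χ q) (χ-square q pr λ d → prime≢1 pr (unit⇒coprime u (ℕD.∣-refl , d))) (χ-bounded q)
        ... | inj₁ h = combine (split⇒ψ q pr h) h both
        go (inj₂ (u , inj₁ z)) | inj₂ h = combine z h first
        go (inj₂ (u , inj₂ z)) | inj₂ h = combine z h second

      contradictory : ⊥
      contradictory = growth-contradiction ψ φ values E 0<E λ i j q pr d →
        let h = principal (suc (k * i)) j (coprime-1+ i) q pr d
            p = split⇒ψ q pr h
        in p , cong₂ ℤ._*_ p h
        where
        coprime-1+ : ∀ i → Coprime (suc (k * i)) k
        coprime-1+ i {d} (d∣x , d∣k) = ℕD.∣1⇒≡1 (ℕD.∣m+n∣m⇒∣n (subst (d ∣_) (ℕ.+-comm 1 (k * i)) d∣x) (ℕD.∣m⇒∣m*n i d∣k))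

    -- Deciding `P` on the residues below `k` is possible under the double negation, and by
    -- periodicity this decides it everywhere.
    existence : ¬ ¬ P a₀
    existence ¬P = ¬¬-decidable {P} k λ d → contradictory
      (λ g → map′ (λ { (c , gc , h) → c , gc , trans h (m%n%n≡m%n g k) }) (λ { (c , gc , h) → c , gc , trans h (sym (m%n%n≡m%n g k)) }) (d (g % k) (m%n<n g k))) ¬P

-- Square roots modulo composite numbers and the passage to ternary forms.

module Roots where
  open Arith
  open Reciprocity using (inverse)
  open Euler using (euclid)
  open Reduction
  open import Data.Nat.Base as ℕ using (ℕ; zero; suc; s≤s; z≤n; NonZero)
  import Data.Nat.Properties as ℕ
  open import Data.Nat.DivMod using (_%_; _/_; m≡m%n+[m/n]*n; m<n⇒m%n≡m)
  import Data.Nat.Tactic.RingSolver as ℕRing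
  open import Data.Nat.Divisibility as ℕD using ()
  open import Data.Nat.Primality using (Prime; prime⇒irreducible)
  open import Data.Nat.ListAction using (product)
  open import Data.Nat.Coprimality using (Coprime)
  open import Data.Integer.Base hiding (suc; pred; NonZero; _%_; _/_)
  open import Data.Integer.Properties
  open import Data.Integer.Tactic.RingSolver using (solve-∀)
  open import Data.Integer.Solver using (module +-*-Solver)
  open +-*-Solver using (solve; _:=_; _:+_; _:*_; _:-_; :-_; con)
  open import Data.Integer.Divisibility.Signed as ℤD using (_∣_; ∣ᵤ⇒∣; _∣?_)
  open import Data.List.Base using ([]; _∷_)
  open import Data.List.Relation.Unary.All using (All; []; _∷_)
  open import Data.Product using (_×_; _,_; ∃)
  open import Data.Sum using (_⊎_; inj₁; inj₂)
  open import Relation.Nullary using (Dec; yes; no; ¬_; contradiction)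
  open import Relation.Nullary.Decidable using (map′)
  open import Relation.Binary.PropositionalEquality

  modular-inverse : ∀ a n .{{_ : NonZero n}} → Coprime a n → ∃ λ b → + n ∣ + b * + a - 1ℤ
  modular-inverse a n c = let (b , e) = inverse a n c in b , ∣-of b e
    where
    ident : ∀ r s t n → r + s * n - (r + t * n) ≡ (s - t) * n
    ident = solve 4 (λ r s t n → r :+ s :* n :- (r :+ t :* n) := (s :- t) :* n) refl
    division : ∀ x → + x ≡ + (x % n) + + (x / n) * + n
    division x = trans (cong +_ (m≡m%n+[m/n]*n x n)) (trans (pos-+ (x % n) ((x / n) ℕ.* n)) (cong (_+_ (+ (x % n))) (pos-* (x / n) n)))
    ∣-of : ∀ b → (b ℕ.* a) % n ≡ 1 % n → + n ∣ + b * + a - 1ℤ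
    ∣-of b e = ℤD.divides (+ ((b ℕ.* a) / n) - + (1 / n)) (trans (cong₂ _-_ (trans (sym (pos-* b a)) (division (b ℕ.* a)))
      (trans (division 1) (cong (λ r → + r + + (1 / n) * + n) (sym e)))) (ident (+ ((b ℕ.* a) % n)) (+ ((b ℕ.* a) / n)) (+ (1 / n)) (+ n)))

  prime-inverse : ∀ {p} → Prime p → ∀ x → ¬ + p ∣ x → ∃ λ y → + p ∣ y * x - 1ℤ
  prime-inverse {suc p} pr x p∤x = signed x (modular-inverse ∣ x ∣ (suc p) coprime)
    where
    coprime : Coprime ∣ x ∣ (suc p)
    coprime {d} (d∣x , d∣p) = go (prime⇒irreducible pr d∣p)
      where
      go : d ≡ 1 ⊎ d ≡ suc p → d ≡ 1
      go (inj₁ d≡1) = d≡1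
      go (inj₂ d≡p) = contradiction (∣ᵤ⇒∣ (subst (ℕD._∣ ∣ x ∣) d≡p d∣x)) p∤x
    signed : ∀ x → (∃ λ b → + suc p ∣ + b * + ∣ x ∣ - 1ℤ) → ∃ λ y → + suc p ∣ y * x - 1ℤ
    signed (+ n) (b , d) = + b , d
    signed -[1+ n ] (b , d) = - + b , subst (+ suc p ∣_) (ident (+ b) (+ suc n)) d
      where
      ident : ∀ b x → b * x - 1ℤ ≡ - b * - x - 1ℤ
      ident = solve-∀

  Root : ℤ → ℕ → Set
  Root M c = ∃ λ b → + c ∣ b * b + M

  -- Hensel's lemma if q divides C, the Chinese remainder theorem otherwise.
  lift-root : ∀ M q C → Prime q → ¬ + q ∣ + 2 → ¬ + q ∣ M → Root M q → Root M C → Root M (q ℕ.* C)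
  lift-root M q C pr q∤2 q∤M (β , dβ) (b , ℤD.divides s eq) = go (+ q ∣? + C)
    where
    -- (b + C t)² + M = C (s + 2bt + C t²).
    close : ∀ t → + q ∣ s + + 2 * b * t + + C * (t * t) → Root M (q ℕ.* C)
    close t (ℤD.divides r h) = b + + C * t , ℤD.divides r (trans (linear₂ 1ℤ (+ C) eq h (ident b (+ C) t s r (+ q) M)) (cong (_*_ r) (sym (pos-* q C))))
      where
      ident : ∀ b C t s r q M → (b + C * t) * (b + C * t) + M - r * (q * C) ≡ 1ℤ * (b * b + M - s * C) + C * (s + + 2 * b * t + C * (t * t) - r * q)
      ident = solve 7 (λ b C t s r q M → (b :+ C :* t) :* (b :+ C :* t) :+ M :- r :* (q :* C)
          := con 1ℤ :* (b :* b :+ M :- s :* C) :+ C :* (s :+ con (+ 2) :* b :* t :+ C :* (t :* t) :- r :* q)) refl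
    go : Dec (+ q ∣ + C) → Root M (q ℕ.* C)
    go (yes q∣C) = hensel (prime-inverse pr (+ 2 * b) q∤2b)
      where
      q∤b : ¬ + q ∣ b
      q∤b d = q∤M (subst (+ q ∣_) (ident (b * b) M) (ℤD.∣m∣n⇒∣m-n {+ q} {b * b + M} {b * b} (subst (+ q ∣_) (sym eq) (ℤD.∣n⇒∣m*n s q∣C)) (ℤD.∣m⇒∣m*n b d)))
        where
        ident : ∀ x M → x + M - x ≡ M
        ident = solve-∀
      q∤2b : ¬ + q ∣ + 2 * b
      q∤2b d = case (euclid pr (+ 2) b d)
        where
        case : ¬ ((+ q ∣ + 2) ⊎ (+ q ∣ b))
        case (inj₁ d) = q∤2 d
        case (inj₂ d) = q∤b d
      hensel : (∃ λ y → + q ∣ y * (+ 2 * b) - 1ℤ) → Root M (q ℕ.* C)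
      -- `y` inverts `2b`, so `t = -sy` solves `s + 2bt ≡ 0` modulo `q`; the quadratic term drops
      -- out because `q` divides `C`.
      hensel (y , d) = close (- s * y) (subst (+ q ∣_) (ident s b y (+ C)) (ℤD.∣m∣n⇒∣m+n {+ q} { - s * (y * (+ 2 * b) - 1ℤ)} {+ C * (- s * y * (- s * y))} (ℤD.∣n⇒∣m*n (- s) d) (ℤD.∣m⇒∣m*n (- s * y * (- s * y)) q∣C)))
        where
        ident : ∀ s b y C → - s * (y * (+ 2 * b) - 1ℤ) + C * (- s * y * (- s * y)) ≡ s + + 2 * b * (- s * y) + C * (- s * y * (- s * y))
        ident = solve 4 (λ s b y C → :- s :* (y :* (con (+ 2) :* b) :- con 1ℤ) :+ C :* (:- s :* y :* (:- s :* y))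
            := s :+ con (+ 2) :* b :* (:- s :* y) :+ C :* (:- s :* y :* (:- s :* y))) refl
    go (no q∤C) = chinese (prime-inverse pr (+ C) q∤C)
      where
      chinese : (∃ λ y → + q ∣ y * + C - 1ℤ) → Root M (q ℕ.* C)
      chinese (y , dy) = close t (cancel (euclid pr (+ C) (s + + 2 * b * t + + C * (t * t)) (subst (+ q ∣_) product≡ whole)))
        where
        t x : ℤ
        -- `y` inverts `C`, so `b + Ct` becomes congruent to `β` modulo `q` while its residue modulo
        -- `C` is kept.
        t = (β - b) * y
        x = b + + C * t
        difference : + q ∣ x - β
        difference = subst (+ q ∣_) (ident b (+ C) β y) (ℤD.∣n⇒∣m*n (β - b) dy)
          where
          ident : ∀ b C β y → (β - b) * (y * C - 1ℤ) ≡ b + C * ((β - b) * y) - β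
          ident = solve 4 (λ b C β y → (β :- b) :* (y :* C :- con 1ℤ) := b :+ C :* ((β :- b) :* y) :- β) refl
        whole : + q ∣ x * x + M
        whole = subst (+ q ∣_) (ident x β M) (ℤD.∣m∣n⇒∣m+n {+ q} {(x - β) * (x + β)} {β * β + M} (ℤD.∣m⇒∣m*n (x + β) difference) dβ)
          where
          ident : ∀ x β M → (x - β) * (x + β) + (β * β + M) ≡ x * x + M
          ident = solve 3 (λ x β M → (x :- β) :* (x :+ β) :+ (β :* β :+ M) := x :* x :+ M) refl
        product≡ : x * x + M ≡ + C * (s + + 2 * b * t + + C * (t * t))
        product≡ = linear 1ℤ eq (ident b (+ C) t s M)
          where
          ident : ∀ b C t s M → (b + C * t) * (b + C * t) + M - C * (s + + 2 * b * t + C * (t * t)) ≡ 1ℤ * (b * b + M - s * C)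
          ident = solve 5 (λ b C t s M → (b :+ C :* t) :* (b :+ C :* t) :+ M :- C :* (s :+ con (+ 2) :* b :* t :+ C :* (t :* t))
              := con 1ℤ :* (b :* b :+ M :- s :* C)) refl
        cancel : (+ q ∣ + C) ⊎ (+ q ∣ s + + 2 * b * t + + C * (t * t)) → + q ∣ s + + 2 * b * t + + C * (t * t)
        cancel (inj₁ d) = contradiction d q∤C
        cancel (inj₂ d) = d

  product-root : ∀ M ps → All Prime ps → (∀ q → Prime q → q ℕD.∣ product ps → (¬ + q ∣ + 2) × (¬ + q ∣ M) × Root M q) → Root M (product ps)
  product-root M [] [] _ = 0ℤ , ∣ᵤ⇒∣ (ℕD.1∣ _)
  product-root M (p ∷ ps) (pr ∷ prs) h =
    let (p∤2 , p∤M , root) = h p pr (ℕD.m∣m*n (product ps)) in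
    lift-root M p (product ps) pr p∤2 p∤M root (product-root M ps prs λ q pq d → h q pq (ℕD.∣n⇒∣m*n p d))

  -- Rescale b to B = bV with V inverse to m modulo c: then B² ≡ −d, because d m ≡ 3.
  root⇒ternary-value : ∀ m c d s → Root (+ 3 * m) c → (∃ λ V → + c ∣ V * m - 1ℤ) → d * m - + c ≡ + 3 → d ≡ + 3 * s + 1ℤ → 0ℤ < + c → 0ℤ < d → TernaryValue m
  root⇒ternary-value m c d s (b , ℤD.divides A h) (V , ℤD.divides r g) e = ternary-value m
    -- The quotient of `B² + d` by `c`, collected from the quotients `A` and `r` after replacing 3
    -- by `dm - c`.
    (V * V * A - d * r * (V * m + 1ℤ) + V * V * m) (b * V) (+ c) d s (linear 1ℤ square≡ (ident₃ b V A d r m (+ c))) e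
    where
    ident₁ : ∀ b V A m c → V * V * (+ 3 * m) - (V * V * (A * c) - b * V * (b * V)) ≡ V * V * (b * b + + 3 * m - A * c)
    ident₁ = solve 5 (λ b V A m c → V :* V :* (con (+ 3) :* m) :- (V :* V :* (A :* c) :- b :* V :* (b :* V))
        := V :* V :* (b :* b :+ con (+ 3) :* m :- A :* c)) refl
    ident₂ : ∀ V r d m c → d - V * V * m * (d * m - c) - (V * V * m * c - d * (V * m + 1ℤ) * (r * c)) ≡ - (d * (V * m + 1ℤ)) * (V * m - 1ℤ - r * c)
    ident₂ = solve 5 (λ V r d m c → d :- V :* V :* m :* (d :* m :- c) :- (V :* V :* m :* c :- d :* (V :* m :+ con 1ℤ) :* (r :* c))
        := :- (d :* (V :* m :+ con 1ℤ)) :* (V :* m :- con 1ℤ :- r :* c)) refl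
    square₁ : V * V * (+ 3 * m) ≡ V * V * (A * + c) - b * V * (b * V)
    square₁ = linear (V * V) h (ident₁ b V A m (+ c))
    square₂ : d - V * V * m * + 3 ≡ V * V * m * + c - d * (V * m + 1ℤ) * (r * + c)
    square₂ = trans (cong (λ x → d - V * V * m * x) (sym e)) (linear (- (d * (V * m + 1ℤ))) g (ident₂ V r d m (+ c)))
    square≡ : V * V * (A * + c) - b * V * (b * V) + (V * V * m * + c - d * (V * m + 1ℤ) * (r * + c)) ≡ d
    square≡ = linear₂ -1ℤ -1ℤ square₁ square₂ (ident₅ V r d m (+ c) A b)
      where
      ident₅ : ∀ V r d m c A b → V * V * (A * c) - b * V * (b * V) + (V * V * m * c - d * (V * m + 1ℤ) * (r * c)) - d
        ≡ -1ℤ * (V * V * (+ 3 * m) - (V * V * (A * c) - b * V * (b * V))) + -1ℤ * (d - V * V * m * + 3 - (V * V * m * c - d * (V * m + 1ℤ) * (r * c)))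
      ident₅ = solve 7 (λ V r d m c A b → V :* V :* (A :* c) :- b :* V :* (b :* V) :+ (V :* V :* m :* c :- d :* (V :* m :+ con 1ℤ) :* (r :* c)) :- d
          := con -1ℤ :* (V :* V :* (con (+ 3) :* m) :- (V :* V :* (A :* c) :- b :* V :* (b :* V))) :+ con -1ℤ :* (d :- V :* V :* m :* con (+ 3) :- (V :* V :* m :* c :- d :* (V :* m :+ con 1ℤ) :* (r :* c)))) refl
    ident₃ : ∀ b V A d r m c → (V * V * A - d * r * (V * m + 1ℤ) + V * V * m) * c - b * V * (b * V) - d
      ≡ 1ℤ * (V * V * (A * c) - b * V * (b * V) + (V * V * m * c - d * (V * m + 1ℤ) * (r * c)) - d)
    ident₃ = solve 7 (λ b V A d r m c → (V :* V :* A :- d :* r :* (V :* m :+ con 1ℤ) :+ V :* V :* m) :* c :- b :* V :* (b :* V) :- d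
        := con 1ℤ :* (V :* V :* (A :* c) :- b :* V :* (b :* V) :+ (V :* V :* m :* c :- d :* (V :* m :+ con 1ℤ) :* (r :* c)) :- d)) refl

  -- `c = 16m - 3 + 24mt` means `c = dm - 3` with `d = 16 + 24t = 3(5 + 8t) + 1`.
  modulus⇒ternary-value : ∀ m k a₀ c .{{_ : NonZero k}} → k ≡ 24 ℕ.* m → a₀ ℕ.+ 3 ≡ 16 ℕ.* m → 0 ℕ.< c → c % k ≡ a₀ % k →
    Coprime c k → Root (+ 3 * + m) c → TernaryValue (+ m)
  modulus⇒ternary-value m k a₀ c k≡ a₀+3 0<c c≈a₀ coprime root =
    root⇒ternary-value (+ m) c (+ d) (+ 5 + + 8 * + t) root (inverse-m {{ℕ.>-nonZero 0<c}}) dm-c≡3 d≡ (+<+ 0<c) (+<+ (s≤s z≤n))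
    where
    t d : ℕ
    t = c / k
    d = 16 ℕ.+ 24 ℕ.* t
    a₀<k : a₀ ℕ.< k
    a₀<k = ℕ.<-≤-trans (ℕ.m<m+n a₀ {3} (s≤s z≤n)) (subst₂ ℕ._≤_ (sym a₀+3) (sym k≡) (ℕ.*-monoˡ-≤ m (ℕ.m≤m+n 16 8)))
    c≡ : c ≡ a₀ ℕ.+ t ℕ.* k
    c≡ = trans (m≡m%n+[m/n]*n c k) (cong (ℕ._+ t ℕ.* k) (trans c≈a₀ (m<n⇒m%n≡m a₀<k)))
    c+3 : c ℕ.+ 3 ≡ d ℕ.* m
    c+3 = trans (cong (ℕ._+ 3) c≡) (trans (ident₁ a₀ (t ℕ.* k)) (trans (cong₂ (λ x y → x ℕ.+ t ℕ.* y) a₀+3 k≡) (ident₂ m t)))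
      where
      ident₁ : ∀ a b → a ℕ.+ b ℕ.+ 3 ≡ a ℕ.+ 3 ℕ.+ b
      ident₁ = ℕRing.solve-∀
      ident₂ : ∀ m t → 16 ℕ.* m ℕ.+ t ℕ.* (24 ℕ.* m) ≡ (16 ℕ.+ 24 ℕ.* t) ℕ.* m
      ident₂ = ℕRing.solve-∀
    dm-c≡3 : + d * + m - + c ≡ + 3
    dm-c≡3 = trans (cong (_- + c) (trans (sym (pos-* d m)) (trans (cong +_ (sym c+3)) (pos-+ c 3)))) (ident (+ c))
      where
      ident : ∀ c → c + + 3 - c ≡ + 3
      ident = solve-∀
    d≡ : + d ≡ + 3 * (+ 5 + + 8 * + t) + 1ℤ
    d≡ = trans (pos-+ 16 (24 ℕ.* t)) (trans (cong (_+_ (+ 16)) (pos-* 24 t)) (ident (+ t)))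
      where
      ident : ∀ t → + 16 + + 24 * t ≡ + 3 * (+ 5 + + 8 * t) + 1ℤ
      ident = solve 1 (λ t → con (+ 16) :+ con (+ 24) :* t := con (+ 3) :* (con (+ 5) :+ con (+ 8) :* t) :+ con 1ℤ) refl
    inverse-m : .{{_ : NonZero c}} → ∃ λ V → + c ∣ V * + m - 1ℤ
    inverse-m = let (v , p) = modular-inverse m c coprime-m in + v , p
      where
      coprime-m : Coprime m c
      coprime-m (p , q) = coprime (q , subst (_ ℕD.∣_) (sym k≡) (ℕD.∣n⇒∣m*n 24 p))

  -- Bounded search, as a natural number is at most its square. This decision is what allows the
  -- double negation to be removed.
  ternaryValue? : ∀ n → Dec (TernaryValue (+ n))
  ternaryValue? n = map′ found bounded (ℕ.anyUpTo? (λ x → ℕ.anyUpTo? (λ y → ℕ.anyUpTo? (λ z → n ℕ.≟ f x y z) (suc n)) (suc n)) (suc n))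
    where
    f : ℕ → ℕ → ℕ → ℕ
    f x y z = x ℕ.* x ℕ.+ y ℕ.* y ℕ.+ 3 ℕ.* (z ℕ.* z)
    Bounded : (ℕ → Set) → Set
    Bounded Q = ∃ λ x → x ℕ.< suc n × Q x
    Found : Set
    Found = Bounded λ x → Bounded λ y → Bounded λ z → n ≡ f x y z
    cast : ∀ x y z → + f x y z ≡ + x * + x + + y * + y + + 3 * (+ z * + z)
    cast x y z = trans (pos-+ (x ℕ.* x ℕ.+ y ℕ.* y) (3 ℕ.* (z ℕ.* z))) (cong₂ _+_ (trans (pos-+ (x ℕ.* x) (y ℕ.* y)) (cong₂ _+_ (pos-* x x) (pos-* y y)))
      (trans (pos-* 3 (z ℕ.* z)) (cong (_*_ (+ 3)) (pos-* z z))))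
    found : Found → TernaryValue (+ n)
    found (x , _ , y , _ , z , _ , e) = + x , + y , + z , trans (cong +_ e) (cast x y z)
    square-abs : ∀ x → x * x ≡ + ∣ x ∣ * + ∣ x ∣
    square-abs (+ _) = refl
    square-abs -[1+ _ ] = refl
    n≤n² : ∀ n → n ℕ.≤ n ℕ.* n
    n≤n² zero = z≤n
    n≤n² (suc n) = ℕ.m≤m*n (suc n) (suc n)
    bounded : TernaryValue (+ n) → Found
    bounded (x , y , z , e) = a , s≤s a≤n , b , s≤s b≤n , c , s≤s c≤n , e′
      where
      a b c : ℕ
      a = ∣ x ∣
      b = ∣ y ∣
      c = ∣ z ∣
      e′ : n ≡ f a b c
      e′ = +-injective (trans e (trans (cong₂ _+_ (cong₂ _+_ (square-abs x) (square-abs y)) (cong (_*_ (+ 3)) (square-abs z))) (sym (cast a b c))))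
      a≤n : a ℕ.≤ n
      a≤n = ℕ.≤-trans (n≤n² a) (subst (a ℕ.* a ℕ.≤_) (sym e′) (ℕ.≤-trans (ℕ.m≤m+n (a ℕ.* a) (b ℕ.* b)) (ℕ.m≤m+n (a ℕ.* a ℕ.+ b ℕ.* b) (3 ℕ.* (c ℕ.* c)))))
      b≤n : b ℕ.≤ n
      b≤n = ℕ.≤-trans (n≤n² b) (subst (b ℕ.* b ℕ.≤_) (sym e′) (ℕ.≤-trans (ℕ.m≤n+m (b ℕ.* b) (a ℕ.* a)) (ℕ.m≤m+n (a ℕ.* a ℕ.+ b ℕ.* b) (3 ℕ.* (c ℕ.* c)))))
      c≤n : c ℕ.≤ n
      c≤n = ℕ.≤-trans (n≤n² c) (subst (c ℕ.* c ℕ.≤_) (sym e′) (ℕ.≤-trans (ℕ.m≤n*m (c ℕ.* c) 3) (ℕ.m≤n+m (3 ℕ.* (c ℕ.* c)) (a ℕ.* a ℕ.+ b ℕ.* b))))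

-- Numbers prime to 3 as values of x² + y² + 3z².

module Ter where
  open Lagrange using (even⊎odd)
  open Positivity using (strip)
  open Existence
  open Reduction using (TernaryValue)
  open Roots
  open import Data.Nat.Base as ℕ using (ℕ; zero; suc; s≤s; z≤n; NonZero; _^_)
  import Data.Nat.Properties as ℕ
  open import Data.Nat.Divisibility as ℕD using (divides)
  open import Data.Nat.Primality using (Prime; prime⇒irreducible; prime?)
  open import Data.Nat.Primality.Factorisation using (factorise; PrimeFactorisation)
  open import Data.Nat.ListAction using (product)
  open import Data.Nat.Coprimality using (Coprime)
  open import Data.Nat.Induction using (<-wellFounded)
  import Data.Nat.Tactic.RingSolver as ℕRing
  open import Data.Integer.Base hiding (suc; pred; NonZero; _^_)
  open import Data.Integer.Properties
  open import Data.Integer.Divisibility.Signed using (_∣_; ∣⇒∣ᵤ)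
  open import Data.Product using (_×_; _,_; ∃)
  open import Data.Sum using (_⊎_; inj₁; inj₂)
  open import Relation.Nullary using (¬_; contradiction)
  open import Relation.Nullary.Decidable using (decidable-stable; from-yes)
  open import Relation.Binary.PropositionalEquality

  ∤24m⇒∤2 : ∀ q m → ¬ q ℕD.∣ 24 ℕ.* m → ¬ + q ∣ + 2
  ∤24m⇒∤2 q m q∤ d = q∤ (ℕD.∣m⇒∣m*n m (ℕD.∣-trans (∣⇒∣ᵤ d) (divides 12 refl)))

  ∤24m⇒∤3m : ∀ q m → ¬ q ℕD.∣ 24 ℕ.* m → ¬ + q ∣ + 3 * + m
  ∤24m⇒∤3m q m q∤ d = q∤ (ℕD.∣-trans (∣⇒∣ᵤ (subst (+ q ∣_) (sym (pos-* 3 m)) d)) (divides 8 (ident m)))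
    where
    ident : ∀ m → 24 ℕ.* m ≡ 8 ℕ.* (3 ℕ.* m)
    ident = ℕRing.solve-∀

  -- The goal is decidable, hence stable, so a modulus `c` known only under a double negation may be
  -- used to reach it.
  split⇒ternary : ∀ {m k a₀} .{{_ : NonZero k}} → k ≡ 24 ℕ.* m → a₀ ℕ.+ 3 ≡ 16 ℕ.* m → (C : SplittingCharacter m k a₀) →
    (∀ q → Prime q → SplittingCharacter.χ C q ≡ 1ℤ → ∃ λ b → + q ∣ + b * + b + + 3 * + m) → TernaryValue (+ m)
  split⇒ternary {m} {k} {a₀} k≡ a₀+3 C split⇒root = decidable-stable (ternaryValue? m) λ ¬t → existence λ p → ¬t (modulus p)
    where
    open SplittingCharacter C
    open SplitPrimes C

    M : ℤ
    M = + 3 * + m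

    good-root : ∀ c → Good c → Root M c
    good-root zero (() , _)
    good-root c@(suc _) (_ , h) = subst (Root M) (sym isFactorisation) (product-root M factors factorsPrime local)
      where
      open PrimeFactorisation (factorise c)
      local : ∀ q → Prime q → q ℕD.∣ product factors → (¬ + q ∣ + 2) × (¬ + q ∣ M) × Root M q
      local q pr d = ∤24m⇒∤2 q m q∤24m , ∤24m⇒∤3m q m q∤24m , root (split⇒root q pr χ≡1)
        where
        χ≡1 : χ q ≡ 1ℤ
        χ≡1 = h q pr (subst (q ℕD.∣_) (sym isFactorisation) d)
        q∤24m : ¬ q ℕD.∣ 24 ℕ.* m
        q∤24m d = contradiction (trans (sym χ≡1) (χ-divisor q pr (subst (q ℕD.∣_) (sym k≡) d))) λ ()
        root : (∃ λ b → + q ∣ + b * + b + M) → Root M q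
        root (b , d) = + b , d

    modulus : P a₀ → TernaryValue (+ m)
    modulus (c , gc@(0<c , _) , c≈a₀) = modulus⇒ternary-value m k a₀ c k≡ a₀+3 0<c c≈a₀ (good-coprime gc) (good-root c gc)

  ternary : ∀ e ν → Coprime (QuadChar.odd ν) 3 → TernaryValue (+ (2 ^ e ℕ.* QuadChar.odd ν))
  ternary e ν c₃ = split⇒ternary {QuadChar.m e ν} {QuadChar.k e ν} {QuadChar.a₀ e ν} {{QuadChar.k≢0 e ν}} refl (QuadChar.a₀+3 e ν) character (QuadChar.split⇒root e ν)
    where
    character : SplittingCharacter (QuadChar.m e ν) (QuadChar.k e ν) (QuadChar.a₀ e ν) {{QuadChar.k≢0 e ν}}
    character = record
      { χ = QuadChar.χ e ν ; χ-* = QuadChar.χ-* e ν ; χ-periodic = QuadChar.χ-periodic e ν ; χ-bounded = QuadChar.χ-bounded e ν ; χ-divisor = QuadChar.χ-divisor e ν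
      ; χ-square = QuadChar.χ-square e ν ; χ-a₀ = QuadChar.χ-a₀ e ν c₃ ; root⇒split = QuadChar.root⇒split e ν
      ; 0<m = ℕ.n≢0⇒n>0 (QuadChar.m≢0 e ν) ; 0<a₀ = s≤s z≤n ; 2∣k = ℕD.∣-trans (divides 4 refl) (QuadChar.8∣k e ν) }

  ∤3⇒ternary : ∀ m → 0 ℕ.< m → ¬ 3 ℕD.∣ m → TernaryValue (+ m)
  ∤3⇒ternary m 0<m 3∤m = split (strip 2 m (s≤s (s≤s z≤n)) 0<m (<-wellFounded m))
    where
    split : (∃ λ e → ∃ λ M → m ≡ 2 ^ e ℕ.* M × ¬ 2 ℕD.∣ M) → TernaryValue (+ m)
    split (e , M , m≡ , 2∤M) = parity (even⊎odd M)
      where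
      parity : (∃ λ h → M ≡ h ℕ.+ h ⊎ M ≡ suc (h ℕ.+ h)) → TernaryValue (+ m)
      parity (h , inj₁ M≡) = contradiction (divides h (trans M≡ (ident h))) 2∤M
        where
        ident : ∀ h → h ℕ.+ h ≡ h ℕ.* 2
        ident = ℕRing.solve-∀
      parity (ν , inj₂ M≡) = subst (λ n → TernaryValue (+ n)) (sym m≡′) (ternary e ν coprime)
        where
        m≡′ : m ≡ 2 ^ e ℕ.* QuadChar.odd ν
        m≡′ = trans m≡ (cong (ℕ._*_ (2 ^ e)) M≡)
        coprime : Coprime (QuadChar.odd ν) 3
        coprime {d} (d∣ν , d∣3) = go (prime⇒irreducible (from-yes (prime? 3)) d∣3)
          where
          go : d ≡ 1 ⊎ d ≡ 3 → d ≡ 1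
          go (inj₁ d≡1) = d≡1
          go (inj₂ refl) = contradiction (subst (3 ℕD.∣_) (sym m≡′) (ℕD.∣n⇒∣m*n (2 ^ e) d∣ν)) 3∤m

  ternary₊ : ∀ M r → 0 ℕ.< r → r ℕ.< 3 → TernaryValue (+ 3 * + M + + r)
  ternary₊ M r 0<r r<3 = subst TernaryValue (trans (pos-+ (3 ℕ.* M) r) (cong (_+ + r) (pos-* 3 M)))
    (∤3⇒ternary (3 ℕ.* M ℕ.+ r) (ℕ.<-≤-trans 0<r (ℕ.m≤n+m r (3 ℕ.* M))) λ d → ℕ.<⇒≱ r<3 (ℕD.∣⇒≤ {{ℕ.>-nonZero 0<r}} (ℕD.∣m+n∣m⇒∣n d (ℕD.m∣m*n M))))

  ternary₁ : ∀ M → TernaryValue (+ 3 * + M + 1ℤ)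
  ternary₁ M = ternary₊ M 1 (s≤s z≤n) (s≤s (s≤s z≤n))

  ternary₂ : ∀ M → TernaryValue (+ 3 * + M + + 2)
  ternary₂ M = ternary₊ M 2 (s≤s z≤n) (s≤s (s≤s (s≤s z≤n)))

-- The forms that rest on x² + y² + 3z².

module Ternary where
  open Arith
  open Units
  open Forms
  open Ter
  open import Data.Nat.Base as ℕ using (ℕ; zero; suc)
  import Data.Nat.Properties as ℕ
  open import Data.Integer.Base hiding (suc; pred; NonZero)
  open import Data.Integer.Properties
  open import Data.Integer.Tactic.RingSolver using (solve-∀)
  open import Data.Integer.Solver using (module +-*-Solver)
  open +-*-Solver using (solve; _:=_; _:+_; _:*_; _:-_; :-_; con)
  open import Data.Product using (_,_; ∃)
  open import Data.Sum using (_⊎_; inj₁; inj₂)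
  open import Relation.Nullary using (contradiction)
  open import Relation.Binary.PropositionalEquality

  TwoUnits OneUnit : ℤ → Set
  TwoUnits n = ∃ λ u → ∃ λ v → ∃ λ z → n ≡ unit² u + unit² v + + 3 * (z * z)
  OneUnit n = ∃ λ u → ∃ λ x → ∃ λ z → n ≡ unit² u + triple² x + + 3 * (z * z)

  -- Squares are 0 or 1 modulo 3, so the residue 2 forces `x` and `y` both to be prime to 3.
  two-units : ∀ M → TwoUnits (+ 3 * + M + + 2)
  two-units M = let (x , y , z , e) = ternary₂ M in go x y z e (by-mod3 x) (by-mod3 y)
    where
    go : ∀ x y z → + 3 * + M + + 2 ≡ square x + square y + + 3 * (z * z) → SquareMod3 x → SquareMod3 y → TwoUnits (+ 3 * + M + + 2)
    go _ _ z e (inj₁ (u , a)) (inj₁ (v , b)) = u , v , z , trans e (cong₂ (λ s t → s + t + + 3 * (z * z)) a b)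
    go _ _ z e (inj₁ (u , a)) (inj₂ (y , b)) = contradiction (trans e (cong₂ (λ s t → s + t + + 3 * (z * z)) a b))
      λ h → indivisible 3 1ℤ (+ 3 * (u * u) + + 2 * u + + 3 * (y * y) + z * z - + M) (linear 1ℤ h (ident (+ M) u y (z * z)))
      where
      ident : ∀ M u y z → 1ℤ - (+ 3 * (u * u) + + 2 * u + + 3 * (y * y) + z - M) * + 3
        ≡ 1ℤ * (+ 3 * M + + 2 - ((+ 3 * u + 1ℤ) * (+ 3 * u + 1ℤ) + + 9 * (y * y) + + 3 * z))
      ident = solve 4 (λ M u y z → con 1ℤ :- (con (+ 3) :* (u :* u) :+ con (+ 2) :* u :+ con (+ 3) :* (y :* y) :+ z :- M) :* con (+ 3)
          := con 1ℤ :* (con (+ 3) :* M :+ con (+ 2) :- ((con (+ 3) :* u :+ con 1ℤ) :* (con (+ 3) :* u :+ con 1ℤ) :+ con (+ 9) :* (y :* y) :+ con (+ 3) :* z))) refl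
    go _ _ z e (inj₂ (x , a)) (inj₁ (v , b)) = contradiction (trans e (cong₂ (λ s t → s + t + + 3 * (z * z)) a b))
      λ h → indivisible 3 1ℤ (+ 3 * (v * v) + + 2 * v + + 3 * (x * x) + z * z - + M) (linear 1ℤ h (ident (+ M) v x (z * z)))
      where
      ident : ∀ M u y z → 1ℤ - (+ 3 * (u * u) + + 2 * u + + 3 * (y * y) + z - M) * + 3
        ≡ 1ℤ * (+ 3 * M + + 2 - (+ 9 * (y * y) + (+ 3 * u + 1ℤ) * (+ 3 * u + 1ℤ) + + 3 * z))
      ident = solve 4 (λ M u y z → con 1ℤ :- (con (+ 3) :* (u :* u) :+ con (+ 2) :* u :+ con (+ 3) :* (y :* y) :+ z :- M) :* con (+ 3)
          := con 1ℤ :* (con (+ 3) :* M :+ con (+ 2) :- (con (+ 9) :* (y :* y) :+ (con (+ 3) :* u :+ con 1ℤ) :* (con (+ 3) :* u :+ con 1ℤ) :+ con (+ 3) :* z))) refl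
    go _ _ z e (inj₂ (x , a)) (inj₂ (y , b)) = contradiction (trans e (cong₂ (λ s t → s + t + + 3 * (z * z)) a b))
      λ h → indivisible 3 (+ 2) (+ 3 * (x * x) + + 3 * (y * y) + z * z - + M) (linear 1ℤ h (ident (+ M) (x * x) (y * y) (z * z)))
      where
      ident : ∀ M x y z → + 2 - (+ 3 * x + + 3 * y + z - M) * + 3 ≡ 1ℤ * (+ 3 * M + + 2 - (+ 9 * x + + 9 * y + + 3 * z))
      ident = solve 4 (λ M x y z → con (+ 2) :- (con (+ 3) :* x :+ con (+ 3) :* y :+ z :- M) :* con (+ 3)
          := con 1ℤ :* (con (+ 3) :* M :+ con (+ 2) :- (con (+ 9) :* x :+ con (+ 9) :* y :+ con (+ 3) :* z))) refl

  -- The residue 1 leaves exactly one of `x`, `y` prime to 3.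
  one-unit : ∀ M → OneUnit (+ 3 * + M + 1ℤ)
  one-unit M = let (x , y , z , e) = ternary₁ M in go x y z e (by-mod3 x) (by-mod3 y)
    where
    go : ∀ x y z → + 3 * + M + 1ℤ ≡ square x + square y + + 3 * (z * z) → SquareMod3 x → SquareMod3 y → OneUnit (+ 3 * + M + 1ℤ)
    go _ _ z e (inj₁ (u , a)) (inj₂ (y , b)) = u , y , z , trans e (cong₂ (λ s t → s + t + + 3 * (z * z)) a b)
    go _ _ z e (inj₂ (x , a)) (inj₁ (v , b)) = v , x , z , trans e (trans (cong₂ (λ s t → s + t + + 3 * (z * z)) a b) (cong (_+ + 3 * (z * z)) (+-comm (triple² x) (unit² v))))
    go _ _ z e (inj₁ (u , a)) (inj₁ (v , b)) = contradiction (trans e (cong₂ (λ s t → s + t + + 3 * (z * z)) a b))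
      λ h → indivisible 3 -1ℤ (+ 3 * (u * u) + + 2 * u + + 3 * (v * v) + + 2 * v + z * z - + M) (linear 1ℤ h (ident (+ M) u v (z * z)))
      where
      ident : ∀ M u v z → -1ℤ - (+ 3 * (u * u) + + 2 * u + + 3 * (v * v) + + 2 * v + z - M) * + 3
        ≡ 1ℤ * (+ 3 * M + 1ℤ - ((+ 3 * u + 1ℤ) * (+ 3 * u + 1ℤ) + (+ 3 * v + 1ℤ) * (+ 3 * v + 1ℤ) + + 3 * z))
      ident = solve 4 (λ M u v z → con -1ℤ :- (con (+ 3) :* (u :* u) :+ con (+ 2) :* u :+ con (+ 3) :* (v :* v) :+ con (+ 2) :* v :+ z :- M) :* con (+ 3)
          := con 1ℤ :* (con (+ 3) :* M :+ con 1ℤ :- ((con (+ 3) :* u :+ con 1ℤ) :* (con (+ 3) :* u :+ con 1ℤ) :+ (con (+ 3) :* v :+ con 1ℤ) :* (con (+ 3) :* v :+ con 1ℤ) :+ con (+ 3) :* z))) refl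
    go _ _ z e (inj₂ (x , a)) (inj₂ (y , b)) = contradiction (trans e (cong₂ (λ s t → s + t + + 3 * (z * z)) a b))
      λ h → indivisible 3 1ℤ (+ 3 * (x * x) + + 3 * (y * y) + z * z - + M) (linear 1ℤ h (ident (+ M) (x * x) (y * y) (z * z)))
      where
      ident : ∀ M x y z → 1ℤ - (+ 3 * x + + 3 * y + z - M) * + 3 ≡ 1ℤ * (+ 3 * M + 1ℤ - (+ 9 * x + + 9 * y + + 3 * z))
      ident = solve 4 (λ M x y z → con 1ℤ :- (con (+ 3) :* x :+ con (+ 3) :* y :+ z :- M) :* con (+ 3)
          := con 1ℤ :* (con (+ 3) :* M :+ con 1ℤ :- (con (+ 9) :* x :+ con (+ 9) :* y :+ con (+ 3) :* z))) refl

  Form₃ Form₄ Form₅ Form₆ Form₇ : ℤ → Set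
  Form₃ n = ∃ λ x → ∃ λ y → ∃ λ z → ∃ λ w → n ≡ + 18 * (x * x) + unit² y + unit² z + + 3 * unit² w
  Form₄ n = ∃ λ x → ∃ λ y → ∃ λ z → ∃ λ w → n ≡ + 9 * (x * x) + unit² y + + 2 * unit² z + + 3 * unit² w
  Form₅ n = ∃ λ x → ∃ λ y → ∃ λ z → ∃ λ w → n ≡ + 3 * (x * x) + + 18 * (y * y) + unit² z + unit² w
  Form₆ n = ∃ λ x → ∃ λ y → ∃ λ z → ∃ λ w → n ≡ + 3 * (x * x) + + 9 * (y * y) + unit² z + + 2 * unit² w
  Form₇ n = ∃ λ x → ∃ λ y → ∃ λ z → ∃ λ w → n ≡ + 3 * (x * x) + unit² y + unit² z + + 2 * unit² w

  form₅ : ∀ N → Form₅ (+ 3 * + N + + 2)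
  form₅ N = let (u , v , z , e) = two-units N in z , 0ℤ , u , v , trans e (ident (unit² u) (unit² v) (z * z))
    where
    ident : ∀ u v z → u + v + + 3 * z ≡ + 3 * z + + 18 * (0ℤ * 0ℤ) + u + v
    ident = solve 3 (λ u v z → u :+ v :+ con (+ 3) :* z := con (+ 3) :* z :+ con (+ 18) :* (con 0ℤ :* con 0ℤ) :+ u :+ v) refl

  form₇ : ∀ N → Form₇ (+ 3 * + N + + 4)
  -- The unit 1 with weight 2 is fixed by `w = 0`, which leaves the residue 2.
  form₇ N = let (u , v , z , e) = two-units N in z , u , v , 0ℤ , linear 1ℤ e (ident (+ N) (unit² u) (unit² v) (z * z))
    where
    ident : ∀ N u v z → + 3 * N + + 4 - (+ 3 * z + u + v + + 2 * ((+ 3 * 0ℤ + 1ℤ) * (+ 3 * 0ℤ + 1ℤ))) ≡ 1ℤ * (+ 3 * N + + 2 - (u + v + + 3 * z))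
    ident = solve 4 (λ N u v z → con (+ 3) :* N :+ con (+ 4) :- (con (+ 3) :* z :+ u :+ v :+ con (+ 2) :* ((con (+ 3) :* con 0ℤ :+ con 1ℤ) :* (con (+ 3) :* con 0ℤ :+ con 1ℤ)))
        := con 1ℤ :* (con (+ 3) :* N :+ con (+ 2) :- (u :+ v :+ con (+ 3) :* z))) refl

  data ℕMod3 : ℕ → Set where
    3m   : ∀ m → ℕMod3 (3 ℕ.* m)
    3m+1 : ∀ m → ℕMod3 (3 ℕ.* m ℕ.+ 1)
    3m+2 : ∀ m → ℕMod3 (3 ℕ.* m ℕ.+ 2)

  ℕmod3 : ∀ n → ℕMod3 n
  ℕmod3 0 = 3m 0
  ℕmod3 1 = 3m+1 0
  ℕmod3 2 = 3m+2 0
  ℕmod3 (suc (suc (suc n))) with ℕmod3 n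
  ... | 3m m = subst ℕMod3 (trans (ℕ.*-suc 3 m) refl) (3m (suc m))
  ... | 3m+1 m = subst ℕMod3 (cong (ℕ._+ 1) (ℕ.*-suc 3 m)) (3m+1 (suc m))
  ... | 3m+2 m = subst ℕMod3 (cong (ℕ._+ 2) (ℕ.*-suc 3 m)) (3m+2 (suc m))

  -- Everything is divided by 3, and `N + 2` or `N` is written as `t² + v² + 3z²`. For the first,
  -- `3t² = t² + 2t²`; for the second, `3t² + 6 = (t - 2)² + 2(t + 1)²`. The root `t` is a unit, or
  -- a multiple of 3 if `N ≡ 1 (mod 3)`.
  form₄ : ∀ N → Form₄ (+ 3 * + N + + 6)
  form₄ N with ℕmod3 N
  ... | 3m M = let (u , v , z , e) = two-units M in z , u , u , v ,
      linear₂ (+ 3) (+ 3) (pos-* 3 M) e (ident (+ (3 ℕ.* M)) (+ M) (unit² u) (unit² v) (z * z))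
    where
    ident : ∀ N M u v z → + 3 * N + + 6 - (+ 9 * z + u + + 2 * u + + 3 * v) ≡ + 3 * (N - + 3 * M) + + 3 * (+ 3 * M + + 2 - (u + v + + 3 * z))
    ident = solve 5 (λ N M u v z → con (+ 3) :* N :+ con (+ 6) :- (con (+ 9) :* z :+ u :+ con (+ 2) :* u :+ con (+ 3) :* v)
        := con (+ 3) :* (N :- con (+ 3) :* M) :+ con (+ 3) :* (con (+ 3) :* M :+ con (+ 2) :- (u :+ v :+ con (+ 3) :* z))) refl
  ... | 3m+2 M = let (u , v , z , e) = two-units M in z , - u , - u - 1ℤ , v ,
      linear₂ (+ 3) (+ 3) (trans (pos-+ (3 ℕ.* M) 2) (cong (_+ + 2) (pos-* 3 M))) e (ident (+ (3 ℕ.* M ℕ.+ 2)) (+ M) u (unit² v) (z * z))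
    where
    ident : ∀ N M u v z → + 3 * N + + 6 - (+ 9 * z + (+ 3 * - u + 1ℤ) * (+ 3 * - u + 1ℤ) + + 2 * ((+ 3 * (- u - 1ℤ) + 1ℤ) * (+ 3 * (- u - 1ℤ) + 1ℤ)) + + 3 * v)
      ≡ + 3 * (N - (+ 3 * M + + 2)) + + 3 * (+ 3 * M + + 2 - ((+ 3 * u + 1ℤ) * (+ 3 * u + 1ℤ) + v + + 3 * z))
    ident = solve 5 (λ N M u v z → con (+ 3) :* N :+ con (+ 6) :- (con (+ 9) :* z :+ (con (+ 3) :* :- u :+ con 1ℤ) :* (con (+ 3) :* :- u :+ con 1ℤ) :+ con (+ 2) :* ((con (+ 3) :* (:- u :- con 1ℤ) :+ con 1ℤ) :* (con (+ 3) :* (:- u :- con 1ℤ) :+ con 1ℤ)) :+ con (+ 3) :* v)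
        := con (+ 3) :* (N :- (con (+ 3) :* M :+ con (+ 2))) :+ con (+ 3) :* (con (+ 3) :* M :+ con (+ 2) :- ((con (+ 3) :* u :+ con 1ℤ) :* (con (+ 3) :* u :+ con 1ℤ) :+ v :+ con (+ 3) :* z))) refl
  ... | 3m+1 M = let (v , x , z , e) = one-unit M in z , x - 1ℤ , x , v ,
      linear₂ (+ 3) (+ 3) (trans (pos-+ (3 ℕ.* M) 1) (cong (_+ + 1) (pos-* 3 M))) e (ident (+ (3 ℕ.* M ℕ.+ 1)) (+ M) x (unit² v) (z * z))
    where
    ident : ∀ N M x v z → + 3 * N + + 6 - (+ 9 * z + (+ 3 * (x - 1ℤ) + 1ℤ) * (+ 3 * (x - 1ℤ) + 1ℤ) + + 2 * ((+ 3 * x + 1ℤ) * (+ 3 * x + 1ℤ)) + + 3 * v)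
      ≡ + 3 * (N - (+ 3 * M + 1ℤ)) + + 3 * (+ 3 * M + 1ℤ - (v + + 9 * (x * x) + + 3 * z))
    ident = solve 5 (λ N M x v z → con (+ 3) :* N :+ con (+ 6) :- (con (+ 9) :* z :+ (con (+ 3) :* (x :- con 1ℤ) :+ con 1ℤ) :* (con (+ 3) :* (x :- con 1ℤ) :+ con 1ℤ) :+ con (+ 2) :* ((con (+ 3) :* x :+ con 1ℤ) :* (con (+ 3) :* x :+ con 1ℤ)) :+ con (+ 3) :* v)
        := con (+ 3) :* (N :- (con (+ 3) :* M :+ con 1ℤ)) :+ con (+ 3) :* (con (+ 3) :* M :+ con 1ℤ :- (v :+ con (+ 9) :* (x :* x) :+ con (+ 3) :* z))) refl

  -- `form₄` for the predecessor of `N`, with `3(3w + 1)²` read as `3x²`; the remaining value 3 is 1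
  -- + 2.
  form₆ : ∀ N → Form₆ (+ 3 * + N + + 3)
  form₆ zero = 0ℤ , 0ℤ , 0ℤ , 0ℤ , refl
  form₆ (suc N) = let (x , y , z , w , e) = form₄ N in + 3 * w + 1ℤ , x , y , z ,
      linear₂ (+ 3) 1ℤ (pos-+ 1 N) e (ident (+ suc N) (+ N) (x * x) (unit² y) (unit² z) (unit² w))
    where
    ident : ∀ N′ N x y z w → + 3 * N′ + + 3 - (+ 3 * w + + 9 * x + y + + 2 * z) ≡ + 3 * (N′ - (1ℤ + N)) + 1ℤ * (+ 3 * N + + 6 - (+ 9 * x + y + + 2 * z + + 3 * w))
    ident = solve 6 (λ N′ N x y z w → con (+ 3) :* N′ :+ con (+ 3) :- (con (+ 3) :* w :+ con (+ 9) :* x :+ y :+ con (+ 2) :* z)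
        := con (+ 3) :* (N′ :- (con 1ℤ :+ N)) :+ con 1ℤ :* (con (+ 3) :* N :+ con (+ 6) :- (con (+ 9) :* x :+ y :+ con (+ 2) :* z :+ con (+ 3) :* w))) refl

  -- x² + 27z′² is invariant under multiplication of x + 3z′√-3 by a cube root of unity if x ≡ z′ (mod 2).
  three-units′ : ∀ M → (∀ t → + 3 * + M + + 2 - + 2 ≢ t * + 4) → (∀ t → + 3 * + M + + 2 - + 3 ≢ t * + 4) →
    ∃ λ u → ∃ λ v → ∃ λ w → + 3 * + M + + 2 ≡ unit² u + unit² v + + 3 * unit² w
  three-units′ M n≢2 n≢3 = let (u , v , z , e) = two-units M in go u v z e (by-mod3 z)
    where
    n = + 3 * + M + + 2
    Goal : Set
    Goal = ∃ λ u → ∃ λ v → ∃ λ w → n ≡ unit² u + unit² v + + 3 * unit² w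
    rotate : ∀ u v z s → z ≡ u + + 2 * s + 1ℤ → n ≡ unit² u + unit² v + + 27 * (z * z) → Goal
    -- With `U = 3u + 1` the new coordinates are, up to sign, `(U + 9z)/2` and
    -- `(U - 3z)/2 = -(3s + 1)`; both are units.
    rotate u v .(u + + 2 * s + 1ℤ) s refl e = - (+ 2 * u) - + 3 * s - + 2 , v , s , trans e (ident u s (unit² v))
      where
      ident : ∀ u s v → (+ 3 * u + 1ℤ) * (+ 3 * u + 1ℤ) + v + + 27 * ((u + + 2 * s + 1ℤ) * (u + + 2 * s + 1ℤ))
        ≡ (+ 3 * (- (+ 2 * u) - + 3 * s - + 2) + 1ℤ) * (+ 3 * (- (+ 2 * u) - + 3 * s - + 2) + 1ℤ) + v + + 3 * ((+ 3 * s + 1ℤ) * (+ 3 * s + 1ℤ))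
      ident = solve 3 (λ u s v → (con (+ 3) :* u :+ con 1ℤ) :* (con (+ 3) :* u :+ con 1ℤ) :+ v :+ con (+ 27) :* ((u :+ con (+ 2) :* s :+ con 1ℤ) :* (u :+ con (+ 2) :* s :+ con 1ℤ))
          := (con (+ 3) :* (:- (con (+ 2) :* u) :- con (+ 3) :* s :- con (+ 2)) :+ con 1ℤ) :* (con (+ 3) :* (:- (con (+ 2) :* u) :- con (+ 3) :* s :- con (+ 2)) :+ con 1ℤ) :+ v :+ con (+ 3) :* ((con (+ 3) :* s :+ con 1ℤ) :* (con (+ 3) :* s :+ con 1ℤ))) refl
    flip : ∀ v z s → v ≡ z + + 2 * s + 1ℤ → z ≡ v + + 2 * (- s - 1ℤ) + 1ℤ
    flip v z s h = linear -1ℤ h (ident v z s)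
      where
      ident : ∀ v z s → z - (v + + 2 * (- s - 1ℤ) + 1ℤ) ≡ -1ℤ * (v - (z + + 2 * s + 1ℤ))
      ident = solve 3 (λ v z s → z :- (v :+ con (+ 2) :* (:- s :- con 1ℤ) :+ con 1ℤ) := con -1ℤ :* (v :- (z :+ con (+ 2) :* s :+ con 1ℤ))) refl
    go₂ : ∀ u v z → n ≡ unit² u + unit² v + + 27 * (z * z) → (∃ λ t → u ≡ z + + 2 * t) ⊎ (∃ λ t → u ≡ z + + 2 * t + 1ℤ) →
      (∃ λ t → v ≡ z + + 2 * t) ⊎ (∃ λ t → v ≡ z + + 2 * t + 1ℤ) → Mod2 z → Goal
    go₂ u v z e (inj₂ (s , h)) _ _ = rotate u v z (- s - 1ℤ) (flip u z s h) e
    go₂ u v z e _ (inj₂ (s , h)) _ = rotate v u z (- s - 1ℤ) (flip v z s h) (trans e (cong (_+ + 27 * (z * z)) (+-comm (unit² u) (unit² v))))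
    -- Here neither unit has the parity of `z`: an even `z` with odd units gives 2 modulo 4, and in
    -- the next clause an odd `z` with even units gives 3.
    go₂ .(+ 2 * r + + 2 * a) .(+ 2 * r + + 2 * b) .(+ 2 * r) e (inj₁ (a , refl)) (inj₁ (b , refl)) (r , inj₁ refl) =
      contradiction (linear 1ℤ e (ident n r a b))
        (n≢2 (+ 9 * ((r + a) * (r + a)) + + 3 * (r + a) + + 9 * ((r + b) * (r + b)) + + 3 * (r + b) + + 27 * (r * r)))
      where
      ident : ∀ n r a b → n - + 2 - (+ 9 * ((r + a) * (r + a)) + + 3 * (r + a) + + 9 * ((r + b) * (r + b)) + + 3 * (r + b) + + 27 * (r * r)) * + 4
        ≡ 1ℤ * (n - ((+ 3 * (+ 2 * r + + 2 * a) + 1ℤ) * (+ 3 * (+ 2 * r + + 2 * a) + 1ℤ)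
          + (+ 3 * (+ 2 * r + + 2 * b) + 1ℤ) * (+ 3 * (+ 2 * r + + 2 * b) + 1ℤ) + + 27 * (+ 2 * r * (+ 2 * r))))
      ident = solve 4 (λ n r a b → n :- con (+ 2) :- (con (+ 9) :* ((r :+ a) :* (r :+ a)) :+ con (+ 3) :* (r :+ a) :+ con (+ 9) :* ((r :+ b) :* (r :+ b)) :+ con (+ 3) :* (r :+ b) :+ con (+ 27) :* (r :* r)) :* con (+ 4)
          := con 1ℤ :* (n :- ((con (+ 3) :* (con (+ 2) :* r :+ con (+ 2) :* a) :+ con 1ℤ) :* (con (+ 3) :* (con (+ 2) :* r :+ con (+ 2) :* a) :+ con 1ℤ) :+ (con (+ 3) :* (con (+ 2) :* r :+ con (+ 2) :* b) :+ con 1ℤ) :* (con (+ 3) :* (con (+ 2) :* r :+ con (+ 2) :* b) :+ con 1ℤ) :+ con (+ 27) :* (con (+ 2) :* r :* (con (+ 2) :* r))))) refl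
    go₂ .(+ 2 * r + 1ℤ + + 2 * a) .(+ 2 * r + 1ℤ + + 2 * b) .(+ 2 * r + 1ℤ) e (inj₁ (a , refl)) (inj₁ (b , refl)) (r , inj₂ refl) =
      contradiction (linear 1ℤ e (ident n r a b))
        (n≢3 ((+ 3 * (r + a) + + 2) * (+ 3 * (r + a) + + 2) + (+ 3 * (r + b) + + 2) * (+ 3 * (r + b) + + 2) + + 27 * (r * r) + + 27 * r + + 6))
      where
      ident : ∀ n r a b → n - + 3 - ((+ 3 * (r + a) + + 2) * (+ 3 * (r + a) + + 2) + (+ 3 * (r + b) + + 2) * (+ 3 * (r + b) + + 2) + + 27 * (r * r) + + 27 * r + + 6) * + 4
        ≡ 1ℤ * (n - ((+ 3 * (+ 2 * r + 1ℤ + + 2 * a) + 1ℤ) * (+ 3 * (+ 2 * r + 1ℤ + + 2 * a) + 1ℤ)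
          + (+ 3 * (+ 2 * r + 1ℤ + + 2 * b) + 1ℤ) * (+ 3 * (+ 2 * r + 1ℤ + + 2 * b) + 1ℤ) + + 27 * ((+ 2 * r + 1ℤ) * (+ 2 * r + 1ℤ))))
      ident = solve 4 (λ n r a b → n :- con (+ 3) :- ((con (+ 3) :* (r :+ a) :+ con (+ 2)) :* (con (+ 3) :* (r :+ a) :+ con (+ 2)) :+ (con (+ 3) :* (r :+ b) :+ con (+ 2)) :* (con (+ 3) :* (r :+ b) :+ con (+ 2)) :+ con (+ 27) :* (r :* r) :+ con (+ 27) :* r :+ con (+ 6)) :* con (+ 4)
          := con 1ℤ :* (n :- ((con (+ 3) :* (con (+ 2) :* r :+ con 1ℤ :+ con (+ 2) :* a) :+ con 1ℤ) :* (con (+ 3) :* (con (+ 2) :* r :+ con 1ℤ :+ con (+ 2) :* a) :+ con 1ℤ) :+ (con (+ 3) :* (con (+ 2) :* r :+ con 1ℤ :+ con (+ 2) :* b) :+ con 1ℤ) :* (con (+ 3) :* (con (+ 2) :* r :+ con 1ℤ :+ con (+ 2) :* b) :+ con 1ℤ) :+ con (+ 27) :* ((con (+ 2) :* r :+ con 1ℤ) :* (con (+ 2) :* r :+ con 1ℤ))))) refl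
    go : ∀ u v z → n ≡ unit² u + unit² v + + 3 * (z * z) → SquareMod3 z → Goal
    go u v z e (inj₁ (w , h)) = u , v , w , trans e (cong (λ t → unit² u + unit² v + + 3 * t) h)
    go u v z e (inj₂ (y , h)) = go₂ u v y (trans e (trans (cong (λ t → unit² u + unit² v + + 3 * t) h) (ident (unit² u) (unit² v) (y * y))))
      (parity u y) (parity v y) (mod2 y)
      where
      ident : ∀ u v y → u + v + + 3 * (+ 9 * y) ≡ u + v + + 27 * y
      ident = solve 3 (λ u v y → u :+ v :+ con (+ 3) :* (con (+ 9) :* y) := u :+ v :+ con (+ 27) :* y) refl

  -- For `M ≡ r (mod 4)` the excluded residues 2 and 3 of `3M + 2` read `3r ≡ 0` and `3r ≡ 1`, so
  -- that `r = 1` and `r = 2` qualify.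
  shifted : ∀ M m r → + M ≡ + 4 * m + r → (∀ t → + 3 * r ≢ t * + 4) → (∀ t → + 3 * r - 1ℤ ≢ t * + 4) →
    ∃ λ u → ∃ λ v → ∃ λ w → + 3 * + M + + 2 ≡ unit² u + unit² v + + 3 * unit² w
  shifted M m r e c₀ c₁ = three-units′ M
    (λ t h → c₀ (t - + 3 * m) (linear₂ 1ℤ (- + 3) h e (ident₀ (+ M) m r t)))
    (λ t h → c₁ (t - + 3 * m) (linear₂ 1ℤ (- + 3) h e (ident₁ (+ M) m r t)))
    where
    ident₀ : ∀ M m r t → + 3 * r - (t - + 3 * m) * + 4 ≡ 1ℤ * (+ 3 * M + + 2 - + 2 - t * + 4) + - + 3 * (M - (+ 4 * m + r))
    ident₀ = solve 4 (λ M m r t → con (+ 3) :* r :- (t :- con (+ 3) :* m) :* con (+ 4)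
        := con 1ℤ :* (con (+ 3) :* M :+ con (+ 2) :- con (+ 2) :- t :* con (+ 4)) :+ :- con (+ 3) :* (M :- (con (+ 4) :* m :+ r))) refl
    ident₁ : ∀ M m r t → + 3 * r - 1ℤ - (t - + 3 * m) * + 4 ≡ 1ℤ * (+ 3 * M + + 2 - + 3 - t * + 4) + - + 3 * (M - (+ 4 * m + r))
    ident₁ = solve 4 (λ M m r t → con (+ 3) :* r :- con 1ℤ :- (t :- con (+ 3) :* m) :* con (+ 4)
        := con 1ℤ :* (con (+ 3) :* M :+ con (+ 2) :- con (+ 3) :- t :* con (+ 4)) :+ :- con (+ 3) :* (M :- (con (+ 4) :* m :+ r))) refl

  mod4 : ∀ n → ∃ λ m → n ≡ 4 ℕ.* m ⊎ n ≡ 1 ℕ.+ 4 ℕ.* m ⊎ n ≡ 2 ℕ.+ 4 ℕ.* m ⊎ n ≡ 3 ℕ.+ 4 ℕ.* m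
  mod4 0 = 0 , inj₁ refl
  mod4 1 = 0 , inj₂ (inj₁ refl)
  mod4 2 = 0 , inj₂ (inj₂ (inj₁ refl))
  mod4 3 = 0 , inj₂ (inj₂ (inj₂ refl))
  mod4 (suc (suc (suc (suc n)))) with mod4 n
  ... | m , inj₁ refl = suc m , inj₁ (sym (ℕ.*-suc 4 m))
  ... | m , inj₂ (inj₁ refl) = suc m , inj₂ (inj₁ (cong (1 ℕ.+_) (sym (ℕ.*-suc 4 m))))
  ... | m , inj₂ (inj₂ (inj₁ refl)) = suc m , inj₂ (inj₂ (inj₁ (cong (2 ℕ.+_) (sym (ℕ.*-suc 4 m)))))
  ... | m , inj₂ (inj₂ (inj₂ refl)) = suc m , inj₂ (inj₂ (inj₂ (cong (3 ℕ.+_) (sym (ℕ.*-suc 4 m)))))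

  cast : ∀ r m → + (r ℕ.+ 4 ℕ.* m) ≡ + 4 * + m + + r
  cast r m = trans (pos-+ r (4 ℕ.* m)) (trans (cong (_+_ (+ r)) (pos-* 4 m)) (+-comm (+ r) (+ 4 * + m)))

  -- Subtracting 18 moves 3N + 5 from the classes 2, 3 modulo 4 to 0, 1.
  form₃ : ∀ N → Form₃ (+ 3 * + N + + 5)
  form₃ N with mod4 N
  ... | m , inj₁ refl = let (u , v , w , e) = shifted (1 ℕ.+ 4 ℕ.* m) (+ m) 1ℤ (cast 1 m) (λ t → indivisible 4 (+ 3) t) (λ t → indivisible 4 (+ 2) t) in
    0ℤ , u , v , w , linear₂ 1ℤ (- + 3) e (pos-+ 1 (4 ℕ.* m)) (ident (+ (4 ℕ.* m)) (+ (1 ℕ.+ 4 ℕ.* m)) (unit² u) (unit² v) (unit² w))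
    where
    ident : ∀ m M u v w → + 3 * m + + 5 - (+ 18 * (0ℤ * 0ℤ) + u + v + + 3 * w) ≡ 1ℤ * (+ 3 * M + + 2 - (u + v + + 3 * w)) + - + 3 * (M - (1ℤ + m))
    ident = solve 5 (λ m M u v w → con (+ 3) :* m :+ con (+ 5) :- (con (+ 18) :* (con 0ℤ :* con 0ℤ) :+ u :+ v :+ con (+ 3) :* w)
        := con 1ℤ :* (con (+ 3) :* M :+ con (+ 2) :- (u :+ v :+ con (+ 3) :* w)) :+ :- con (+ 3) :* (M :- (con 1ℤ :+ m))) refl
  ... | m , inj₂ (inj₁ refl) = let (u , v , w , e) = shifted (2 ℕ.+ 4 ℕ.* m) (+ m) (+ 2) (cast 2 m) (λ t → indivisible 4 (+ 6) t) (λ t → indivisible 4 (+ 5) t) in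
    0ℤ , u , v , w , linear₂ 1ℤ (- + 3) e (pos-+ 1 (1 ℕ.+ 4 ℕ.* m)) (ident (+ (1 ℕ.+ 4 ℕ.* m)) (+ (2 ℕ.+ 4 ℕ.* m)) (unit² u) (unit² v) (unit² w))
    where
    ident : ∀ m M u v w → + 3 * m + + 5 - (+ 18 * (0ℤ * 0ℤ) + u + v + + 3 * w) ≡ 1ℤ * (+ 3 * M + + 2 - (u + v + + 3 * w)) + - + 3 * (M - (1ℤ + m))
    ident = solve 5 (λ m M u v w → con (+ 3) :* m :+ con (+ 5) :- (con (+ 18) :* (con 0ℤ :* con 0ℤ) :+ u :+ v :+ con (+ 3) :* w)
        := con 1ℤ :* (con (+ 3) :* M :+ con (+ 2) :- (u :+ v :+ con (+ 3) :* w)) :+ :- con (+ 3) :* (M :- (con 1ℤ :+ m))) refl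
  -- The numbers 11 and 14 are too small for 18 to be subtracted: 11 = 4 + 4 + 3 and 14 = 1 + 1 +
  -- 12.
  ... | 0 , inj₂ (inj₂ (inj₁ refl)) = 0ℤ , -1ℤ , -1ℤ , 0ℤ , refl
  ... | 0 , inj₂ (inj₂ (inj₂ refl)) = 0ℤ , 0ℤ , 0ℤ , -1ℤ , refl
  ... | suc m , inj₂ (inj₂ (inj₁ refl)) = let (u , v , w , e) = shifted (1 ℕ.+ 4 ℕ.* m) (+ m) (+ 1) (cast 1 m) (λ t → indivisible 4 (+ 3) t) (λ t → indivisible 4 (+ 2) t) in
    1ℤ , u , v , w , linear₂ 1ℤ (+ 3) e (trans (cast 2 (suc m)) (trans (cong (λ z → + 4 * z + + 2) (pos-+ 1 m)) (trans (ident₁ (+ m)) (cong (_+_ (+ 5)) (sym (cast 1 m))))))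
      (ident (+ (2 ℕ.+ 4 ℕ.* suc m)) (+ (1 ℕ.+ 4 ℕ.* m)) (unit² u) (unit² v) (unit² w))
    where
    ident₁ : ∀ m → + 4 * (1ℤ + m) + + 2 ≡ + 5 + (+ 4 * m + + 1)
    ident₁ = solve 1 (λ m → con (+ 4) :* (con 1ℤ :+ m) :+ con (+ 2) := con (+ 5) :+ (con (+ 4) :* m :+ con (+ 1))) refl
    ident : ∀ N M u v w → + 3 * N + + 5 - (+ 18 * (1ℤ * 1ℤ) + u + v + + 3 * w) ≡ 1ℤ * (+ 3 * M + + 2 - (u + v + + 3 * w)) + + 3 * (N - (+ 5 + M))
    ident = solve-∀
  ... | suc m , inj₂ (inj₂ (inj₂ refl)) = let (u , v , w , e) = shifted (2 ℕ.+ 4 ℕ.* m) (+ m) (+ 2) (cast 2 m) (λ t → indivisible 4 (+ 6) t) (λ t → indivisible 4 (+ 5) t) in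
    1ℤ , u , v , w , linear₂ 1ℤ (+ 3) e (trans (cast 3 (suc m)) (trans (cong (λ z → + 4 * z + + 3) (pos-+ 1 m)) (trans (ident₁ (+ m)) (cong (_+_ (+ 5)) (sym (cast 2 m))))))
      (ident (+ (3 ℕ.+ 4 ℕ.* suc m)) (+ (2 ℕ.+ 4 ℕ.* m)) (unit² u) (unit² v) (unit² w))
    where
    ident₁ : ∀ m → + 4 * (1ℤ + m) + + 3 ≡ + 5 + (+ 4 * m + + 2)
    ident₁ = solve 1 (λ m → con (+ 4) :* (con 1ℤ :+ m) :+ con (+ 3) := con (+ 5) :+ (con (+ 4) :* m :+ con (+ 2))) refl
    ident : ∀ N M u v w → + 3 * N + + 5 - (+ 18 * (1ℤ * 1ℤ) + u + v + + 3 * w) ≡ 1ℤ * (+ 3 * M + + 2 - (u + v + + 3 * w)) + + 3 * (N - (+ 5 + M))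
    ident = solve-∀

-- Polygonal numbers and completed squares.

module Polygonal where
  open import Defs
  open Arith
  open Units
  open Forms
  open Forms24
  open Form8
  open import Data.Nat.Base as ℕ using (ℕ; zero; suc)
  import Data.Nat.Properties as ℕ
  open import Data.Integer.Base hiding (suc; pred; NonZero)
  open import Data.Integer.Properties
  open import Data.Integer.DivMod using (_/_; _%_; n%d<d; a≡a%n+[a/n]*n)
  open import Data.Integer.Tactic.RingSolver using (solve-∀)
  open import Data.Integer.Solver using (module +-*-Solver)
  open +-*-Solver using (solve; _:=_; _:+_; _:*_; _:-_; :-_; con)
  open import Data.Product using (_,_)
  open import Relation.Nullary using (contradiction)
  open import Relation.Binary.PropositionalEquality

  -- The integer division in `p` is evaluated through a known half of the numerator; the remainder 1
  -- is refuted by parity.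
  halve : ∀ n y → n ≡ + 2 * y → n / + 2 ≡ y
  halve n y e with n % + 2 | n%d<d n (+ 2) | n / + 2 | a≡a%n+[a/n]*n n (+ 2)
  ... | 0 | _ | q | e′ = *-cancelˡ-≡ (+ 2) q y (linear₂ 1ℤ -1ℤ e e′ (ident n y q))
    where
    ident : ∀ n y q → + 2 * q - + 2 * y ≡ 1ℤ * (n - + 2 * y) + -1ℤ * (n - (+ 0 + q * + 2))
    ident = solve 3 (λ n y q → con (+ 2) :* q :- con (+ 2) :* y
        := con 1ℤ :* (n :- con (+ 2) :* y) :+ con -1ℤ :* (n :- (con (+ 0) :+ q :* con (+ 2)))) refl
  ... | 1 | _ | q | e′ = contradiction (linear₂ 1ℤ -1ℤ e e′ (ident n y q)) (indivisible 2 1ℤ (y - q))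
    where
    ident : ∀ n y q → 1ℤ - (y - q) * + 2 ≡ 1ℤ * (n - + 2 * y) + -1ℤ * (n - (+ 1 + q * + 2))
    ident = solve 3 (λ n y q → con 1ℤ :- (y :- q) :* con (+ 2)
        := con 1ℤ :* (n :- con (+ 2) :* y) :+ con -1ℤ :* (n :- (con (+ 1) :+ q :* con (+ 2)))) refl
  ... | suc (suc _) | ℕ.s≤s (ℕ.s≤s ()) | _ | _

  p4-square : ∀ x → p 4 x ≡ x * x
  p4-square x = halve ((+ 4 - + 2) * x * x - (+ 4 - + 4) * x) (x * x) (ident x)
    where
    ident : ∀ x → + 2 * x * x - 0ℤ * x ≡ + 2 * (x * x)
    ident = solve-∀

  p8-square : ∀ x → + 3 * p 8 x + 1ℤ ≡ unit² (- x)
  p8-square x = trans (cong (λ t → + 3 * t + 1ℤ) (halve ((+ 8 - + 2) * x * x - (+ 8 - + 4) * x) (+ 3 * (x * x) - + 2 * x) (ident x))) (ident′ x)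
    where
    ident : ∀ x → + 6 * x * x - + 4 * x ≡ + 2 * (+ 3 * (x * x) - + 2 * x)
    ident = solve 1 (λ x → con (+ 6) :* x :* x :- con (+ 4) :* x := con (+ 2) :* (con (+ 3) :* (x :* x) :- con (+ 2) :* x)) refl
    ident′ : ∀ x → + 3 * (+ 3 * (x * x) - + 2 * x) + 1ℤ ≡ (+ 3 * - x + 1ℤ) * (+ 3 * - x + 1ℤ)
    ident′ = solve-∀

  p3-square : ∀ x → + 8 * p 3 x + 1ℤ ≡ odd² x
  p3-square x with half-product x 0ℤ
  ... | y , e = trans (cong (λ t → + 8 * t + 1ℤ) (halve ((+ 3 - + 2) * x * x - (+ 3 - + 4) * x) y (trans (ident x) e))) (linear (- + 4) e (ident′ x y))
    where
    ident : ∀ x → 1ℤ * x * x - -1ℤ * x ≡ x * (x + + 2 * 0ℤ + 1ℤ)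
    ident = solve 1 (λ x → con 1ℤ :* x :* x :- con -1ℤ :* x := x :* (x :+ con (+ 2) :* con 0ℤ :+ con 1ℤ)) refl
    ident′ : ∀ x y → + 8 * y + 1ℤ - (+ 2 * x + 1ℤ) * (+ 2 * x + 1ℤ) ≡ - + 4 * (x * (x + + 2 * 0ℤ + 1ℤ) - + 2 * y)
    ident′ = solve-∀

  p5-square : ∀ x → + 24 * p 5 x + 1ℤ ≡ sixth² (- x)
  p5-square x with half-product x (x - 1ℤ)
  ... | y , e = trans (cong (λ t → + 24 * t + 1ℤ) (halve ((+ 5 - + 2) * x * x - (+ 5 - + 4) * x) y (trans (ident x) e))) (linear (- + 12) e (ident′ x y))
    where
    ident : ∀ x → + 3 * x * x - 1ℤ * x ≡ x * (x + + 2 * (x - 1ℤ) + 1ℤ)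
    ident = solve 1 (λ x → con (+ 3) :* x :* x :- con 1ℤ :* x := x :* (x :+ con (+ 2) :* (x :- con 1ℤ) :+ con 1ℤ)) refl
    ident′ : ∀ x y → + 24 * y + 1ℤ - (+ 6 * - x + 1ℤ) * (+ 6 * - x + 1ℤ) ≡ - + 12 * (x * (x + + 2 * (x - 1ℤ) + 1ℤ) - + 2 * y)
    ident′ = solve-∀

  unit-p8 : ∀ u → unit² u ≡ + 3 * p 8 (- u) + 1ℤ
  unit-p8 u = sym (trans (p8-square (- u)) (cong unit² (neg-involutive u)))

  sixth-p5 : ∀ u → sixth² u ≡ + 24 * p 5 (- u) + 1ℤ
  sixth-p5 u = sym (trans (p5-square (- u)) (cong sixth² (neg-involutive u)))

  odd-p3 : ∀ u → odd² u ≡ + 8 * p 3 u + 1ℤ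
  odd-p3 u = sym (p3-square u)

  square-p4 : ∀ u → u * u ≡ p 4 u
  square-p4 u = sym (p4-square u)

  -- A factor of at least 2 is essential: with it, `P ≤ -1` makes the square at most -1.
  nonneg-from-square : ∀ k P s → + suc (suc k) * P + 1ℤ ≡ s → 0ℤ ≤ s → 0ℤ ≤ P
  nonneg-from-square k (+ n) s e h = 0≤+
  nonneg-from-square k P@(-[1+ n ]) _ refl h = contradiction (≤-trans h
    (+-monoˡ-≤ 1ℤ (≤-trans (*-monoˡ-≤-nonNeg (+ suc (suc k)) { -[1+ n ]} { -1ℤ} (-≤- ℕ.z≤n)) (≤-reflexive (*-comm (+ suc (suc k)) -1ℤ))))) (below-zero k)
    where
    below-zero : ∀ k → 0ℤ ≰ -1ℤ * + suc (suc k) + 1ℤ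
    below-zero zero ()
    below-zero (suc k) ()

  0≤p3 : ∀ x → 0ℤ ≤ p 3 x
  0≤p3 x = nonneg-from-square 6 (p 3 x) (odd² x) (p3-square x) (0≤sq (+ 2 * x + 1ℤ))

  0≤p4 : ∀ x → 0ℤ ≤ p 4 x
  0≤p4 x = subst (0ℤ ≤_) (sym (p4-square x)) (0≤sq x)

  0≤p5 : ∀ x → 0ℤ ≤ p 5 x
  0≤p5 x = nonneg-from-square 22 (p 5 x) (sixth² (- x)) (p5-square x) (0≤sq (+ 6 * - x + 1ℤ))

  0≤p8 : ∀ x → 0ℤ ≤ p 8 x
  0≤p8 x = nonneg-from-square 1 (p 8 x) (unit² (- x)) (p8-square x) (0≤sq (+ 3 * - x + 1ℤ))

  0≤sum4 : ∀ a r b s c t d u → (∀ x → 0ℤ ≤ p r x) → (∀ x → 0ℤ ≤ p s x) → (∀ x → 0ℤ ≤ p t x) → (∀ x → 0ℤ ≤ p u x) →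
    ∀ h l m n → 0ℤ ≤ sum4 a r b s c t d u h l m n
  0≤sum4 a r b s c t d u hr hs ht hu h l m n =
    0≤+-both (0≤+-both (0≤+-both (0≤* (+ a) (p r h) 0≤+ (hr h)) (0≤* (+ b) (p s l) 0≤+ (hs l))) (0≤* (+ c) (p t m) 0≤+ (ht m))) (0≤* (+ d) (p u n) 0≤+ (hu n))

-- The thirteen sums.

module Sums where
  open import Defs
  open Arith
  open Units
  open Forms
  open Forms24
  open Form8
  open Ternary
  open Polygonal
  open import Data.Nat.Base using (suc)
  open import Data.Integer.Base hiding (suc; pred; NonZero)
  open import Data.Integer.Properties
  open import Data.Integer.Solver using (module +-*-Solver)
  open +-*-Solver using (solve; _:=_; _:+_; _:*_; _:-_; :-_; con)
  open import Data.Product using (_,_)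
  open import Relation.Binary.PropositionalEquality

  divide : ∀ k l {a b c d} → a ≡ b → + suc k * c - + suc k * d ≡ l * (a - b) → c ≡ d
  divide k l {c = c} {d} e h = *-cancelˡ-≡ (+ suc k) c d (linear l e h)

  sum4-unfold : ∀ a r b s c t d u h l m n → sum4 a r b s c t d u h l m n ≡ + a * p r h + + b * p s l + + c * p t m + + d * p u n
  sum4-unfold a r b s c t d u h l m n = refl

  -- The constant 4 is 1 + 1 + 2, from `3p₈ + 1` with these weights. In the sums scaled by 24 a
  -- weight `a` contributes `3a` for p₃, `a` for p₅ and `8a` for p₈.
  universal₁ : Universal 6 4 1 8 1 8 2 8
  universal₁ = 0≤sum4 6 4 1 8 1 8 2 8 0≤p4 0≤p8 0≤p8 0≤p8 , λ N → let (x , y , z , w , e) = form₁ N in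
    x , - y , - z , - w , trans (sum4-unfold 6 4 1 8 1 8 2 8 x (- y) (- z) (- w))
      (solved (+ N) (p 4 x) (p 8 (- y)) (p 8 (- z)) (p 8 (- w)) (x * x) (unit² y) (unit² z) (unit² w) e (square-p4 x) (unit-p8 y) (unit-p8 z) (unit-p8 w))
    where
    ident : ∀ N P Q R S → + 3 * (+ 6 * P + + 1 * Q + + 1 * R + + 2 * S) - + 3 * N ≡ -1ℤ * (+ 3 * N + + 4 - (+ 18 * P + (+ 3 * Q + 1ℤ) + (+ 3 * R + 1ℤ) + + 2 * (+ 3 * S + 1ℤ)))
    ident = solve 5 (λ N P Q R S → con (+ 3) :* (con (+ 6) :* P :+ con (+ 1) :* Q :+ con (+ 1) :* R :+ con (+ 2) :* S) :- con (+ 3) :* N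
        := con -1ℤ :* (con (+ 3) :* N :+ con (+ 4) :- (con (+ 18) :* P :+ (con (+ 3) :* Q :+ con 1ℤ) :+ (con (+ 3) :* R :+ con 1ℤ) :+ con (+ 2) :* (con (+ 3) :* S :+ con 1ℤ)))) refl
    -- The polygonal values are abstracted to variables, so that only a linear relation is left for
    -- the solver.
    solved : ∀ N P Q R S X Y Z W → + 3 * N + + 4 ≡ + 18 * X + Y + Z + + 2 * W → X ≡ P → Y ≡ + 3 * Q + 1ℤ → Z ≡ + 3 * R + 1ℤ → W ≡ + 3 * S + 1ℤ → + 6 * P + + 1 * Q + + 1 * R + + 2 * S ≡ N
    solved N P Q R S _ _ _ _ e refl refl refl refl = divide 2 -1ℤ e (ident N P Q R S)

  universal₂ : Universal 3 4 1 8 2 8 2 8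
  universal₂ = 0≤sum4 3 4 1 8 2 8 2 8 0≤p4 0≤p8 0≤p8 0≤p8 , λ N → let (x , y , z , w , e) = form₂ N in
    x , - y , - z , - w , trans (sum4-unfold 3 4 1 8 2 8 2 8 x (- y) (- z) (- w))
      (solved (+ N) (p 4 x) (p 8 (- y)) (p 8 (- z)) (p 8 (- w)) (x * x) (unit² y) (unit² z) (unit² w) e (square-p4 x) (unit-p8 y) (unit-p8 z) (unit-p8 w))
    where
    ident : ∀ N P Q R S → + 3 * (+ 3 * P + + 1 * Q + + 2 * R + + 2 * S) - + 3 * N ≡ -1ℤ * (+ 3 * N + + 5 - (+ 9 * P + (+ 3 * Q + 1ℤ) + + 2 * (+ 3 * R + 1ℤ) + + 2 * (+ 3 * S + 1ℤ)))
    ident = solve 5 (λ N P Q R S → con (+ 3) :* (con (+ 3) :* P :+ con (+ 1) :* Q :+ con (+ 2) :* R :+ con (+ 2) :* S) :- con (+ 3) :* N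
        := con -1ℤ :* (con (+ 3) :* N :+ con (+ 5) :- (con (+ 9) :* P :+ (con (+ 3) :* Q :+ con 1ℤ) :+ con (+ 2) :* (con (+ 3) :* R :+ con 1ℤ) :+ con (+ 2) :* (con (+ 3) :* S :+ con 1ℤ)))) refl
    solved : ∀ N P Q R S X Y Z W → + 3 * N + + 5 ≡ + 9 * X + Y + + 2 * Z + + 2 * W → X ≡ P → Y ≡ + 3 * Q + 1ℤ → Z ≡ + 3 * R + 1ℤ → W ≡ + 3 * S + 1ℤ → + 3 * P + + 1 * Q + + 2 * R + + 2 * S ≡ N
    solved N P Q R S _ _ _ _ e refl refl refl refl = divide 2 -1ℤ e (ident N P Q R S)

  universal₃ : Universal 6 4 1 8 1 8 3 8
  universal₃ = 0≤sum4 6 4 1 8 1 8 3 8 0≤p4 0≤p8 0≤p8 0≤p8 , λ N → let (x , y , z , w , e) = form₃ N in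
    x , - y , - z , - w , trans (sum4-unfold 6 4 1 8 1 8 3 8 x (- y) (- z) (- w))
      (solved (+ N) (p 4 x) (p 8 (- y)) (p 8 (- z)) (p 8 (- w)) (x * x) (unit² y) (unit² z) (unit² w) e (square-p4 x) (unit-p8 y) (unit-p8 z) (unit-p8 w))
    where
    ident : ∀ N P Q R S → + 3 * (+ 6 * P + + 1 * Q + + 1 * R + + 3 * S) - + 3 * N ≡ -1ℤ * (+ 3 * N + + 5 - (+ 18 * P + (+ 3 * Q + 1ℤ) + (+ 3 * R + 1ℤ) + + 3 * (+ 3 * S + 1ℤ)))
    ident = solve 5 (λ N P Q R S → con (+ 3) :* (con (+ 6) :* P :+ con (+ 1) :* Q :+ con (+ 1) :* R :+ con (+ 3) :* S) :- con (+ 3) :* N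
        := con -1ℤ :* (con (+ 3) :* N :+ con (+ 5) :- (con (+ 18) :* P :+ (con (+ 3) :* Q :+ con 1ℤ) :+ (con (+ 3) :* R :+ con 1ℤ) :+ con (+ 3) :* (con (+ 3) :* S :+ con 1ℤ)))) refl
    solved : ∀ N P Q R S X Y Z W → + 3 * N + + 5 ≡ + 18 * X + Y + Z + + 3 * W → X ≡ P → Y ≡ + 3 * Q + 1ℤ → Z ≡ + 3 * R + 1ℤ → W ≡ + 3 * S + 1ℤ → + 6 * P + + 1 * Q + + 1 * R + + 3 * S ≡ N
    solved N P Q R S _ _ _ _ e refl refl refl refl = divide 2 -1ℤ e (ident N P Q R S)

  universal₄ : Universal 3 4 1 8 2 8 3 8
  universal₄ = 0≤sum4 3 4 1 8 2 8 3 8 0≤p4 0≤p8 0≤p8 0≤p8 , λ N → let (x , y , z , w , e) = form₄ N in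
    x , - y , - z , - w , trans (sum4-unfold 3 4 1 8 2 8 3 8 x (- y) (- z) (- w))
      (solved (+ N) (p 4 x) (p 8 (- y)) (p 8 (- z)) (p 8 (- w)) (x * x) (unit² y) (unit² z) (unit² w) e (square-p4 x) (unit-p8 y) (unit-p8 z) (unit-p8 w))
    where
    ident : ∀ N P Q R S → + 3 * (+ 3 * P + + 1 * Q + + 2 * R + + 3 * S) - + 3 * N ≡ -1ℤ * (+ 3 * N + + 6 - (+ 9 * P + (+ 3 * Q + 1ℤ) + + 2 * (+ 3 * R + 1ℤ) + + 3 * (+ 3 * S + 1ℤ)))
    ident = solve 5 (λ N P Q R S → con (+ 3) :* (con (+ 3) :* P :+ con (+ 1) :* Q :+ con (+ 2) :* R :+ con (+ 3) :* S) :- con (+ 3) :* N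
        := con -1ℤ :* (con (+ 3) :* N :+ con (+ 6) :- (con (+ 9) :* P :+ (con (+ 3) :* Q :+ con 1ℤ) :+ con (+ 2) :* (con (+ 3) :* R :+ con 1ℤ) :+ con (+ 3) :* (con (+ 3) :* S :+ con 1ℤ)))) refl
    solved : ∀ N P Q R S X Y Z W → + 3 * N + + 6 ≡ + 9 * X + Y + + 2 * Z + + 3 * W → X ≡ P → Y ≡ + 3 * Q + 1ℤ → Z ≡ + 3 * R + 1ℤ → W ≡ + 3 * S + 1ℤ → + 3 * P + + 1 * Q + + 2 * R + + 3 * S ≡ N
    solved N P Q R S _ _ _ _ e refl refl refl refl = divide 2 -1ℤ e (ident N P Q R S)

  universal₅ : Universal 1 4 6 4 1 8 1 8
  universal₅ = 0≤sum4 1 4 6 4 1 8 1 8 0≤p4 0≤p4 0≤p8 0≤p8 , λ N → let (x , y , z , w , e) = form₅ N in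
    x , y , - z , - w , trans (sum4-unfold 1 4 6 4 1 8 1 8 x y (- z) (- w))
      (solved (+ N) (p 4 x) (p 4 y) (p 8 (- z)) (p 8 (- w)) (x * x) (y * y) (unit² z) (unit² w) e (square-p4 x) (square-p4 y) (unit-p8 z) (unit-p8 w))
    where
    ident : ∀ N P Q R S → + 3 * (+ 1 * P + + 6 * Q + + 1 * R + + 1 * S) - + 3 * N ≡ -1ℤ * (+ 3 * N + + 2 - (+ 3 * P + + 18 * Q + (+ 3 * R + 1ℤ) + (+ 3 * S + 1ℤ)))
    ident = solve 5 (λ N P Q R S → con (+ 3) :* (con (+ 1) :* P :+ con (+ 6) :* Q :+ con (+ 1) :* R :+ con (+ 1) :* S) :- con (+ 3) :* N
        := con -1ℤ :* (con (+ 3) :* N :+ con (+ 2) :- (con (+ 3) :* P :+ con (+ 18) :* Q :+ (con (+ 3) :* R :+ con 1ℤ) :+ (con (+ 3) :* S :+ con 1ℤ)))) refl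
    solved : ∀ N P Q R S X Y Z W → + 3 * N + + 2 ≡ + 3 * X + + 18 * Y + Z + W → X ≡ P → Y ≡ Q → Z ≡ + 3 * R + 1ℤ → W ≡ + 3 * S + 1ℤ → + 1 * P + + 6 * Q + + 1 * R + + 1 * S ≡ N
    solved N P Q R S _ _ _ _ e refl refl refl refl = divide 2 -1ℤ e (ident N P Q R S)

  universal₆ : Universal 1 4 3 4 1 8 2 8
  universal₆ = 0≤sum4 1 4 3 4 1 8 2 8 0≤p4 0≤p4 0≤p8 0≤p8 , λ N → let (x , y , z , w , e) = form₆ N in
    x , y , - z , - w , trans (sum4-unfold 1 4 3 4 1 8 2 8 x y (- z) (- w))
      (solved (+ N) (p 4 x) (p 4 y) (p 8 (- z)) (p 8 (- w)) (x * x) (y * y) (unit² z) (unit² w) e (square-p4 x) (square-p4 y) (unit-p8 z) (unit-p8 w))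
    where
    ident : ∀ N P Q R S → + 3 * (+ 1 * P + + 3 * Q + + 1 * R + + 2 * S) - + 3 * N ≡ -1ℤ * (+ 3 * N + + 3 - (+ 3 * P + + 9 * Q + (+ 3 * R + 1ℤ) + + 2 * (+ 3 * S + 1ℤ)))
    ident = solve 5 (λ N P Q R S → con (+ 3) :* (con (+ 1) :* P :+ con (+ 3) :* Q :+ con (+ 1) :* R :+ con (+ 2) :* S) :- con (+ 3) :* N
        := con -1ℤ :* (con (+ 3) :* N :+ con (+ 3) :- (con (+ 3) :* P :+ con (+ 9) :* Q :+ (con (+ 3) :* R :+ con 1ℤ) :+ con (+ 2) :* (con (+ 3) :* S :+ con 1ℤ)))) refl
    solved : ∀ N P Q R S X Y Z W → + 3 * N + + 3 ≡ + 3 * X + + 9 * Y + Z + + 2 * W → X ≡ P → Y ≡ Q → Z ≡ + 3 * R + 1ℤ → W ≡ + 3 * S + 1ℤ → + 1 * P + + 3 * Q + + 1 * R + + 2 * S ≡ N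
    solved N P Q R S _ _ _ _ e refl refl refl refl = divide 2 -1ℤ e (ident N P Q R S)

  universal₇ : Universal 1 4 1 8 1 8 2 8
  universal₇ = 0≤sum4 1 4 1 8 1 8 2 8 0≤p4 0≤p8 0≤p8 0≤p8 , λ N → let (x , y , z , w , e) = form₇ N in
    x , - y , - z , - w , trans (sum4-unfold 1 4 1 8 1 8 2 8 x (- y) (- z) (- w))
      (solved (+ N) (p 4 x) (p 8 (- y)) (p 8 (- z)) (p 8 (- w)) (x * x) (unit² y) (unit² z) (unit² w) e (square-p4 x) (unit-p8 y) (unit-p8 z) (unit-p8 w))
    where
    ident : ∀ N P Q R S → + 3 * (+ 1 * P + + 1 * Q + + 1 * R + + 2 * S) - + 3 * N ≡ -1ℤ * (+ 3 * N + + 4 - (+ 3 * P + (+ 3 * Q + 1ℤ) + (+ 3 * R + 1ℤ) + + 2 * (+ 3 * S + 1ℤ)))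
    ident = solve 5 (λ N P Q R S → con (+ 3) :* (con (+ 1) :* P :+ con (+ 1) :* Q :+ con (+ 1) :* R :+ con (+ 2) :* S) :- con (+ 3) :* N
        := con -1ℤ :* (con (+ 3) :* N :+ con (+ 4) :- (con (+ 3) :* P :+ (con (+ 3) :* Q :+ con 1ℤ) :+ (con (+ 3) :* R :+ con 1ℤ) :+ con (+ 2) :* (con (+ 3) :* S :+ con 1ℤ)))) refl
    solved : ∀ N P Q R S X Y Z W → + 3 * N + + 4 ≡ + 3 * X + Y + Z + + 2 * W → X ≡ P → Y ≡ + 3 * Q + 1ℤ → Z ≡ + 3 * R + 1ℤ → W ≡ + 3 * S + 1ℤ → + 1 * P + + 1 * Q + + 1 * R + + 2 * S ≡ N
    solved N P Q R S _ _ _ _ e refl refl refl refl = divide 2 -1ℤ e (ident N P Q R S)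

  universal₈ : Universal 1 3 1 4 1 5 2 5
  universal₈ = 0≤sum4 1 3 1 4 1 5 2 5 0≤p3 0≤p4 0≤p5 0≤p5 , λ N → let (x , y , z , w , e) = form₈ N in
    x , y , - z , - w , trans (sum4-unfold 1 3 1 4 1 5 2 5 x y (- z) (- w))
      (solved (+ N) (p 3 x) (p 4 y) (p 5 (- z)) (p 5 (- w)) (odd² x) (y * y) (sixth² z) (sixth² w) e (odd-p3 x) (square-p4 y) (sixth-p5 z) (sixth-p5 w))
    where
    ident : ∀ N P Q R S → + 24 * (+ 1 * P + + 1 * Q + + 1 * R + + 2 * S) - + 24 * N ≡ -1ℤ * (+ 24 * N + + 6 - (+ 3 * (+ 8 * P + 1ℤ) + + 24 * Q + (+ 24 * R + 1ℤ) + + 2 * (+ 24 * S + 1ℤ)))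
    ident = solve 5 (λ N P Q R S → con (+ 24) :* (con (+ 1) :* P :+ con (+ 1) :* Q :+ con (+ 1) :* R :+ con (+ 2) :* S) :- con (+ 24) :* N
        := con -1ℤ :* (con (+ 24) :* N :+ con (+ 6) :- (con (+ 3) :* (con (+ 8) :* P :+ con 1ℤ) :+ con (+ 24) :* Q :+ (con (+ 24) :* R :+ con 1ℤ) :+ con (+ 2) :* (con (+ 24) :* S :+ con 1ℤ)))) refl
    solved : ∀ N P Q R S X Y Z W → + 24 * N + + 6 ≡ + 3 * X + + 24 * Y + Z + + 2 * W → X ≡ + 8 * P + 1ℤ → Y ≡ Q → Z ≡ + 24 * R + 1ℤ → W ≡ + 24 * S + 1ℤ → + 1 * P + + 1 * Q + + 1 * R + + 2 * S ≡ N
    solved N P Q R S _ _ _ _ e refl refl refl refl = divide 23 -1ℤ e (ident N P Q R S)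

  universal₉ : Universal 1 3 3 3 1 4 2 5
  universal₉ = 0≤sum4 1 3 3 3 1 4 2 5 0≤p3 0≤p3 0≤p4 0≤p5 , λ N → let (x , y , z , w , e) = form₉ N in
    x , y , z , - w , trans (sum4-unfold 1 3 3 3 1 4 2 5 x y z (- w))
      (solved (+ N) (p 3 x) (p 3 y) (p 4 z) (p 5 (- w)) (odd² x) (odd² y) (z * z) (sixth² w) e (odd-p3 x) (odd-p3 y) (square-p4 z) (sixth-p5 w))
    where
    ident : ∀ N P Q R S → + 24 * (+ 1 * P + + 3 * Q + + 1 * R + + 2 * S) - + 24 * N ≡ -1ℤ * (+ 24 * N + + 14 - (+ 3 * (+ 8 * P + 1ℤ) + + 9 * (+ 8 * Q + 1ℤ) + + 24 * R + + 2 * (+ 24 * S + 1ℤ)))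
    ident = solve 5 (λ N P Q R S → con (+ 24) :* (con (+ 1) :* P :+ con (+ 3) :* Q :+ con (+ 1) :* R :+ con (+ 2) :* S) :- con (+ 24) :* N
        := con -1ℤ :* (con (+ 24) :* N :+ con (+ 14) :- (con (+ 3) :* (con (+ 8) :* P :+ con 1ℤ) :+ con (+ 9) :* (con (+ 8) :* Q :+ con 1ℤ) :+ con (+ 24) :* R :+ con (+ 2) :* (con (+ 24) :* S :+ con 1ℤ)))) refl
    solved : ∀ N P Q R S X Y Z W → + 24 * N + + 14 ≡ + 3 * X + + 9 * Y + + 24 * Z + + 2 * W → X ≡ + 8 * P + 1ℤ → Y ≡ + 8 * Q + 1ℤ → Z ≡ R → W ≡ + 24 * S + 1ℤ → + 1 * P + + 3 * Q + + 1 * R + + 2 * S ≡ N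
    solved N P Q R S _ _ _ _ e refl refl refl refl = divide 23 -1ℤ e (ident N P Q R S)

  universal₁₀ : Universal 1 3 6 3 1 4 1 5
  universal₁₀ = 0≤sum4 1 3 6 3 1 4 1 5 0≤p3 0≤p3 0≤p4 0≤p5 , λ N → let (x , y , z , w , e) = form₁₀ N in
    x , y , z , - w , trans (sum4-unfold 1 3 6 3 1 4 1 5 x y z (- w))
      (solved (+ N) (p 3 x) (p 3 y) (p 4 z) (p 5 (- w)) (odd² x) (odd² y) (z * z) (sixth² w) e (odd-p3 x) (odd-p3 y) (square-p4 z) (sixth-p5 w))
    where
    ident : ∀ N P Q R S → + 24 * (+ 1 * P + + 6 * Q + + 1 * R + + 1 * S) - + 24 * N ≡ -1ℤ * (+ 24 * N + + 22 - (+ 3 * (+ 8 * P + 1ℤ) + + 18 * (+ 8 * Q + 1ℤ) + + 24 * R + (+ 24 * S + 1ℤ)))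
    ident = solve 5 (λ N P Q R S → con (+ 24) :* (con (+ 1) :* P :+ con (+ 6) :* Q :+ con (+ 1) :* R :+ con (+ 1) :* S) :- con (+ 24) :* N
        := con -1ℤ :* (con (+ 24) :* N :+ con (+ 22) :- (con (+ 3) :* (con (+ 8) :* P :+ con 1ℤ) :+ con (+ 18) :* (con (+ 8) :* Q :+ con 1ℤ) :+ con (+ 24) :* R :+ (con (+ 24) :* S :+ con 1ℤ)))) refl
    solved : ∀ N P Q R S X Y Z W → + 24 * N + + 22 ≡ + 3 * X + + 18 * Y + + 24 * Z + W → X ≡ + 8 * P + 1ℤ → Y ≡ + 8 * Q + 1ℤ → Z ≡ R → W ≡ + 24 * S + 1ℤ → + 1 * P + + 6 * Q + + 1 * R + + 1 * S ≡ N
    solved N P Q R S _ _ _ _ e refl refl refl refl = divide 23 -1ℤ e (ident N P Q R S)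

  universal₁₁ : Universal 1 3 2 3 3 4 1 5
  universal₁₁ = 0≤sum4 1 3 2 3 3 4 1 5 0≤p3 0≤p3 0≤p4 0≤p5 , λ N → let (x , y , z , w , e) = form₁₁ N in
    x , y , z , - w , trans (sum4-unfold 1 3 2 3 3 4 1 5 x y z (- w))
      (solved (+ N) (p 3 x) (p 3 y) (p 4 z) (p 5 (- w)) (odd² x) (odd² y) (z * z) (sixth² w) e (odd-p3 x) (odd-p3 y) (square-p4 z) (sixth-p5 w))
    where
    ident : ∀ N P Q R S → + 24 * (+ 1 * P + + 2 * Q + + 3 * R + + 1 * S) - + 24 * N ≡ -1ℤ * (+ 24 * N + + 10 - (+ 3 * (+ 8 * P + 1ℤ) + + 6 * (+ 8 * Q + 1ℤ) + + 72 * R + (+ 24 * S + 1ℤ)))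
    ident = solve 5 (λ N P Q R S → con (+ 24) :* (con (+ 1) :* P :+ con (+ 2) :* Q :+ con (+ 3) :* R :+ con (+ 1) :* S) :- con (+ 24) :* N
        := con -1ℤ :* (con (+ 24) :* N :+ con (+ 10) :- (con (+ 3) :* (con (+ 8) :* P :+ con 1ℤ) :+ con (+ 6) :* (con (+ 8) :* Q :+ con 1ℤ) :+ con (+ 72) :* R :+ (con (+ 24) :* S :+ con 1ℤ)))) refl
    solved : ∀ N P Q R S X Y Z W → + 24 * N + + 10 ≡ + 3 * X + + 6 * Y + + 72 * Z + W → X ≡ + 8 * P + 1ℤ → Y ≡ + 8 * Q + 1ℤ → Z ≡ R → W ≡ + 24 * S + 1ℤ → + 1 * P + + 2 * Q + + 3 * R + + 1 * S ≡ N
    solved N P Q R S _ _ _ _ e refl refl refl refl = divide 23 -1ℤ e (ident N P Q R S)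

  universal₁₂ : Universal 1 3 2 3 1 5 1 8
  universal₁₂ = 0≤sum4 1 3 2 3 1 5 1 8 0≤p3 0≤p3 0≤p5 0≤p8 , λ N → let (x , y , z , w , e) = form₁₂ N in
    x , y , - z , - w , trans (sum4-unfold 1 3 2 3 1 5 1 8 x y (- z) (- w))
      (solved (+ N) (p 3 x) (p 3 y) (p 5 (- z)) (p 8 (- w)) (odd² x) (odd² y) (sixth² z) (unit² w) e (odd-p3 x) (odd-p3 y) (sixth-p5 z) (unit-p8 w))
    where
    ident : ∀ N P Q R S → + 24 * (+ 1 * P + + 2 * Q + + 1 * R + + 1 * S) - + 24 * N ≡ -1ℤ * (+ 24 * N + + 18 - (+ 3 * (+ 8 * P + 1ℤ) + + 6 * (+ 8 * Q + 1ℤ) + (+ 24 * R + 1ℤ) + + 8 * (+ 3 * S + 1ℤ)))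
    ident = solve 5 (λ N P Q R S → con (+ 24) :* (con (+ 1) :* P :+ con (+ 2) :* Q :+ con (+ 1) :* R :+ con (+ 1) :* S) :- con (+ 24) :* N
        := con -1ℤ :* (con (+ 24) :* N :+ con (+ 18) :- (con (+ 3) :* (con (+ 8) :* P :+ con 1ℤ) :+ con (+ 6) :* (con (+ 8) :* Q :+ con 1ℤ) :+ (con (+ 24) :* R :+ con 1ℤ) :+ con (+ 8) :* (con (+ 3) :* S :+ con 1ℤ)))) refl
    solved : ∀ N P Q R S X Y Z W → + 24 * N + + 18 ≡ + 3 * X + + 6 * Y + Z + + 8 * W → X ≡ + 8 * P + 1ℤ → Y ≡ + 8 * Q + 1ℤ → Z ≡ + 24 * R + 1ℤ → W ≡ + 3 * S + 1ℤ → + 1 * P + + 2 * Q + + 1 * R + + 1 * S ≡ N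
    solved N P Q R S _ _ _ _ e refl refl refl refl = divide 23 -1ℤ e (ident N P Q R S)

  universal₁₃ : Universal 1 3 2 3 3 3 1 8
  universal₁₃ = 0≤sum4 1 3 2 3 3 3 1 8 0≤p3 0≤p3 0≤p3 0≤p8 , λ N → let (x , y , z , w , e) = form₁₃ N in
    x , y , z , - w , trans (sum4-unfold 1 3 2 3 3 3 1 8 x y z (- w))
      (solved (+ N) (p 3 x) (p 3 y) (p 3 z) (p 8 (- w)) (odd² x) (odd² y) (odd² z) (unit² w) e (odd-p3 x) (odd-p3 y) (odd-p3 z) (unit-p8 w))
    where
    ident : ∀ N P Q R S → + 24 * (+ 1 * P + + 2 * Q + + 3 * R + + 1 * S) - + 24 * N ≡ -1ℤ * (+ 24 * N + + 26 - (+ 3 * (+ 8 * P + 1ℤ) + + 6 * (+ 8 * Q + 1ℤ) + + 9 * (+ 8 * R + 1ℤ) + + 8 * (+ 3 * S + 1ℤ)))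
    ident = solve 5 (λ N P Q R S → con (+ 24) :* (con (+ 1) :* P :+ con (+ 2) :* Q :+ con (+ 3) :* R :+ con (+ 1) :* S) :- con (+ 24) :* N
        := con -1ℤ :* (con (+ 24) :* N :+ con (+ 26) :- (con (+ 3) :* (con (+ 8) :* P :+ con 1ℤ) :+ con (+ 6) :* (con (+ 8) :* Q :+ con 1ℤ) :+ con (+ 9) :* (con (+ 8) :* R :+ con 1ℤ) :+ con (+ 8) :* (con (+ 3) :* S :+ con 1ℤ)))) refl
    solved : ∀ N P Q R S X Y Z W → + 24 * N + + 26 ≡ + 3 * X + + 6 * Y + + 9 * Z + + 8 * W → X ≡ + 8 * P + 1ℤ → Y ≡ + 8 * Q + 1ℤ → Z ≡ + 8 * R + 1ℤ → W ≡ + 3 * S + 1ℤ → + 1 * P + + 2 * Q + + 3 * R + + 1 * S ≡ N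
    solved N P Q R S _ _ _ _ e refl refl refl refl = divide 23 -1ℤ e (ident N P Q R S)

open import Defs
open import Data.Product using (_×_; _,_)
open Sums

theorem3p2 : Universal 6 4 1 8 1 8 2 8
    × Universal 3 4 1 8 2 8 2 8
    × Universal 6 4 1 8 1 8 3 8
    × Universal 3 4 1 8 2 8 3 8
    × Universal 1 4 6 4 1 8 1 8
    × Universal 1 4 3 4 1 8 2 8
    × Universal 1 4 1 8 1 8 2 8
    × Universal 1 3 1 4 1 5 2 5
    × Universal 1 3 3 3 1 4 2 5
    × Universal 1 3 6 3 1 4 1 5
    × Universal 1 3 2 3 3 4 1 5
    × Universal 1 3 2 3 1 5 1 8
    × Universal 1 3 2 3 3 3 1 8
theorem3p2 = universal₁ , universal₂ , universal₃ , universal₄ , universal₅ , universal₆ , universal₇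
  , universal₈ , universal₉ , universal₁₀ , universal₁₁ , universal₁₂ , universal₁₃
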